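{- For every $\varepsilon>0$ there exists a positive integer $m$ such that at least $(1-\varepsilon)m$ of the residue classes $a \pmod{4m}$ with $0<a<4m$ and $a\equiv 2\pmod 4$ are totient-free.
   Context: A totient is a value $\phi(n)$ of Euler's function for some positive integer $n$. A residue class $a \pmod{M}$ is totient-free if it contains no totient, i.e. there is no positive integer $n$ with $\phi(n)\equiv a \pmod M$. -}

module Defs where

open import Data.Nat using (ℕ; suc; _<_)
open import Data.Nat.GCD using (gcd)
open import Data.Nat.Properties using (_≟_)
open import Data.List using (List; length; filter; map; upTo)
open import Data.Integer as ℤ using (ℤ; +_)
open import Data.Integer.Divisibility using () renaming (_∣_ to _∣ℤ_)
open import Relation.Nullary using (¬_)

φ : ℕ → ℕ
φ n = length (filter (λ k → gcd k n ≟ 1) (map suc (upTo n)))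

_≡_[mod_] : ℕ → ℕ → ℕ → Set
a ≡ b [mod M ] = (+ M) ∣ℤ ((+ a) ℤ.- (+ b))

TotientFree : ℕ → ℕ → Set
TotientFree M a = ∀ n → 0 < n → ¬ (φ n ≡ a [mod M ])

-- A totient φ(n) ≡ 2 (mod 4) has the form p^j(p − 1) with p prime. Let m be a product of primes q
-- taken from many dyadic ranges 2^(k−1) ≤ q < 2^k. Unless p ∣ m, a class a mod 4m that contains
-- p^j(p − 1) has, modulo every q ∣ m, a residue in the image of x ↦ x^j(x − 1) on 𝔽_q^*, and this
-- image depends only on j mod q − 1. The substitution x ↦ 1/x reduces odd j to even j, up to sign.
-- If q − 1 ∣ j for all q ∣ m, then a ≢ −1 modulo every q, which leaves a proportion Π(1 − 1/q) of the
-- classes; by Mertens this is as small as we like. Otherwise, for some k, the exponent j is nonzero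
-- modulo a common multiple of the q − 1 with q in the k-th range. Comparing the moments
-- Σ (x^j(x − 1))^w with power sums shows that the image then misses a fixed proportion of 𝔽_q when
-- j/(q − 1) is far from an integer, and enough residues in every nontrivial case. After discarding
-- few primes from the range (those for which q − 1 has a large square factor, two large prime factors,
-- many prime factors, or a small cofactor, the last by Brun's sieve, or shares a divisor with too few
-- other q′ − 1), a union bound over the exponents leaves a proportion 2^(−k), and Σ 2^(−k) is small.

module Submission where

open import Defs
open import Data.Empty using (⊥; ⊥-elim)
open import Data.Integer as ℤ using ()
open import Data.List using (List; []; _∷_; length; filter; map; upTo; applyUpTo)
open import Data.Nat.ListAction using (product)
open import Data.List.Relation.Unary.All using (All; []; _∷_)
open import Data.List.Relation.Unary.Unique.Propositional using (Unique)
open import Data.Nat using (ℕ; zero; suc; _+_; _*_; _∸_; _^_; _≤_; _<_; _≰_; _%_; _/_; _!; ∣_-_∣; z≤n; s≤s; s≤s⁻¹; z<s; NonZero; >-nonZero; >-nonZero⁻¹; ≢-nonZero; ≢-nonZero⁻¹; nonTrivial⇒n>1)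
open import Data.Nat.Combinatorics using (_C_; nCk≡n!/k![n-k]!; k![n∸k]!∣n!; nCk+nC[k+1]≡[n+1]C[k+1]; nCn≡1; k>n⇒nCk≡0; nC1≡n)
open import Data.Nat.Coprimality as Coprime using (Coprime; coprime-divisor)
open import Data.Nat.Divisibility
open import Data.Nat.DivMod
open import Data.Nat.GCD using (gcd; gcd[m,n]∣m; gcd[m,n]∣n; gcd-greatest)
open import Data.Nat.Induction using (<-rec)
open import Data.Nat.Primality.Factorisation using (factorise)
open import Data.Nat.Primality using (Prime; prime?; euclidsLemma; prime⇒nonZero; prime⇒nonTrivial; prime⇒irreducible; prime[2])
open import Data.Nat.Properties
open import Data.Nat.Tactic.RingSolver using (solve-∀)
open import Data.Product using (Σ; ∃; _×_; _,_; proj₁; proj₂)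
open import Data.Rational as ℚ using (ℚ; 0ℚ; 1ℚ)
open import Data.Sum using (_⊎_; inj₁; inj₂; [_,_]′)
open import Function using (_∘_; id; case_of_)
open import Relation.Binary.Definitions using (Tri; tri<; tri≈; tri>)
open import Relation.Binary.PropositionalEquality using (_≡_; _≢_; refl; sym; trans; cong; cong₂; subst; subst₂; module ≡-Reasoning)
open import Relation.Nullary using (¬_; Dec; yes; no; contradiction; ¬?)
open import Relation.Nullary.Decidable using (_×-dec_; _⊎-dec_; _→-dec_; decidable-stable)
open import Relation.Unary using (Decidable)
import Data.Integer.Properties as ℤP
import Data.Rational.Properties as ℚP
import Data.Rational.Unnormalised as ℚᵘ
import Data.Rational.Unnormalised.Properties as ℚᵘP
import Data.List.Relation.Unary.All as All
import Data.List.Relation.Unary.All.Properties as AllP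
import Data.List.Relation.Unary.Unique.Propositional.Properties as UniqueP
import Data.Integer.Tactic.RingSolver as ℤ-solve

-- Finite sums, products and counting

-- The exponents modulo L = lcm(q - 1) are far too many for a plain union bound. They are built one
-- prime l at a time, each step choosing among fewer than 2^k lifts, and the proof arranges that at
-- most one lift is cheap while every other one gains a factor 2^(4k). For l below about 2^(k/2) the
-- cheap lift is the one divisible by the full power of l in L: any other exponent misses about √q
-- residues for every q concerned, and there are enough such q. For larger l there are too few, so
-- only exponents with j/(q - 1) far from integers help; that two lifts cannot both be near integers
-- for a third of these q is the reason for most of the discarding. Even exponents are required
-- because j ≡ -1 gives 1 - 1/x, which misses a single value. Missing values are detected thus: if
-- few values were irregular, some polynomial would vanish on all of them, and its sums over the
-- values and over 𝔽_q would agree, against the computed moments. The proportion lost in the k-th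
-- range must be summable over k; 1/k would diverge, but the sieve for the two forms n and en + 1
-- saves more than the first power of k.

Σ< : ℕ → (ℕ → ℕ) → ℕ
Σ< zero    f = 0
Σ< (suc n) f = Σ< n f + f n

Π< : ℕ → (ℕ → ℕ) → ℕ
Π< zero    f = 1
Π< (suc n) f = Π< n f * f n

𝟙 : ∀ {a} {P : Set a} → Dec P → ℕ
𝟙 (yes _) = 1
𝟙 (no  _) = 0

# : ∀ {P : ℕ → Set} → ℕ → Decidable P → ℕ
# N P? = Σ< N (λ n → 𝟙 (P? n))

module _ {P : Set} where

  𝟙-yes : P → (d : Dec P) → 𝟙 d ≡ 1
  𝟙-yes p (yes _) = refl
  𝟙-yes p (no ¬p) = contradiction p ¬p

  𝟙-no : ¬ P → (d : Dec P) → 𝟙 d ≡ 0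
  𝟙-no ¬p (yes p) = contradiction p ¬p
  𝟙-no ¬p (no _)  = refl

  𝟙≤1 : (d : Dec P) → 𝟙 d ≤ 1
  𝟙≤1 (yes _) = ≤-refl
  𝟙≤1 (no _)  = z≤n

  𝟙-mono : {Q : Set} → (P → Q) → (d : Dec P) (e : Dec Q) → 𝟙 d ≤ 𝟙 e
  𝟙-mono f (yes p) e = ≤-reflexive (sym (𝟙-yes′ e))
    where
    𝟙-yes′ : ∀ e → 𝟙 e ≡ 1
    𝟙-yes′ (yes _) = refl
    𝟙-yes′ (no ¬q) = contradiction (f p) ¬q
  𝟙-mono f (no _) e = z≤n

  𝟙-mono₂ : {Q R : Set} → (P → Q ⊎ R) → (d : Dec P) (e : Dec Q) (f : Dec R) → 𝟙 d ≤ 𝟙 e + 𝟙 f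
  𝟙-mono₂ g (no _)  e       f       = z≤n
  𝟙-mono₂ g (yes p) (yes _) f       = s≤s z≤n
  𝟙-mono₂ g (yes p) (no _)  (yes _) = ≤-refl
  𝟙-mono₂ g (yes p) (no ¬q) (no ¬r) = ⊥-elim ([ ¬q , ¬r ]′ (g p))

  𝟙≤-elim : ∀ {b} (d : Dec P) → (P → 1 ≤ b) → 𝟙 d ≤ b
  𝟙≤-elim (yes p) h = h p
  𝟙≤-elim (no _)  h = z≤n

Σ-cong : ∀ n {f g} → (∀ i → i < n → f i ≡ g i) → Σ< n f ≡ Σ< n g
Σ-cong zero    h = refl
Σ-cong (suc n) h = cong₂ _+_ (Σ-cong n (λ i i<n → h i (m<n⇒m<1+n i<n))) (h n ≤-refl)

Σ-mono : ∀ n {f g} → (∀ i → i < n → f i ≤ g i) → Σ< n f ≤ Σ< n g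
Σ-mono zero    h = z≤n
Σ-mono (suc n) h = +-mono-≤ (Σ-mono n (λ i i<n → h i (m<n⇒m<1+n i<n))) (h n ≤-refl)

Σ-extend : ∀ {m n} (f : ℕ → ℕ) → m ≤ n → Σ< m f ≤ Σ< n f
Σ-extend {m} {zero} f z≤n = z≤n
Σ-extend {m} {suc n} f m≤1+n with m≤n⇒m<n∨m≡n m≤1+n
... | inj₁ m<1+n = ≤-trans (Σ-extend f (s≤s⁻¹ m<1+n)) (m≤m+n _ _)
... | inj₂ refl  = ≤-refl

Σ-+ : ∀ n (f g : ℕ → ℕ) → Σ< n (λ i → f i + g i) ≡ Σ< n f + Σ< n g
Σ-+ zero    f g = refl
Σ-+ (suc n) f g rewrite Σ-+ n f g = swap (Σ< n f) (Σ< n g) (f n) (g n)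
  where
  swap : ∀ a b c d → a + b + (c + d) ≡ a + c + (b + d)
  swap = solve-∀

Σ-*ˡ : ∀ c n (f : ℕ → ℕ) → Σ< n (λ i → c * f i) ≡ c * Σ< n f
Σ-*ˡ c zero    f = sym (*-zeroʳ c)
Σ-*ˡ c (suc n) f rewrite Σ-*ˡ c n f = sym (*-distribˡ-+ c (Σ< n f) (f n))

Σ-*ʳ : ∀ c n (f : ℕ → ℕ) → Σ< n (λ i → f i * c) ≡ Σ< n f * c
Σ-*ʳ c n f = trans (Σ-cong n (λ i _ → *-comm (f i) c)) (trans (Σ-*ˡ c n f) (*-comm c _))

Σ-const : ∀ n c → Σ< n (λ _ → c) ≡ n * c
Σ-const zero    c = refl
Σ-const (suc n) c rewrite Σ-const n c = +-comm (n * c) c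

Σ-zero : ∀ n (f : ℕ → ℕ) → (∀ i → i < n → f i ≡ 0) → Σ< n f ≡ 0
Σ-zero n f h = trans (Σ-cong n h) (trans (Σ-const n 0) (*-zeroʳ n))

Σ-bound : ∀ n (f : ℕ → ℕ) b → (∀ i → i < n → f i ≤ b) → Σ< n f ≤ n * b
Σ-bound n f b h = ≤-trans (Σ-mono n h) (≤-reflexive (Σ-const n b))

Σ-swap : ∀ m n (f : ℕ → ℕ → ℕ) → Σ< m (λ i → Σ< n (f i)) ≡ Σ< n (λ j → Σ< m (λ i → f i j))
Σ-swap zero    n f = sym (Σ-zero n _ (λ _ _ → refl))
Σ-swap (suc m) n f = trans (cong (_+ Σ< n (f m)) (Σ-swap m n f))
                           (sym (Σ-+ n (λ j → Σ< m (λ i → f i j)) (f m)))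

Σ-split : ∀ m n (f : ℕ → ℕ) → Σ< (m + n) f ≡ Σ< m f + Σ< n (λ i → f (m + i))
Σ-split m zero    f rewrite +-identityʳ m = sym (+-identityʳ _)
Σ-split m (suc n) f rewrite +-suc m n | Σ-split m n f = +-assoc (Σ< m f) _ _

Σ-radix : ∀ m n (f : ℕ → ℕ) → Σ< (n * m) f ≡ Σ< n (λ i → Σ< m (λ j → f (j + i * m)))
Σ-radix m zero    f = refl
Σ-radix m (suc n) f = begin
  Σ< (m + n * m) f ≡⟨ cong (λ z → Σ< z f) (+-comm m (n * m)) ⟩
  Σ< (n * m + m) f ≡⟨ Σ-split (n * m) m f ⟩
  Σ< (n * m) f + Σ< m (λ j → f (n * m + j)) ≡⟨ cong₂ _+_ (Σ-radix m n f) (Σ-cong m (λ j _ → cong f (+-comm (n * m) j))) ⟩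
  Σ< n (λ i → Σ< m (λ j → f (j + i * m))) + Σ< m (λ j → f (j + n * m)) ∎
  where open ≡-Reasoning

term≤Σ : ∀ n (f : ℕ → ℕ) {i} → i < n → f i ≤ Σ< n f
term≤Σ (suc n) f {i} i<1+n with m≤n⇒m<n∨m≡n (s≤s⁻¹ i<1+n)
... | inj₁ i<n  = ≤-trans (term≤Σ n f i<n) (m≤m+n _ _)
... | inj₂ refl = m≤n+m _ _

Σ-pick : ∀ n (f : ℕ → ℕ) {t} → t < n → Σ< n (λ i → 𝟙 (i ≟ t) * f i) ≡ f t
Σ-pick (suc n) f {t} t<1+n with n ≟ t
... | yes refl = trans (cong (_+ 1 * f n) (Σ-zero n _ off)) (*-identityˡ (f n))
  where
  off : ∀ i → i < n → 𝟙 (i ≟ n) * f i ≡ 0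
  off i i<n = cong (_* f i) (𝟙-no (<⇒≢ i<n) (i ≟ n))
... | no n≢t = trans (+-identityʳ _) (Σ-pick n f (≤∧≢⇒< (s≤s⁻¹ t<1+n) (n≢t ∘ sym)))

Π-cong : ∀ n {f g} → (∀ i → i < n → f i ≡ g i) → Π< n f ≡ Π< n g
Π-cong zero    h = refl
Π-cong (suc n) h = cong₂ _*_ (Π-cong n (λ i i<n → h i (m<n⇒m<1+n i<n))) (h n ≤-refl)

Π-mono : ∀ n {f g} → (∀ i → i < n → f i ≤ g i) → Π< n f ≤ Π< n g
Π-mono zero    h = ≤-refl
Π-mono (suc n) h = *-mono-≤ (Π-mono n (λ i i<n → h i (m<n⇒m<1+n i<n))) (h n ≤-refl)

*-interchange : ∀ a b c d → (a * b) * (c * d) ≡ (a * c) * (b * d)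
*-interchange = solve-∀

Π-* : ∀ n (f g : ℕ → ℕ) → Π< n (λ i → f i * g i) ≡ Π< n f * Π< n g
Π-* zero    f g = refl
Π-* (suc n) f g rewrite Π-* n f g = *-interchange (Π< n f) (Π< n g) (f n) (g n)

Π-const : ∀ n c → Π< n (λ _ → c) ≡ c ^ n
Π-const zero    c = refl
Π-const (suc n) c rewrite Π-const n c = *-comm (c ^ n) c

Π-one : ∀ n (f : ℕ → ℕ) → (∀ i → i < n → f i ≡ 1) → Π< n f ≡ 1
Π-one n f h = trans (Π-cong n h) (trans (Π-const n 1) (^-zeroˡ n))

Π-swap : ∀ m n (f : ℕ → ℕ → ℕ) → Π< m (λ i → Π< n (f i)) ≡ Π< n (λ j → Π< m (λ i → f i j))
Π-swap zero    n f = sym (Π-one n _ (λ _ _ → refl))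
Π-swap (suc m) n f = trans (cong (_* Π< n (f m)) (Π-swap m n f))
                           (sym (Π-* n (λ j → Π< m (λ i → f i j)) (f m)))

^-distribʳ-* : ∀ a b e → (a * b) ^ e ≡ a ^ e * b ^ e
^-distribʳ-* a b zero    = refl
^-distribʳ-* a b (suc e) rewrite ^-distribʳ-* a b e = *-interchange a b (a ^ e) (b ^ e)

Π-^ : ∀ n (f : ℕ → ℕ) e → Π< n (λ i → f i ^ e) ≡ Π< n f ^ e
Π-^ zero    f e = sym (^-zeroˡ e)
Π-^ (suc n) f e rewrite Π-^ n f e = sym (^-distribʳ-* (Π< n f) (f n) e)

Π-^Σ : ∀ n c (f : ℕ → ℕ) → Π< n (λ i → c ^ f i) ≡ c ^ Σ< n f
Π-^Σ zero    c f = refl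
Π-^Σ (suc n) c f rewrite Π-^Σ n c f = sym (^-distribˡ-+-* c (Σ< n f) (f n))

Π-pos : ∀ n (f : ℕ → ℕ) → (∀ i → i < n → 1 ≤ f i) → 1 ≤ Π< n f
Π-pos zero    f h = ≤-refl
Π-pos (suc n) f h = *-mono-≤ (Π-pos n f (λ i i<n → h i (m<n⇒m<1+n i<n))) (h n ≤-refl)

term∣Π : ∀ n (f : ℕ → ℕ) {i} → i < n → f i ∣ Π< n f
term∣Π (suc n) f {i} i<1+n with m≤n⇒m<n∨m≡n (s≤s⁻¹ i<1+n)
... | inj₁ i<n  = ∣m⇒∣m*n (f n) (term∣Π n f i<n)
... | inj₂ refl = n∣m*n (Π< n f)

Π∣Π : ∀ {m n} (f : ℕ → ℕ) → m ≤ n → Π< m f ∣ Π< n f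
Π∣Π {m} {zero} f z≤n = ∣-refl
Π∣Π {m} {suc n} f m≤1+n with m≤n⇒m<n∨m≡n m≤1+n
... | inj₁ m<1+n = ∣m⇒∣m*n (f n) (Π∣Π f (s≤s⁻¹ m<1+n))
... | inj₂ refl  = ∣-refl

Π-split : ∀ m n (f : ℕ → ℕ) → Π< (m + n) f ≡ Π< m f * Π< n (λ i → f (m + i))
Π-split m zero    f rewrite +-identityʳ m = sym (*-identityʳ _)
Π-split m (suc n) f rewrite +-suc m n | Π-split m n f = *-assoc (Π< m f) _ _

module _ {P : ℕ → Set} {P? : Decidable P} where

  #≤ : ∀ n → # n P? ≤ n
  #≤ n = ≤-trans (Σ-bound n _ 1 (λ i _ → 𝟙≤1 (P? i))) (≤-reflexive (*-identityʳ n))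

  #-mono : ∀ n {Q : ℕ → Set} {Q? : Decidable Q} → (∀ i → i < n → P i → Q i) → # n P? ≤ # n Q?
  #-mono n {Q? = Q?} h = Σ-mono n (λ i i<n → 𝟙-mono (h i i<n) (P? i) (Q? i))

  #-∪ : ∀ n {Q R : ℕ → Set} {Q? : Decidable Q} {R? : Decidable R} →
        (∀ i → i < n → P i → Q i ⊎ R i) → # n P? ≤ # n Q? + # n R?
  #-∪ n {Q? = Q?} {R?} h = ≤-trans (Σ-mono n (λ i i<n → 𝟙-mono₂ (h i i<n) (P? i) (Q? i) (R? i)))
                                   (≤-reflexive (Σ-+ n _ _))

  #-none : ∀ n → (∀ i → i < n → ¬ P i) → # n P? ≡ 0
  #-none n h = Σ-zero n _ (λ i i<n → 𝟙-no (h i i<n) (P? i))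

  #-all : ∀ n → (∀ i → i < n → P i) → # n P? ≡ n
  #-all n h = trans (Σ-cong n (λ i i<n → 𝟙-yes (h i i<n) (P? i))) (trans (Σ-const n 1) (*-identityʳ n))

  #-extend : ∀ {m n} → m ≤ n → # m P? ≤ # n P?
  #-extend = Σ-extend _

  #>0⇒∃ : ∀ n → 0 < # n P? → ∃ λ i → i < n × P i
  #>0⇒∃ n 0<# with anyUpTo? P? n
  ... | yes p = p
  ... | no ¬p = contradiction 0<# (<-irrefl (sym (#-none n (λ i i<n pi → ¬p (i , i<n , pi)))))

  ∃⇒#>0 : ∀ n {i} → i < n → P i → 0 < # n P?
  ∃⇒#>0 n {i} i<n pi = ≤-trans (≤-reflexive (sym (𝟙-yes pi (P? i)))) (term≤Σ n _ i<n)

  #≤1 : ∀ n → (∀ i j → i < n → j < n → P i → P j → i ≡ j) → # n P? ≤ 1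
  #≤1 zero    h = z≤n
  #≤1 (suc n) h with P? n
  ... | no _   rewrite +-identityʳ (# n P?) = #≤1 n (λ i j i<n j<n → h i j (m<n⇒m<1+n i<n) (m<n⇒m<1+n j<n))
  ... | yes pn rewrite #-none n (λ i i<n pi → <⇒≢ i<n (h i n (m<n⇒m<1+n i<n) ≤-refl pi pn)) = ≤-refl

#-cover : ∀ n I {P : ℕ → Set} {Q : ℕ → ℕ → Set} (P? : Decidable P) (Q? : ∀ c → Decidable (Q c)) →
          (∀ i → i < n → P i → ∃ λ c → c < I × Q c i) → # n P? ≤ Σ< I (λ c → # n (Q? c))
#-cover n I P? Q? h = ≤-trans (Σ-mono n point) (≤-reflexive (Σ-swap n I (λ i c → 𝟙 (Q? c i))))
  where
  point : ∀ i → i < n → 𝟙 (P? i) ≤ Σ< I (λ c → 𝟙 (Q? c i))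
  point i i<n = 𝟙≤-elim (P? i) λ pi → case h i i<n pi of λ where
    (c , c<I , q) → ≤-trans (≤-reflexive (sym (𝟙-yes q (Q? c i)))) (term≤Σ I _ c<I)

Σ-fibre : ∀ m n (σ g : ℕ → ℕ) → (∀ i → i < m → σ i < n) →
          Σ< m (λ i → g (σ i)) ≡ Σ< n (λ b → # m (λ i → b ≟ σ i) * g b)
Σ-fibre m n σ g σ< = begin
  Σ< m (λ i → g (σ i)) ≡⟨ Σ-cong m (λ i i<m → sym (Σ-pick n g (σ< i i<m))) ⟩
  Σ< m (λ i → Σ< n (λ b → 𝟙 (b ≟ σ i) * g b)) ≡⟨ Σ-swap m n _ ⟩
  Σ< n (λ b → Σ< m (λ i → 𝟙 (b ≟ σ i) * g b)) ≡⟨ Σ-cong n (λ b _ → Σ-*ʳ (g b) m _) ⟩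
  Σ< n (λ b → # m (λ i → b ≟ σ i) * g b) ∎
  where open ≡-Reasoning

Σ-inject : ∀ m n (σ g : ℕ → ℕ) → (∀ i → i < m → σ i < n) →
           (∀ i j → i < m → j < m → σ i ≡ σ j → i ≡ j) → Σ< m (λ i → g (σ i)) ≤ Σ< n g
Σ-inject m n σ g σ< inj = ≤-trans (≤-reflexive (Σ-fibre m n σ g σ<)) (Σ-mono n λ b _ →
  ≤-trans (*-monoˡ-≤ (g b) (#≤1 m (λ i j i<m j<m p q → inj i j i<m j<m (trans (sym p) q))))
          (≤-reflexive (*-identityˡ (g b))))

#-inject : ∀ m n {P Q : ℕ → Set} {P? : Decidable P} {Q? : Decidable Q} (σ : ℕ → ℕ) →
           (∀ i → i < m → P i → σ i < n × Q (σ i)) →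
           (∀ i j → i < m → j < m → P i → P j → σ i ≡ σ j → i ≡ j) → # m P? ≤ # n Q?
#-inject m n {P} {Q} {P?} {Q?} σ h inj = begin
  # m P? ≤⟨ #-cover m n P? Fib? (λ i i<m pi → σ i , proj₁ (h i i<m pi) , pi , refl) ⟩
  Σ< n (λ b → # m (Fib? b)) ≤⟨ Σ-mono n bound ⟩
  # n Q? ∎
  where
  open ≤-Reasoning
  Fib? : ∀ b → Decidable (λ i → P i × b ≡ σ i)
  Fib? b i = P? i ×-dec (b ≟ σ i)
  bound : ∀ b → b < n → # m (Fib? b) ≤ 𝟙 (Q? b)
  bound b b<n with Q? b
  ... | yes _ = #≤1 m (λ i j i<m j<m (pi , e) (pj , e′) → inj i j i<m j<m pi pj (trans (sym e) e′))
  ... | no ¬q = ≤-reflexive (#-none m λ { i i<m (pi , refl) → ¬q (proj₂ (h i i<m pi)) })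

-- Certificates for linear inequalities: the hypothesis x ≤ y is used once, and w is the slack.
linear : ∀ {x y} a b w → x ≤ y → a + y + w ≡ b + x → a ≤ b
linear {x} {y} a b w x≤y eq = +-cancelʳ-≤ y a b (begin
  a + y ≤⟨ m≤m+n (a + y) w ⟩
  a + y + w ≡⟨ eq ⟩
  b + x ≤⟨ +-monoʳ-≤ b x≤y ⟩
  b + y ∎)
  where open ≤-Reasoning

least : ∀ {P : ℕ → Set} → Decidable P → ∀ n → (∃ λ i → i < n × P i) →
        ∃ λ i → i < n × P i × (∀ j → j < i → ¬ P j)
least P? (suc n) (i , i<1+n , pi) with anyUpTo? P? n
... | yes p = case least P? n p of λ where (j , j<n , pj , m) → j , m<n⇒m<1+n j<n , pj , m
... | no ¬p with m≤n⇒m<n∨m≡n (s≤s⁻¹ i<1+n)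
...   | inj₁ i<n  = contradiction (i , i<n , pi) ¬p
...   | inj₂ refl = n , ≤-refl , pi , λ j j<n pj → ¬p (j , j<n , pj)

-- Binomial coefficients and divisibility by a prime

Σ-shift : ∀ n (f : ℕ → ℕ) → Σ< (suc n) f ≡ f 0 + Σ< n (λ i → f (suc i))
Σ-shift zero    f = +-comm 0 (f 0)
Σ-shift (suc n) f rewrite Σ-shift n f = +-assoc (f 0) _ _

nC0≡1 : ∀ n → n C 0 ≡ 1
nC0≡1 zero    = refl
nC0≡1 (suc n) = refl

binomial : ∀ v y → (1 + y) ^ v ≡ Σ< (suc v) (λ i → (v C i) * y ^ i)
binomial zero    y = refl
binomial (suc v) y = begin
  (1 + y) * (1 + y) ^ v ≡⟨ cong ((1 + y) *_) (binomial v y) ⟩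
  (1 + y) * B ≡⟨ cong (_+ y * B) (sym extend) ⟩
  Σ< (suc (suc v)) b + y * B ≡⟨ cong (_+ y * B) (Σ-shift (suc v) b) ⟩
  b 0 + Σ< (suc v) (b ∘ suc) + y * B ≡⟨ +-assoc (b 0) (Σ< (suc v) (b ∘ suc)) (y * B) ⟩
  b 0 + (Σ< (suc v) (b ∘ suc) + y * B) ≡⟨ cong₂ _+_ b0 tail ⟩
  (suc v C 0) * y ^ 0 + Σ< (suc v) (λ i → (suc v C suc i) * y ^ suc i) ≡⟨ sym (Σ-shift (suc v) (λ i → (suc v C i) * y ^ i)) ⟩
  Σ< (suc (suc v)) (λ i → (suc v C i) * y ^ i) ∎
  where
  open ≡-Reasoning
  b : ℕ → ℕ
  b i = (v C i) * y ^ i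
  B : ℕ
  B = Σ< (suc v) b
  extend : Σ< (suc (suc v)) b ≡ B
  extend = trans (cong (λ c → B + c * y ^ suc v) (k>n⇒nCk≡0 (n<1+n v))) (+-identityʳ B)
  b0 : b 0 ≡ (suc v C 0) * y ^ 0
  b0 = cong (_* 1) (trans (nC0≡1 v) (sym (nC0≡1 (suc v))))
  distr : ∀ c d y z → d * (y * z) + y * (c * z) ≡ (c + d) * (y * z)
  distr = solve-∀
  tail : Σ< (suc v) (b ∘ suc) + y * B ≡ Σ< (suc v) (λ i → (suc v C suc i) * y ^ suc i)
  tail = begin
    Σ< (suc v) (b ∘ suc) + y * B ≡⟨ cong (Σ< (suc v) (b ∘ suc) +_) (sym (Σ-*ˡ y (suc v) b)) ⟩
    Σ< (suc v) (b ∘ suc) + Σ< (suc v) (λ i → y * b i) ≡⟨ sym (Σ-+ (suc v) (b ∘ suc) (λ i → y * b i)) ⟩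
    Σ< (suc v) (λ i → b (suc i) + y * b i) ≡⟨ Σ-cong (suc v) (λ i _ → trans (distr (v C i) (v C suc i) y (y ^ i))
                                                                 (cong (_* y ^ suc i) (nCk+nC[k+1]≡[n+1]C[k+1] v i))) ⟩
    Σ< (suc v) (λ i → (suc v C suc i) * y ^ suc i) ∎

-- Used in two directions: with `suc n` equal to a prime q it makes q divide the inner binomial
-- coefficients, and with `suc n` below a prime it keeps that prime out of the coefficient.
absorption : ∀ n k → suc k * (suc n C suc k) ≡ suc n * (n C k)
absorption zero    zero    = refl
absorption zero    (suc k) = trans (cong (suc (suc k) *_) (k>n⇒nCk≡0 {1} {suc (suc k)} (s≤s (s≤s z≤n))))
  (trans (*-zeroʳ (suc (suc k))) (sym (cong (1 *_) (k>n⇒nCk≡0 {0} {suc k} (s≤s z≤n)))))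
absorption (suc n) zero    = trans (cong (1 *_) (nC1≡n (suc (suc n))))
  (trans (*-identityˡ (suc (suc n))) (sym (trans (cong (suc (suc n) *_) (nC0≡1 (suc n))) (*-identityʳ (suc (suc n))))))
absorption (suc n) (suc k) = begin
  suc (suc k) * (suc (suc n) C suc (suc k)) ≡⟨ cong (suc (suc k) *_) (sym (nCk+nC[k+1]≡[n+1]C[k+1] (suc n) (suc k))) ⟩
  suc (suc k) * (a + (suc n C suc (suc k))) ≡⟨ lem₁ k a (suc n C suc (suc k)) ⟩
  a + (suc k * a + suc (suc k) * (suc n C suc (suc k))) ≡⟨ cong₂ (λ s t → a + (s + t)) (absorption n k) (absorption n (suc k)) ⟩
  a + (suc n * (n C k) + suc n * (n C suc k)) ≡⟨ cong (λ s → a + s) (trans (sym (*-distribˡ-+ (suc n) (n C k) (n C suc k))) (cong (suc n *_) (nCk+nC[k+1]≡[n+1]C[k+1] n k))) ⟩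
  a + suc n * a ≡⟨⟩
  suc (suc n) * a ∎
  where
  open ≡-Reasoning
  a : ℕ
  a = suc n C suc k
  lem₁ : ∀ k a b → suc (suc k) * (a + b) ≡ a + (suc k * a + suc (suc k) * b)
  lem₁ = solve-∀

prime>1 : ∀ {p} → Prime p → 1 < p
prime>1 {p} pp = nonTrivial⇒n>1 p {{prime⇒nonTrivial pp}}

prime∤* : ∀ {p} a b → Prime p → p ∤ a → p ∤ b → p ∤ a * b
prime∤* a b pp p∤a p∤b p∣ab = [ p∤a , p∤b ]′ (euclidsLemma a b pp p∣ab)

prime∤^ : ∀ {p} a k → Prime p → p ∤ a → p ∤ a ^ k
prime∤^ a zero    pp p∤a p∣1 = <⇒≢ (prime>1 pp) (sym (∣1⇒≡1 p∣1))
prime∤^ a (suc k) pp p∤a = prime∤* a (a ^ k) pp p∤a (prime∤^ a k pp p∤a)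

∤-small : ∀ {p a} → 0 < a → a < p → p ∤ a
∤-small {p} {a} 0<a a<p p∣a = <⇒≱ a<p (∣⇒≤ {{>-nonZero 0<a}} p∣a)

prime∤C : ∀ {p} v i → Prime p → v < p → i ≤ v → p ∤ v C i
prime∤C v zero pp v<p _ rewrite nC0≡1 v = λ p∣1 → <⇒≢ (prime>1 pp) (sym (∣1⇒≡1 p∣1))
prime∤C {p} (suc v) (suc i) pp v<p (s≤s i≤v) p∣C =
  prime∤* (suc v) (v C i) pp (∤-small z<s v<p) (prime∤C v i pp (<-trans (n<1+n v) v<p) i≤v)
    (subst (p ∣_) (absorption v i) (∣n⇒∣m*n (suc i) p∣C))

∣Σ : ∀ n (f : ℕ → ℕ) {d} → (∀ i → i < n → d ∣ f i) → d ∣ Σ< n f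
∣Σ zero    f {d} h = d ∣0
∣Σ (suc n) f h = ∣m∣n⇒∣m+n (∣Σ n f (λ i i<n → h i (m<n⇒m<1+n i<n))) (h n ≤-refl)

-- Arithmetic modulo a prime

module Congruence (q : ℕ) .{{_ : NonZero q}} where

  infix 4 _≈_
  _≈_ : ℕ → ℕ → Set
  a ≈ b = a % q ≡ b % q

  +-≈ : ∀ {a b c d} → a ≈ b → c ≈ d → a + c ≈ b + d
  +-≈ {a} {b} {c} {d} e f = trans (%-distribˡ-+ a c q) (trans (cong₂ (λ s t → (s + t) % q) e f) (sym (%-distribˡ-+ b d q)))

  *-≈ : ∀ {a b c d} → a ≈ b → c ≈ d → a * c ≈ b * d
  *-≈ {a} {b} {c} {d} e f = trans (%-distribˡ-* a c q) (trans (cong₂ (λ s t → (s * t) % q) e f) (sym (%-distribˡ-* b d q)))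

  ^-≈ : ∀ {a b} k → a ≈ b → a ^ k ≈ b ^ k
  ^-≈ zero    e = refl
  ^-≈ {a} {b} (suc k) e = *-≈ {a} {b} {a ^ k} {b ^ k} e (^-≈ {a} {b} k e)

  Σ-≈ : ∀ n {f g : ℕ → ℕ} → (∀ i → i < n → f i ≈ g i) → Σ< n f ≈ Σ< n g
  Σ-≈ zero    h = refl
  Σ-≈ (suc n) {f} {g} h = +-≈ {Σ< n f} {Σ< n g} (Σ-≈ n (λ i i<n → h i (m<n⇒m<1+n i<n))) (h n ≤-refl)

  %-≈ : ∀ a → a % q ≈ a
  %-≈ a = m%n%n≡m%n a q

  0%q≡0 : 0 % q ≡ 0
  0%q≡0 = m<n⇒m%n≡m (>-nonZero⁻¹ q)

  ∣⇒≈0 : ∀ {a} → q ∣ a → a ≈ 0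
  ∣⇒≈0 {a} q∣a = trans (n∣m⇒m%n≡0 a q q∣a) (sym (0%q≡0))

  ≈0⇒∣ : ∀ {a} → a ≈ 0 → q ∣ a
  ≈0⇒∣ {a} e = m%n≡0⇒n∣m a q (trans e (0%q≡0))

  +∣-≈ : ∀ {a b} → q ∣ b → a + b ≈ a
  +∣-≈ {a} {b} q∣b = %-remove-+ʳ a q∣b

  private
    ≈⇒∣-≤ : ∀ {a b} → a ≤ b → a ≈ b → q ∣ b ∸ a
    ≈⇒∣-≤ {a} {b} a≤b e = divides (b / q ∸ a / q) (begin
      b ∸ a ≡⟨ cong₂ _∸_ (m≡m%n+[m/n]*n b q) (m≡m%n+[m/n]*n a q) ⟩
      (b % q + b / q * q) ∸ (a % q + a / q * q) ≡⟨ cong (λ s → (b % q + b / q * q) ∸ (s + a / q * q)) e ⟩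
      (b % q + b / q * q) ∸ (b % q + a / q * q) ≡⟨ [m+n]∸[m+o]≡n∸o (b % q) _ _ ⟩
      b / q * q ∸ a / q * q ≡⟨ sym (*-distribʳ-∸ q (b / q) (a / q)) ⟩
      (b / q ∸ a / q) * q ∎)
      where open ≡-Reasoning

  ≈⇒∣ : ∀ a b → a ≈ b → q ∣ ∣ a - b ∣
  ≈⇒∣ a b e with ≤-total a b
  ... | inj₁ a≤b rewrite m≤n⇒∣m-n∣≡n∸m a≤b = ≈⇒∣-≤ a≤b e
  ... | inj₂ b≤a rewrite m≤n⇒∣n-m∣≡n∸m b≤a = ≈⇒∣-≤ b≤a (sym e)

  ∣⇒≈ : ∀ a b → q ∣ ∣ a - b ∣ → a ≈ b
  ∣⇒≈ a b d with ≤-total a b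
  ... | inj₁ a≤b rewrite m≤n⇒∣m-n∣≡n∸m a≤b = sym (trans (cong (_% q) (sym (m+[n∸m]≡n a≤b))) (+∣-≈ d))
  ... | inj₂ b≤a rewrite m≤n⇒∣n-m∣≡n∸m b≤a = trans (cong (_% q) (sym (m+[n∸m]≡n b≤a))) (+∣-≈ d)

  ≈⇒≡ : ∀ {a b} → a < q → b < q → a ≈ b → a ≡ b
  ≈⇒≡ a<q b<q e = trans (sym (m<n⇒m%n≡m a<q)) (trans e (m<n⇒m%n≡m b<q))

  -- q ∸ 1 plays the role of −1
  neg : ℕ → ℕ
  neg a = (q ∸ 1) * a

  +-neg : ∀ a → a + neg a ≈ 0
  +-neg a = ∣⇒≈0 (subst (q ∣_) (cong (_* a) (sym (m+[n∸m]≡n (>-nonZero⁻¹ q)))) (m∣m*n a))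

  +-cancelʳ-≈ : ∀ a b c → a + c ≈ b + c → a ≈ b
  +-cancelʳ-≈ a b c e = begin
    a % q ≡⟨ sym (drop a) ⟩
    (a + c + neg c) % q ≡⟨ +-≈ {a + c} {b + c} {neg c} {neg c} e refl ⟩
    (b + c + neg c) % q ≡⟨ drop b ⟩
    b % q ∎
    where
    open ≡-Reasoning
    drop : ∀ a → a + c + neg c ≈ a
    drop a = trans (cong (_% q) (+-assoc a c (neg c))) (+∣-≈ (≈0⇒∣ (+-neg c)))

module PrimeField (q : ℕ) (q-prime : Prime q) where

  instance
    q≢0 : NonZero q
    q≢0 = prime⇒nonZero q-prime

  open Congruence q public

  n : ℕ
  n = q ∸ 1

  q≡1+n : q ≡ suc n
  q≡1+n = sym (m+[n∸m]≡n (<⇒≤ (prime>1 q-prime)))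

  n<q : n < q
  n<q = ≤-reflexive (sym q≡1+n)

  0<n : 0 < n
  0<n = m<n⇒0<n∸m (prime>1 q-prime)

  *-cancelˡ-≈ : ∀ x a b → q ∤ x → x * a ≈ x * b → a ≈ b
  *-cancelˡ-≈ x a b q∤x e =
    [ (λ q∣x → contradiction q∣x q∤x) , ∣⇒≈ a b ]′
      (euclidsLemma x ∣ a - b ∣ q-prime (subst (q ∣_) (sym (*-distribˡ-∣-∣ x a b)) (≈⇒∣ (x * a) (x * b) e)))

  -- Induction on x: modulo q only the two outer terms of (1 + x)^q survive.
  fermat′ : ∀ x → x ^ q ≈ x
  fermat′ zero    = cong (_% q) (cong (0 ^_) q≡1+n)
  fermat′ (suc x) = begin
    suc x ^ q % q ≡⟨ cong (_% q) (binomial q x) ⟩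
    Σ< (suc q) b % q ≡⟨ cong (_% q) (cong (_+ b q) (trans (cong (λ z → Σ< z b) q≡1+n) (Σ-shift n b))) ⟩
    (b 0 + Σ< n (b ∘ suc) + b q) % q ≡⟨ +-≈ {b 0 + Σ< n (b ∘ suc)} {1} {b q} {x}
                                                        (+-≈ {b 0} {1} {Σ< n (b ∘ suc)} {0} (cong (_% q) (trans (*-identityʳ _) (nC0≡1 q)))
                                                          (∣⇒≈0 (∣Σ n (b ∘ suc) (λ i i<n → ∣m⇒∣m*n (x ^ suc i) (q∣C i i<n)))))
                                                        (trans (cong (_% q) (trans (cong (_* x ^ q) (nCn≡1 q)) (*-identityˡ _))) (fermat′ x)) ⟩
    (1 + x) % q ∎
    where
    open ≡-Reasoning
    b : ℕ → ℕ
    b i = (q C i) * x ^ i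
    q∣C : ∀ i → i < n → q ∣ q C suc i
    q∣C i i<n = [ (λ q∣i → contradiction q∣i (∤-small z<s (≤-trans (s≤s i<n) (≤-reflexive (sym q≡1+n))))) , id ]′
      (euclidsLemma (suc i) (q C suc i) q-prime
        (subst (q ∣_) (sym (trans (cong (λ z → suc i * (z C suc i)) q≡1+n) (trans (absorption n i) (cong (_* (n C i)) (sym q≡1+n))))) (m∣m*n (n C i))))

  fermat : ∀ x → q ∤ x → x ^ n ≈ 1
  fermat x q∤x = *-cancelˡ-≈ x (x ^ n) 1 q∤x (trans (cong (λ z → x ^ z % q) (sym q≡1+n)) (trans (fermat′ x) (cong (_% q) (sym (*-identityʳ x)))))

  fermat-* : ∀ x c → q ∤ x → x ^ (c * n) ≈ 1
  fermat-* x c q∤x = trans (cong (_% q) (trans (cong (x ^_) (*-comm c n)) (sym (^-*-assoc x n c))))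
    (trans (^-≈ {x ^ n} {1} c (fermat x q∤x)) (cong (_% q) (^-zeroˡ c)))

  -- For x prime to q this is Fermat. The bound 1 ≤ a matters at x ≡ 0, where the zeroth power is 1
  -- and all others are 0.
  ^-period : ∀ x a c → 1 ≤ a → x ^ (a + c * n) ≈ x ^ a
  ^-period x a c 1≤a with q ∣? x
  ... | no q∤x = trans (cong (_% q) (^-distribˡ-+-* x a (c * n)))
                   (trans (*-≈ {x ^ a} {x ^ a} {x ^ (c * n)} {1} refl (fermat-* x c q∤x)) (cong (_% q) (*-identityʳ (x ^ a))))
  ... | yes q∣x = trans (zeros (a + c * n) (≤-trans 1≤a (m≤m+n a _))) (sym (zeros a 1≤a))
    where
    zeros : ∀ e → 1 ≤ e → x ^ e ≈ 0
    zeros (suc e) _ = ∣⇒≈0 (∣m⇒∣m*n (x ^ e) q∣x)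

  powerSum : ℕ → ℕ
  powerSum k = Σ< q (λ x → x ^ k)

  private
    telescope : ∀ m k → Σ< m (λ x → suc x ^ suc k) ≡ Σ< m (λ x → x ^ suc k) + m ^ suc k
    telescope zero    k = refl
    telescope (suc m) k rewrite telescope m k = refl

    -- Pascal's recursion for power sums: expand (x + 1)^(k+1) binomially and telescope over x < q.
    recursion : ∀ k → Σ< (suc k) (λ i → (suc k C i) * powerSum i) ≡ q ^ suc k
    recursion k = +-cancelʳ-≡ (powerSum (suc k)) _ _ (begin
      Σ< (suc k) c + powerSum (suc k) ≡⟨ cong (Σ< (suc k) c +_) (sym (trans (cong (_* powerSum (suc k)) (nCn≡1 (suc k))) (*-identityˡ _))) ⟩
      Σ< (suc (suc k)) c ≡⟨ Σ-cong (suc (suc k)) (λ i _ → sym (Σ-*ˡ (suc k C i) q (λ x → x ^ i))) ⟩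
      Σ< (suc (suc k)) (λ i → Σ< q (λ x → (suc k C i) * x ^ i)) ≡⟨ Σ-swap (suc (suc k)) q (λ i x → (suc k C i) * x ^ i) ⟩
      Σ< q (λ x → Σ< (suc (suc k)) (λ i → (suc k C i) * x ^ i)) ≡⟨ Σ-cong q (λ x _ → sym (binomial (suc k) x)) ⟩
      Σ< q (λ x → suc x ^ suc k) ≡⟨ telescope q k ⟩
      powerSum (suc k) + q ^ suc k ≡⟨ +-comm (powerSum (suc k)) _ ⟩
      q ^ suc k + powerSum (suc k) ∎)
      where
      open ≡-Reasoning
      c : ℕ → ℕ
      c i = (suc k C i) * powerSum i

    1+nCn : ∀ k → suc k C k ≡ suc k
    1+nCn zero    = refl
    1+nCn (suc k) = trans (sym (nCk+nC[k+1]≡[n+1]C[k+1] (suc k) k))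
                          (trans (cong₂ _+_ (1+nCn k) (nCn≡1 (suc k))) (+-comm (suc k) 1))

  -- In `recursion` the coefficient of `powerSum k` is k + 1, which is prime to q for k < q - 1, so
  -- the lower power sums determine this one. The case k = 0 relies on 0^0 = 1.
  powerSum-small : ∀ k → k < n → q ∣ powerSum k
  powerSum-small = <-rec _ step
    where
    step : ∀ k → (∀ {i} → i < k → i < n → q ∣ powerSum i) → k < n → q ∣ powerSum k
    step k rec k<n = [ (λ q∣1+k → contradiction q∣1+k (∤-small z<s (≤-trans (s≤s k<n) (≤-reflexive (sym q≡1+n))))) , id ]′
      (euclidsLemma (suc k) (powerSum k) q-prime (subst (λ z → q ∣ z * powerSum k) (1+nCn k)
        (∣m+n∣m⇒∣n (subst (q ∣_) (sym (recursion k)) (m∣m*n (q ^ k)))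
                    (∣Σ k _ (λ i i<k → ∣n⇒∣m*n (suc k C i) (rec i<k (<-trans i<k k<n)))))))

  powerSum-period : ∀ a c → 1 ≤ a → powerSum (a + c * n) ≈ powerSum a
  powerSum-period a c 1≤a = Σ-≈ q (λ x _ → ^-period x a c 1≤a)

  powerSum-n : powerSum n ≈ n
  powerSum-n = begin
    powerSum n % q ≡⟨ cong (λ z → Σ< z (λ x → x ^ n) % q) q≡1+n ⟩
    Σ< (suc n) (λ x → x ^ n) % q ≡⟨ cong (_% q) (Σ-shift n (λ x → x ^ n)) ⟩
    (0 ^ n + Σ< n (λ x → suc x ^ n)) % q ≡⟨ +-≈ {0 ^ n} {0} {Σ< n (λ x → suc x ^ n)} {Σ< n (λ _ → 1)} (cong (_% q) (0^ 0<n))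
                                                            (Σ-≈ n (λ x x<n → fermat (suc x) (∤-small z<s (≤-trans (s≤s x<n) (≤-reflexive (sym q≡1+n)))))) ⟩
    Σ< n (λ _ → 1) % q ≡⟨ cong (_% q) (trans (Σ-const n 1) (*-identityʳ n)) ⟩
    n % q ∎
    where
    open ≡-Reasoning
    0^ : ∀ {k} → 0 < k → 0 ^ k ≡ 0
    0^ {suc k} _ = refl

  mixedSum : ℕ → ℕ → ℕ
  mixedSum v w = Σ< q (λ y → (1 + y) ^ v * y ^ w)

  mixedSum-expand : ∀ v w → mixedSum v w ≡ Σ< (suc v) (λ i → (v C i) * powerSum (w + i))
  mixedSum-expand v w = begin
    Σ< q (λ y → (1 + y) ^ v * y ^ w) ≡⟨ Σ-cong q (λ y _ → trans (cong (_* y ^ w) (binomial v y)) (sym (Σ-*ʳ (y ^ w) (suc v) (λ i → (v C i) * y ^ i)))) ⟩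
    Σ< q (λ y → Σ< (suc v) (λ i → (v C i) * y ^ i * y ^ w)) ≡⟨ Σ-swap q (suc v) (λ y i → (v C i) * y ^ i * y ^ w) ⟩
    Σ< (suc v) (λ i → Σ< q (λ y → (v C i) * y ^ i * y ^ w)) ≡⟨ Σ-cong (suc v) (λ i _ → trans (Σ-cong q (λ y _ → pull i y)) (Σ-*ˡ (v C i) q (λ y → y ^ (w + i)))) ⟩
    Σ< (suc v) (λ i → (v C i) * powerSum (w + i)) ∎
    where
    open ≡-Reasoning
    pull : ∀ i y → (v C i) * y ^ i * y ^ w ≡ (v C i) * y ^ (w + i)
    pull i y = trans (*-assoc (v C i) (y ^ i) (y ^ w)) (cong ((v C i) *_) (trans (sym (^-distribˡ-+-* y i w)) (cong (y ^_) (+-comm i w))))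

  -- Every power sum in the expansion has an exponent of at most w + v, hence below q - 1.
  mixedSum-vanish : ∀ v w → w + v < n → q ∣ mixedSum v w
  mixedSum-vanish v w w+v<n rewrite mixedSum-expand v w =
    ∣Σ (suc v) _ (λ i i<1+v → ∣n⇒∣m*n (v C i) (powerSum-small (w + i) (≤-<-trans (+-monoʳ-≤ w (s≤s⁻¹ i<1+v)) w+v<n)))

  -- Only the power sum with exponent n = q − 1 contributes.
  mixedSum-nonzero : ∀ v w i → w + i ≡ n → 1 ≤ w → i ≤ v → v < n → q ∤ mixedSum v w
  mixedSum-nonzero v w i w+i≡n 1≤w i≤v v<n q∣M =
    prime∤* n (v C i) q-prime (∤-small 0<n n<q) (prime∤C v i q-prime (<-trans v<n n<q) i≤v)
      (≈0⇒∣ (trans (sym single) (trans (cong (_% q) (sym (mixedSum-expand v w))) (∣⇒≈0 q∣M))))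
    where
    open ≡-Reasoning
    term : ∀ t → t < suc v → (v C t) * powerSum (w + t) ≈ 𝟙 (t ≟ i) * (n * (v C i))
    term t t<1+v with t ≟ i
    ... | yes refl = trans (*-≈ {v C t} {v C t} {powerSum (w + t)} {n} refl (trans (cong (λ z → powerSum z % q) w+i≡n) powerSum-n))
                           (cong (_% q) (trans (*-comm (v C t) n) (sym (*-identityˡ _))))
    ... | no t≢i with w + t <? n
    ...   | yes lt = ∣⇒≈0 (∣n⇒∣m*n (v C t) (powerSum-small (w + t) lt))
    -- Here w + t exceeds n, and lowering the exponent by n leaves a positive exponent below n, so
    -- this power sum vanishes too.
    ...   | no  ≮n = trans (*-≈ {v C t} {v C t} {powerSum (w + t)} {0} refl (trans (cong (λ z → powerSum z % q) (sym eq)) (trans (powerSum-period s 1 1≤s) (∣⇒≈0 (powerSum-small s s<n)))))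
                           (cong (_% q) (*-zeroʳ (v C t)))
      where
      s : ℕ
      s = w + t ∸ n
      eq : s + 1 * n ≡ w + t
      eq = trans (cong (s +_) (*-identityˡ n)) (m∸n+n≡m (≮⇒≥ ≮n))
      i<t : i < t
      i<t = ≤∧≢⇒< (+-cancelˡ-≤ w i t (≤-trans (≤-reflexive w+i≡n) (≮⇒≥ ≮n))) (t≢i ∘ sym)
      1≤s : 1 ≤ s
      1≤s = m<n⇒0<n∸m (≤-trans (s≤s (≤-reflexive (sym w+i≡n))) (+-monoʳ-< w i<t))
      s<n : s < n
      s<n = +-cancelʳ-< n s n (≤-trans (s≤s (≤-reflexive (m∸n+n≡m (≮⇒≥ ≮n)))) (+-mono-≤-< (≤-trans (m≤m+n w i) (≤-reflexive w+i≡n)) (≤-trans t<1+v v<n)))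
    single : Σ< (suc v) (λ t → (v C t) * powerSum (w + t)) ≈ n * (v C i)
    single = trans (Σ-≈ (suc v) term) (cong (_% q) (Σ-pick (suc v) (λ _ → n * (v C i)) (s≤s i≤v)))

-- Linear systems modulo a prime

module Elimination (q : ℕ) (q-prime : Prime q) where
  open PrimeField q q-prime

  -- A homogeneous linear system over 𝔽_q with more unknowns (t < u, W t) than equations
  -- (a < N, E a) has a nontrivial solution.
  solution : ∀ N {E : ℕ → Set} (E? : Decidable E) u {W : ℕ → Set} (W? : Decidable W) (A : ℕ → ℕ → ℕ) →
             # N E? < # u W? →
             ∃ λ (g : ℕ → ℕ) → (∃ λ t → t < u × W t × q ∤ g t) ×
                     (∀ a → a < N → E a → q ∣ Σ< u (λ t → 𝟙 (W? t) * (A a t * g t)))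
  solution zero E? u W? A 0<# = case #>0⇒∃ u 0<# of λ where
    (t , t<u , wt) → (λ _ → 1) , (t , t<u , wt , ∤-small z<s (prime>1 q-prime)) , λ _ ()
  solution (suc N) {E} E? u {W} W? A lt with E? N
  ... | no ¬E = case solution N E? u W? A (subst (_< # u W?) (+-identityʳ _) lt) of λ where
    (g , nz , sol) → g , nz , λ a a<1+N Ea → case m≤n⇒m<n∨m≡n (s≤s⁻¹ a<1+N) of λ where
      (inj₁ a<N)  → sol a a<N Ea
      (inj₂ refl) → contradiction Ea ¬E
  ... | yes _ with anyUpTo? (λ t → W? t ×-dec ¬? (q ∣? A N t)) u
  ...   | no none = case solution N E? u W? A (≤-<-trans (m≤m+n _ 1) lt) of λ where
      (g , nz , sol) → g , nz , λ a a<1+N Ea → case m≤n⇒m<n∨m≡n (s≤s⁻¹ a<1+N) of λ where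
        (inj₁ a<N)  → sol a a<N Ea
        (inj₂ refl) → ∣Σ u _ λ t t<u → zeroTerm t t<u (W? t) (g t)
    where
    zeroTerm : ∀ t → t < u → (d : Dec (W t)) → ∀ x → q ∣ 𝟙 d * (A N t * x)
    zeroTerm t t<u (no _)  x = q ∣0
    zeroTerm t t<u (yes w) x with q ∣? A N t
    ... | yes q∣A = ∣n⇒∣m*n 1 (∣m⇒∣m*n x q∣A)
    ... | no  q∤A = contradiction (t , t<u , w , q∤A) none
  ...   | yes (p , p<u , wp , q∤rp) = g , nonzero , solves
    where
    W′? : Decidable (λ t → W t × t ≢ p)
    W′? t = W? t ×-dec ¬? (t ≟ p)

    split𝟙 : ∀ t → 𝟙 (W? t) ≡ 𝟙 (t ≟ p) + 𝟙 (W′? t)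
    split𝟙 t with t ≟ p | W? t
    ... | yes refl | yes _ = refl
    ... | yes refl | no ¬w = contradiction wp ¬w
    ... | no _     | yes _ = refl
    ... | no _     | no _  = refl

    count : # u W? ≡ 1 + # u W′?
    count = trans (Σ-cong u (λ t _ → split𝟙 t)) (trans (Σ-+ u _ _)
      (cong (_+ # u W′?) (trans (Σ-cong u (λ t _ → sym (*-identityʳ _))) (Σ-pick u (λ _ → 1) p<u))))

    -- Elimination without division: row a times the pivot, minus the pivot row times the entry of
    -- row a in the pivot column.
    A′ : ℕ → ℕ → ℕ
    A′ a t = A a t * A N p + neg (A a p * A N t)

    rec = solution N E? u W′? A′ (s≤s⁻¹ (subst₂ _<_ (+-comm (# N E?) 1) count lt))
    h = proj₁ rec

    s : ℕ
    s = Σ< u (λ t → 𝟙 (W′? t) * (A N t * h t))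

    -- Scaling the other coordinates by the pivot makes -s solve row N for the pivot coordinate,
    -- again without an inverse.
    val : ∀ t → Dec (t ≡ p) → ℕ
    val t (yes _) = neg s
    val t (no _)  = A N p * h t

    g : ℕ → ℕ
    g t = val t (t ≟ p)

    nonzero : ∃ λ t → t < u × W t × q ∤ g t
    nonzero = case proj₁ (proj₂ rec) of λ where (t , t<u , (wt , t≢p) , q∤ht) → t , t<u , wt , λ q∣g →
                                                  prime∤* (A N p) (h t) q-prime q∤rp q∤ht (subst (q ∣_) (off t t≢p) q∣g)
      where
      off : ∀ t → t ≢ p → g t ≡ A N p * h t
      off t t≢p with t ≟ p
      ... | yes e = contradiction e t≢p
      ... | no _  = refl

    term : ∀ a t → 𝟙 (W? t) * (A a t * g t) ≡ 𝟙 (t ≟ p) * (A a t * neg s) + 𝟙 (W′? t) * (A a t * (A N p * h t))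
    term a t with t ≟ p | W? t
    ... | yes refl | yes _ = sym (+-identityʳ _)
    ... | yes refl | no ¬w = contradiction wp ¬w
    ... | no _     | yes _ = refl
    ... | no _     | no _  = refl

    total : ∀ a → Σ< u (λ t → 𝟙 (W? t) * (A a t * g t)) ≡ A a p * neg s + Σ< u (λ t → 𝟙 (W′? t) * (A a t * (A N p * h t)))
    total a = trans (Σ-cong u (λ t _ → term a t)) (trans (Σ-+ u _ _) (cong (_+ Σ< u (λ t → 𝟙 (W′? t) * (A a t * (A N p * h t)))) (Σ-pick u (λ t → A a t * neg s) p<u)))

    rearrange : ∀ i a b c d e m → i * ((a * b + m * (c * d)) * e) ≡ i * (a * (b * e)) + (m * c) * (i * (d * e))
    rearrange = solve-∀

    solves : ∀ a → a < suc N → E a → q ∣ Σ< u (λ t → 𝟙 (W? t) * (A a t * g t))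
    solves a a<1+N Ea with m≤n⇒m<n∨m≡n (s≤s⁻¹ a<1+N)
    ... | inj₁ a<N = subst (q ∣_) (sym (trans (total a) eq)) (proj₂ (proj₂ rec) a a<N Ea)
      where
      assoc′ : ∀ x m y → x * (m * y) ≡ (m * x) * y
      assoc′ = solve-∀
      eq : A a p * neg s + Σ< u (λ t → 𝟙 (W′? t) * (A a t * (A N p * h t))) ≡ Σ< u (λ t → 𝟙 (W′? t) * (A′ a t * h t))
      eq = begin
        A a p * neg s + Σ< u (λ t → 𝟙 (W′? t) * (A a t * (A N p * h t)))
          ≡⟨ +-comm (A a p * neg s) _ ⟩
        Σ< u (λ t → 𝟙 (W′? t) * (A a t * (A N p * h t))) + A a p * neg s
          ≡⟨ cong (Σ< u (λ t → 𝟙 (W′? t) * (A a t * (A N p * h t))) +_) (trans (assoc′ (A a p) (q ∸ 1) s) (sym (Σ-*ˡ ((q ∸ 1) * A a p) u (λ t → 𝟙 (W′? t) * (A N t * h t))))) ⟩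
        Σ< u (λ t → 𝟙 (W′? t) * (A a t * (A N p * h t))) + Σ< u (λ t → ((q ∸ 1) * A a p) * (𝟙 (W′? t) * (A N t * h t)))
          ≡⟨ sym (Σ-+ u _ _) ⟩
        Σ< u (λ t → 𝟙 (W′? t) * (A a t * (A N p * h t)) + ((q ∸ 1) * A a p) * (𝟙 (W′? t) * (A N t * h t)))
          ≡⟨ Σ-cong u (λ t _ → sym (rearrange (𝟙 (W′? t)) (A a t) (A N p) (A a p) (A N t) (h t) (q ∸ 1))) ⟩
        Σ< u (λ t → 𝟙 (W′? t) * (A′ a t * h t))
          ∎
        where open ≡-Reasoning
    ... | inj₂ refl = subst (q ∣_) (sym (trans (total N) eq)) (≈0⇒∣ (+-neg (A N p * s)))
      where
      flip : ∀ i a b c → i * (a * (b * c)) ≡ b * (i * (a * c))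
      flip = solve-∀
      assoc″ : ∀ x m y → x * (m * y) ≡ m * (x * y)
      assoc″ = solve-∀
      eq : A N p * neg s + Σ< u (λ t → 𝟙 (W′? t) * (A N t * (A N p * h t))) ≡ A N p * s + neg (A N p * s)
      eq = trans (cong₂ _+_ (assoc″ (A N p) (q ∸ 1) s)
                   (trans (Σ-cong u (λ t _ → flip (𝟙 (W′? t)) (A N t) (A N p) (h t))) (Σ-*ˡ (A N p) u (λ t → 𝟙 (W′? t) * (A N t * h t)))))
                 (+-comm (neg (A N p * s)) (A N p * s))

-- The image of x ↦ x^j(x − 1)

_ShiftedPower_ : ℕ → ℕ → ℕ
j ShiftedPower y = (1 + y) ^ j * y

-- With x = 1 + y these are the residues of x^j(x − 1).
Image : (q : ℕ) .{{_ : NonZero q}} → ℕ → ℕ → Set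
Image q j a = ∃ λ y → y < q × a ≡ (j ShiftedPower y) % q

Image? : ∀ q .{{_ : NonZero q}} j → Decidable (Image q j)
Image? q j a = anyUpTo? (λ y → a ≟ (j ShiftedPower y) % q) q

imageSize : (q : ℕ) .{{_ : NonZero q}} → ℕ → ℕ
imageSize q j = # q (Image? q j)

missing : (q : ℕ) .{{_ : NonZero q}} → ℕ → ℕ
missing q j = # q (λ a → ¬? (Image? q j a))

imageSize+missing : ∀ q .{{_ : NonZero q}} j → imageSize q j + missing q j ≡ q
imageSize+missing q j = trans (sym (Σ-+ q _ _)) (trans (Σ-cong q (λ a _ → compl (Image? q j a))) (trans (Σ-const q 1) (*-identityʳ q)))
  where
  compl : ∀ {P : Set} (d : Dec P) → 𝟙 d + 𝟙 (¬? d) ≡ 1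
  compl (yes _) = refl
  compl (no _)  = refl

module Values (q : ℕ) (q-prime : Prime q) (j : ℕ) (1≤j : 1 ≤ j) where
  open PrimeField q q-prime
  open Elimination q q-prime

  f : ℕ → ℕ
  f y = j ShiftedPower y

  fibre : ℕ → ℕ
  fibre a = # q (λ y → a ≟ f y % q)

  -- The residues at which summing over values differs from summing over 𝔽_q. The residue 0 is left
  -- out because every test function below has a factor a^w with w ≥ 1.
  Irregular : ℕ → Set
  Irregular a = a ≢ 0 × fibre a ≢ 1

  Irregular? : Decidable Irregular
  Irregular? a = ¬? (a ≟ 0) ×-dec ¬? (fibre a ≟ 1)

  private
    Σ-fibres : Σ< q fibre ≡ q
    Σ-fibres = trans (Σ-cong q (λ a _ → sym (*-identityʳ (fibre a))))
      (trans (sym (Σ-fibre q q (λ y → f y % q) (λ _ → 1) (λ y _ → m%n<n (f y) q)))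
             (trans (Σ-const q 1) (*-identityʳ q)))

    fibre+missing : ∀ a → 1 ≤ fibre a + 𝟙 (¬? (Image? q j a))
    fibre+missing a with Image? q j a
    ... | no _ = m≤n+m 1 (fibre a)
    ... | yes (y , y<q , e) = ≤-trans (∃⇒#>0 q y<q e) (m≤m+n (fibre a) 0)

    1<fibre? : Decidable (λ a → 1 < fibre a)
    1<fibre? a = 1 <? fibre a

    -- The fibres have total size q, and so has 𝔽_q; the surplus of a repeated value must be paid
    -- for by a missing one.
    repeated≤missing : # q 1<fibre? ≤ missing q j
    repeated≤missing = +-cancelʳ-≤ q _ _ (begin
      # q 1<fibre? + q ≡⟨ cong (# q 1<fibre? +_) (sym (trans (Σ-const q 1) (*-identityʳ q))) ⟩
      # q 1<fibre? + Σ< q (λ _ → 1) ≡⟨ sym (Σ-+ q _ _) ⟩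
      Σ< q (λ a → 𝟙 (1<fibre? a) + 1) ≤⟨ Σ-mono q (λ a _ → point a) ⟩
      Σ< q (λ a → 𝟙 (¬? (Image? q j a)) + fibre a) ≡⟨ Σ-+ q _ _ ⟩
      missing q j + Σ< q fibre ≡⟨ cong (missing q j +_) Σ-fibres ⟩
      missing q j + q ∎)
      where
      open ≤-Reasoning
      point : ∀ a → 𝟙 (1<fibre? a) + 1 ≤ 𝟙 (¬? (Image? q j a)) + fibre a
      point a with 1<fibre? a
      ... | yes 1<fib = ≤-trans 1<fib (m≤n+m _ _)
      ... | no _      = ≤-trans (fibre+missing a) (≤-reflexive (+-comm (fibre a) _))

  irregular≤2missing : # q Irregular? ≤ 2 * missing q j
  irregular≤2missing = ≤-trans (#-∪ {P? = Irregular?} q {Q? = 1<fibre?} {R? = λ a → ¬? (Image? q j a)} cases)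
    (≤-trans (+-monoˡ-≤ (missing q j) repeated≤missing) (≤-reflexive (cong (missing q j +_) (sym (+-identityʳ _)))))
    where
    cases : ∀ a → a < q → Irregular a → 1 < fibre a ⊎ ¬ Image q j a
    cases a _ (_ , ≢1) with fibre a in eq
    ... | zero        = inj₂ λ { (y , y<q , e) → <⇒≢ (∃⇒#>0 q y<q e) (sym eq) }
    ... | suc zero    = contradiction refl ≢1
    ... | suc (suc m) = inj₁ (s≤s (s≤s z≤n))

  -- y = 0 and y = −1 are both sent to 0
  missing>0 : 1 ≤ missing q j
  missing>0 = ≤-trans (∃⇒#>0 {P? = 1<fibre?} q (>-nonZero⁻¹ q) two) repeated≤missing
    where
    hit : ∀ y → y < q → q ∣ f y → 1 ≤ 𝟙 (0 ≟ f y % q)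
    hit y y<q q∣fy = ≤-reflexive (sym (𝟙-yes (sym (n∣m⇒m%n≡0 (f y) q q∣fy)) (0 ≟ f y % q)))
    q∣f0 : q ∣ f 0
    q∣f0 = subst (q ∣_) (sym (*-zeroʳ (1 ^ j))) (q ∣0)
    q∣fn : q ∣ f n
    q∣fn = ∣m⇒∣m*n n (subst (λ z → q ∣ z ^ j) q≡1+n (∣^ 1≤j))
      where
      ∣^ : ∀ {j} → 1 ≤ j → q ∣ q ^ j
      ∣^ {suc j} _ = m∣m*n (q ^ j)
    two : 1 < fibre 0
    two = subst (λ z → 1 < Σ< z (λ y → 𝟙 (0 ≟ f y % q))) (sym q≡1+n)
      (+-mono-≤ (≤-trans (hit 0 (>-nonZero⁻¹ q) q∣f0) (term≤Σ n (λ y → 𝟙 (0 ≟ f y % q)) 0<n)) (hit n n<q q∣fn))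

  valueSum : ℕ → ℕ
  valueSum w = Σ< q (λ y → f y ^ w)

  -- Grouped by value, the left side is the sum of `fibre a * h a`, and the weight `fibre a` is 1
  -- wherever `h` need not vanish.
  Σ-regular : (h : ℕ → ℕ) → (∀ a b → a ≈ b → h a ≈ h b) → q ∣ h 0 → (∀ a → a < q → Irregular a → q ∣ h a) →
              Σ< q (λ y → h (f y)) ≈ Σ< q h
  Σ-regular h h-cong h0 hE = trans (Σ-≈ q (λ y _ → h-cong (f y) (f y % q) (sym (%-≈ (f y)))))
    (trans (cong (_% q) (Σ-fibre q q (λ y → f y % q) h (λ y _ → m%n<n (f y) q))) (Σ-≈ q point))
    where
    point : ∀ a → a < q → fibre a * h a ≈ h a
    point a a<q with a ≟ 0 | fibre a ≟ 1
    ... | yes refl | _       = trans (∣⇒≈0 (∣n⇒∣m*n (fibre 0) h0)) (sym (∣⇒≈0 h0))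
    ... | no _     | yes fib≡1 = cong (_% q) (trans (cong (_* h a) fib≡1) (*-identityˡ (h a)))
    ... | no a≢0   | no fib≢1  = trans (∣⇒≈0 (∣n⇒∣m*n (fibre a) (hE a a<q (a≢0 , fib≢1)))) (sym (∣⇒≈0 (hE a a<q (a≢0 , fib≢1))))

  Σ-≈-cancel : ∀ m (x z : ℕ → ℕ) t → t < m → (∀ i → i < m → i ≢ t → x i ≈ z i) → Σ< m x ≈ Σ< m z → x t ≈ z t
  Σ-≈-cancel (suc m) x z t t<1+m off e with m≤n⇒m<n∨m≡n (s≤s⁻¹ t<1+m)
  ... | inj₂ refl = +-cancelʳ-≈ (x m) (z m) (Σ< m z) (begin
      (x m + Σ< m z) % q ≡⟨ +-≈ {x m} {x m} refl (Σ-≈ m (λ i i<m → sym (off i (m<n⇒m<1+n i<m) (<⇒≢ i<m)))) ⟩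
      (x m + Σ< m x) % q ≡⟨ cong (_% q) (+-comm (x m) _) ⟩
      (Σ< m x + x m) % q ≡⟨ e ⟩
      (Σ< m z + z m) % q ≡⟨ cong (_% q) (+-comm (Σ< m z) _) ⟩
      (z m + Σ< m z) % q ∎)
    where open ≡-Reasoning
  ... | inj₁ t<m = Σ-≈-cancel m x z t t<m (λ i i<m → off i (m<n⇒m<1+n i<m))
    (+-cancelʳ-≈ (Σ< m x) (Σ< m z) (x m) (trans e (+-≈ {Σ< m z} {Σ< m z} refl (sym (off m ≤-refl (<⇒≢ t<m ∘ sym))))))

  private
    -- The lowest term of the combination Σ g t · a^(tε) is isolated by the moment relations.
    isolated : ∀ u ε w₀ {W : ℕ → Set} (W? : Decidable W) → u * ε < w₀ →
      (∀ t₀ t → t₀ < t → t < u → W t₀ → W t → valueSum (w₀ + (t ∸ t₀) * ε) ≈ powerSum (w₀ + (t ∸ t₀) * ε)) →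
      (g : ℕ → ℕ) → (∀ a → a < q → Irregular a → q ∣ Σ< u (λ t → 𝟙 (W? t) * (a ^ (t * ε) * g t))) →
      ∀ t₀ → t₀ < u → W t₀ → (∀ t → t < t₀ → ¬ (W t × q ∤ g t)) → g t₀ * valueSum w₀ ≈ g t₀ * powerSum w₀
    isolated u ε w₀ {W} W? uε<w₀ vanish g kills t₀ t₀<u wt₀ minimal = subst₂ _≈_ (simp valueSum) (simp powerSum) (Σ-≈-cancel u X Z t₀ t₀<u off sums)
      where
      -- The shift gives the term t₀ of a^w · Σ g t · a^(tε) the exponent w₀. It stays positive
      -- because uε < w₀, so the test function vanishes at 0.
      w : ℕ
      w = w₀ ∸ t₀ * ε
      t₀ε≤ : t₀ * ε ≤ u * ε
      t₀ε≤ = *-monoˡ-≤ ε (<⇒≤ t₀<u)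
      1≤w : 1 ≤ w
      1≤w = m<n⇒0<n∸m (≤-<-trans t₀ε≤ uε<w₀)
      w+ : w + t₀ * ε ≡ w₀
      w+ = m∸n+n≡m (<⇒≤ (≤-<-trans t₀ε≤ uε<w₀))

      G : ℕ → ℕ
      G a = Σ< u (λ t → 𝟙 (W? t) * (a ^ (t * ε) * g t))
      h : ℕ → ℕ
      h a = a ^ w * G a
      h-cong : ∀ a b → a ≈ b → h a ≈ h b
      h-cong a b e = *-≈ {a ^ w} {b ^ w} (^-≈ {a} {b} w e) (Σ-≈ u (λ t _ → *-≈ {𝟙 (W? t)} refl (*-≈ {a ^ (t * ε)} {b ^ (t * ε)} {g t} {g t} (^-≈ {a} {b} (t * ε) e) refl)))
      h0 : q ∣ h 0
      h0 = subst (λ z → q ∣ z * G 0) (sym (0^ 1≤w)) (q ∣0)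
        where
        0^ : ∀ {e} → 1 ≤ e → 0 ^ e ≡ 0
        0^ {suc e} _ = refl

      expand : ∀ (σ : ℕ → ℕ) → Σ< q (λ y → h (σ y)) ≡ Σ< u (λ t → 𝟙 (W? t) * (g t * Σ< q (λ y → σ y ^ (w + t * ε))))
      expand σ = begin
        Σ< q (λ y → σ y ^ w * G (σ y)) ≡⟨ Σ-cong q (λ y _ → sym (Σ-*ˡ (σ y ^ w) u _)) ⟩
        Σ< q (λ y → Σ< u (λ t → σ y ^ w * (𝟙 (W? t) * (σ y ^ (t * ε) * g t)))) ≡⟨ Σ-swap q u (λ y t → σ y ^ w * (𝟙 (W? t) * (σ y ^ (t * ε) * g t))) ⟩
        Σ< u (λ t → Σ< q (λ y → σ y ^ w * (𝟙 (W? t) * (σ y ^ (t * ε) * g t)))) ≡⟨ Σ-cong u (λ t _ → trans (Σ-cong q (λ y _ → move t y)) (trans (Σ-*ˡ (𝟙 (W? t)) q _) (cong (𝟙 (W? t) *_) (Σ-*ˡ (g t) q _)))) ⟩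
        Σ< u (λ t → 𝟙 (W? t) * (g t * Σ< q (λ y → σ y ^ (w + t * ε)))) ∎
        where
        open ≡-Reasoning
        ring : ∀ a i b c → a * (i * (b * c)) ≡ i * (c * (a * b))
        ring = solve-∀
        move : ∀ t y → σ y ^ w * (𝟙 (W? t) * (σ y ^ (t * ε) * g t)) ≡ 𝟙 (W? t) * (g t * σ y ^ (w + t * ε))
        move t y = trans (ring (σ y ^ w) (𝟙 (W? t)) (σ y ^ (t * ε)) (g t))
                         (cong (λ z → 𝟙 (W? t) * (g t * z)) (sym (^-distribˡ-+-* (σ y) w (t * ε))))

      X Z : ℕ → ℕ
      X t = 𝟙 (W? t) * (g t * valueSum (w + t * ε))
      Z t = 𝟙 (W? t) * (g t * powerSum (w + t * ε))

      sums : Σ< u X ≈ Σ< u Z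
      sums = trans (cong (_% q) (sym (expand f))) (trans (Σ-regular h h-cong h0 (λ a a<q irr → ∣n⇒∣m*n (a ^ w) (kills a a<q irr)))
                   (cong (_% q) (expand id)))

      off : ∀ t → t < u → t ≢ t₀ → X t ≈ Z t
      off t t<u t≢t₀ = weigh (W? t)
        where
        compare : W t → Tri (t < t₀) (t ≡ t₀) (t₀ < t) → g t * valueSum (w + t * ε) ≈ g t * powerSum (w + t * ε)
        compare wt (tri≈ _ t≡t₀ _) = contradiction t≡t₀ t≢t₀
        compare wt (tri< t<t₀ _ _) = trans (∣⇒≈0 (∣m⇒∣m*n (valueSum (w + t * ε)) q∣g)) (sym (∣⇒≈0 (∣m⇒∣m*n (powerSum (w + t * ε)) q∣g)))
          where
          q∣g : q ∣ g t
          q∣g = decidable-stable (q ∣? g t) λ q∤g → minimal t t<t₀ (wt , q∤g)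
        compare wt (tri> _ _ t₀<t) = *-≈ {g t} {g t} refl (subst (λ z → valueSum z ≈ powerSum z) eq (vanish t₀ t t₀<t t<u wt₀ wt))
          where
          eq : w₀ + (t ∸ t₀) * ε ≡ w + t * ε
          eq = begin
            w₀ + (t ∸ t₀) * ε ≡⟨ cong (_+ (t ∸ t₀) * ε) (sym w+) ⟩
            w + t₀ * ε + (t ∸ t₀) * ε ≡⟨ +-assoc w _ _ ⟩
            w + (t₀ * ε + (t ∸ t₀) * ε) ≡⟨ cong (w +_) (sym (*-distribʳ-+ ε t₀ (t ∸ t₀))) ⟩
            w + (t₀ + (t ∸ t₀)) * ε ≡⟨ cong (λ z → w + z * ε) (m+[n∸m]≡n (<⇒≤ t₀<t)) ⟩
            w + t * ε ∎
            where open ≡-Reasoning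
        weigh : (d : Dec (W t)) → 𝟙 d * (g t * valueSum (w + t * ε)) ≈ 𝟙 d * (g t * powerSum (w + t * ε))
        weigh (no _)   = refl
        weigh (yes wt) = *-≈ {1} {1} refl (compare wt (<-cmp t t₀))

      simp : ∀ (S : ℕ → ℕ) → 𝟙 (W? t₀) * (g t₀ * S (w + t₀ * ε)) ≡ g t₀ * S w₀
      simp S = trans (cong₂ (λ i z → i * (g t₀ * S z)) (𝟙-yes wt₀ (W? t₀)) w+) (*-identityˡ _)

  -- If the moments indexed by W were more numerous than the irregular values, some nonzero
  -- combination of the monomials a^(tε) would vanish on the latter.
  moments≤irregular : ∀ u ε w₀ {W : ℕ → Set} (W? : Decidable W) → u * ε < w₀ →
    (∀ t₀ t → t₀ < t → t < u → W t₀ → W t → valueSum (w₀ + (t ∸ t₀) * ε) ≈ powerSum (w₀ + (t ∸ t₀) * ε)) →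
    ¬ (valueSum w₀ ≈ powerSum w₀) → # u W? ≤ # q Irregular?
  moments≤irregular u ε w₀ W? uε<w₀ vanish base = ≮⇒≥ λ more → case solution q Irregular? u W? (λ a t → a ^ (t * ε)) more of λ where
    (g , nonzero , kills) → case least (λ t → W? t ×-dec ¬? (q ∣? g t)) u nonzero of λ where
      (t₀ , t₀<u , (wt₀ , q∤g₀) , minimal) → base (*-cancelˡ-≈ (g t₀) (valueSum w₀) (powerSum w₀) q∤g₀ (isolated u ε w₀ W? uε<w₀ vanish g kills t₀ t₀<u wt₀ minimal))

-- Lower bounds for the number of missing values

private
  -- This and the next two lemmas place v = n + b - m - a strictly between n/8 and 7n/8, for m in
  -- the middle half [n/4, 3n/4] and a, b in a common window of length n/8.
  window-≤ : ∀ n m a b → 4 * m ≤ 3 * n → 8 * a < 8 * b + n → m + a ≤ n + b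
  window-≤ n m a b h₁ h₂ = *-cancelˡ-≤ 8 (linear (8 * (m + a)) (8 * (n + b)) n (+-mono-≤ (*-monoʳ-≤ 2 h₁) (<⇒≤ h₂)) (ring n m a b))
    where
    ring : ∀ n m a b → 8 * (m + a) + (2 * (3 * n) + (8 * b + n)) + n ≡ 8 * (n + b) + (2 * (4 * m) + 8 * a)
    ring = solve-∀

  window-lower : ∀ n m a b v → 4 * m ≤ 3 * n → 8 * a < 8 * b + n → v + (m + a) ≡ n + b → n < 8 * v
  window-lower n m a b v h₁ h₂ e = linear (suc n) (8 * v) 0 (+-mono-≤ (*-monoʳ-≤ 2 h₁) h₂)
    (trans (ring₁ n b) (trans (cong (λ z → suc (8 * z)) (sym e)) (ring₂ m a v)))
    where
    ring₁ : ∀ n b → suc n + (2 * (3 * n) + (8 * b + n)) + 0 ≡ suc (8 * (n + b))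
    ring₁ = solve-∀
    ring₂ : ∀ m a v → suc (8 * (v + (m + a))) ≡ 8 * v + (2 * (4 * m) + suc (8 * a))
    ring₂ = solve-∀

  window-upper : ∀ n m a b v → n ≤ 4 * m → 8 * b < 8 * a + n → v + (m + a) ≡ n + b → 8 * v < 7 * n
  window-upper n m a b v h₁ h₂ e = linear (suc (8 * v)) (7 * n) 0 (+-mono-≤ (*-monoʳ-≤ 2 h₁) h₂)
    (trans (ring₁ m a v n) (trans (cong (λ z → suc (8 * z) + n) e) (ring₂ n b)))
    where
    ring₁ : ∀ m a v n → suc (8 * v) + (2 * (4 * m) + (8 * a + n)) + 0 ≡ suc (8 * (v + (m + a))) + n
    ring₁ = solve-∀
    ring₂ : ∀ n b → suc (8 * (n + b)) + n ≡ 7 * n + (2 * n + suc (8 * b))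
    ring₂ = solve-∀

  8-sum : ∀ n w v → 8 * w < n → 8 * v < 7 * n → w + v < n
  8-sum n w v h₁ h₂ = *-cancelˡ-< 8 (w + v) n (≤-trans (≤-reflexive (cong suc (*-distribˡ-+ 8 w v)))
    (≤-trans (n≤1+n _) (≤-trans (≤-reflexive (sym (cong suc (+-suc (8 * w) (8 * v))))) (≤-trans (+-mono-≤ h₁ h₂) (≤-reflexive refl)))))

module MissingValues (q : ℕ) (q-prime : Prime q) (j : ℕ) (1≤j : 1 ≤ j) where
  open PrimeField q q-prime
  open Values q q-prime j 1≤j

  private
    instance
      n≢0 : NonZero n
      n≢0 = >-nonZero 0<n
    module N = Congruence n

  ^-exponent : ∀ x a b → 1 ≤ a → 1 ≤ b → a N.≈ b → x ^ a ≈ x ^ b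
  ^-exponent x a b 1≤a 1≤b e = case ≤-total a b of λ where
      (inj₁ a≤b) → sym (ordered a b a≤b 1≤a e)
      (inj₂ b≤a) → ordered b a b≤a 1≤b (sym e)
    where
    ordered : ∀ a b → a ≤ b → 1 ≤ a → a N.≈ b → x ^ b ≈ x ^ a
    ordered a b a≤b 1≤a e with subst (n ∣_) (m≤n⇒∣m-n∣≡n∸m a≤b) (N.≈⇒∣ a b e)
    ... | divides c eq = trans (cong (λ z → x ^ z % q) (trans (sym (m+[n∸m]≡n a≤b)) (cong (a +_) eq))) (^-period x a c 1≤a)

  valueSum≈mixedSum : ∀ v w → 1 ≤ v → 1 ≤ w → j * w N.≈ v → valueSum w ≈ mixedSum v w
  valueSum≈mixedSum v w 1≤v 1≤w e = Σ-≈ q (λ y _ → trans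
    (cong (_% q) (trans (^-distribʳ-* ((1 + y) ^ j) y w) (cong (_* y ^ w) (^-*-assoc (1 + y) j w))))
    (*-≈ {(1 + y) ^ (j * w)} {(1 + y) ^ v} {y ^ w} {y ^ w} (^-exponent (1 + y) (j * w) v (*-mono-≤ 1≤j 1≤w) 1≤v e) refl))

  valueSum-period : ∀ w → 1 ≤ w → valueSum (w + 1 * n) ≈ valueSum w
  valueSum-period w 1≤w = Σ-≈ q (λ y _ → ^-period (f y) w 1 1≤w)

  -- Both sides vanish: modulo n the exponent is w, the value sum becomes a mixed sum of degree w +
  -- v < n, and the power sum has exponent w < n.
  moment-relation : ∀ v w → 1 ≤ v → 1 ≤ w → j * w N.≈ v → w + v < n → valueSum (w + 1 * n) ≈ powerSum (w + 1 * n)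
  moment-relation v w 1≤v 1≤w e w+v<n = begin
    valueSum (w + 1 * n) % q ≡⟨ valueSum-period w 1≤w ⟩
    valueSum w % q ≡⟨ valueSum≈mixedSum v w 1≤v 1≤w e ⟩
    mixedSum v w % q ≡⟨ ∣⇒≈0 (mixedSum-vanish v w w+v<n) ⟩
    0 % q ≡⟨ sym (∣⇒≈0 (powerSum-small w (≤-<-trans (m≤m+n w v) w+v<n))) ⟩
    powerSum w % q ≡⟨ sym (powerSum-period w 1 1≤w) ⟩
    powerSum (w + 1 * n) % q ∎
    where open ≡-Reasoning

  -- The exponents tε with jtε mod n in a window of length n/8 satisfy moment relations after a shift by −ε,
  -- because jε mod n is far from 0.
  window-bound : ∀ ε K → 1 ≤ ε → 1 ≤ K → 8 * (K * ε) ≤ n → n ≤ 4 * ((j * ε) % n) → 4 * ((j * ε) % n) ≤ 3 * n →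
                 K ≤ 16 * missing q j
  window-bound ε K 1≤ε 1≤K 8Kε≤n n≤4m 4m≤3n = begin
    K ≡⟨ sym (#-all {P? = λ t → t ≟ t} K (λ _ _ → refl)) ⟩
    # K (λ t → t ≟ t) ≤⟨ #-cover K 8 (λ t → t ≟ t) Window? inWindow ⟩
    Σ< 8 (λ c → # K (Window? c)) ≤⟨ Σ-bound 8 _ (# q Irregular?) (λ c _ → each c) ⟩
    8 * # q Irregular? ≤⟨ *-monoʳ-≤ 8 irregular≤2missing ⟩
    8 * (2 * missing q j) ≡⟨ sym (*-assoc 8 2 (missing q j)) ⟩
    16 * missing q j ∎
    where
    open ≤-Reasoning
    m : ℕ
    m = (j * ε) % n
    val : ℕ → ℕ
    val t = (j * (t * ε)) % n
    Window : ℕ → ℕ → Set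
    Window c t = c * n ≤ 8 * val t × 8 * val t < suc c * n
    Window? : ∀ c → Decidable (Window c)
    Window? c t = (c * n ≤? 8 * val t) ×-dec (8 * val t <? suc c * n)
    inWindow : ∀ t → t < K → t ≡ t → ∃ λ c → c < 8 × Window c t
    inWindow t _ _ = 8 * val t / n , m<n*o⇒m/o<n (*-monoʳ-< 8 (m%n<n (j * (t * ε)) n)) ,
      m/n*n≤m (8 * val t) n , ≤-trans (s≤s (≤-reflexive (m≡m%n+[m/n]*n (8 * val t) n))) (+-monoˡ-≤ _ (m%n<n (8 * val t) n))
    8ε≤n : 8 * ε ≤ n
    8ε≤n = ≤-trans (*-monoʳ-≤ 8 (≤-trans (≤-reflexive (sym (*-identityˡ ε))) (*-monoˡ-≤ ε 1≤K))) 8Kε≤n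
    ε≤n : ε ≤ n
    ε≤n = ≤-trans (m≤n*m ε 8) 8ε≤n
    m<n : m < n
    m<n = m%n<n (j * ε) n
    1≤m : 1 ≤ m
    1≤m = *-cancelˡ-< 4 0 m (≤-trans 0<n n≤4m)
    Kε<n-ε : K * ε < n ∸ ε
    Kε<n-ε = +-cancelʳ-< ε (K * ε) (n ∸ ε) (≤-trans (*-cancelˡ-< 8 (K * ε + ε) n (≤-trans (s≤s (≤-trans (≤-reflexive (*-distribˡ-+ 8 (K * ε) ε)) (+-mono-≤ 8Kε≤n 8ε≤n)))
                        (2n<8n n 0<n))) (≤-reflexive (sym (m∸n+n≡m ε≤n))))
      where
      2n<8n : ∀ n → 0 < n → n + n < 8 * n
      2n<8n n 0<n = linear (suc (n + n)) (8 * n) (5 * n) 0<n (ring n)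
        where
        ring : ∀ n → suc (n + n) + n + 5 * n ≡ 8 * n + 1
        ring = solve-∀
    -- At the exponent n - ε the power sum vanishes, while the value sum is a mixed sum in which the
    -- exponent n does occur, because ε ≤ n - m.
    base : ¬ (valueSum (n ∸ ε) ≈ powerSum (n ∸ ε))
    base e = mixedSum-nonzero (n ∸ m) (n ∸ ε) ε (m∸n+n≡m ε≤n) 1≤n-ε ε≤n-m (∸-monoʳ-< 1≤m (<⇒≤ m<n))
      (≈0⇒∣ (trans (sym (valueSum≈mixedSum (n ∸ m) (n ∸ ε) (m<n⇒0<n∸m m<n) 1≤n-ε cong′)) (trans e (∣⇒≈0 (powerSum-small (n ∸ ε) (∸-monoʳ-< 1≤ε ε≤n))))))
      where
      1≤n-ε : 1 ≤ n ∸ ε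
      1≤n-ε = ≤-trans (s≤s z≤n) Kε<n-ε
      ε≤n-m : ε ≤ n ∸ m
      ε≤n-m = m+n≤o⇒m≤o∸n ε (*-cancelˡ-≤ 8 (linear (8 * (ε + m)) (8 * n) n (+-mono-≤ 8ε≤n (*-monoʳ-≤ 2 4m≤3n)) (ring ε m n)))
        where
        ring : ∀ ε m n → 8 * (ε + m) + (n + 2 * (3 * n)) + n ≡ 8 * n + (8 * ε + 2 * (4 * m))
        ring = solve-∀
      cong′ : j * (n ∸ ε) N.≈ n ∸ m
      cong′ = N.+-cancelʳ-≈ (j * (n ∸ ε)) (n ∸ m) m (begin-equality
        (j * (n ∸ ε) + m) % n ≡⟨ N.+-≈ {j * (n ∸ ε)} {j * (n ∸ ε)} {m} {j * ε} refl (N.%-≈ (j * ε)) ⟩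
        (j * (n ∸ ε) + j * ε) % n ≡⟨ cong (_% n) (trans (sym (*-distribˡ-+ j (n ∸ ε) ε)) (cong (j *_) (m∸n+n≡m ε≤n))) ⟩
        (j * n) % n ≡⟨ trans (m*n%n≡0 j n) (sym (n%n≡0 n)) ⟩
        n % n ≡⟨ cong (_% n) (sym (m∸n+n≡m (<⇒≤ m<n))) ⟩
        (n ∸ m + m) % n ∎)
    each : ∀ c → # K (Window? c) ≤ # q Irregular?
    each c = moments≤irregular K ε (n ∸ ε) (Window? c) Kε<n-ε relation base
      where
      relation : ∀ t₀ t → t₀ < t → t < K → Window c t₀ → Window c t →
                 valueSum (n ∸ ε + (t ∸ t₀) * ε) ≈ powerSum (n ∸ ε + (t ∸ t₀) * ε)
      relation t₀ t t₀<t t<K (lo₀ , hi₀) (lo , hi) =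
        subst (λ z → valueSum z ≈ powerSum z) (sym exponent) (moment-relation v w 1≤v 1≤w cong′ (8-sum n w v 8w<n 8v<7n))
        where
        a b d w v : ℕ
        a = val t₀
        b = val t
        d = t ∸ suc t₀
        w = d * ε
        -- A representative of jw: since w = (t - t₀ - 1)ε, jw ≡ b - a - m modulo n.
        v = n + b ∸ (m + a)
        1+d : suc d ≡ t ∸ t₀
        1+d = sym (+-∸-assoc 1 t₀<t)
        exponent : n ∸ ε + (t ∸ t₀) * ε ≡ w + 1 * n
        exponent = begin-equality
          n ∸ ε + (t ∸ t₀) * ε ≡⟨ cong (λ z → n ∸ ε + z * ε) (sym 1+d) ⟩
          n ∸ ε + (ε + w) ≡⟨ sym (+-assoc (n ∸ ε) ε w) ⟩
          n ∸ ε + ε + w ≡⟨ cong (_+ w) (m∸n+n≡m ε≤n) ⟩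
          n + w ≡⟨ +-comm n w ⟩
          w + n ≡⟨ cong (w +_) (sym (*-identityˡ n)) ⟩
          w + 1 * n ∎
        8a< : 8 * a < 8 * b + n
        8a< = <-≤-trans hi₀ (≤-trans (≤-reflexive (+-comm n (c * n))) (+-monoˡ-≤ n lo))
        8b< : 8 * b < 8 * a + n
        8b< = <-≤-trans hi (≤-trans (≤-reflexive (+-comm n (c * n))) (+-monoˡ-≤ n lo₀))
        v+ : v + (m + a) ≡ n + b
        v+ = m∸n+n≡m (window-≤ n m a b 4m≤3n 8a<)
        n<8v : n < 8 * v
        n<8v = window-lower n m a b v 4m≤3n 8a< v+
        8v<7n : 8 * v < 7 * n
        8v<7n = window-upper n m a b v n≤4m 8b< v+
        1≤v : 1 ≤ v
        1≤v = *-cancelˡ-< 8 0 v (≤-trans z<s n<8v)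
        v<n : v < n
        v<n = *-cancelˡ-< 8 v n (<-≤-trans 8v<7n (*-monoˡ-≤ n (n≤1+n 7)))
        1+d+t₀ : suc d + t₀ ≡ t
        1+d+t₀ = trans (cong (_+ t₀) 1+d) (m∸n+n≡m (<⇒≤ t₀<t))
        cong′ : j * w N.≈ v
        cong′ = N.+-cancelʳ-≈ (j * w) v (m + a) (begin-equality
          (j * w + (m + a)) % n ≡⟨ N.+-≈ {j * w} {j * w} {m + a} {j * ε + j * (t₀ * ε)} refl
                                                              (N.+-≈ {m} {j * ε} {a} {j * (t₀ * ε)} (N.%-≈ (j * ε)) (N.%-≈ (j * (t₀ * ε)))) ⟩
          (j * w + (j * ε + j * (t₀ * ε))) % n ≡⟨ cong (_% n) (ring j d t₀ ε) ⟩
          (j * ((suc d + t₀) * ε)) % n ≡⟨ cong (λ z → (j * (z * ε)) % n) 1+d+t₀ ⟩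
          (j * (t * ε)) % n ≡⟨ sym (N.%-≈ (j * (t * ε))) ⟩
          b % n ≡⟨ sym ([m+n]%n≡m%n b n) ⟩
          (b + n) % n ≡⟨ cong (_% n) (trans (+-comm b n) (sym v+)) ⟩
          (v + (m + a)) % n ∎)
          where
          ring : ∀ j d t₀ ε → j * (d * ε) + (j * ε + j * (t₀ * ε)) ≡ j * ((suc d + t₀) * ε)
          ring = solve-∀
        -- For w = 0 the number v, strictly between 0 and n, would be divisible by n. In other
        -- words, consecutive multiples of ε never share a window, as jε is far from 0 modulo n.
        1≤w : 1 ≤ w
        1≤w with w ≟ 0
        ... | no w≢0 = n≢0⇒n>0 w≢0
        ... | yes w≡0 = contradiction (N.≈0⇒∣ (trans (sym cong′) (cong (_% n) (trans (cong (j *_) w≡0) (*-zeroʳ j))))) (∤-small 1≤v v<n)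
        8w<n : 8 * w < n
        8w<n = <-≤-trans (*-monoʳ-< 8 (≤-trans (+-monoˡ-≤ w 1≤ε) (*-monoˡ-≤ ε (≤-trans (≤-trans (m≤m+n (suc d) t₀) (≤-reflexive 1+d+t₀)) (<⇒≤ t<K))))) 8Kε≤n

  private
    -- The multiplier is the least ε with sε > n/4, and the overshoot is at most s ≤ n/2.
    middle-multiple : ∀ s .{{_ : NonZero (4 * s)}} → 2 * s ≤ n →
                      n ≤ 4 * (s * suc (n / (4 * s))) × 4 * (s * suc (n / (4 * s))) ≤ 3 * n
    middle-multiple s 2s≤n =
        ≤-trans (≤-trans (≤-reflexive (m≡m%n+[m/n]*n n (4 * s))) (+-monoˡ-≤ _ (m%n≤n n (4 * s)))) (≤-reflexive (ring₁ s (n / (4 * s))))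
      , linear (4 * (s * suc (n / (4 * s)))) (3 * n) 0 (+-mono-≤ (m/n*n≤m n (4 * s)) (*-monoʳ-≤ 2 2s≤n)) (ring₂ s (n / (4 * s)) n)
      where
      ring₁ : ∀ s t → 4 * s + t * (4 * s) ≡ 4 * (s * suc t)
      ring₁ = solve-∀
      ring₂ : ∀ s t n → 4 * (s * suc t) + (n + 2 * n) + 0 ≡ 3 * n + (t * (4 * s) + 2 * (2 * s))
      ring₂ = solve-∀

    multiplier≤ : ∀ B s .{{_ : NonZero (4 * s)}} → n ≤ 4 * (B * s) → suc (n / (4 * s)) ≤ suc B
    multiplier≤ B s n≤4Bs = s≤s (≤-trans (/-monoˡ-≤ (4 * s) n≤4Bs) (≤-reflexive (trans (cong (_/ (4 * s)) (ring B s)) (m*n/n≡m B (4 * s)))))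
      where
      ring : ∀ B s → 4 * (B * s) ≡ B * (4 * s)
      ring = solve-∀

    -- The constant is 136 = 8 · 17: `window-bound` gives K ≤ 16 · missing for K = ⌊n/8ε⌋, rounding
    -- up to K + 1 costs at most one more multiple of the missing count, and ε ≤ B + 1.
    middle-bound : ∀ B ε → 1 ≤ ε → ε ≤ suc B → n ≤ 4 * ((j * ε) % n) → 4 * ((j * ε) % n) ≤ 3 * n → q ≤ 136 * suc B * missing q j
    middle-bound B ε@(suc ε′) 1≤ε ε≤ lo hi = begin
      q ≡⟨ q≡1+n ⟩
      suc n ≤⟨ s≤s (≤-reflexive (m≡m%n+[m/n]*n n (8 * ε))) ⟩
      suc (n % (8 * ε)) + K * (8 * ε) ≤⟨ +-monoˡ-≤ _ (m%n<n n (8 * ε)) ⟩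
      suc K * (8 * ε) ≤⟨ *-mono-≤ (s≤s K≤) (*-monoʳ-≤ 8 ε≤) ⟩
      suc (16 * M) * (8 * suc B) ≤⟨ *-monoˡ-≤ (8 * suc B) (+-monoˡ-≤ (16 * M) missing>0) ⟩
      (M + 16 * M) * (8 * suc B) ≡⟨ ring M B ⟩
      136 * suc B * M ∎
      where
      open ≤-Reasoning
      M : ℕ
      M = missing q j
      K : ℕ
      K = n / (8 * ε)
      K≤ : K ≤ 16 * M
      K≤ with K ≟ 0
      ... | yes K≡0 = subst (_≤ 16 * M) (sym K≡0) z≤n
      ... | no  K≢0 = window-bound ε K 1≤ε (n≢0⇒n>0 K≢0) (≤-trans (≤-reflexive (swap K ε)) (m/n*n≤m n (8 * ε))) lo hi
        where
        swap : ∀ K ε → 8 * (K * ε) ≡ K * (8 * ε)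
        swap = solve-∀
      ring : ∀ M B → (M + 16 * M) * (8 * suc B) ≡ 136 * suc B * M
      ring = solve-∀

    factor>0 : ∀ B s → n ≤ 4 * (B * s) → 1 ≤ s
    factor>0 B zero    h = contradiction (≤-trans 0<n (≤-trans h (≤-reflexive (trans (cong (4 *_) (*-zeroʳ B)) refl)))) λ ()
    factor>0 B (suc s) h = s≤s z≤n

  -- Some multiplier ε ≤ B + 1 moves j into the middle half modulo n. If j lies in the upper half,
  -- the same is done with s = n - (j mod n), using jε ≡ -sε.
  missing-far : ∀ B → n ≤ 4 * (B * (j % n)) → n ≤ 4 * (B * (n ∸ j % n)) → q ≤ 136 * suc B * missing q j
  missing-far B n≤4Br n≤4Bs with 2 * (j % n) ≤? n
  ... | yes 2r≤n = middle-bound B ε (s≤s z≤n) (multiplier≤ B r n≤4Br) (subst (λ z → n ≤ 4 * z) (sym m≡) (proj₁ mm)) (subst (λ z → 4 * z ≤ 3 * n) (sym m≡) (proj₂ mm))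
    where
    r : ℕ
    r = j % n
    instance
      4r≢0 : NonZero (4 * r)
      4r≢0 = >-nonZero (*-mono-≤ (s≤s {n = 3} z≤n) (factor>0 B r n≤4Br))
    ε : ℕ
    ε = suc (n / (4 * r))
    mm = middle-multiple r 2r≤n
    rε<n : r * ε < n
    rε<n = *-cancelˡ-< 4 (r * ε) n (≤-<-trans (proj₂ mm) (*-monoˡ-< n (n<1+n 3)))
    m≡ : (j * ε) % n ≡ r * ε
    m≡ = trans (N.*-≈ {j} {r} {ε} {ε} (sym (N.%-≈ j)) refl) (m<n⇒m%n≡m rε<n)
  ... | no 2r≰n = middle-bound B ε (s≤s z≤n) (multiplier≤ B s n≤4Bs)
                    (subst (λ z → n ≤ 4 * z) (sym m≡) (linear n (4 * (n ∸ s * ε)) 0 (proj₂ mm) (trans (ring₁ n) (trans (cong (4 *_) (sym n≡)) (*-distribˡ-+ 4 (n ∸ s * ε) (s * ε))))))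
                    (subst (λ z → 4 * z ≤ 3 * n) (sym m≡) (linear (4 * (n ∸ s * ε)) (3 * n) 0 (proj₁ mm) (trans (trans (+-identityʳ _) (trans (sym (*-distribˡ-+ 4 (n ∸ s * ε) (s * ε))) (cong (4 *_) n≡))) (ring₂ n))))
    where
    r s : ℕ
    r = j % n
    s = n ∸ r
    r+s : r + s ≡ n
    r+s = m+[n∸m]≡n (m%n≤n j n)
    2s≤n : 2 * s ≤ n
    2s≤n = linear (2 * s) n 0 (<⇒≤ (≰⇒> 2r≰n)) (trans (ring r s) (trans (cong (2 *_) r+s) (cong (n +_) (+-identityʳ n))))
      where
      ring : ∀ r s → 2 * s + 2 * r + 0 ≡ 2 * (r + s)
      ring = solve-∀
    instance
      4s≢0 : NonZero (4 * s)
      4s≢0 = >-nonZero (*-mono-≤ (s≤s {n = 3} z≤n) (factor>0 B s n≤4Bs))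
    ε : ℕ
    ε = suc (n / (4 * s))
    mm = middle-multiple s 2s≤n
    ring₁ : ∀ n → n + 3 * n + 0 ≡ 4 * n
    ring₁ = solve-∀
    ring₂ : ∀ n → 4 * n ≡ 3 * n + n
    ring₂ = solve-∀
    sε<n : s * ε < n
    sε<n = *-cancelˡ-< 4 (s * ε) n (≤-<-trans (proj₂ mm) (*-monoˡ-< n (n<1+n 3)))
    n≡ : n ∸ s * ε + s * ε ≡ n
    n≡ = m∸n+n≡m (<⇒≤ sε<n)
    0<sε : 0 < s * ε
    0<sε = *-cancelˡ-< 4 0 (s * ε) (≤-trans 0<n (proj₁ mm))
    m≡ : (j * ε) % n ≡ n ∸ s * ε
    m≡ = trans (N.+-cancelʳ-≈ (j * ε) (n ∸ s * ε) (s * ε) (begin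
      (j * ε + s * ε) % n ≡⟨ N.+-≈ {j * ε} {r * ε} {s * ε} {s * ε} (N.*-≈ {j} {r} {ε} {ε} (sym (N.%-≈ j)) refl) refl ⟩
      (r * ε + s * ε) % n ≡⟨ cong (_% n) (trans (sym (*-distribʳ-+ ε r s)) (trans (cong (_* ε) r+s) (*-comm n ε))) ⟩
      (ε * n) % n ≡⟨ trans (m*n%n≡0 ε n) (sym (n%n≡0 n)) ⟩
      n % n ≡⟨ cong (_% n) (sym n≡) ⟩
      (n ∸ s * ε + s * ε) % n ∎)) (m<n⇒m%n≡m (∸-monoʳ-< 0<sε (<⇒≤ sε<n)))
      where open ≡-Reasoning

  private
    -- The n-th power of `f y` is 1 except at the two zeros y = 0 and y = q - 1, so the sum falls
    -- short of `powerSum n` by one.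
    valueSum-n : valueSum n ≈ n ∸ 1
    valueSum-n = begin
      valueSum n % q ≡⟨ cong (λ z → Σ< z g % q) (trans q≡1+n (cong suc n≡)) ⟩
      (Σ< (suc (n ∸ 1)) g + g (suc (n ∸ 1))) % q ≡⟨ cong (λ z → (z + g (suc (n ∸ 1))) % q) (Σ-shift (n ∸ 1) g) ⟩
      (g 0 + Σ< (n ∸ 1) (g ∘ suc) + g (suc (n ∸ 1))) % q ≡⟨ +-≈ {g 0 + Σ< (n ∸ 1) (g ∘ suc)} {0 + Σ< (n ∸ 1) (λ _ → 1)} {g (suc (n ∸ 1))} {0}
                                                                      (+-≈ {g 0} {0} (pow-zero 0 q∣f0) (Σ-≈ (n ∸ 1) (λ y y<n → fermat (f (suc y)) (nonzero y y<n))))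
                                                                      (trans (cong (λ z → g z % q) (sym n≡)) (pow-zero n q∣fn)) ⟩
      (Σ< (n ∸ 1) (λ _ → 1) + 0) % q ≡⟨ cong (_% q) (trans (+-identityʳ _) (trans (Σ-const (n ∸ 1) 1) (*-identityʳ _))) ⟩
      (n ∸ 1) % q ∎
      where
      open ≡-Reasoning
      g : ℕ → ℕ
      g y = f y ^ n
      n≡ : n ≡ suc (n ∸ 1)
      n≡ = sym (m+[n∸m]≡n 0<n)
      pow-zero : ∀ y → q ∣ f y → g y ≈ 0
      pow-zero y q∣fy = ∣⇒≈0 (subst (λ z → q ∣ f y ^ z) (sym n≡) (∣m⇒∣m*n (f y ^ (n ∸ 1)) q∣fy))
      q∣f0 : q ∣ f 0
      q∣f0 = subst (q ∣_) (sym (*-zeroʳ (1 ^ j))) (q ∣0)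
      ∣^ : ∀ {j} → 1 ≤ j → q ∣ q ^ j
      ∣^ {suc j} _ = m∣m*n (q ^ j)
      q∣fn : q ∣ f n
      q∣fn = ∣m⇒∣m*n n (subst (λ z → q ∣ z ^ j) q≡1+n (∣^ 1≤j))
      nonzero : ∀ y → y < n ∸ 1 → q ∤ f (suc y)
      nonzero y y<n-1 = prime∤* ((2 + y) ^ j) (suc y) q-prime
        (prime∤^ (2 + y) j q-prime (∤-small z<s (≤-<-trans (≤-trans (s≤s y<n-1) (≤-reflexive (sym n≡))) n<q)))
        (∤-small z<s (≤-<-trans y<n-1 (≤-<-trans (m∸n≤m n 1) n<q)))

    base-n : ¬ (valueSum n ≈ powerSum n)
    base-n e = ∤-small z<s (prime>1 q-prime) (≈0⇒∣ (sym (+-cancelʳ-≈ 0 1 (n ∸ 1)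
      (trans (sym valueSum-n) (trans e (trans powerSum-n (cong (_% q) (sym (m+[n∸m]≡n 0<n)))))))))

    -- For exponents near a multiple of n no multiplier is taken: ε = 1, the base exponent is n
    -- itself, and a run of R consecutive moments replaces the windows.
    run-bound : ∀ R → R < n → (∀ d → 1 ≤ d → d < R → ∃ λ v → 1 ≤ v × j * d N.≈ v × d + v < n) → R ≤ 2 * missing q j
    run-bound R R<n exps = ≤-trans (≤-reflexive (sym (#-all {P? = λ t → t ≟ t} R (λ _ _ → refl))))
      (≤-trans (moments≤irregular R 1 n (λ t → t ≟ t) (subst (_< n) (sym (*-identityʳ R)) R<n) relation base-n) irregular≤2missing)
      where
      relation : ∀ t₀ t → t₀ < t → t < R → t₀ ≡ t₀ → t ≡ t → valueSum (n + (t ∸ t₀) * 1) ≈ powerSum (n + (t ∸ t₀) * 1)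
      relation t₀ t t₀<t t<R _ _ with exps (t ∸ t₀) (m<n⇒0<n∸m t₀<t) (≤-<-trans (m∸n≤m t t₀) t<R)
      ... | v , 1≤v , e , lt = subst (λ z → valueSum z ≈ powerSum z) (ring (t ∸ t₀) n) (moment-relation v (t ∸ t₀) 1≤v (m<n⇒0<n∸m t₀<t) e lt)
        where
        ring : ∀ d n → d + 1 * n ≡ n + d * 1
        ring = solve-∀

    product< : ∀ R s → 2 ≤ s → R * s ≤ n → R < n
    product< zero    s           2≤s Rs≤n = 0<n
    product< (suc R) s@(suc _) 2≤s Rs≤n = ≤-trans (s≤s (s≤s (m≤m*n R s))) (≤-trans (+-monoˡ-≤ (R * s) 2≤s) Rs≤n)

  run-above : ∀ R → 1 ≤ j % n → R * suc (j % n) ≤ n → R ≤ 2 * missing q j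
  run-above R 1≤r Rr≤n = run-bound R R<n λ d 1≤d d<R → (j % n) * d , *-mono-≤ 1≤r 1≤d ,
      N.*-≈ {j} {j % n} {d} {d} (sym (N.%-≈ j)) refl ,
      <-≤-trans (≤-trans (s≤s (≤-reflexive (trans (cong (d +_) (*-comm (j % n) d)) (sym (*-suc d (j % n)))))) (*-monoˡ-< (suc (j % n)) d<R)) Rr≤n
    where
    R<n : R < n
    R<n = product< R (suc (j % n)) (s≤s 1≤r) Rr≤n

  -- With s = n - (j mod n) the exponent of x becomes v = n - ds, and d + v < n holds exactly
  -- because s ≥ 2. The excluded s = 1 is the map 1 - 1/x, injective on nonzero x.
  run-below : ∀ R → 2 ≤ n ∸ j % n → R * (n ∸ j % n) ≤ n → R ≤ 2 * missing q j
  run-below R 2≤s Rs≤n = run-bound R R<n λ d 1≤d d<R →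
      let sd<n = <-≤-trans (*-monoˡ-< s d<R) Rs≤n in
      n ∸ d * s , m<n⇒0<n∸m sd<n , expo d (<⇒≤ sd<n) ,
      (+-cancelʳ-< (d * s) (d + (n ∸ d * s)) n (≤-trans (s≤s (≤-reflexive (trans (+-assoc d _ _) (cong (d +_) (m∸n+n≡m (<⇒≤ sd<n))))))
        (≤-trans (s≤s (≤-reflexive (+-comm d n))) (≤-trans (≤-reflexive (sym (+-suc n d))) (+-monoʳ-≤ n (≤-trans (+-monoˡ-≤ d 1≤d) (≤-trans (≤-reflexive (trans (cong (d +_) (sym (+-identityʳ d))) (*-comm 2 d))) (*-monoʳ-≤ d 2≤s))))))))
    where
    s : ℕ
    s = n ∸ j % n
    instance
      s≢0 : NonZero s
      s≢0 = >-nonZero (≤-trans (s≤s z≤n) 2≤s)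
    R<n : R < n
    R<n = product< R s 2≤s Rs≤n
    expo : ∀ d → d * s ≤ n → j * d N.≈ n ∸ d * s
    expo d ds≤n = N.+-cancelʳ-≈ (j * d) (n ∸ d * s) (d * s) (begin
      (j * d + d * s) % n ≡⟨ N.+-≈ {j * d} {(j % n) * d} {d * s} {d * s} (N.*-≈ {j} {j % n} {d} {d} (sym (N.%-≈ j)) refl) refl ⟩
      ((j % n) * d + d * s) % n ≡⟨ cong (_% n) (trans (cong (_+ d * s) (*-comm (j % n) d)) (trans (sym (*-distribˡ-+ d (j % n) s)) (cong (d *_) (m+[n∸m]≡n (m%n≤n j n))))) ⟩
      (d * n) % n ≡⟨ trans (m*n%n≡0 d n) (sym (n%n≡0 n)) ⟩
      n % n ≡⟨ cong (_% n) (sym (m∸n+n≡m ds≤n)) ⟩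
      (n ∸ d * s + d * s) % n ∎)
      where open ≡-Reasoning

  private
    quotient-bound : ∀ s .{{_ : NonZero s}} → n / s ≤ 2 * missing q j → n ≤ s * (3 * missing q j)
    quotient-bound s h = begin
      n ≡⟨ m≡m%n+[m/n]*n n s ⟩
      n % s + n / s * s ≤⟨ +-mono-≤ (m%n≤n n s) (*-monoˡ-≤ s h) ⟩
      s + 2 * M * s ≤⟨ +-monoˡ-≤ (2 * M * s) (≤-trans (≤-reflexive (sym (*-identityʳ s))) (*-monoʳ-≤ s missing>0)) ⟩
      s * M + 2 * M * s ≡⟨ ring s M ⟩
      s * (3 * M) ∎
      where
      open ≤-Reasoning
      M : ℕ
      M = missing q j
      ring : ∀ s M → s * M + 2 * M * s ≡ s * (3 * M)
      ring = solve-∀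

    near-bound : ∀ B s → 4 * (B * s) ≤ 2 * n → n ≤ s * (3 * missing q j) → 2 * B ≤ 3 * missing q j
    near-bound B s 4Bs≤2n n≤ = *-cancelʳ-≤ (2 * B) (3 * M) (2 * n) {{m*n≢0 2 n}} (begin
      2 * B * (2 * n) ≤⟨ *-monoʳ-≤ (2 * B) (*-monoʳ-≤ 2 n≤) ⟩
      2 * B * (2 * (s * (3 * M))) ≡⟨ ring B s (3 * M) ⟩
      4 * (B * s) * (3 * M) ≤⟨ *-monoˡ-≤ (3 * M) 4Bs≤2n ⟩
      2 * n * (3 * M) ≡⟨ *-comm (2 * n) (3 * M) ⟩
      3 * M * (2 * n) ∎)
      where
      open ≤-Reasoning
      M : ℕ
      M = missing q j
      ring : ∀ B s m → 2 * B * (2 * (s * m)) ≡ 4 * (B * s) * m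
      ring = solve-∀

  -- If j/n is within about 1/4B of an integer, a run of length about B fits; otherwise
  -- `missing-far` applies. For B near √q both alternatives give a constant multiple of √q missing
  -- values.
  missing-general : ∀ B → 4 * B ≤ n → 1 ≤ j % n → 2 ≤ n ∸ j % n → q ≤ 136 * suc B * missing q j ⊎ 2 * B ≤ 3 * missing q j
  missing-general B 4B≤n 1≤r 2≤s with n ≤? 4 * (B * (j % n)) | n ≤? 4 * (B * (n ∸ j % n))
  ... | yes p | yes p′ = inj₁ (missing-far B p p′)
  ... | no ¬p | _ = inj₂ (near-bound B (suc (j % n))
        (≤-trans (≤-reflexive (trans (cong (4 *_) (*-suc B (j % n))) (*-distribˡ-+ 4 B (B * (j % n))))) (≤-trans (+-mono-≤ 4B≤n (<⇒≤ (≰⇒> ¬p))) (≤-reflexive (cong (n +_) (sym (+-identityʳ n))))))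
        (quotient-bound (suc (j % n)) (run-above (n / suc (j % n)) 1≤r (m/n*n≤m n (suc (j % n))))))
  ... | yes _ | no ¬p = inj₂ (near-bound B (n ∸ j % n) (≤-trans (<⇒≤ (≰⇒> ¬p)) (m≤m+n n _))
        (quotient-bound (n ∸ j % n) {{s≢0}} (run-below (_/_ n (n ∸ j % n) {{s≢0}}) 2≤s (m/n*n≤m n (n ∸ j % n) {{s≢0}}))))
    where
    s≢0 : NonZero (n ∸ j % n)
    s≢0 = >-nonZero (≤-trans (s≤s z≤n) 2≤s)

-- Prime powers, radicals and divisor counts

prime-factor : ∀ n → 1 < n → ∃ λ p → Prime p × p ∣ n
prime-factor n 1<n with factorise n {{>-nonZero (<⇒≤ 1<n)}}
... | record { factors = []     ; isFactorisation = refl } = contradiction 1<n (<-irrefl refl)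
... | record { factors = p ∷ ps ; isFactorisation = refl ; factorsPrime = pp ∷ _ } = p , pp , m∣m*n (product ps)

∤⇒coprime : ∀ {p} m → Prime p → p ∤ m → Coprime p m
∤⇒coprime m pp p∤m {d} (d∣p , d∣m) with prime⇒irreducible pp d∣p
... | inj₁ d≡1  = d≡1
... | inj₂ refl = contradiction d∣m p∤m

prime∣prime : ∀ {p r} → Prime p → Prime r → p ∣ r → p ≡ r
prime∣prime pp pr p∣r with prime⇒irreducible pr p∣r
... | inj₁ refl = contradiction (prime>1 pp) (<-irrefl refl)
... | inj₂ p≡r  = p≡r

prime∣^ : ∀ {p} a k → Prime p → p ∣ a ^ k → p ∣ a
prime∣^ {p} a k pp p∣a^k with p ∣? a
... | yes p∣a = p∣a
... | no  p∤a = contradiction p∣a^k (prime∤^ a k pp p∤a)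

prime∤Π : ∀ {p} n (f : ℕ → ℕ) → Prime p → (∀ i → i < n → p ∤ f i) → p ∤ Π< n f
prime∤Π zero    f pp h p∣1 = <⇒≢ (prime>1 pp) (sym (∣1⇒≡1 p∣1))
prime∤Π (suc n) f pp h = prime∤* (Π< n f) (f n) pp (prime∤Π n f pp (λ i i<n → h i (m<n⇒m<1+n i<n))) (h n ≤-refl)

coprime-*∣ : ∀ {a b n} → Coprime a b → a ∣ n → b ∣ n → a * b ∣ n
coprime-*∣ {a} {b} co (divides c refl) b∣n =
  subst (a * b ∣_) (*-comm a c) (*-monoʳ-∣ a (coprime-divisor (Coprime.sym co) (subst (b ∣_) (*-comm c a) b∣n)))

coprime-^ : ∀ {p} m a → Prime p → p ∤ m → Coprime (p ^ a) m
coprime-^ {p} m a pp p∤m {d} (d∣pᵃ , d∣m) with d ≟ 1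
... | yes d≡1 = d≡1
... | no  d≢1 with d ≟ 0
...   | yes refl = contradiction (subst (p ∣_) (sym (0∣⇒≡0 d∣m)) (p ∣0)) p∤m
...   | no  d≢0 with prime-factor d (≤∧≢⇒< (n≢0⇒n>0 d≢0) (d≢1 ∘ sym))
...     | r , pr , r∣d with prime∣prime pr pp (prime∣^ p a pr (∣-trans r∣d d∣pᵃ))
...       | refl = contradiction (∣-trans r∣d d∣m) p∤m

prime-part : ∀ {p} → Prime p → ∀ n → 1 ≤ n → ∃ λ a → ∃ λ m → n ≡ p ^ a * m × p ∤ m
prime-part {p} pp = <-rec _ step
  where
  step : ∀ n → (∀ {i} → i < n → 1 ≤ i → ∃ λ a → ∃ λ m → i ≡ p ^ a * m × p ∤ m) → 1 ≤ n → ∃ λ a → ∃ λ m → n ≡ p ^ a * m × p ∤ m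
  step n rec 1≤n with p ∣? n
  ... | no p∤n = 0 , n , sym (+-identityʳ n) , p∤n
  ... | yes (divides c refl) with rec {c} (m<m*n c p {{c≢0}} (prime>1 pp)) 1≤c
    where
    c≢0 : NonZero c
    c≢0 = m*n≢0⇒m≢0 c {{>-nonZero 1≤n}}
    1≤c : 1 ≤ c
    1≤c = >-nonZero⁻¹ c {{c≢0}}
  ...   | a , m , eq , p∤m = suc a , m , trans (cong (_* p) eq) (ring (p ^ a) m p) , p∤m
    where
    ring : ∀ x m p → x * m * p ≡ p * x * m
    ring = solve-∀

prime-powers⇒∣ : ∀ n L → 1 ≤ n → (∀ p a → Prime p → p ^ a ∣ n → p ^ a ∣ L) → n ∣ L
prime-powers⇒∣ = <-rec _ step
  where
  step : ∀ n → (∀ {i} → i < n → ∀ L → 1 ≤ i → (∀ p a → Prime p → p ^ a ∣ i → p ^ a ∣ L) → i ∣ L) →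
         ∀ L → 1 ≤ n → (∀ p a → Prime p → p ^ a ∣ n → p ^ a ∣ L) → n ∣ L
  step n rec L 1≤n h with n ≟ 1
  ... | yes refl = 1∣ L
  ... | no n≢1 with prime-factor n (≤∧≢⇒< 1≤n (n≢1 ∘ sym))
  ...   | p , pp , p∣n with prime-part pp n 1≤n
  ...     | zero  , m , refl , p∤m = contradiction (subst (p ∣_) (+-identityʳ m) p∣n) p∤m
  ...     | suc a , m , refl , p∤m = coprime-*∣ (coprime-^ m (suc a) pp p∤m) (h p (suc a) pp (m∣m*n m))
            (rec {m} (subst (m <_) (*-comm m (p ^ suc a)) (m<m*n m (p ^ suc a) {{m≢0}} 1<pᵃ)) L (>-nonZero⁻¹ m {{m≢0}}) (λ r b pr rᵇ∣m → h r b pr (∣n⇒∣m*n (p ^ suc a) rᵇ∣m)))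
    where
    m≢0 : NonZero m
    m≢0 = m*n≢0⇒n≢0 (p ^ suc a) {{>-nonZero 1≤n}}
    1<pᵃ : 1 < p ^ suc a
    1<pᵃ = ≤-trans (prime>1 pp) (m≤m*n p (p ^ a) {{m^n≢0 p a {{prime⇒nonZero pp}}}})

PrimeDivisor? : ∀ n → Decidable (λ p → Prime p × p ∣ n)
PrimeDivisor? n p = prime? p ×-dec (p ∣? n)

ω : ℕ → ℕ → ℕ
ω X n = # X (PrimeDivisor? n)

radical : ℕ → ℕ → ℕ
radical X n = Π< X (λ p → p ^ 𝟙 (PrimeDivisor? n p))

∤radical : ∀ {p} n → Prime p → p ∤ radical p n
∤radical {p} n pp = prime∤Π p _ pp term
  where
  term : ∀ i → i < p → p ∤ i ^ 𝟙 (PrimeDivisor? n i)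
  term i i<p with PrimeDivisor? n i
  ... | no _ = λ p∣1 → <⇒≢ (prime>1 pp) (sym (∣1⇒≡1 p∣1))
  ... | yes (pi , _) = λ p∣ → <⇒≢ i<p (sym (prime∣prime pp pi (prime∣^ i 1 pp p∣)))

radical∣ : ∀ X n → radical X n ∣ n
radical∣ zero    n = 1∣ n
radical∣ (suc X) n with PrimeDivisor? n X
... | no _ = subst (_∣ n) (sym (*-identityʳ (radical X n))) (radical∣ X n)
... | yes (pX , X∣n) = subst (_∣ n) (cong (radical X n *_) (sym (*-identityʳ X)))
        (coprime-*∣ (Coprime.sym (∤⇒coprime (radical X n) pX (∤radical n pX))) (radical∣ X n) X∣n)

radical>0 : ∀ X n → 1 ≤ radical X n
radical>0 X n = Π-pos X _ pos
  where
  pos : ∀ i → i < X → 1 ≤ i ^ 𝟙 (PrimeDivisor? n i)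
  pos i _ with PrimeDivisor? n i
  ... | no _ = ≤-refl
  ... | yes (pi , _) = subst (1 ≤_) (sym (*-identityʳ i)) (<⇒≤ (prime>1 pi))

divisorCount : ℕ → ℕ
divisorCount n = # (suc n) (λ d → d ∣? n)

2^ω≤n : ∀ X n → 1 ≤ n → 2 ^ ω X n ≤ n
2^ω≤n X n 1≤n = ≤-trans (≤-reflexive (sym (Π-^Σ X 2 _)))
  (≤-trans (Π-mono X big) (∣⇒≤ {{>-nonZero 1≤n}} (radical∣ X n)))
  where
  big : ∀ i → i < X → 2 ^ 𝟙 (PrimeDivisor? n i) ≤ i ^ 𝟙 (PrimeDivisor? n i)
  big i _ with PrimeDivisor? n i
  ... | no _ = ≤-refl
  ... | yes (pi , _) = ≤-trans (prime>1 pi) (≤-reflexive (sym (*-identityʳ i)))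

divisorCount-mono : ∀ {m n} → 1 ≤ n → m ∣ n → divisorCount m ≤ divisorCount n
divisorCount-mono {m} {n} 1≤n m∣n = ≤-trans (#-extend {P? = λ d → d ∣? m} (s≤s (∣⇒≤ {{>-nonZero 1≤n}} m∣n)))
  (#-mono {P? = λ d → d ∣? m} (suc n) (λ d _ d∣m → ∣-trans d∣m m∣n))

-- Each divisor d of r yields d and dp, and p ∤ r keeps the two families disjoint.
divisorCount-prime : ∀ {p} r → Prime p → p ∤ r → 1 ≤ r → 2 * divisorCount r ≤ divisorCount (r * p)
divisorCount-prime {p} r pp p∤r 1≤r = begin
  2 * divisorCount r ≡⟨ cong (divisorCount r +_) (+-identityʳ _) ⟩
  divisorCount r + divisorCount r ≤⟨ +-mono-≤ (#-extend {P? = λ d → d ∣? r} (s≤s (m≤m*n r p {{prime⇒nonZero pp}})))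
                                                               (#-inject (suc r) (suc (r * p)) {P? = λ d → d ∣? r} {Q? = Mult?} (_* p) image (λ i j _ _ _ _ e → *-cancelʳ-≡ i j p {{prime⇒nonZero pp}} e)) ⟩
  # (suc (r * p)) (λ d → d ∣? r) + # (suc (r * p)) Mult? ≡⟨ sym (Σ-+ (suc (r * p)) _ _) ⟩
  Σ< (suc (r * p)) (λ d → 𝟙 (d ∣? r) + 𝟙 (Mult? d)) ≤⟨ Σ-mono (suc (r * p)) (λ d _ → point d) ⟩
  divisorCount (r * p) ∎
  where
  open ≤-Reasoning
  Mult? : Decidable (λ d → p ∣ d × d ∣ r * p)
  Mult? d = (p ∣? d) ×-dec (d ∣? r * p)
  image : ∀ d → d < suc r → d ∣ r → d * p < suc (r * p) × p ∣ d * p × d * p ∣ r * p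
  image d d≤r d∣r = s≤s (*-monoˡ-≤ p (s≤s⁻¹ d≤r)) , n∣m*n d , *-monoˡ-∣ p d∣r
  point : ∀ d → 𝟙 (d ∣? r) + 𝟙 (Mult? d) ≤ 𝟙 (d ∣? r * p)
  point d with d ∣? r
  ... | yes d∣r rewrite 𝟙-no {P = p ∣ d × d ∣ r * p} (λ { (p∣d , _) → p∤r (∣-trans p∣d d∣r) }) (Mult? d) = ≤-reflexive (sym (𝟙-yes (∣m⇒∣m*n p d∣r) (d ∣? r * p)))
  ... | no _ = 𝟙-mono proj₂ (Mult? d) (d ∣? r * p)

2^ω≤divisorCount : ∀ X n → 1 ≤ n → 2 ^ ω X n ≤ divisorCount n
2^ω≤divisorCount X n 1≤n = ≤-trans (go X) (divisorCount-mono 1≤n (radical∣ X n))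
  where
  go : ∀ X → 2 ^ ω X n ≤ divisorCount (radical X n)
  go zero = s≤s z≤n
  go (suc X) with PrimeDivisor? n X
  ... | no _ = subst₂ _≤_ (cong (2 ^_) (sym (+-identityʳ (ω X n)))) (cong divisorCount (sym (*-identityʳ (radical X n)))) (go X)
  ... | yes (pX , _) = begin
      2 ^ (ω X n + 1) ≡⟨ cong (2 ^_) (+-comm (ω X n) 1) ⟩
      2 * 2 ^ ω X n ≤⟨ *-monoʳ-≤ 2 (go X) ⟩
      2 * divisorCount (radical X n) ≤⟨ divisorCount-prime (radical X n) pX (∤radical n pX) (radical>0 X n) ⟩
      divisorCount (radical X n * X) ≡⟨ cong (λ z → divisorCount (radical X n * z)) (sym (*-identityʳ X)) ⟩
      divisorCount (radical X n * (X * 1)) ∎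
    where open ≤-Reasoning

#-multiples : ∀ N d .{{_ : NonZero d}} → # N (λ n → (0 <? n) ×-dec (d ∣? n)) ≤ N / d
#-multiples N d = ≤-trans (#-inject N (N / d) {P? = λ n → (0 <? n) ×-dec (d ∣? n)} {Q? = λ c → c ≟ c} (λ n → n / d ∸ 1) image inj) (#≤ {P? = λ c → c ≟ c} (N / d))
  where
  quot>0 : ∀ {n} → 0 < n → d ∣ n → 0 < n / d
  quot>0 {n} 0<n d∣n = m≥n⇒m/n>0 (∣⇒≤ {{>-nonZero 0<n}} d∣n)
  image : ∀ n → n < N → 0 < n × d ∣ n → n / d ∸ 1 < N / d × n / d ∸ 1 ≡ n / d ∸ 1
  image n n<N (0<n , d∣n) = <-≤-trans (∸-monoʳ-< z<s (quot>0 0<n d∣n)) (/-monoˡ-≤ d (<⇒≤ n<N)) , refl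
  inj : ∀ i j → i < N → j < N → 0 < i × d ∣ i → 0 < j × d ∣ j → i / d ∸ 1 ≡ j / d ∸ 1 → i ≡ j
  inj i j _ _ (0<i , d∣i) (0<j , d∣j) e = trans (sym (m/n*n≡m d∣i)) (trans (cong (_* d) (trans (sym (m∸n+n≡m (quot>0 0<i d∣i))) (trans (cong (_+ 1) e) (m∸n+n≡m (quot>0 0<j d∣j))))) (m/n*n≡m d∣j))

2^-suc : ∀ i → 2 ^ suc i ≡ 2 ^ i + 2 ^ i
2^-suc i = cong (2 ^ i +_) (+-identityʳ (2 ^ i))

Σ-dyadic : ∀ k (f : ℕ → ℕ) → Σ< (2 ^ k) f ≡ f 0 + Σ< k (λ i → Σ< (2 ^ i) (λ d → f (2 ^ i + d)))
Σ-dyadic zero    f = +-comm 0 (f 0)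
Σ-dyadic (suc k) f = trans (cong (λ z → Σ< z f) (2^-suc k)) (trans (Σ-split (2 ^ k) (2 ^ k) f)
  (trans (cong (_+ Σ< (2 ^ k) (λ d → f (2 ^ k + d))) (Σ-dyadic k f)) (+-assoc (f 0) _ _)))

-- The harmonic sum in dyadic form: each of the k blocks [2^i, 2^(i+1)) has 2^i terms of size at
-- most c/2^i. It takes the place of Σ 1/d ≪ log in the later counts.
Σ-harmonic : ∀ k c (f : ℕ → ℕ) → f 0 ≡ 0 → (∀ i d → i < k → 2 ^ i ≤ d → d < 2 ^ suc i → 2 ^ i * f d ≤ c) →
             Σ< (2 ^ k) f ≤ k * c
Σ-harmonic k c f f0 h = ≤-trans (≤-reflexive (trans (Σ-dyadic k f) (cong (_+ Σ< k block) f0))) (Σ-bound k block c bound)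
  where
  block : ℕ → ℕ
  block i = Σ< (2 ^ i) (λ d → f (2 ^ i + d))
  bound : ∀ i → i < k → block i ≤ c
  bound i i<k = *-cancelˡ-≤ (2 ^ i) {{m^n≢0 2 i}} (≤-trans (≤-reflexive (sym (Σ-*ˡ (2 ^ i) (2 ^ i) _)))
    (Σ-bound (2 ^ i) _ c λ d d<2ⁱ → h i (2 ^ i + d) i<k (m≤m+n _ _) (<-≤-trans (+-monoʳ-< (2 ^ i) d<2ⁱ) (≤-reflexive (sym (2^-suc i))))))

Σ-divisorCount : ∀ k → Σ< (2 ^ k) (λ n → 𝟙 (0 <? n) * divisorCount n) ≤ k * 2 ^ k
Σ-divisorCount k = begin
  Σ< N (λ n → 𝟙 (0 <? n) * divisorCount n) ≤⟨ Σ-mono N (λ n n<N → *-monoʳ-≤ (𝟙 (0 <? n)) (#-extend {P? = λ d → d ∣? n} n<N)) ⟩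
  Σ< N (λ n → 𝟙 (0 <? n) * Σ< N (λ d → 𝟙 (d ∣? n))) ≡⟨ Σ-cong N (λ n _ → sym (Σ-*ˡ (𝟙 (0 <? n)) N _)) ⟩
  Σ< N (λ n → Σ< N (λ d → 𝟙 (0 <? n) * 𝟙 (d ∣? n))) ≡⟨ Σ-swap N N (λ n d → 𝟙 (0 <? n) * 𝟙 (d ∣? n)) ⟩
  Σ< N f ≤⟨ Σ-harmonic k N f (Σ-zero N _ f0) bound ⟩
  k * N ∎
  where
  open ≤-Reasoning
  N : ℕ
  N = 2 ^ k
  f : ℕ → ℕ
  f d = Σ< N (λ n → 𝟙 (0 <? n) * 𝟙 (d ∣? n))
  f0 : ∀ n → n < N → 𝟙 (0 <? n) * 𝟙 (0 ∣? n) ≡ 0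
  f0 n _ with 0 <? n
  ... | no _    = refl
  ... | yes 0<n = trans (+-identityʳ _) (𝟙-no (λ 0∣n → <⇒≢ 0<n (sym (0∣⇒≡0 0∣n))) (0 ∣? n))
  bound : ∀ i d → i < k → 2 ^ i ≤ d → d < 2 ^ suc i → 2 ^ i * f d ≤ N
  bound i d _ 2ⁱ≤d _ = ≤-trans (*-mono-≤ 2ⁱ≤d (≤-trans (≤-reflexive (Σ-cong N (λ n _ → both (0 <? n) (d ∣? n)))) (#-multiples N d {{d≢0}})))
                             (≤-trans (≤-reflexive (*-comm d _)) (m/n*n≤m N d {{d≢0}}))
    where
    d≢0 : NonZero d
    d≢0 = >-nonZero (≤-trans (m^n>0 2 i) 2ⁱ≤d)
    both : ∀ {P Q : Set} (p : Dec P) (q : Dec Q) → 𝟙 p * 𝟙 q ≡ 𝟙 (p ×-dec q)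
    both (yes _) (yes _) = refl
    both (yes _) (no _)  = refl
    both (no _)  _       = refl

-- Exponents in mixed radix and the accumulation of savings

^-cancelˡ-≤ : ∀ c .{{_ : NonZero c}} a b → a ^ c ≤ b ^ c → a ≤ b
^-cancelˡ-≤ c a b aᶜ≤bᶜ with a ≤? b
... | yes a≤b = a≤b
... | no  a≰b = contradiction aᶜ≤bᶜ (<⇒≱ (^-monoˡ-< c (≰⇒> a≰b)))

T*Π-≤ : ∀ n (T f g : ℕ → ℕ) → (∀ i → i < n → T i * f i ≤ g i) → Π< n T * Π< n f ≤ Π< n g
T*Π-≤ n T f g h = ≤-trans (≤-reflexive (sym (Π-* n T f))) (Π-mono n h)

-- The digits of J are fixed one after another. `periodic` says that whether step i is cheap is
-- known once J is known modulo L (i + 1), and `unique` that at most one choice of the digit is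
-- cheap.
module MixedRadix (T : ℕ) (m : ℕ → ℕ) {Cheap : ℕ → ℕ → Set} (Cheap? : ∀ i → Decidable (Cheap i)) where

  L : ℕ → ℕ
  L Y = Π< Y m

  weight : ℕ → ℕ → ℕ
  weight Y J = Π< Y (λ i → T ^ 𝟙 (Cheap? i J))

  module _ (periodic : ∀ i J c → (Cheap i J → Cheap i (J + c * L (suc i))) × (Cheap i (J + c * L (suc i)) → Cheap i J))
           (unique : ∀ i J a b → a < m i → b < m i → Cheap i (J + a * L i) → Cheap i (J + b * L i) → a ≡ b) where

    private
      factor-periodic : ∀ i J c → 𝟙 (Cheap? i (J + c * L (suc i))) ≡ 𝟙 (Cheap? i J)
      factor-periodic i J c = ≤-antisym (𝟙-mono (proj₂ (periodic i J c)) _ _) (𝟙-mono (proj₁ (periodic i J c)) _ _)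

      weight-periodic : ∀ Y J a → weight Y (J + a * L Y) ≡ weight Y J
      weight-periodic Y J a = Π-cong Y λ i i<Y → case Π∣Π {suc i} {Y} m i<Y of λ where
        (divides c eq) → cong (T ^_) (trans (cong (λ z → 𝟙 (Cheap? i (J + z))) (trans (cong (a *_) eq) (sym (*-assoc a c (L (suc i))))))
                                            (factor-periodic i J (a * c)))

    -- Each of the m i lifts from modulus L i to L (i + 1) costs a factor 1, except a cheap one, which costs T.
    Σ-weight : ∀ Y → Σ< (L Y) (weight Y) ≤ Π< Y (λ i → T + m i)
    Σ-weight zero    = ≤-refl
    Σ-weight (suc Y) = begin
      Σ< (L Y * m Y) (weight (suc Y)) ≡⟨ cong (λ z → Σ< z (weight (suc Y))) (*-comm (L Y) (m Y)) ⟩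
      Σ< (m Y * L Y) (weight (suc Y)) ≡⟨ Σ-radix (L Y) (m Y) (weight (suc Y)) ⟩
      Σ< (m Y) (λ a → Σ< (L Y) (λ J → weight (suc Y) (J + a * L Y))) ≡⟨ Σ-swap (m Y) (L Y) (λ a J → weight (suc Y) (J + a * L Y)) ⟩
      Σ< (L Y) (λ J → Σ< (m Y) (λ a → weight (suc Y) (J + a * L Y))) ≤⟨ Σ-mono (L Y) (λ J _ → line J) ⟩
      Σ< (L Y) (λ J → weight Y J * (T + m Y)) ≡⟨ Σ-*ʳ (T + m Y) (L Y) (weight Y) ⟩
      Σ< (L Y) (weight Y) * (T + m Y) ≤⟨ *-monoˡ-≤ (T + m Y) (Σ-weight Y) ⟩
      Π< Y (λ i → T + m i) * (T + m Y) ∎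
      where
      open ≤-Reasoning
      line : ∀ J → Σ< (m Y) (λ a → weight (suc Y) (J + a * L Y)) ≤ weight Y J * (T + m Y)
      line J = begin
        Σ< (m Y) (λ a → weight Y (J + a * L Y) * T ^ 𝟙 (Cheap? Y (J + a * L Y))) ≡⟨ Σ-cong (m Y) (λ a _ → cong (_* T ^ 𝟙 (Cheap? Y (J + a * L Y))) (weight-periodic Y J a)) ⟩
        Σ< (m Y) (λ a → weight Y J * T ^ 𝟙 (Cheap? Y (J + a * L Y))) ≡⟨ Σ-*ˡ (weight Y J) (m Y) _ ⟩
        weight Y J * Σ< (m Y) (λ a → T ^ 𝟙 (Cheap? Y (J + a * L Y))) ≤⟨ *-monoʳ-≤ (weight Y J) (begin
          Σ< (m Y) (λ a → T ^ 𝟙 (Cheap? Y (J + a * L Y))) ≤⟨ Σ-mono (m Y) (λ a _ → pow (Cheap? Y (J + a * L Y))) ⟩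
          Σ< (m Y) (λ a → 𝟙 (Cheap? Y (J + a * L Y)) * T + 1) ≡⟨ Σ-+ (m Y) _ _ ⟩
          Σ< (m Y) (λ a → 𝟙 (Cheap? Y (J + a * L Y)) * T) + Σ< (m Y) (λ _ → 1) ≡⟨ cong₂ _+_ (Σ-*ʳ T (m Y) _) (trans (Σ-const (m Y) 1) (*-identityʳ (m Y))) ⟩
          # (m Y) (λ a → Cheap? Y (J + a * L Y)) * T + m Y ≤⟨ +-monoˡ-≤ (m Y) (*-monoˡ-≤ T (#≤1 (m Y) (unique Y J))) ⟩
          1 * T + m Y ≡⟨ cong (_+ m Y) (*-identityˡ T) ⟩
          T + m Y ∎) ⟩
        weight Y J * (T + m Y) ∎
        where
        pow : ∀ {P : Set} (d : Dec P) → T ^ 𝟙 d ≤ 𝟙 d * T + 1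
        pow (yes _) = ≤-trans (≤-reflexive (trans (*-identityʳ T) (sym (+-identityʳ T)))) (m≤m+n (T + 0) 1)
        pow (no _)  = ≤-refl

-- The savings from the non-cheap moduli add up because each q is used for at most c of them.
combine-savings : ∀ c .{{_ : NonZero c}} τ X Y {Q C : ℕ → Set} {R : ℕ → ℕ → Set}
  (Q? : Decidable Q) (C? : Decidable C) (R? : ∀ i → Decidable (R i)) (im : ℕ → ℕ) →
  (∀ q → q < X → Q q → im q ≤ q) → (∀ i q → R i q → Q q) →
  (∀ q → q < X → # Y (λ i → R? i q) ≤ c) →
  (∀ i → i < Y → ¬ C i → 2 ^ (c * τ) * Π< X (λ q → im q ^ 𝟙 (R? i q)) ≤ Π< X (λ q → q ^ 𝟙 (R? i q))) →
  (2 ^ τ) ^ Y * Π< X (λ q → im q ^ 𝟙 (Q? q)) ≤ Π< X (λ q → q ^ 𝟙 (Q? q)) * Π< Y (λ i → (2 ^ τ) ^ 𝟙 (C? i))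
combine-savings c τ X Y {Q} {C} {R} Q? C? R? im im≤ R⇒Q mult saving = ≤-trans (≤-reflexive split) (≤-trans (*-monoˡ-≤ WC main) ≤-refl)
  where
  T : ℕ
  T = 2 ^ τ
  nc : ℕ → ℕ
  nc i = 𝟙 (¬? (C? i))
  WN WC IM QQ : ℕ
  WN = Π< Y (λ i → T ^ nc i)
  WC = Π< Y (λ i → T ^ 𝟙 (C? i))
  IM = Π< X (λ q → im q ^ 𝟙 (Q? q))
  QQ = Π< X (λ q → q ^ 𝟙 (Q? q))
  split : T ^ Y * IM ≡ WN * IM * WC
  split = begin
    T ^ Y * IM ≡⟨ cong (_* IM) (sym (Π-const Y T)) ⟩
    Π< Y (λ _ → T) * IM ≡⟨ cong (_* IM) (Π-cong Y (λ i _ → both (C? i))) ⟩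
    Π< Y (λ i → T ^ nc i * T ^ 𝟙 (C? i)) * IM ≡⟨ cong (_* IM) (Π-* Y _ _) ⟩
    WN * WC * IM ≡⟨ ring WN WC IM ⟩
    WN * IM * WC ∎
    where
    open ≡-Reasoning
    ring : ∀ a b d → a * b * d ≡ a * d * b
    ring = solve-∀
    both : ∀ {P : Set} (d : Dec P) → T ≡ T ^ 𝟙 (¬? d) * T ^ 𝟙 d
    both (yes _) = sym (trans (+-identityʳ _) (*-identityʳ T))
    both (no _)  = sym (trans (*-identityʳ _) (*-identityʳ T))
  -- The number of non-cheap steps that use q. As it is at most c, the product of all savings can be
  -- completed with factors `im q` ≤ q to a full c-th power, whose root is then taken.
  e : ℕ → ℕ
  e q = Σ< Y (λ i → 𝟙 (R? i q) * nc i)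
  e≤ : ∀ q → q < X → e q ≤ 𝟙 (Q? q) * c
  e≤ q q<X with Q? q
  ... | yes _ = ≤-trans (Σ-mono Y (λ i _ → ≤-trans (*-monoʳ-≤ (𝟙 (R? i q)) (𝟙≤1 (¬? (C? i)))) (≤-reflexive (*-identityʳ _))))
                        (≤-trans (mult q q<X) (≤-reflexive (sym (+-identityʳ c))))
  ... | no ¬Q = ≤-reflexive (Σ-zero Y _ (λ i _ → cong (_* nc i) (𝟙-no (¬Q ∘ R⇒Q i q) (R? i q))))
  power : ∀ (g : ℕ → ℕ) → Π< Y (λ i → Π< X (λ q → g q ^ 𝟙 (R? i q)) ^ nc i) ≡ Π< X (λ q → g q ^ e q)
  power g = begin
    Π< Y (λ i → Π< X (λ q → g q ^ 𝟙 (R? i q)) ^ nc i) ≡⟨ Π-cong Y (λ i _ → trans (sym (Π-^ X _ (nc i))) (Π-cong X (λ q _ → ^-*-assoc (g q) (𝟙 (R? i q)) (nc i)))) ⟩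
    Π< Y (λ i → Π< X (λ q → g q ^ (𝟙 (R? i q) * nc i))) ≡⟨ Π-swap Y X (λ i q → g q ^ (𝟙 (R? i q) * nc i)) ⟩
    Π< X (λ q → Π< Y (λ i → g q ^ (𝟙 (R? i q) * nc i))) ≡⟨ Π-cong X (λ q _ → Π-^Σ Y (g q) _) ⟩
    Π< X (λ q → g q ^ e q) ∎
    where open ≡-Reasoning
  collected : Π< Y (λ i → (2 ^ (c * τ)) ^ nc i) * Π< X (λ q → im q ^ e q) ≤ Π< X (λ q → q ^ e q)
  collected = subst₂ (λ a b → Π< Y (λ i → (2 ^ (c * τ)) ^ nc i) * a ≤ b) (power im) (power id) (T*Π-≤ Y _ _ _ one)
    where
    one : ∀ i → i < Y → (2 ^ (c * τ)) ^ nc i * Π< X (λ q → im q ^ 𝟙 (R? i q)) ^ nc i ≤ Π< X (λ q → q ^ 𝟙 (R? i q)) ^ nc i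
    one i i<Y with C? i
    ... | yes _ = ≤-refl
    ... | no ¬C = subst₂ _≤_ (cong₂ _*_ (sym (*-identityʳ (2 ^ (c * τ)))) (sym (*-identityʳ (Π< X (λ q → im q ^ 𝟙 (R? i q)))))) (sym (*-identityʳ (Π< X (λ q → q ^ 𝟙 (R? i q))))) (saving i i<Y ¬C)
  fill : Π< X (λ q → im q ^ (𝟙 (Q? q) * c ∸ e q)) ≤ Π< X (λ q → q ^ (𝟙 (Q? q) * c ∸ e q))
  fill = Π-mono X step
    where
    step : ∀ q → q < X → im q ^ (𝟙 (Q? q) * c ∸ e q) ≤ q ^ (𝟙 (Q? q) * c ∸ e q)
    step q q<X with Q? q
    ... | yes Qq = ^-monoˡ-≤ (c + 0 ∸ e q) (im≤ q q<X Qq)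
    ... | no _ rewrite 0∸n≡0 (e q) = ≤-refl
  assemble : ∀ (g : ℕ → ℕ) → Π< X (λ q → g q ^ e q) * Π< X (λ q → g q ^ (𝟙 (Q? q) * c ∸ e q)) ≡ Π< X (λ q → g q ^ 𝟙 (Q? q)) ^ c
  assemble g = begin
    Π< X (λ q → g q ^ e q) * Π< X (λ q → g q ^ (𝟙 (Q? q) * c ∸ e q)) ≡⟨ sym (Π-* X _ _) ⟩
    Π< X (λ q → g q ^ e q * g q ^ (𝟙 (Q? q) * c ∸ e q)) ≡⟨ Π-cong X (λ q q<X → trans (sym (^-distribˡ-+-* (g q) (e q) _)) (trans (cong (g q ^_) (m+[n∸m]≡n (e≤ q q<X))) (sym (^-*-assoc (g q) (𝟙 (Q? q)) c)))) ⟩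
    Π< X (λ q → (g q ^ 𝟙 (Q? q)) ^ c) ≡⟨ Π-^ X _ c ⟩
    Π< X (λ q → g q ^ 𝟙 (Q? q)) ^ c ∎
    where open ≡-Reasoning
  WNᶜ : Π< Y (λ i → (2 ^ (c * τ)) ^ nc i) ≡ WN ^ c
  WNᶜ = trans (Π-cong Y (λ i _ → trans (cong (_^ nc i) (trans (cong (2 ^_) (*-comm c τ)) (sym (^-*-assoc 2 τ c))))
          (trans (^-*-assoc T c (nc i)) (trans (cong (T ^_) (*-comm c (nc i))) (sym (^-*-assoc T (nc i) c)))))) (Π-^ Y (λ i → T ^ nc i) c)
  main : WN * IM ≤ QQ
  main = ^-cancelˡ-≤ c (WN * IM) QQ (begin
    (WN * IM) ^ c ≡⟨ ^-distribʳ-* WN IM c ⟩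
    WN ^ c * IM ^ c ≡⟨ cong₂ _*_ (sym WNᶜ) (sym (assemble im)) ⟩
    Π< Y (λ i → (2 ^ (c * τ)) ^ nc i) * (Π< X (λ q → im q ^ e q) * Π< X (λ q → im q ^ (𝟙 (Q? q) * c ∸ e q)))
                                                                                     ≡⟨ sym (*-assoc (Π< Y (λ i → (2 ^ (c * τ)) ^ nc i)) (Π< X (λ q → im q ^ e q)) (Π< X (λ q → im q ^ (𝟙 (Q? q) * c ∸ e q)))) ⟩
    Π< Y (λ i → (2 ^ (c * τ)) ^ nc i) * Π< X (λ q → im q ^ e q) * Π< X (λ q → im q ^ (𝟙 (Q? q) * c ∸ e q))
                                                                                     ≤⟨ *-mono-≤ collected fill ⟩
    Π< X (λ q → q ^ e q) * Π< X (λ q → q ^ (𝟙 (Q? q) * c ∸ e q)) ≡⟨ assemble id ⟩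
    QQ ^ c ∎)
    where open ≤-Reasoning

bernoulli : ∀ b n → b ^ suc n + suc n * b ^ n ≤ suc b ^ suc n
bernoulli b zero    = ≤-reflexive (ring b)
  where
  ring : ∀ b → b * 1 + 1 * 1 ≡ suc b * 1
  ring = solve-∀
bernoulli b (suc n) = ≤-trans (≤-trans (m≤m+n _ (suc n * b ^ n)) (≤-reflexive (ring b (b ^ n) n))) (*-monoʳ-≤ (suc b) (bernoulli b n))
  where
  ring : ∀ b x n → b * (b * x) + suc (suc n) * (b * x) + suc n * x ≡ suc b * (b * x + suc n * x)
  ring = solve-∀

-- (1 − 1/(b+1))^(b+1) ≤ 1/2
halving : ∀ b → 2 * b ^ suc b ≤ suc b ^ suc b
halving b = ≤-trans (+-monoʳ-≤ (b ^ suc b) (≤-trans (≤-reflexive (+-identityʳ _)) (m≤n+m (b * b ^ b) (b ^ b)))) (bernoulli b b)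

halving-^ : ∀ b t N → suc b * t ≤ N → 2 ^ t * b ^ N ≤ suc b ^ N
halving-^ b t N le = begin
  2 ^ t * b ^ N ≡⟨ cong (λ z → 2 ^ t * b ^ z) (sym (m+[n∸m]≡n le)) ⟩
  2 ^ t * b ^ (suc b * t + (N ∸ suc b * t)) ≡⟨ cong (2 ^ t *_) (^-distribˡ-+-* b (suc b * t) _) ⟩
  2 ^ t * (b ^ (suc b * t) * b ^ (N ∸ suc b * t)) ≡⟨ sym (*-assoc (2 ^ t) (b ^ (suc b * t)) _) ⟩
  2 ^ t * b ^ (suc b * t) * b ^ (N ∸ suc b * t) ≡⟨ cong (λ z → 2 ^ t * z * b ^ (N ∸ suc b * t)) (sym (^-*-assoc b (suc b) t)) ⟩
  2 ^ t * (b ^ suc b) ^ t * b ^ (N ∸ suc b * t) ≡⟨ cong (_* b ^ (N ∸ suc b * t)) (sym (^-distribʳ-* 2 (b ^ suc b) t)) ⟩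
  (2 * b ^ suc b) ^ t * b ^ (N ∸ suc b * t) ≤⟨ *-mono-≤ (^-monoˡ-≤ t (halving b)) (^-monoˡ-≤ (N ∸ suc b * t) (n≤1+n b)) ⟩
  (suc b ^ suc b) ^ t * suc b ^ (N ∸ suc b * t) ≡⟨ cong (_* suc b ^ (N ∸ suc b * t)) (^-*-assoc (suc b) (suc b) t) ⟩
  suc b ^ (suc b * t) * suc b ^ (N ∸ suc b * t) ≡⟨ sym (^-distribˡ-+-* (suc b) (suc b * t) _) ⟩
  suc b ^ (suc b * t + (N ∸ suc b * t)) ≡⟨ cong (suc b ^_) (m+[n∸m]≡n le) ⟩
  suc b ^ N ∎
  where open ≤-Reasoning

-- Every q in `G` contributes a factor b/(b + 1), and b + 1 such factors together are at most 1/2.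
saving-product : ∀ b .{{_ : NonZero b}} t X {R G : ℕ → Set} (R? : Decidable R) (G? : Decidable G) (im : ℕ → ℕ) →
  (∀ q → q < X → R q → im q ≤ q) → (∀ q → q < X → G q → R q × suc b * im q ≤ b * q) → suc b * t ≤ # X G? →
  2 ^ t * Π< X (λ q → im q ^ 𝟙 (R? q)) ≤ Π< X (λ q → q ^ 𝟙 (R? q))
saving-product b t X {R} {G} R? G? im im≤ good le = *-cancelˡ-≤ (b ^ N) {{m^n≢0 b N}} (begin
  b ^ N * (2 ^ t * IM) ≡⟨ ring (b ^ N) (2 ^ t) IM ⟩
  2 ^ t * b ^ N * IM ≤⟨ *-monoˡ-≤ IM (halving-^ b t N le) ⟩
  suc b ^ N * IM ≡⟨ cong (_* IM) (sym (Π-^Σ X (suc b) _)) ⟩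
  Π< X (λ q → suc b ^ 𝟙 (G? q)) * IM ≡⟨ sym (Π-* X _ _) ⟩
  Π< X (λ q → suc b ^ 𝟙 (G? q) * im q ^ 𝟙 (R? q)) ≤⟨ Π-mono X step ⟩
  Π< X (λ q → b ^ 𝟙 (G? q) * q ^ 𝟙 (R? q)) ≡⟨ Π-* X _ _ ⟩
  Π< X (λ q → b ^ 𝟙 (G? q)) * QQ ≡⟨ cong (_* QQ) (Π-^Σ X b _) ⟩
  b ^ N * QQ ∎)
  where
  open ≤-Reasoning
  N IM QQ : ℕ
  N = # X G?
  IM = Π< X (λ q → im q ^ 𝟙 (R? q))
  QQ = Π< X (λ q → q ^ 𝟙 (R? q))
  ring : ∀ a b d → a * (b * d) ≡ b * a * d
  ring = solve-∀
  step : ∀ q → q < X → suc b ^ 𝟙 (G? q) * im q ^ 𝟙 (R? q) ≤ b ^ 𝟙 (G? q) * q ^ 𝟙 (R? q)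
  step q q<X with G? q | R? q
  ... | yes g | yes _ = subst₂ _≤_ (cong₂ _*_ (sym (*-identityʳ (suc b))) (sym (*-identityʳ (im q)))) (cong₂ _*_ (sym (*-identityʳ b)) (sym (*-identityʳ q))) (proj₂ (good q q<X g))
  ... | yes g | no ¬r = contradiction (proj₁ (good q q<X g)) ¬r
  ... | no _  | yes r = *-monoʳ-≤ 1 (*-monoˡ-≤ 1 (im≤ q q<X r))
  ... | no _  | no _  = ≤-refl

im : ℕ → ℕ → ℕ
im zero    j = 0
im (suc q) j = imageSize (suc q) j

im≡imageSize : ∀ q .{{_ : NonZero q}} j → im q j ≡ imageSize q j
im≡imageSize (suc q) j = refl

im≤ : ∀ q j → im q j ≤ q
im≤ zero    j = z≤n
im≤ (suc q) j = #≤ {P? = Image? (suc q) j} (suc q)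

missing⇒saving : ∀ q .{{_ : NonZero q}} j b → q ≤ suc b * missing q j → suc b * im q j ≤ b * q
missing⇒saving q j b h = +-cancelʳ-≤ (suc b * missing q j) (suc b * im q j) (b * q) (begin
  suc b * im q j + suc b * missing q j ≡⟨ cong (λ z → suc b * z + suc b * missing q j) (im≡imageSize q j) ⟩
  suc b * imageSize q j + suc b * missing q j ≡⟨ sym (*-distribˡ-+ (suc b) (imageSize q j) (missing q j)) ⟩
  suc b * (imageSize q j + missing q j) ≡⟨ cong (suc b *_) (imageSize+missing q j) ⟩
  suc b * q ≡⟨ +-comm q (b * q) ⟩
  b * q + q ≤⟨ +-monoʳ-≤ (b * q) h ⟩
  b * q + suc b * missing q j ∎)
  where open ≤-Reasoning

-- The quotient J/n has distance at least 1/(4B) from every integer.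
Far : ℕ → ℕ → ℕ → Set
Far B zero      J = ⊥
Far B n@(suc _) J = n ≤ 4 * (B * (J % n)) × n ≤ 4 * (B * (n ∸ J % n))

Far? : ∀ B n → Decidable (Far B n)
Far? B zero      J = no λ ()
Far? B n@(suc _) J = (n ≤? 4 * (B * (J % n))) ×-dec (n ≤? 4 * (B * (n ∸ J % n)))

¬Far-0 : ∀ B n → ¬ Far B n 0
¬Far-0 B (suc n) (h , _) = contradiction (≤-trans h (≤-reflexive (trans (cong (λ z → 4 * (B * z)) (m<n⇒m%n≡m {n = suc n} {0} z<s)) (cong (4 *_) (*-zeroʳ B))))) λ ()

Far-% : ∀ B n .{{_ : NonZero n}} J J′ → J % n ≡ J′ % n → Far B n J → Far B n J′
Far-% B (suc n) J J′ e (h₁ , h₂) = subst (λ r → suc n ≤ 4 * (B * r)) e h₁ , subst (λ r → suc n ≤ 4 * (B * (suc n ∸ r))) e h₂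

far⇒saving : ∀ q → Prime q → ∀ B b J → 1 ≤ J → 136 * suc B ≤ suc b → Far B (q ∸ 1) J → suc b * im q J ≤ b * q
far⇒saving q@(suc (suc n)) pq B b J 1≤J B≤b (h₁ , h₂) = missing⇒saving q J b
  (≤-trans (MissingValues.missing-far q pq J 1≤J B h₁ h₂) (*-monoˡ-≤ (missing q J) B≤b))
far⇒saving (suc zero) pq B b J 1≤J B≤b ()

-- Since J and q - 1 are even, so is the residue of J; being nonzero, it has distance at least 2
-- from q - 1. This excludes the exponent -1 and is the purpose of the reduction to even exponents.
general⇒saving : ∀ q → Prime q → ∀ B b J → 1 ≤ J → 2 ∣ q ∸ 1 → 2 ∣ J → (q ∸ 1) ∤ J →
                 4 * B ≤ q ∸ 1 → 136 * suc B ≤ suc b → 3 * q ≤ 2 * B * suc b → suc b * im q J ≤ b * q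
general⇒saving (suc zero) pq B b J 1≤J _ _ _ = contradiction (prime>1 pq) (<-irrefl refl)
general⇒saving q@(suc (suc n′)) pq B b J 1≤J 2∣n 2∣J n∤J 4B≤n B≤b q≤ = missing⇒saving q J b
    (case MissingValues.missing-general q pq J 1≤J B 4B≤n 1≤r 2≤s of λ where
      (inj₁ h) → ≤-trans h (*-monoˡ-≤ (missing q J) B≤b)
      (inj₂ h) → *-cancelˡ-≤ 3 (≤-trans q≤ (≤-trans (*-monoˡ-≤ (suc b) h) (≤-reflexive (ring (missing q J) b)))))
  where
  n r : ℕ
  n = suc n′
  r = J % n
  ring : ∀ M b → 3 * M * suc b ≡ 3 * (suc b * M)
  ring = solve-∀
  1≤r : 1 ≤ r
  1≤r = n≢0⇒n>0 λ r≡0 → n∤J (m%n≡0⇒n∣m J n r≡0)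
  2∣r : 2 ∣ r
  2∣r = subst (2 ∣_) (sym (m%n≡m∸m/n*n J n)) (∣m∸n′ J (J / n * n) (m/n*n≤m J n) 2∣J (∣n⇒∣m*n (J / n) 2∣n))
    where
    ∣m∸n′ : ∀ a b → b ≤ a → 2 ∣ a → 2 ∣ b → 2 ∣ a ∸ b
    ∣m∸n′ a b b≤a 2∣a 2∣b = ∣m+n∣m⇒∣n (subst (2 ∣_) (sym (m+[n∸m]≡n b≤a)) 2∣a) 2∣b
  2≤s : 2 ≤ n ∸ r
  2≤s = ∣⇒≤ {{>-nonZero (m<n⇒0<n∸m (m%n<n J n))}} (∣m+n∣m⇒∣n (subst (2 ∣_) (sym (m+[n∸m]≡n (m%n≤n J n))) 2∣n) 2∣r)

top : ∀ {P : ℕ → Set} → Decidable P → ℕ → ℕ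
top P? zero    = 0
top P? (suc k) with P? (suc k)
... | yes _ = suc k
... | no  _ = top P? k

top-≥ : ∀ {P : ℕ → Set} (P? : Decidable P) k a → a ≤ k → P a → a ≤ top P? k
top-≥ P? zero    a a≤0   pa = a≤0
top-≥ P? (suc k) a a≤1+k pa with P? (suc k)
... | yes _ = a≤1+k
... | no ¬p with m≤n⇒m<n∨m≡n a≤1+k
...   | inj₁ a<1+k = top-≥ P? k a (s≤s⁻¹ a<1+k) pa
...   | inj₂ refl  = contradiction pa ¬p

top-holds : ∀ {P : ℕ → Set} (P? : Decidable P) k → top P? k ≢ 0 → P (top P? k)
top-holds P? zero    ≢0 = contradiction refl ≢0
top-holds P? (suc k) ≢0 with P? (suc k)
... | yes p = p
... | no  _ = top-holds P? k ≢0

^-∣ : ∀ p {a b} → a ≤ b → p ^ a ∣ p ^ b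
^-∣ p {a} {b} a≤b = subst (λ z → p ^ a ∣ p ^ z) (m+[n∸m]≡n a≤b) (subst (p ^ a ∣_) (sym (^-distribˡ-+-* p a (b ∸ a))) (m∣m*n (p ^ (b ∸ a))))

-- The union bound over exponents

-- A prime l ∣ q − 1 is small if l ≤ z and large otherwise; count m is the number of q in Q with m ∣ q − 1.
record ScaleFrame : Set₁ where
  field
    k τ X z      : ℕ
    {{k≢0}}      : NonZero k
    {Q}          : ℕ → Set
    Q?           : Decidable Q
    Q-prime      : ∀ q → Q q → Prime q
    Q<X          : ∀ q → Q q → q < X
    Q-odd        : ∀ q → Q q → 2 ∣ q ∸ 1
    Q≤           : ∀ q → Q q → q ∸ 1 < 2 ^ k
    large-unique : ∀ q l l′ → Q q → Prime l → Prime l′ → z < l → z < l′ → l ∣ q ∸ 1 → l′ ∣ q ∸ 1 → l ≡ l′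
    large-simple : ∀ q l → Q q → Prime l → z < l → l * l ∤ q ∸ 1

module Scale (frame : ScaleFrame) where
  open ScaleFrame frame

  Divisible? : ∀ m → Decidable (λ q → Q q × m ∣ q ∸ 1)
  Divisible? m q = Q? q ×-dec (m ∣? q ∸ 1)

  count : ℕ → ℕ
  count m = # X (Divisible? m)

  FarAt? : ∀ B m J → Decidable (λ q → (Q q × m ∣ q ∸ 1) × Far B (q ∸ 1) J)
  FarAt? B m J q = Divisible? m q ×-dec Far? B (q ∸ 1) J

  NearBoth? : ∀ B m J J′ → Decidable (λ q → (Q q × m ∣ q ∸ 1) × ¬ Far B (q ∸ 1) J × ¬ Far B (q ∸ 1) J′)
  NearBoth? B m J J′ q = Divisible? m q ×-dec (¬? (Far? B (q ∸ 1) J) ×-dec ¬? (Far? B (q ∸ 1) J′))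

  -- A prime power of a small prime divides so many q - 1 that the weak saving 1/(b₁ + 1), valid for
  -- all nontrivial even exponents, is enough. For a large prime l only the saving 1/(b l + 1) at
  -- exponents far from multiples of q - 1 is enough, and `large-near` prevents two lifts from both
  -- being near too often.
  record Tolerances : Set where
    field
      B₁ b₁       : ℕ
      {{b₁≢0}}    : NonZero b₁
      B b         : ℕ → ℕ
      b>0         : ∀ l → 1 ≤ b l
      B≤b         : ∀ l → 136 * suc (B l) ≤ suc (b l)
      4B₁≤        : ∀ q → Q q → 4 * B₁ ≤ q ∸ 1
      B₁≤b₁       : 136 * suc B₁ ≤ suc b₁
      Q≤Bb        : ∀ q → Q q → 3 * q ≤ 2 * B₁ * suc b₁
      small-count : ∀ p a q → Prime p → p ≤ z → 1 ≤ a → Q q → p ^ a ∣ q ∸ 1 → suc b₁ * (k * τ) ≤ count (p ^ a)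
      large-count : ∀ l q → Prime l → z < l → Q q → l ∣ q ∸ 1 → 3 * (suc (b l) * (k * τ)) ≤ count l
      large-near  : ∀ l J J′ → Prime l → z < l → l ∤ ∣ J - J′ ∣ → (∀ q e → Q q → q ∸ 1 ≡ l * e → e ∣ ∣ J - J′ ∣) →
                    3 * # X (NearBoth? (B l) l J J′) ≤ count l

  module Bounds (tolerances : Tolerances) where
    open Tolerances tolerances

    private
      n>0 : ∀ q → Q q → 1 ≤ q ∸ 1
      n>0 q Qq = m<n⇒0<n∸m (prime>1 (Q-prime q Qq))

      Power? : ∀ i → Decidable (λ a → ∃ λ q → q < X × Q q × i ^ a ∣ q ∸ 1)
      Power? i a = anyUpTo? (λ q → Divisible? (i ^ a) q) X

      modulus′ : ∀ i → Dec (Prime i) → ℕ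
      modulus′ i (yes _) = i ^ top (Power? i) k
      modulus′ i (no _)  = 1

    -- The power of the prime i in lcm(q - 1), so that `L X` is this least common multiple; it is 1
    -- for the i that do not matter.
    modulus : ℕ → ℕ
    modulus i = modulus′ i (prime? i)

    private
      modulus-prime : ∀ {i} → Prime i → modulus i ≡ i ^ top (Power? i) k
      modulus-prime {i} pi with prime? i
      ... | yes _  = refl
      ... | no ¬pi = contradiction pi ¬pi

      power-bound : ∀ p a n → Prime p → 1 ≤ n → n < 2 ^ k → p ^ a ∣ n → a ≤ k
      power-bound p a n pp 1≤n n<2ᵏ pᵃ∣n = ≮⇒≥ λ k<a →
        <-irrefl refl (<-≤-trans n<2ᵏ (≤-trans (^-monoʳ-≤ 2 (<⇒≤ k<a)) (≤-trans (^-monoˡ-≤ a (prime>1 pp)) (∣⇒≤ {{>-nonZero 1≤n}} pᵃ∣n))))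

      ∣modulus : ∀ p a q → Prime p → Q q → p ^ a ∣ q ∸ 1 → p ^ a ∣ modulus p
      ∣modulus p a q pp Qq pᵃ∣ = subst (p ^ a ∣_) (sym (modulus-prime pp))
        (^-∣ p (top-≥ (Power? p) k a (power-bound p a (q ∸ 1) pp (n>0 q Qq) (Q≤ q Qq) pᵃ∣) (q , Q<X q Qq , Qq , pᵃ∣)))

      modulus-witness : ∀ i → modulus i ≢ 1 → Prime i × ∃ λ a → 1 ≤ a × modulus i ≡ i ^ a × ∃ λ q → Q q × i ^ a ∣ q ∸ 1
      modulus-witness i m≢1 with prime? i
      ... | no _   = contradiction refl m≢1
      ... | yes pi = pi , top (Power? i) k , n≢0⇒n>0 t≢0 , refl , (case top-holds (Power? i) k t≢0 of λ where (q , _ , Qq , d) → q , Qq , d)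
        where
        t≢0 : top (Power? i) k ≢ 0
        t≢0 e = m≢1 (cong (i ^_) e)

      modulus>0 : ∀ i → 1 ≤ modulus i
      modulus>0 i with prime? i
      ... | yes pi = m^n>0 i {{prime⇒nonZero pi}} (top (Power? i) k)
      ... | no _   = ≤-refl

      modulus-large : ∀ l → z < l → modulus l ≢ 1 → modulus l ≡ l
      modulus-large l z<l m≢1 with modulus-witness l m≢1
      ... | pl , suc zero , _ , eq , _ = trans eq (*-identityʳ l)
      ... | pl , suc (suc a) , _ , eq , q , Qq , d = contradiction (∣-trans (subst (_∣ l ^ suc (suc a)) (cong (l *_) (*-identityʳ l)) (^-∣ l {2} {suc (suc a)} (s≤s (s≤s z≤n)))) d) (large-simple q l Qq pl z<l)

      prime∤modulus : ∀ p i → Prime p → p ≢ i → p ∤ modulus i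
      prime∤modulus p i pp p≢i p∣m with modulus i ≟ 1
      ... | yes e = <⇒≢ (prime>1 pp) (sym (∣1⇒≡1 (subst (p ∣_) e p∣m)))
      ... | no m≢1 with modulus-witness i m≢1
      ...   | pi , a , _ , eq , _ = p≢i (prime∣prime pp pi (prime∣^ i a pp (subst (p ∣_) eq p∣m)))

    -- A step is cheap if no saving can be claimed for it. The threshold of one third is chosen so
    -- that, after two cheap lifts, more than a third of the q would be near both.
    Cheap : ℕ → ℕ → Set
    Cheap i J = (i ≤ z × modulus i ∣ J) ⊎ (z < i × (modulus i ≡ 1 ⊎ 3 * # X (FarAt? (B i) i J) < count i))

    Cheap? : ∀ i → Decidable (Cheap i)
    Cheap? i J = ((i ≤? z) ×-dec (modulus i ∣? J)) ⊎-dec ((z <? i) ×-dec ((modulus i ≟ 1) ⊎-dec (3 * # X (FarAt? (B i) i J) <? count i)))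

    open MixedRadix (2 ^ τ) modulus Cheap? public

    private
      L>0 : ∀ Y → 1 ≤ L Y
      L>0 Y = Π-pos Y modulus (λ i _ → modulus>0 i)

      ∣L : ∀ {p Y} → p < Y → modulus p ∣ L Y
      ∣L {p} {Y} p<Y = term∣Π Y modulus p<Y

      -- By `large-unique`, l is the only prime factor of q - 1 beyond z and thus the largest one,
      -- so all its prime powers are among the moduli up to l. Hence the increasing order of the
      -- primes.
      order∣L : ∀ q l → Q q → Prime l → z < l → l ∣ q ∸ 1 → q ∸ 1 ∣ L (suc l)
      order∣L q l Qq pl z<l l∣ = prime-powers⇒∣ (q ∸ 1) (L (suc l)) (n>0 q Qq) λ p a pp pᵃ∣ →
        case a ≟ 0 of λ where
          (yes refl) → 1∣ L (suc l)
          (no a≢0)   → ∣-trans (∣modulus p a q pp Qq pᵃ∣) (∣L (s≤s (p≤l p a pp a≢0 pᵃ∣)))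
        where
        p≤l : ∀ p a → Prime p → a ≢ 0 → p ^ a ∣ q ∸ 1 → p ≤ l
        p≤l p zero    pp a≢0 _   = contradiction refl a≢0
        p≤l p (suc a) pp a≢0 pᵃ∣ with p ≤? z
        ... | yes p≤z = <⇒≤ (≤-<-trans p≤z z<l)
        ... | no  p≰z = ≤-reflexive (large-unique q p l Qq pp pl (≰⇒> p≰z) z<l (m*n∣⇒m∣ p (p ^ a) pᵃ∣) l∣)

      cofactor∣L : ∀ q l e → Q q → Prime l → z < l → q ∸ 1 ≡ l * e → e ∣ L l
      cofactor∣L q l e Qq pl z<l eq = prime-powers⇒∣ e (L l) (n≢0⇒n>0 e≢0) λ p a pp pᵃ∣ → case a ≟ 0 of λ where
          (yes refl) → 1∣ L l
          (no a≢0)   → ∣-trans (∣modulus p a q pp Qq (subst (p ^ a ∣_) (sym eq) (∣n⇒∣m*n l pᵃ∣))) (∣L (p<l p a pp a≢0 pᵃ∣))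
        where
        e≢0 : e ≢ 0
        e≢0 refl = <⇒≢ (n>0 q Qq) (sym (trans eq (*-zeroʳ l)))
        p<l : ∀ p a → Prime p → a ≢ 0 → p ^ a ∣ e → p < l
        p<l p zero    pp a≢0 _   = contradiction refl a≢0
        p<l p (suc a) pp a≢0 pᵃ∣ with p ≤? z
        ... | yes p≤z = ≤-<-trans p≤z z<l
        ... | no  p≰z with large-unique q p l Qq pp pl (≰⇒> p≰z) z<l (subst (p ∣_) (sym eq) (∣n⇒∣m*n l (m*n∣⇒m∣ p (p ^ a) pᵃ∣))) (subst (l ∣_) (sym eq) (m∣m*n e))
        ...   | refl = contradiction (subst (p * p ∣_) (sym eq) (*-monoʳ-∣ p (m*n∣⇒m∣ p (p ^ a) pᵃ∣))) (large-simple q p Qq pp z<l)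

    order∣L-total : ∀ q → Q q → q ∸ 1 ∣ L X
    order∣L-total q Qq = prime-powers⇒∣ (q ∸ 1) (L X) (n>0 q Qq) λ p a pp pᵃ∣ → case a ≟ 0 of λ where
        (yes refl) → 1∣ L X
        (no a≢0)   → ∣-trans (∣modulus p a q pp Qq pᵃ∣) (∣L (≤-<-trans (p≤n p a a≢0 pᵃ∣) (≤-<-trans (m∸n≤m q 1) (Q<X q Qq))))
      where
      p≤n : ∀ p a → a ≢ 0 → p ^ a ∣ q ∸ 1 → p ≤ q ∸ 1
      p≤n p zero    a≢0 _   = contradiction refl a≢0
      p≤n p (suc a) a≢0 pᵃ∣ = ∣⇒≤ {{>-nonZero (n>0 q Qq)}} (m*n∣⇒m∣ p (p ^ a) pᵃ∣)

    private
      far-count-% : ∀ l J J′ → Prime l → z < l → (∀ q → Q q → l ∣ q ∸ 1 → q ∸ 1 ∣ ∣ J - J′ ∣) → # X (FarAt? (B l) l J) ≤ # X (FarAt? (B l) l J′)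
      far-count-% l J J′ pl z<l h = #-mono {P? = FarAt? (B l) l J} X λ q _ → λ { ((Qq , l∣) , far) →
        (Qq , l∣) , Far-% (B l) (q ∸ 1) {{>-nonZero (n>0 q Qq)}} J J′ (Congruence.∣⇒≈ (q ∸ 1) {{>-nonZero (n>0 q Qq)}} J J′ (h q Qq l∣)) far }

      shift-dist : ∀ J c → ∣ J - (J + c) ∣ ≡ c
      shift-dist J c = trans (m≤n⇒∣m-n∣≡n∸m (m≤m+n J c)) (m+n∸m≡n J c)

      -- The condition depends on J modulo `modulus i` or modulo the numbers q - 1 with i ∣ q - 1,
      -- and all of these divide L (i + 1).
      periodic : ∀ i J c → (Cheap i J → Cheap i (J + c * L (suc i))) × (Cheap i (J + c * L (suc i)) → Cheap i J)
      periodic i J c = to , from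
        where
        M : ℕ
        M = c * L (suc i)
        m∣M : modulus i ∣ M
        m∣M = ∣n⇒∣m*n c (∣L {i} {suc i} ≤-refl)
        dist : ∀ q → Q q → z < i → Prime i → i ∣ q ∸ 1 → q ∸ 1 ∣ M
        dist q Qq z<i pi i∣ = ∣n⇒∣m*n c (order∣L q i Qq pi z<i i∣)
        to : Cheap i J → Cheap i (J + M)
        to (inj₁ (i≤z , d)) = inj₁ (i≤z , ∣m∣n⇒∣m+n d m∣M)
        to (inj₂ (z<i , inj₁ e)) = inj₂ (z<i , inj₁ e)
        to (inj₂ (z<i , inj₂ lt)) with modulus i ≟ 1
        ... | yes e = inj₂ (z<i , inj₁ e)
        ... | no m≢1 = let pi = proj₁ (modulus-witness i m≢1) in
          inj₂ (z<i , inj₂ (≤-<-trans (*-monoʳ-≤ 3 (far-count-% i (J + M) J pi z<i (λ q Qq i∣ → subst (q ∸ 1 ∣_) (sym (trans (∣-∣-comm (J + M) J) (shift-dist J M))) (dist q Qq z<i pi i∣)))) lt))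
        from : Cheap i (J + M) → Cheap i J
        from (inj₁ (i≤z , d)) = inj₁ (i≤z , ∣m+n∣m⇒∣n (subst (modulus i ∣_) (+-comm J M) d) m∣M)
        from (inj₂ (z<i , inj₁ e)) = inj₂ (z<i , inj₁ e)
        from (inj₂ (z<i , inj₂ lt)) with modulus i ≟ 1
        ... | yes e = inj₂ (z<i , inj₁ e)
        ... | no m≢1 = let pi = proj₁ (modulus-witness i m≢1) in
          inj₂ (z<i , inj₂ (≤-<-trans (*-monoʳ-≤ 3 (far-count-% i J (J + M) pi z<i (λ q Qq i∣ → subst (q ∸ 1 ∣_) (sym (shift-dist J M)) (dist q Qq z<i pi i∣)))) lt))

      coprime-L : ∀ i → Prime i → i ∤ L i
      coprime-L i pi = prime∤Π i modulus pi (λ p p<i → prime∤modulus i p pi (<⇒≢ p<i ∘ sym))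

      line-dist : ∀ J a b M → ∣ (J + a * M) - (J + b * M) ∣ ≡ M * ∣ a - b ∣
      line-dist J a b M = trans (∣m+n-m+o∣≡∣n-o∣ J (a * M) (b * M)) (trans (cong₂ ∣_-_∣ (*-comm a M) (*-comm b M)) (sym (*-distribˡ-∣-∣ M a b)))

      small-dist : ∀ m a b → a < m → b < m → m ∣ ∣ a - b ∣ → a ≡ b
      small-dist m a b a<m b<m d with ∣ a - b ∣ ≟ 0
      ... | yes e = ∣m-n∣≡0⇒m≡n e
      ... | no ≢0 = contradiction d (∤-small (n≢0⇒n>0 ≢0) (≤-<-trans (∣m-n∣≤m⊔n a b) (⊔-lub a<m b<m)))

      ∣dist : ∀ m a b → m ∣ a → m ∣ b → m ∣ ∣ a - b ∣
      ∣dist zero a b m∣a m∣b rewrite 0∣⇒≡0 m∣a | 0∣⇒≡0 m∣b = ∣-refl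
      ∣dist m@(suc _) a b m∣a m∣b = Congruence.≈⇒∣ m a b (trans (n∣m⇒m%n≡0 a m m∣a) (sym (n∣m⇒m%n≡0 b m m∣b)))

      unique : ∀ i J a b → a < modulus i → b < modulus i → Cheap i (J + a * L i) → Cheap i (J + b * L i) → a ≡ b
      unique i J a b a<m b<m ch ch′ = case modulus i ≟ 1 of λ where
          (yes e)  → trans (n<1⇒n≡0 (subst (a <_) e a<m)) (sym (n<1⇒n≡0 (subst (b <_) e b<m)))
          (no m≢1) → nontrivial m≢1 ch ch′
        where
        nontrivial : modulus i ≢ 1 → Cheap i (J + a * L i) → Cheap i (J + b * L i) → a ≡ b
        nontrivial m≢1 (inj₁ (i≤z , _)) (inj₂ (z<i , _)) = contradiction z<i (≤⇒≯ i≤z)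
        nontrivial m≢1 (inj₂ (z<i , _)) (inj₁ (i≤z , _)) = contradiction z<i (≤⇒≯ i≤z)
        nontrivial m≢1 (inj₂ (_ , inj₁ e)) _ = contradiction e m≢1
        nontrivial m≢1 _ (inj₂ (_ , inj₁ e)) = contradiction e m≢1
        nontrivial m≢1 (inj₁ (_ , d)) (inj₁ (_ , d′)) = small-dist (modulus i) a b a<m b<m
                  (coprime-divisor co (subst (modulus i ∣_) (line-dist J a b (L i)) (∣dist (modulus i) _ _ d d′)))
          where
          co : Coprime (modulus i) (L i)
          co = case modulus-witness i m≢1 of λ where
            (pi , e , _ , eq , _) → subst (λ m → Coprime m (L i)) (sym eq) (coprime-^ (L i) e pi (coprime-L i pi))
        nontrivial m≢1 (inj₂ (z<i , inj₂ lt)) (inj₂ (_ , inj₂ lt′)) = case ∣ a - b ∣ ≟ 0 of λ where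
                  (yes e) → ∣m-n∣≡0⇒m≡n e
                  (no ≢0) → ⊥-elim (<-irrefl refl (<-≤-trans (majority ≢0) (large-near i J₁ J₂ pi z<i (i∤ ≢0) e∣)))
          where
          J₁ J₂ N : ℕ
          J₁ = J + a * L i
          J₂ = J + b * L i
          N = count i
          pi : Prime i
          pi = proj₁ (modulus-witness i m≢1)
          m≡i : modulus i ≡ i
          m≡i = modulus-large i z<i m≢1
          i∤ : ∣ a - b ∣ ≢ 0 → i ∤ ∣ J₁ - J₂ ∣
          i∤ ≢0 = subst (i ∤_) (sym (line-dist J a b (L i)))
            (prime∤* (L i) ∣ a - b ∣ pi (coprime-L i pi) (∤-small (n≢0⇒n>0 ≢0) (subst (∣ a - b ∣ <_) m≡i (≤-<-trans (∣m-n∣≤m⊔n a b) (⊔-lub a<m b<m)))))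
          e∣ : ∀ q e → Q q → q ∸ 1 ≡ i * e → e ∣ ∣ J₁ - J₂ ∣
          e∣ q e Qq eq = subst (e ∣_) (sym (line-dist J a b (L i))) (∣m⇒∣m*n ∣ a - b ∣ (cofactor∣L q i e Qq pi z<i eq))
          -- Fewer than a third of the q are far from J₁, fewer than a third far from J₂, so more
          -- than a third are near both, against `large-near`.
          majority : ∣ a - b ∣ ≢ 0 → N < 3 * # X (NearBoth? (B i) i J₁ J₂)
          majority _ = linear (suc N) (3 * # X (NearBoth? (B i) i J₁ J₂)) 1 (+-mono-≤ (*-monoʳ-≤ 3 cover) (+-mono-≤ lt lt′))
              (ring N (# X (FarAt? (B i) i J₁)) (# X (FarAt? (B i) i J₂)) (# X (NearBoth? (B i) i J₁ J₂)))
            where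
            cover : N ≤ # X (FarAt? (B i) i J₁) + (# X (FarAt? (B i) i J₂) + # X (NearBoth? (B i) i J₁ J₂))
            cover = ≤-trans (Σ-mono X point) (≤-reflexive (trans (Σ-+ X _ _) (cong (# X (FarAt? (B i) i J₁) +_) (Σ-+ X _ _))))
              where
              point : ∀ q → q < X → 𝟙 (Divisible? i q) ≤ 𝟙 (FarAt? (B i) i J₁ q) + (𝟙 (FarAt? (B i) i J₂ q) + 𝟙 (NearBoth? (B i) i J₁ J₂ q))
              point q _ with Divisible? i q | Far? (B i) (q ∸ 1) J₁ | Far? (B i) (q ∸ 1) J₂
              ... | no _  | _     | _     = z≤n
              ... | yes _ | yes _ | _     = s≤s z≤n
              ... | yes _ | no _  | yes _ = s≤s z≤n
              ... | yes _ | no _  | no _  = s≤s z≤n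
            ring : ∀ N f g h → suc N + (3 * (f + (g + h)) + (N + N)) + 1 ≡ 3 * h + (3 * N + (suc (3 * f) + suc (3 * g)))
            ring = solve-∀

      Uses? : ∀ i → Decidable (λ q → Q q × Prime i × i ∣ q ∸ 1 × modulus i ∣ q ∸ 1)
      Uses? i q = Q? q ×-dec (prime? i ×-dec ((i ∣? q ∸ 1) ×-dec (modulus i ∣? q ∸ 1)))

      -- A number below 2^k has at most k prime factors; this is the multiplicity c in
      -- `combine-savings`, and the reason why every step must save kτ bits.
      uses≤k : ∀ q → q < X → # X (λ i → Uses? i q) ≤ k
      uses≤k q q<X = go (Q? q)
        where
        go : Dec (Q q) → # X (λ i → Uses? i q) ≤ k
        go (no ¬Qq) = ≤-trans (≤-reflexive (#-none {P? = λ i → Uses? i q} X (λ i _ u → ¬Qq (proj₁ u)))) z≤n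
        go (yes Qq) = ≤-trans (#-mono {P? = λ i → Uses? i q} X {Q? = PrimeDivisor? (q ∸ 1)} (λ i _ u → proj₁ (proj₂ u) , proj₁ (proj₂ (proj₂ u))))
                       (≮⇒≥ λ k<ω → <-irrefl refl (<-≤-trans (Q≤ q Qq) (≤-trans (^-monoʳ-≤ 2 (<⇒≤ k<ω)) (2^ω≤n X (q ∸ 1) (n>0 q Qq)))))

      saving-small : ∀ J → 1 ≤ J → 2 ∣ J → ∀ i → i ≤ z → ¬ Cheap i J →
        2 ^ (k * τ) * Π< X (λ q → im q J ^ 𝟙 (Uses? i q)) ≤ Π< X (λ q → q ^ 𝟙 (Uses? i q))
      saving-small J 1≤J 2∣J i i≤z ¬C = saving-product b₁ (k * τ) X (Uses? i) (Uses? i) (λ q → im q J) (λ q _ _ → im≤ q J) good enough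
        where
        m∤J : modulus i ∤ J
        m∤J d = ¬C (inj₁ (i≤z , d))
        m≢1 : modulus i ≢ 1
        m≢1 e = m∤J (subst (_∣ J) (sym e) (1∣ J))
        wit = modulus-witness i m≢1
        pi = proj₁ wit
        a = proj₁ (proj₂ wit)
        1≤a = proj₁ (proj₂ (proj₂ wit))
        m≡ : modulus i ≡ i ^ a
        m≡ = proj₁ (proj₂ (proj₂ (proj₂ wit)))
        i∣m : i ∣ modulus i
        i∣m = subst (i ∣_) (sym m≡) (subst (_∣ i ^ a) (*-identityʳ i) (^-∣ i {1} {a} 1≤a))
        good : ∀ q → q < X → Q q × Prime i × i ∣ q ∸ 1 × modulus i ∣ q ∸ 1 → (Q q × Prime i × i ∣ q ∸ 1 × modulus i ∣ q ∸ 1) × suc b₁ * im q J ≤ b₁ * q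
        good q q<X u@(Qq , _ , _ , m∣) = u , general⇒saving q (Q-prime q Qq) B₁ b₁ J 1≤J (Q-odd q Qq) 2∣J (λ n∣J → m∤J (∣-trans m∣ n∣J)) (4B₁≤ q Qq) B₁≤b₁ (Q≤Bb q Qq)
        enough : suc b₁ * (k * τ) ≤ # X (Uses? i)
        enough = case proj₂ (proj₂ (proj₂ (proj₂ wit))) of λ where
          (q , Qq , d) → ≤-trans (small-count i a q pi i≤z 1≤a Qq d) (#-mono {P? = Divisible? (i ^ a)} X λ q′ _ → λ { (Qq′ , d′) →
             Qq′ , pi , ∣-trans i∣m (subst (_∣ q′ ∸ 1) (sym m≡) d′) , subst (_∣ q′ ∸ 1) (sym m≡) d′ })

      saving-large : ∀ J → 1 ≤ J → 2 ∣ J → ∀ i → z < i → ¬ Cheap i J →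
        2 ^ (k * τ) * Π< X (λ q → im q J ^ 𝟙 (Uses? i q)) ≤ Π< X (λ q → q ^ 𝟙 (Uses? i q))
      saving-large J 1≤J 2∣J i z<i ¬C = saving-product (b i) {{>-nonZero (b>0 i)}} (k * τ) X (Uses? i) (FarAt? (B i) i J) (λ q → im q J) (λ q _ _ → im≤ q J) good enough
        where
        m≢1 : modulus i ≢ 1
        m≢1 e = ¬C (inj₂ (z<i , inj₁ e))
        m≡i : modulus i ≡ i
        m≡i = modulus-large i z<i m≢1
        wit = modulus-witness i m≢1
        pi = proj₁ wit
        good : ∀ q → q < X → (Q q × i ∣ q ∸ 1) × Far (B i) (q ∸ 1) J → (Q q × Prime i × i ∣ q ∸ 1 × modulus i ∣ q ∸ 1) × suc (b i) * im q J ≤ b i * q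
        good q q<X ((Qq , i∣) , far) = (Qq , pi , i∣ , subst (_∣ q ∸ 1) (sym m≡i) i∣) , far⇒saving q (Q-prime q Qq) (B i) (b i) J 1≤J (B≤b i) far
        enough : suc (b i) * (k * τ) ≤ # X (FarAt? (B i) i J)
        enough = *-cancelˡ-≤ 3 (≤-trans (case proj₂ (proj₂ (proj₂ (proj₂ wit))) of λ where
          (q , Qq , d) → large-count i q pi z<i Qq (∣-trans (subst (i ∣_) (trans (sym m≡i) (proj₁ (proj₂ (proj₂ (proj₂ wit))))) ∣-refl) d)) (≮⇒≥ (λ lt → ¬C (inj₂ (z<i , inj₂ lt)))))

      saving : ∀ J → 1 ≤ J → 2 ∣ J → ∀ i → i < X → ¬ Cheap i J →
        2 ^ (k * τ) * Π< X (λ q → im q J ^ 𝟙 (Uses? i q)) ≤ Π< X (λ q → q ^ 𝟙 (Uses? i q))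
      saving J 1≤J 2∣J i _ ¬C = case i ≤? z of λ where
        (yes i≤z) → saving-small J 1≤J 2∣J i i≤z ¬C
        (no i≰z)  → saving-large J 1≤J 2∣J i (≰⇒> i≰z) ¬C

      cheap-0 : ∀ i → Cheap i 0
      cheap-0 i with i ≤? z
      ... | yes i≤z = inj₁ (i≤z , modulus i ∣0)
      ... | no i≰z with modulus i ≟ 1
      ...   | yes e = inj₂ (≰⇒> i≰z , inj₁ e)
      ...   | no m≢1 = inj₂ (≰⇒> i≰z , inj₂ (subst (_< count i) (sym (cong (3 *_) (#-none {P? = FarAt? (B i) i 0} X (λ q _ f → ¬Far-0 (B i) (q ∸ 1) (proj₂ f)))))
          (case modulus-witness i m≢1 of λ where
            (pi , suc a , _ , _ , q , Qq , d) → ∃⇒#>0 {P? = Divisible? i} X (Q<X q Qq) (Qq , m*n∣⇒m∣ i (i ^ a) d))))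

    Π-images : ℕ → ℕ
    Π-images J = Π< X (λ q → im q J ^ 𝟙 (Q? q))

    Π-Q : ℕ
    Π-Q = Π< X (λ q → q ^ 𝟙 (Q? q))

    Relevant? : Decidable (λ J → 1 ≤ J × 2 ∣ J)
    Relevant? J = (1 ≤? J) ×-dec (2 ∣? J)

    private
      im-zero-free : ∀ J → J < L X → (2 ^ τ) ^ X * (𝟙 (Relevant? J) * Π-images J) + 𝟙 (J ≟ 0) * ((2 ^ τ) ^ X * Π-Q) ≤ Π-Q * weight X J
      im-zero-free J _ = go (J ≟ 0) (Relevant? J)
        where
        TX : ℕ
        TX = (2 ^ τ) ^ X
        go : (d : Dec (J ≡ 0)) (r : Dec (1 ≤ J × 2 ∣ J)) → TX * (𝟙 r * Π-images J) + 𝟙 d * (TX * Π-Q) ≤ Π-Q * weight X J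
        go (yes refl) r = ≤-reflexive (trans (cong (_+ 1 * (TX * Π-Q)) (trans (cong (λ z → TX * (z * Π-images 0)) (𝟙-no (λ { (() , _) }) r)) (*-zeroʳ TX)))
          (trans (+-identityʳ _) (trans (*-comm TX Π-Q) (cong (Π-Q *_) (sym (trans (Π-cong X (λ i _ → trans (cong ((2 ^ τ) ^_) (𝟙-yes (cheap-0 i) (Cheap? i 0))) (*-identityʳ (2 ^ τ)))) (Π-const X (2 ^ τ))))))))
        go (no J≢0) (no _) = subst (_≤ Π-Q * weight X J) (sym (trans (+-identityʳ _) (*-zeroʳ TX))) z≤n
        go (no J≢0) (yes (1≤J , 2∣J)) = subst (_≤ Π-Q * weight X J) (sym (trans (+-identityʳ _) (cong (TX *_) (+-identityʳ (Π-images J)))))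
          (combine-savings k τ X X Q? (λ i → Cheap? i J) Uses? (λ q → im q J) (λ q _ _ → im≤ q J) (λ i q u → proj₁ u) uses≤k (saving J 1≤J 2∣J))

    -- The exponent 0 is cheap at every step, so its weight is T^X with T = 2^τ. Keeping it on the
    -- left cancels the main term of Π (T + m i), and only the small rest is left for the relevant
    -- exponents.
    union-bound : (2 ^ τ) ^ X * Σ< (L X) (λ J → 𝟙 (Relevant? J) * Π-images J) + (2 ^ τ) ^ X * Π-Q ≤ Π-Q * Π< X (λ i → 2 ^ τ + modulus i)
    union-bound = begin
      TX * Σ< (L X) (λ J → 𝟙 (Relevant? J) * Π-images J) + TX * Π-Q
        ≡⟨ cong₂ _+_ (sym (Σ-*ˡ TX (L X) _)) (sym (Σ-pick (L X) (λ _ → TX * Π-Q) (L>0 X))) ⟩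
      Σ< (L X) (λ J → TX * (𝟙 (Relevant? J) * Π-images J)) + Σ< (L X) (λ J → 𝟙 (J ≟ 0) * (TX * Π-Q))
        ≡⟨ sym (Σ-+ (L X) _ _) ⟩
      Σ< (L X) (λ J → TX * (𝟙 (Relevant? J) * Π-images J) + 𝟙 (J ≟ 0) * (TX * Π-Q))
        ≤⟨ Σ-mono (L X) im-zero-free ⟩
      Σ< (L X) (λ J → Π-Q * weight X J)
        ≡⟨ Σ-*ˡ Π-Q (L X) (weight X) ⟩
      Π-Q * Σ< (L X) (weight X)
        ≤⟨ *-monoʳ-≤ Π-Q (Σ-weight periodic unique X) ⟩
      Π-Q * Π< X (λ i → 2 ^ τ + modulus i)
        ∎
      where
      open ≤-Reasoning
      TX : ℕ
      TX = (2 ^ τ) ^ X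

    modulus<2^k : ∀ i → modulus i < 2 ^ k
    modulus<2^k i with modulus i ≟ 1
    ... | yes e = subst (_< 2 ^ k) (sym e) (≤-trans (s≤s (s≤s z≤n)) (^-monoʳ-≤ 2 {1} {k} (>-nonZero⁻¹ k)))
    ... | no m≢1 = case modulus-witness i m≢1 of λ where
      (pi , a , _ , eq , q , Qq , d) → subst (_< 2 ^ k) (sym eq) (≤-<-trans (∣⇒≤ {{>-nonZero (n>0 q Qq)}} d) (Q≤ q Qq))

    L-positive : ∀ Y → 1 ≤ L Y
    L-positive = L>0

-- Primes q that are near two exponents at once

¬Far⇒close : ∀ B n J → 1 ≤ n → ¬ Far B n J → ∃ λ c → 4 * (B * ∣ J - c * n ∣) < n
¬Far⇒close B n@(suc _) J 1≤n ¬far with n ≤? 4 * (B * (J % n)) | n ≤? 4 * (B * (n ∸ J % n))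
... | yes h | yes h′ = contradiction (h , h′) ¬far
... | no ≰ | _ = J / n , subst (λ d → 4 * (B * d) < n) (sym dist) (≰⇒> ≰)
  where
  dist : ∣ J - J / n * n ∣ ≡ J % n
  dist = trans (m≤n⇒∣n-m∣≡n∸m (m/n*n≤m J n)) (sym (m%n≡m∸m/n*n J n))
... | yes _ | no ≰ = suc (J / n) , subst (λ d → 4 * (B * d) < n) (sym dist) (≰⇒> ≰)
  where
  open ≡-Reasoning
  dist : ∣ J - suc (J / n) * n ∣ ≡ n ∸ J % n
  dist = begin
    ∣ J - (n + J / n * n) ∣ ≡⟨ cong (λ z → ∣ z - (n + J / n * n) ∣) (m≡m%n+[m/n]*n J n) ⟩
    ∣ (J % n + J / n * n) - (n + J / n * n) ∣ ≡⟨ cong₂ ∣_-_∣ (+-comm (J % n) _) (+-comm n _) ⟩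
    ∣ (J / n * n + J % n) - (J / n * n + n) ∣ ≡⟨ ∣m+n-m+o∣≡∣n-o∣ (J / n * n) (J % n) n ⟩
    ∣ J % n - n ∣ ≡⟨ m≤n⇒∣m-n∣≡n∸m (m%n≤n J n) ⟩
    n ∸ J % n ∎

dist-cross : ∀ a b c d → ∣ (a + d) - (b + c) ∣ ≤ ∣ a - c ∣ + ∣ b - d ∣
dist-cross a b c d = ≤-trans (∣-∣-triangle (a + d) (c + d) (b + c)) (≤-reflexive (cong₂ _+_
  (trans (cong₂ ∣_-_∣ (+-comm a d) (+-comm c d)) (∣m+n-m+o∣≡∣n-o∣ d a c))
  (trans (cong (∣ c + d -_∣) (+-comm b c)) (trans (∣m+n-m+o∣≡∣n-o∣ c d b) (∣-∣-comm d b)))))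

∣-+-dist : ∀ e a b x y → e ∣ ∣ a - b ∣ → e ∣ x → e ∣ y → e ∣ ∣ (a + x) - (b + y) ∣
∣-+-dist zero a b x y d e∣x e∣y rewrite 0∣⇒≡0 e∣x | 0∣⇒≡0 e∣y | +-identityʳ a | +-identityʳ b = d
∣-+-dist e@(suc _) a b x y d e∣x e∣y = ≈⇒∣ (a + x) (b + y) (trans (+∣-≈ {a} {x} e∣x) (trans (∣⇒≈ a b d) (sym (+∣-≈ {b} {y} e∣y))))
  where open Congruence e

-- Let q - 1 = n = le be near both J and J′. Subtracting multiples of n gives V = |(J - cn) - (J′ -
-- c′n)| < n/2B, which is divisible by e and congruent to ±(J - J′) modulo l; the size leaves 2H
-- candidates. A given V > 0 has at most k prime factors, one of them is a prime factor s > y of e,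
-- and s divides at most E/y of the possible e.
module NearCount (k X l B H E y J J′ : ℕ) .{{_ : NonZero y}} (l-prime : Prime l) (l∤ : l ∤ ∣ J - J′ ∣)
  (2^k≤lE : 2 ^ k ≤ l * E) (2^k≤BHl : 2 ^ k ≤ 2 * (B * (H * l)))
  {D : ℕ → Set} (D? : Decidable D) (D<X : ∀ q → D q → q < X)
  (order : ∀ q → D q → ∃ λ e → q ∸ 1 ≡ l * e × 1 ≤ q ∸ 1 × q ∸ 1 < 2 ^ k × e ∣ ∣ J - J′ ∣ × ∃ λ s → Prime s × y < s × s ∣ e)
  (near : ∀ q → D q → ¬ Far B (q ∸ 1) J × ¬ Far B (q ∸ 1) J′) where

  private
    instance
      l≢0 : NonZero l
      l≢0 = prime⇒nonZero l-prime
    open Congruence l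

    Hit : ℕ → ℕ → Set
    Hit s q = D q × ∃ λ e → e < E × 0 < e × q ∸ 1 ≡ l * e × s ∣ e

    Hit? : ∀ s → Decidable (Hit s)
    Hit? s q = D? q ×-dec anyUpTo? (λ e → (0 <? e) ×-dec ((q ∸ 1 ≟ l * e) ×-dec (s ∣? e))) E

    hit-count : ∀ s → y < s → # X (Hit? s) ≤ E / y
    hit-count s y<s = ≤-trans (#-inject X E {P? = Hit? s} {Q? = λ e → (0 <? e) ×-dec (s ∣? e)} (λ q → (q ∸ 1) / l) image inj)
      (≤-trans (#-multiples E s {{s≢0}}) (/-monoʳ-≤ E {{s≢0}} {{_}} (<⇒≤ y<s)))
      where
      s≢0 : NonZero s
      s≢0 = >-nonZero (≤-trans (s≤s z≤n) y<s)
      quot : ∀ {q e} → q ∸ 1 ≡ l * e → (q ∸ 1) / l ≡ e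
      quot {q} {e} eq = trans (cong (_/ l) (trans eq (*-comm l e))) (m*n/n≡m e l)
      image : ∀ q → q < X → Hit s q → (q ∸ 1) / l < E × 0 < (q ∸ 1) / l × s ∣ (q ∸ 1) / l
      image q _ (_ , e , e<E , 0<e , eq , s∣e) = subst (λ z → z < E × 0 < z × s ∣ z) (sym (quot {q} eq)) (e<E , 0<e , s∣e)
      positive : ∀ q → D q → suc (q ∸ 1) ≡ q
      positive q Dq = case order q Dq of λ where (_ , _ , 1≤n , _) → m+[n∸m]≡n (<⇒≤ (m<n∸o⇒o+m<n 0 q 1≤n))
        where
        m<n∸o⇒o+m<n : ∀ m n → m < n ∸ 1 → suc m < n
        m<n∸o⇒o+m<n m (suc n) h = s≤s h
      inj : ∀ i j → i < X → j < X → Hit s i → Hit s j → (i ∸ 1) / l ≡ (j ∸ 1) / l → i ≡ j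
      inj i j _ _ (Di , e , _ , _ , eq , _) (Dj , e′ , _ , _ , eq′ , _) same =
        trans (sym (positive i Di)) (trans (cong suc (trans eq (trans (cong (l *_) (trans (sym (quot {i} eq)) (trans same (quot {j} eq′)))) (sym eq′)))) (positive j Dj))

    Value : ℕ → ℕ → Set
    Value V q = D q × 0 < V × V < 2 ^ k × ∃ λ e → e < E × 0 < e × q ∸ 1 ≡ l * e × e ∣ V

    Value? : ∀ V → Decidable (Value V)
    Value? V q = D? q ×-dec ((0 <? V) ×-dec ((V <? 2 ^ k) ×-dec anyUpTo? (λ e → (0 <? e) ×-dec ((q ∸ 1 ≟ l * e) ×-dec (e ∣? V))) E))

    Relevant? : ∀ V s → Decidable (λ q → (Prime s × s ∣ V) × y < s × Hit s q)
    Relevant? V s q = PrimeDivisor? V s ×-dec ((y <? s) ×-dec Hit? s q)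

    value-count : ∀ V → # X (Value? V) ≤ k * (E / y)
    value-count V = cases (0 <? V) (V <? 2 ^ k)
      where
      open ≤-Reasoning
      cover : ∀ q → q < X → Value V q → ∃ λ s → s < X × (Prime s × s ∣ V) × y < s × Hit s q
      cover q q<X (Dq , _ , _ , e , e<E , 0<e , eq , e∣V) = case order q Dq of λ where
        (e′ , eq′ , 1≤n , _ , _ , s , ps , y<s , s∣e′) →
          let s∣e = subst (s ∣_) (*-cancelˡ-≡ e′ e l (trans (sym eq′) eq)) s∣e′ in
          s , ≤-<-trans (∣⇒≤ {{>-nonZero 1≤n}} (subst (s ∣_) (sym eq) (∣n⇒∣m*n l s∣e))) (≤-<-trans (m∸n≤m q 1) q<X) ,
          (ps , ∣-trans s∣e e∣V) , y<s , Dq , e , e<E , 0<e , eq , s∣e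
      per : ∀ s → (d : Dec (Prime s × s ∣ V)) → Dec (y < s) → # X (Relevant? V s) ≤ 𝟙 d * (E / y)
      per s (no ¬d) _         = ≤-reflexive (#-none {P? = Relevant? V s} X (λ q _ r → ¬d (proj₁ r)))
      per s (yes _) (no y≮s)  = ≤-trans (≤-reflexive (#-none {P? = Relevant? V s} X (λ q _ r → y≮s (proj₁ (proj₂ r))))) z≤n
      per s (yes _) (yes y<s) = ≤-trans (#-mono {P? = Relevant? V s} X {Q? = Hit? s} (λ q _ r → proj₂ (proj₂ r))) (≤-trans (hit-count s y<s) (≤-reflexive (sym (+-identityʳ _))))
      cases : Dec (0 < V) → Dec (V < 2 ^ k) → # X (Value? V) ≤ k * (E / y)
      cases (no ¬p) _ = ≤-trans (≤-reflexive (#-none {P? = Value? V} X (λ q _ v → ¬p (proj₁ (proj₂ v))))) z≤n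
      cases (yes _) (no ¬p) = ≤-trans (≤-reflexive (#-none {P? = Value? V} X (λ q _ v → ¬p (proj₁ (proj₂ (proj₂ v)))))) z≤n
      cases (yes 0<V) (yes V<2ᵏ) = begin
        # X (Value? V) ≤⟨ #-cover X X (Value? V) (Relevant? V) cover ⟩
        Σ< X (λ s → # X (Relevant? V s)) ≤⟨ Σ-mono X (λ s _ → per s (PrimeDivisor? V s) (y <? s)) ⟩
        Σ< X (λ s → 𝟙 (PrimeDivisor? V s) * (E / y)) ≡⟨ Σ-*ʳ (E / y) X _ ⟩
        ω X V * (E / y) ≤⟨ *-monoˡ-≤ (E / y) {ω X V} {k} (≮⇒≥ λ k<ω → <-irrefl refl (<-≤-trans V<2ᵏ (≤-trans (^-monoʳ-≤ 2 (<⇒≤ k<ω)) (2^ω≤n X V 0<V)))) ⟩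
        k * (E / y) ∎

    residue : ℕ → ℕ → ℕ
    residue a b = (a + neg b) % l

    residue-≡ : ∀ V a b → V + b ≡ a → ∀ a′ b′ → a ≈ a′ → b ≈ b′ → V % l ≡ residue a′ b′
    residue-≡ V a b eq a′ b′ a≈ b≈ = +-cancelʳ-≈ V (a′ + neg b′) b′ (trans (+-≈ {V} {V} {b′} {b} refl (sym b≈)) (trans (cong (_% l) eq)
      (trans a≈ (sym (trans (cong (_% l) (trans (+-assoc a′ (neg b′) b′) (cong (a′ +_) (+-comm (neg b′) b′)))) (+∣-≈ (≈0⇒∣ (+-neg b′))))))))

    candidate : ℕ → ℕ → ℕ → ℕ
    candidate a b t = residue a b + t * l

    candidate-≡ : ∀ V a b → V + b ≡ a → ∀ a′ b′ → a ≈ a′ → b ≈ b′ → V ≡ candidate a′ b′ (V / l)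
    candidate-≡ V a b eq a′ b′ a≈ b≈ = trans (m≡m%n+[m/n]*n V l) (cong (_+ V / l * l) (residue-≡ V a b eq a′ b′ a≈ b≈))

    Candidates? : ∀ a b t → Decidable (Value (candidate a b t))
    Candidates? a b t = Value? (candidate a b t)

    classify : ∀ q → D q → (∃ λ t → t < H × Value (candidate J J′ t) q) ⊎ (∃ λ t → t < H × Value (candidate J′ J t) q)
    classify q Dq = case (order q Dq , near q Dq) of λ where
        ((e , eq , 1≤n , n<2ᵏ , e∣ , _) , ¬far , ¬far′) → find e eq 1≤n n<2ᵏ e∣ (¬Far⇒close B (q ∸ 1) J 1≤n ¬far) (¬Far⇒close B (q ∸ 1) J′ 1≤n ¬far′)
      where
      find : ∀ e → q ∸ 1 ≡ l * e → 1 ≤ q ∸ 1 → q ∸ 1 < 2 ^ k → e ∣ ∣ J - J′ ∣ →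
             (∃ λ c → 4 * (B * ∣ J - c * (q ∸ 1) ∣) < q ∸ 1) → (∃ λ c → 4 * (B * ∣ J′ - c * (q ∸ 1) ∣) < q ∸ 1) →
             (∃ λ t → t < H × Value (candidate J J′ t) q) ⊎ (∃ λ t → t < H × Value (candidate J′ J t) q)
      find e eq 1≤n n<2ᵏ e∣ (c , h) (c′ , h′) = choose (≤-total a b)
        where
        open ≤-Reasoning
        n a b V : ℕ
        n = q ∸ 1
        a = J + c′ * n
        b = J′ + c * n
        V = ∣ a - b ∣
        l∣n : l ∣ n
        l∣n = subst (l ∣_) (sym eq) (m∣m*n e)
        e∣n : e ∣ n
        e∣n = subst (e ∣_) (sym eq) (n∣m*n l)
        a≈ : a ≈ J
        a≈ = +∣-≈ (∣n⇒∣m*n c′ l∣n)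
        b≈ : b ≈ J′
        b≈ = +∣-≈ (∣n⇒∣m*n c l∣n)
        2BV<n : 2 * (B * V) < n
        2BV<n = *-cancelˡ-< 2 (2 * (B * V)) n (begin-strict
          2 * (2 * (B * V)) ≤⟨ *-monoʳ-≤ 2 (*-monoʳ-≤ 2 (*-monoʳ-≤ B (dist-cross J J′ (c * n) (c′ * n)))) ⟩
          2 * (2 * (B * (∣ J - c * n ∣ + ∣ J′ - c′ * n ∣))) ≡⟨ ring B ∣ J - c * n ∣ ∣ J′ - c′ * n ∣ ⟩
          4 * (B * ∣ J - c * n ∣) + 4 * (B * ∣ J′ - c′ * n ∣) <⟨ +-mono-< h h′ ⟩
          n + n ≡⟨ cong (n +_) (sym (+-identityʳ n)) ⟩
          2 * n ∎)
          where
          ring : ∀ B x y → 2 * (2 * (B * (x + y))) ≡ 4 * (B * x) + 4 * (B * y)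
          ring = solve-∀
        V<Hl : V < H * l
        V<Hl = ≰⇒> λ Hl≤V → <-irrefl refl (<-trans (<-≤-trans n<2ᵏ (≤-trans 2^k≤BHl (*-monoʳ-≤ 2 (*-monoʳ-≤ B Hl≤V)))) 2BV<n)
        V/l<H : V / l < H
        V/l<H = m<n*o⇒m/o<n V<Hl
        B≢0 : B ≢ 0
        B≢0 refl = <⇒≱ (m^n>0 2 k) 2^k≤BHl
        V<2ᵏ : V < 2 ^ k
        V<2ᵏ = ≤-<-trans (≤-trans (m≤n*m V B {{≢-nonZero B≢0}}) (m≤n*m (B * V) 2)) (<-trans 2BV<n n<2ᵏ)
        -- For V = 0 the numbers J and J′ would be congruent modulo l, as l ∣ n. A nonzero V is
        -- essential for bounding its prime factors.
        0<V : 0 < V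
        0<V = n≢0⇒n>0 λ V≡0 → l∤ (≈⇒∣ J J′ (trans (sym a≈) (trans (cong (_% l) (∣m-n∣≡0⇒m≡n V≡0)) b≈)))
        val : Value V q
        val = Dq , 0<V , V<2ᵏ , e , *-cancelˡ-< l e E (<-≤-trans (subst (_< 2 ^ k) eq n<2ᵏ) 2^k≤lE) ,
              n≢0⇒n>0 (λ { refl → <⇒≢ 1≤n (sym (trans eq (*-zeroʳ l))) }) , eq , ∣-+-dist e J J′ (c′ * n) (c * n) e∣ (∣n⇒∣m*n c′ e∣n) (∣n⇒∣m*n c e∣n)
        choose : a ≤ b ⊎ b ≤ a → (∃ λ t → t < H × Value (candidate J J′ t) q) ⊎ (∃ λ t → t < H × Value (candidate J′ J t) q)
        choose (inj₁ a≤b) = inj₂ (V / l , V/l<H , subst (λ z → Value z q) (candidate-≡ V b a (sum a≤b) J′ J b≈ a≈) val)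
          where
          sum : a ≤ b → V + a ≡ b
          sum a≤b = trans (cong (_+ a) (m≤n⇒∣m-n∣≡n∸m a≤b)) (m∸n+n≡m a≤b)
        choose (inj₂ b≤a) = inj₁ (V / l , V/l<H , subst (λ z → Value z q) (candidate-≡ V a b (sum b≤a) J J′ a≈ b≈) val)
          where
          sum : b ≤ a → V + b ≡ a
          sum b≤a = trans (cong (_+ b) (m≤n⇒∣n-m∣≡n∸m b≤a)) (m∸n+n≡m b≤a)

  near-count : # X D? ≤ 2 * (H * (k * (E / y)))
  near-count = begin
    # X D? ≤⟨ #-∪ {P? = D?} X {Q? = Any? J J′} {R? = Any? J′ J} (λ q _ Dq → classify q Dq) ⟩
    # X (Any? J J′) + # X (Any? J′ J) ≤⟨ +-mono-≤ (side J J′) (side J′ J) ⟩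
    H * (k * (E / y)) + H * (k * (E / y)) ≡⟨ cong (H * (k * (E / y)) +_) (sym (+-identityʳ _)) ⟩
    2 * (H * (k * (E / y))) ∎
    where
    open ≤-Reasoning
    Any? : ∀ a b → Decidable (λ q → ∃ λ t → t < H × Value (candidate a b t) q)
    Any? a b q = anyUpTo? (λ t → Candidates? a b t q) H
    side : ∀ a b → # X (Any? a b) ≤ H * (k * (E / y))
    side a b = ≤-trans (#-cover X H (Any? a b) (Candidates? a b) (λ q _ p → p)) (Σ-bound H _ (k * (E / y)) (λ t _ → value-count (candidate a b t)))

-- Discarding primes with rare divisors of q - 1

record Pruning (X M : ℕ) (θ : ℕ → ℕ) {P : ℕ → Set} (P? : Decidable P) (budget : ℕ) : Set₁ where
  field
    Q     : ℕ → Set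
    Q?    : Decidable Q
    Q⊆P   : ∀ q → Q q → P q
    dense : ∀ m q → m < M → q < X → Q q → m ∣ q ∸ 1 → θ m ≤ # X (λ q → Q? q ×-dec (m ∣? q ∸ 1))
    lost  : # X (λ q → P? q ×-dec ¬? (Q? q)) ≤ budget

-- Remove all q with m ∣ q − 1 whenever there are fewer than θ m of them; each m is treated at most once.
prune : ∀ X M (θ : ℕ → ℕ) N {P A : ℕ → Set} (P? : Decidable P) (A? : Decidable A) → # M A? ≤ N →
        (∀ m q → m < M → q < X → ¬ A m → P q → m ∤ q ∸ 1) → Pruning X M θ P? (Σ< M (λ m → 𝟙 (A? m) * θ m))
prune X M θ N {P} {A} P? A? #A≤N dead with anyUpTo? (λ m → A? m ×-dec (# X (λ q → P? q ×-dec (m ∣? q ∸ 1)) <? θ m)) M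
... | no none = record
  { Q = P ; Q? = P? ; Q⊆P = λ _ p → p
  ; dense = λ m q m<M q<X Pq m∣ → ≮⇒≥ λ lt → case A? m of λ where
      (yes Am) → none (m , m<M , Am , lt)
      (no ¬Am) → dead m q m<M q<X ¬Am Pq m∣
  ; lost = ≤-trans (≤-reflexive (#-none {P? = λ q → P? q ×-dec ¬? (P? q)} X (λ q _ b → proj₂ b (proj₁ b)))) z≤n }
prune X M θ zero {P} {A} P? A? #A≤N dead | yes (m , m<M , Am , lt) =
  contradiction (≤-trans (∃⇒#>0 {P? = A?} M m<M Am) #A≤N) λ ()
prune X M θ (suc N) {P} {A} P? A? #A≤N dead | yes (m , m<M , Am , lt) = record
  { Q = Q rec ; Q? = Q? rec ; Q⊆P = λ q Qq → proj₁ (Q⊆P rec q Qq) ; dense = dense rec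
  ; lost = begin
      # X (λ q → P? q ×-dec ¬? (Q? rec q))
        ≤⟨ #-∪ {P? = λ q → P? q ×-dec ¬? (Q? rec q)} X {Q? = λ q → P? q ×-dec (m ∣? q ∸ 1)} {R? = λ q → P′? q ×-dec ¬? (Q? rec q)} split ⟩
      # X (λ q → P? q ×-dec (m ∣? q ∸ 1)) + # X (λ q → P′? q ×-dec ¬? (Q? rec q))
        ≤⟨ +-mono-≤ (<⇒≤ lt) (lost rec) ⟩
      θ m + Σ< M (λ i → 𝟙 (A′? i) * θ i)
        ≡⟨ cong (_+ Σ< M (λ i → 𝟙 (A′? i) * θ i)) (sym (Σ-pick M θ m<M)) ⟩
      Σ< M (λ i → 𝟙 (i ≟ m) * θ i) + Σ< M (λ i → 𝟙 (A′? i) * θ i)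
        ≡⟨ sym (Σ-+ M _ _) ⟩
      Σ< M (λ i → 𝟙 (i ≟ m) * θ i + 𝟙 (A′? i) * θ i)
        ≡⟨ Σ-cong M (λ i _ → trans (sym (*-distribʳ-+ (θ i) (𝟙 (i ≟ m)) (𝟙 (A′? i)))) (cong (_* θ i) (sym (split𝟙 i)))) ⟩
      Σ< M (λ i → 𝟙 (A? i) * θ i) ∎ }
  where
  open ≤-Reasoning
  open Pruning
  P′? : Decidable (λ q → P q × m ∤ q ∸ 1)
  P′? q = P? q ×-dec ¬? (m ∣? q ∸ 1)
  A′? : Decidable (λ i → A i × i ≢ m)
  A′? i = A? i ×-dec ¬? (i ≟ m)
  split𝟙 : ∀ i → 𝟙 (A? i) ≡ 𝟙 (i ≟ m) + 𝟙 (A′? i)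
  split𝟙 i with i ≟ m | A? i
  ... | yes refl | yes _ = refl
  ... | yes refl | no ¬a = contradiction Am ¬a
  ... | no _     | yes _ = refl
  ... | no _     | no _  = refl
  #A : # M A? ≡ suc (# M A′?)
  #A = trans (Σ-cong M (λ i _ → split𝟙 i)) (trans (Σ-+ M _ _)
    (cong (_+ # M A′?) (trans (Σ-cong M (λ i _ → sym (*-identityʳ _))) (Σ-pick M (λ _ → 1) m<M))))
  rec : Pruning X M θ P′? (Σ< M (λ i → 𝟙 (A′? i) * θ i))
  -- After the removal no q with m ∣ q - 1 is left, so m is settled for good, although the counts of
  -- other moduli may have dropped below their thresholds.
  rec = prune X M θ N P′? A′? (s≤s⁻¹ (subst (_≤ suc N) #A #A≤N)) λ i q i<M q<X ¬A′ (Pq , m∤) → case i ≟ m of λ where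
    (yes refl) → m∤
    (no i≢m)   → dead i q i<M q<X (λ Ai → ¬A′ (Ai , i≢m)) Pq
  split : ∀ q → q < X → P q × ¬ Q rec q → (P q × m ∣ q ∸ 1) ⊎ ((P q × m ∤ q ∸ 1) × ¬ Q rec q)
  split q _ (Pq , ¬Qq) with m ∣? q ∸ 1
  ... | yes m∣ = inj₁ (Pq , m∣)
  ... | no  m∤ = inj₂ ((Pq , m∤) , ¬Qq)

-- Euler products, Chebyshev's bound and Mertens' estimate

Π-primes : ℕ → ℕ
Π-primes Y = Π< Y (λ p → p ^ 𝟙 (prime? p))

Π-predecessors : ℕ → ℕ
Π-predecessors Y = Π< Y (λ p → (p ∸ 1) ^ 𝟙 (prime? p))

Smooth : ℕ → ℕ → Set
Smooth Y n = ∀ {p} → p < suc n → Prime p × p ∣ n → p < Y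

Smooth? : ∀ Y → Decidable (Smooth Y)
Smooth? Y n = allUpTo? (λ p → PrimeDivisor? n p →-dec (p <? Y)) (suc n)

module _ where
  private
    Term? : ∀ Y → Decidable (λ n → 0 < n × Smooth Y n)
    Term? Y n = (0 <? n) ×-dec Smooth? Y n

    quot₀ : ℕ → ℕ → ℕ
    quot₀ Z zero    = 0
    quot₀ Z (suc n) = Z / suc n

    -- An integer version of Z · Σ 1/n over the n ≤ Z with all prime factors below Y.
    smoothSum : ℕ → ℕ → ℕ
    smoothSum Y Z = Σ< (suc Z) (λ n → 𝟙 (Term? Y n) * quot₀ Z n)

    Σ-multiples : ∀ Z Y .{{_ : NonZero Y}} (g : ℕ → ℕ) → Σ< (suc Z) (λ n → 𝟙 (Y ∣? n) * g n) ≤ Σ< (suc (Z / Y)) (λ c → g (c * Y))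
    Σ-multiples Z Y g = begin
      Σ< (suc Z) (λ n → 𝟙 (Y ∣? n) * g n) ≤⟨ Σ-mono (suc Z) (λ n n<1+Z → ≤-trans (*-monoˡ-≤ (g n) (𝟙≤-elim (Y ∣? n) (λ Y∣n → found n n<1+Z Y∣n))) (≤-reflexive (sym (Σ-*ʳ (g n) (suc (Z / Y)) _)))) ⟩
      Σ< (suc Z) (λ n → Σ< (suc (Z / Y)) (λ c → 𝟙 (n ≟ c * Y) * g n)) ≡⟨ Σ-swap (suc Z) (suc (Z / Y)) (λ n c → 𝟙 (n ≟ c * Y) * g n) ⟩
      Σ< (suc (Z / Y)) (λ c → Σ< (suc Z) (λ n → 𝟙 (n ≟ c * Y) * g n)) ≡⟨ Σ-cong (suc (Z / Y)) (λ c c<1+Z/Y → Σ-pick (suc Z) g (s≤s (≤-trans (*-monoˡ-≤ Y (s≤s⁻¹ c<1+Z/Y)) (m/n*n≤m Z Y)))) ⟩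
      Σ< (suc (Z / Y)) (λ c → g (c * Y)) ∎
      where
      open ≤-Reasoning
      found : ∀ n → n < suc Z → Y ∣ n → 1 ≤ Σ< (suc (Z / Y)) (λ c → 𝟙 (n ≟ c * Y))
      found n n<1+Z Y∣n = ≤-trans (≤-reflexive (sym (𝟙-yes (sym (m/n*n≡m Y∣n)) (n ≟ n / Y * Y))))
        (term≤Σ (suc (Z / Y)) (λ c → 𝟙 (n ≟ c * Y)) (s≤s (/-monoˡ-≤ Y (s≤s⁻¹ n<1+Z))))

    smoothSum-nonprime : ∀ Y Z → ¬ Prime Y → smoothSum (suc Y) Z ≤ smoothSum Y Z
    smoothSum-nonprime Y Z ¬pY = Σ-mono (suc Z) λ n _ → *-monoˡ-≤ (quot₀ Z n) (𝟙-mono (λ (0<n , sm) → 0<n , λ {p} p<1+n pd →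
      ≤∧≢⇒< (s≤s⁻¹ (sm p<1+n pd)) (λ { refl → ¬pY (proj₁ pd) })) (Term? (suc Y) n) (Term? Y n))

    -- Terms prime to Y belong to the first sum; a multiple cY contributes ⌊Z/cY⌋ = ⌊⌊Z/Y⌋/c⌋, a
    -- term of the second.
    smoothSum-prime : ∀ Y Z .{{_ : NonZero Y}} → smoothSum (suc Y) Z ≤ smoothSum Y Z + smoothSum (suc Y) (Z / Y)
    smoothSum-prime Y Z = begin
      smoothSum (suc Y) Z
        ≤⟨ Σ-mono (suc Z) (λ n n<1+Z → point n) ⟩
      Σ< (suc Z) (λ n → 𝟙 (Term? Y n) * quot₀ Z n + 𝟙 (Y ∣? n) * (𝟙 (Term? (suc Y) n) * quot₀ Z n))
        ≡⟨ Σ-+ (suc Z) _ _ ⟩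
      smoothSum Y Z + Σ< (suc Z) (λ n → 𝟙 (Y ∣? n) * (𝟙 (Term? (suc Y) n) * quot₀ Z n))
        ≤⟨ +-monoʳ-≤ (smoothSum Y Z) (Σ-multiples Z Y (λ n → 𝟙 (Term? (suc Y) n) * quot₀ Z n)) ⟩
      smoothSum Y Z + Σ< (suc (Z / Y)) (λ c → 𝟙 (Term? (suc Y) (c * Y)) * quot₀ Z (c * Y))
        ≤⟨ +-monoʳ-≤ (smoothSum Y Z) (Σ-mono (suc (Z / Y)) (λ c _ → divide c)) ⟩
      smoothSum Y Z + smoothSum (suc Y) (Z / Y) ∎
      where
      open ≤-Reasoning
      point : ∀ n → 𝟙 (Term? (suc Y) n) * quot₀ Z n ≤ 𝟙 (Term? Y n) * quot₀ Z n + 𝟙 (Y ∣? n) * (𝟙 (Term? (suc Y) n) * quot₀ Z n)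
      point n with Y ∣? n
      ... | yes _ = ≤-trans (≤-reflexive (sym (+-identityʳ _))) (m≤n+m _ (𝟙 (Term? Y n) * quot₀ Z n))
      ... | no Y∤n = ≤-trans (*-monoˡ-≤ (quot₀ Z n) (𝟙-mono (λ (0<n , sm) → 0<n , λ {p} p<1+n pd →
            ≤∧≢⇒< (s≤s⁻¹ (sm p<1+n pd)) (λ { refl → Y∤n (proj₂ pd) })) (Term? (suc Y) n) (Term? Y n))) (m≤m+n _ 0)
      quot : ∀ c → 0 < c → quot₀ Z (c * Y) ≡ quot₀ (Z / Y) c
      quot c@(suc c′) _ = trans (nz (c * Y) {{m*n≢0 c Y}}) (trans (/-congʳ {{m*n≢0 c Y}} {{m*n≢0 Y c}} (*-comm c Y)) (sym (m/n/o≡m/[n*o] Z Y c {{_}} {{_}} {{m*n≢0 Y c}})))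
        where
        nz : ∀ n .{{_ : NonZero n}} → quot₀ Z n ≡ Z / n
        nz (suc n) = refl
      divide : ∀ c → 𝟙 (Term? (suc Y) (c * Y)) * quot₀ Z (c * Y) ≤ 𝟙 (Term? (suc Y) c) * quot₀ (Z / Y) c
      divide zero    = ≤-trans (≤-reflexive (*-zeroʳ (𝟙 (Term? (suc Y) 0)))) z≤n
      divide c@(suc _) = *-mono-≤ (𝟙-mono (λ (_ , sm) → z<s , λ {p} p<1+c (pp , p∣c) →
          sm (s≤s (∣⇒≤ {{m*n≢0 c Y}} (∣m⇒∣m*n Y p∣c))) (pp , ∣m⇒∣m*n Y p∣c)) (Term? (suc Y) (c * Y)) (Term? (suc Y) c)) (≤-reflexive (quot c z<s))

    smoothSum-0 : ∀ Z → smoothSum 0 Z ≤ Z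
    smoothSum-0 zero      = ≤-reflexive (*-zeroʳ (𝟙 (Term? 0 0)))
    smoothSum-0 Z@(suc _) = ≤-trans (Σ-mono (suc Z) (λ n _ → point n)) (≤-reflexive (Σ-pick (suc Z) (λ _ → Z) {1} (s≤s (s≤s z≤n))))
      where
      point : ∀ n → 𝟙 (Term? 0 n) * quot₀ Z n ≤ 𝟙 (n ≟ 1) * Z
      point zero          = ≤-trans (≤-reflexive (*-zeroʳ (𝟙 (Term? 0 0)))) z≤n
      point (suc zero)    = *-mono-≤ (𝟙≤1 (Term? 0 1)) (≤-reflexive (n/1≡n Z))
      point n@(suc (suc _)) = ≤-trans (≤-reflexive (cong (_* quot₀ Z n) (𝟙-no (λ (_ , sm) → case prime-factor n (s≤s (s≤s z≤n)) of λ where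
        (p , pp , p∣n) → case sm (s≤s (∣⇒≤ p∣n)) (pp , p∣n) of λ ()) (Term? 0 n)))) z≤n

    -- For prime Y, strong induction on Z unrolls `smoothSum-prime` into the geometric series 1 +
    -- 1/Y + ⋯ = Y/(Y - 1).
    smoothSum-bound : ∀ Y Z → smoothSum Y Z * Π-predecessors Y ≤ Z * Π-primes Y
    smoothSum-bound zero    Z = *-monoˡ-≤ 1 (smoothSum-0 Z)
    smoothSum-bound (suc Y) Z = go (prime? Y) Z
      where
      open ≤-Reasoning
      go : (d : Dec (Prime Y)) → ∀ Z → smoothSum (suc Y) Z * (Π-predecessors Y * (Y ∸ 1) ^ 𝟙 d) ≤ Z * (Π-primes Y * Y ^ 𝟙 d)
      go (no ¬pY) Z = subst₂ _≤_ (cong (smoothSum (suc Y) Z *_) (sym (*-identityʳ _))) (cong (Z *_) (sym (*-identityʳ _)))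
        (≤-trans (*-monoˡ-≤ (Π-predecessors Y) (smoothSum-nonprime Y Z ¬pY)) (smoothSum-bound Y Z))
      go (yes pY) = subst₂ (λ a b → ∀ Z → smoothSum (suc Y) Z * (Π-predecessors Y * a) ≤ Z * (Π-primes Y * b)) (sym (*-identityʳ (Y ∸ 1))) (sym (*-identityʳ Y)) (<-rec _ step)
        where
        instance
          Y≢0 : NonZero Y
          Y≢0 = prime⇒nonZero pY
        D N : ℕ
        D = Π-predecessors Y
        N = Π-primes Y
        step : ∀ Z → (∀ {Z′} → Z′ < Z → smoothSum (suc Y) Z′ * (D * (Y ∸ 1)) ≤ Z′ * (N * Y)) → smoothSum (suc Y) Z * (D * (Y ∸ 1)) ≤ Z * (N * Y)
        step zero      rec = ≤-reflexive (cong (_* (D * (Y ∸ 1))) (*-zeroʳ (𝟙 (Term? (suc Y) 0))))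
        step Z@(suc _) rec = begin
          smoothSum (suc Y) Z * (D * (Y ∸ 1)) ≤⟨ *-monoˡ-≤ (D * (Y ∸ 1)) (smoothSum-prime Y Z) ⟩
          (smoothSum Y Z + smoothSum (suc Y) (Z / Y)) * (D * (Y ∸ 1)) ≡⟨ ring₁ (smoothSum Y Z) (smoothSum (suc Y) (Z / Y)) D (Y ∸ 1) ⟩
          smoothSum Y Z * D * (Y ∸ 1) + smoothSum (suc Y) (Z / Y) * (D * (Y ∸ 1)) ≤⟨ +-mono-≤ (*-monoˡ-≤ (Y ∸ 1) (smoothSum-bound Y Z)) (rec (m/n<m Z Y (prime>1 pY))) ⟩
          Z * N * (Y ∸ 1) + Z / Y * (N * Y) ≡⟨ cong (Z * N * (Y ∸ 1) +_) (ring₂ (Z / Y) N Y) ⟩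
          Z * N * (Y ∸ 1) + Z / Y * Y * N ≤⟨ +-monoʳ-≤ (Z * N * (Y ∸ 1)) (*-monoˡ-≤ N (m/n*n≤m Z Y)) ⟩
          Z * N * (Y ∸ 1) + Z * N ≡⟨ trans (+-comm (Z * N * (Y ∸ 1)) (Z * N)) (trans (cong (_+ Z * N * (Y ∸ 1)) (sym (*-identityʳ (Z * N)))) (sym (*-distribˡ-+ (Z * N) 1 (Y ∸ 1)))) ⟩
          Z * N * (1 + (Y ∸ 1)) ≡⟨ cong (Z * N *_) (m+[n∸m]≡n (<⇒≤ (prime>1 pY))) ⟩
          Z * N * Y ≡⟨ *-assoc Z N Y ⟩
          Z * (N * Y) ∎
          where
          ring₁ : ∀ a b d e → (a + b) * (d * e) ≡ a * d * e + b * (d * e)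
          ring₁ = solve-∀
          ring₂ : ∀ a b d → a * (b * d) ≡ a * d * b
          ring₂ = solve-∀

    smoothSum-lower : ∀ ζ → ζ * 2 ^ ζ ≤ 2 * smoothSum (2 ^ ζ) (2 ^ ζ)
    smoothSum-lower ζ = begin
      ζ * Z ≡⟨ sym (Σ-const ζ Z) ⟩
      Σ< ζ (λ _ → Z) ≤⟨ Σ-mono ζ block ⟩
      Σ< ζ (λ i → 2 * Σ< (2 ^ i) (λ d → f (2 ^ i + d))) ≡⟨ Σ-*ˡ 2 ζ _ ⟩
      2 * Σ< ζ (λ i → Σ< (2 ^ i) (λ d → f (2 ^ i + d))) ≤⟨ *-monoʳ-≤ 2 (≤-trans (m≤n+m _ (f 0)) (≤-trans (≤-reflexive (sym (Σ-dyadic ζ f))) (m≤m+n (Σ< Z f) (f Z)))) ⟩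
      2 * smoothSum Z Z ∎
      where
      open ≤-Reasoning
      Z : ℕ
      Z = 2 ^ ζ
      f : ℕ → ℕ
      f n = 𝟙 (Term? Z n) * quot₀ Z n
      f-lower : ∀ i n → i < ζ → 2 ^ i ≤ n → n < 2 ^ suc i → 2 ^ (ζ ∸ suc i) ≤ f n
      f-lower i zero i<ζ 2ⁱ≤0 _ = contradiction (≤-trans (m^n>0 2 i) 2ⁱ≤0) λ ()
      f-lower i n@(suc _) i<ζ 2ⁱ≤n n<2ⁱ⁺¹ = ≤-trans (≤-trans (≤-reflexive (sym (m*n/n≡m (2 ^ (ζ ∸ suc i)) n))) (/-monoˡ-≤ n
          (≤-trans (*-monoʳ-≤ (2 ^ (ζ ∸ suc i)) (<⇒≤ n<2ⁱ⁺¹)) (≤-reflexive (trans (sym (^-distribˡ-+-* 2 (ζ ∸ suc i) (suc i))) (cong (2 ^_) (m∸n+n≡m i<ζ)))))))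
          (≤-reflexive (sym (trans (cong (_* (Z / n)) (𝟙-yes (z<s , λ {p} p<1+n _ → <-≤-trans p<1+n (≤-trans n<2ⁱ⁺¹ (^-monoʳ-≤ 2 i<ζ))) (Term? Z n))) (*-identityˡ _))))
      block : ∀ i → i < ζ → Z ≤ 2 * Σ< (2 ^ i) (λ d → f (2 ^ i + d))
      block i i<ζ = begin
        Z ≡⟨ cong (2 ^_) (sym (m+[n∸m]≡n i<ζ)) ⟩
        2 ^ (suc i + (ζ ∸ suc i)) ≡⟨ ^-distribˡ-+-* 2 (suc i) (ζ ∸ suc i) ⟩
        2 * 2 ^ i * 2 ^ (ζ ∸ suc i) ≡⟨ *-assoc 2 (2 ^ i) _ ⟩
        2 * (2 ^ i * 2 ^ (ζ ∸ suc i)) ≡⟨ cong (2 *_) (sym (Σ-const (2 ^ i) _)) ⟩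
        2 * Σ< (2 ^ i) (λ _ → 2 ^ (ζ ∸ suc i)) ≤⟨ *-monoʳ-≤ 2 (Σ-mono (2 ^ i) (λ d d<2ⁱ → f-lower i (2 ^ i + d) i<ζ (m≤m+n _ _) (<-≤-trans (+-monoʳ-< (2 ^ i) d<2ⁱ) (≤-reflexive (sym (2^-suc i)))))) ⟩
        2 * Σ< (2 ^ i) (λ d → f (2 ^ i + d)) ∎

  -- Euler: Σ_{n < 2^ζ} 1/n ≤ Π_{p < 2^ζ} (1 − 1/p)⁻¹
  euler-product : ∀ ζ → ζ * Π-predecessors (2 ^ ζ) ≤ 2 * Π-primes (2 ^ ζ)
  euler-product ζ = *-cancelˡ-≤ (2 ^ ζ) {{m^n≢0 2 ζ}} (begin
    2 ^ ζ * (ζ * D) ≡⟨ ring₁ (2 ^ ζ) ζ D ⟩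
    ζ * 2 ^ ζ * D ≤⟨ *-monoˡ-≤ D (smoothSum-lower ζ) ⟩
    2 * smoothSum (2 ^ ζ) (2 ^ ζ) * D ≡⟨ *-assoc 2 (smoothSum (2 ^ ζ) (2 ^ ζ)) D ⟩
    2 * (smoothSum (2 ^ ζ) (2 ^ ζ) * D) ≤⟨ *-monoʳ-≤ 2 (smoothSum-bound (2 ^ ζ) (2 ^ ζ)) ⟩
    2 * (2 ^ ζ * N) ≡⟨ ring₂ (2 ^ ζ) N ⟩
    2 ^ ζ * (2 * N) ∎)
    where
    open ≤-Reasoning
    D N : ℕ
    D = Π-predecessors (2 ^ ζ)
    N = Π-primes (2 ^ ζ)
    ring₁ : ∀ a b d → a * (b * d) ≡ b * a * d
    ring₁ = solve-∀
    ring₂ : ∀ a b → 2 * (a * b) ≡ a * (2 * b)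
    ring₂ = solve-∀

C≤2^ : ∀ n k → n C k ≤ 2 ^ n
C≤2^ n       zero    rewrite nC0≡1 n = m^n>0 2 n
C≤2^ zero    (suc k) rewrite k>n⇒nCk≡0 {0} {suc k} (s≤s z≤n) = z≤n
C≤2^ (suc n) (suc k) = ≤-trans (≤-reflexive (sym (nCk+nC[k+1]≡[n+1]C[k+1] n k)))
  (≤-trans (+-mono-≤ (C≤2^ n k) (C≤2^ n (suc k))) (≤-reflexive (sym (2^-suc n))))

prime∤! : ∀ {p} n → Prime p → n < p → p ∤ n !
prime∤! zero    pp n<p p∣1 = <⇒≢ (prime>1 pp) (sym (∣1⇒≡1 p∣1))
prime∤! (suc n) pp n<p = prime∤* (suc n) (n !) pp (∤-small z<s n<p) (prime∤! n pp (<-trans (n<1+n n) n<p))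

prime∣central : ∀ {p} n → Prime p → n < p → p ≤ n + n → p ∣ (n + n) C n
prime∣central {p} n pp n<p p≤2n = [ id , (λ d → contradiction d (prime∤* (n !) ((n + n ∸ n) !) pp (prime∤! n pp n<p)
    (subst (λ m → p ∤ m !) (sym (m+n∸m≡n n n)) (prime∤! n pp n<p)))) ]′
  (euclidsLemma ((n + n) C n) (n ! * (n + n ∸ n) !) pp (subst (p ∣_) (sym factorials) p∣!))
  where
  instance
    den≢0 : NonZero (n ! * (n + n ∸ n) !)
    den≢0 = n !* (n + n ∸ n) !≢0
  factorials : ((n + n) C n) * (n ! * (n + n ∸ n) !) ≡ (n + n) !
  factorials = trans (cong (_* (n ! * (n + n ∸ n) !)) (nCk≡n!/k![n-k]! (m≤m+n n n))) (m/n*n≡m (k![n∸k]!∣n! (m≤m+n n n)))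
  p∣! : p ∣ (n + n) !
  p∣! = ∣-trans (p∣p! p (prime⇒nonZero pp)) (m≤n⇒m!∣n! p≤2n)
    where
    p∣p! : ∀ p → NonZero p → p ∣ p !
    p∣p! (suc p) _ = m∣m*n (p !)

primesInBlock : ℕ → ℕ
primesInBlock i = # (2 ^ i) (λ d → prime? (2 ^ i + d))

2^-cancel-≤ : ∀ a b → 2 ^ a ≤ 2 ^ b → a ≤ b
2^-cancel-≤ a b h = ≮⇒≥ λ b<a → <⇒≱ (^-monoʳ-< 2 (s≤s (s≤s z≤n)) b<a) h

2^-not-prime : ∀ i → 2 ≤ i → ¬ Prime (2 ^ i)
2^-not-prime i 2≤i p = <⇒≢ (≤-trans (s≤s (s≤s (s≤s z≤n))) (^-monoʳ-≤ 2 2≤i)) (prime∣prime prime[2] p (subst (_∣ 2 ^ i) refl (^-∣ 2 {1} {i} (≤-trans (s≤s z≤n) 2≤i))))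

-- The primes between 2^i and 2^(i+1) all divide the central binomial coefficient, which is at most
-- 2^(2^(i+1)), and each of them is at least 2^i. For i ≥ 2 the left endpoint is not a prime.
chebyshev : ∀ i → 2 ≤ i → i * primesInBlock i ≤ 2 ^ suc i
chebyshev i 2≤i = 2^-cancel-≤ (i * primesInBlock i) (2 ^ suc i) (begin
  2 ^ (i * primesInBlock i) ≡⟨ sym (^-*-assoc 2 i (primesInBlock i)) ⟩
  N ^ primesInBlock i ≡⟨ sym (Π-^Σ N N _) ⟩
  Π< N (λ d → N ^ 𝟙 (prime? (N + d))) ≤⟨ Π-mono N (λ d d<N → term d d<N (prime? (N + d))) ⟩
  Π< N (λ d → (N + d) ^ 𝟙 (PrimeDivisor? c (N + d))) ≤⟨ m≤n*m _ (radical N c) {{>-nonZero (radical>0 N c)}} ⟩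
  radical N c * Π< N (λ d → (N + d) ^ 𝟙 (PrimeDivisor? c (N + d))) ≡⟨ sym (Π-split N N (λ p → p ^ 𝟙 (PrimeDivisor? c p))) ⟩
  radical (N + N) c ≤⟨ ∣⇒≤ {{c≢0}} (radical∣ (N + N) c) ⟩
  c ≤⟨ C≤2^ (N + N) N ⟩
  2 ^ (N + N) ≡⟨ cong (2 ^_) (sym (2^-suc i)) ⟩
  2 ^ (2 ^ suc i) ∎)
  where
  open ≤-Reasoning
  N c : ℕ
  N = 2 ^ i
  c = (N + N) C N
  c≢0 : NonZero c
  c≢0 = ≢-nonZero λ c≡0 → prime∤c c≡0
    where
    -- the factorial formula exhibits c as a divisor of (2N)!
    prime∤c : c ≢ 0
    prime∤c c≡0 = ≢-nonZero⁻¹ ((N + N) !) {{(N + N) !≢0}} (trans (sym (m/n*n≡m {{den≢0}} (k![n∸k]!∣n! (m≤m+n N N))))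
      (cong (_* (N ! * (N + N ∸ N) !)) (trans (sym (nCk≡n!/k![n-k]! (m≤m+n N N))) c≡0)))
      where
      den≢0 : NonZero (N ! * (N + N ∸ N) !)
      den≢0 = N !* (N + N ∸ N) !≢0
  term : ∀ d → d < N → (dec : Dec (Prime (N + d))) → N ^ 𝟙 dec ≤ (N + d) ^ 𝟙 (PrimeDivisor? c (N + d))
  term d d<N (no _) = m^n>0 (N + d) {{>-nonZero (≤-trans (m^n>0 2 i) (m≤m+n N d))}} (𝟙 (PrimeDivisor? c (N + d)))
  term zero d<N (yes p) = contradiction (subst Prime (+-identityʳ N) p) (2^-not-prime i 2≤i)
  term d@(suc d′) d<N (yes p) = subst (λ e → N ^ 1 ≤ (N + d) ^ e) (sym (𝟙-yes (p , prime∣central N p (m<m+n N z<s) (+-monoʳ-≤ N (<⇒≤ d<N))) (PrimeDivisor? c (N + d))))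
    (^-monoˡ-≤ 1 (m≤m+n N d))

-- (1 + 1/b)^N ≤ 1/(1 − N/b)
power-ratio : ∀ b N → suc b ^ N * (b ∸ N) ≤ b ^ suc N
power-ratio b zero = ≤-reflexive (trans (+-identityʳ b) (sym (*-identityʳ b)))
power-ratio b (suc N) = begin
  suc b * suc b ^ N * (b ∸ suc N) ≡⟨ trans (cong (_* (b ∸ suc N)) (*-comm (suc b) (suc b ^ N))) (*-assoc (suc b ^ N) (suc b) (b ∸ suc N)) ⟩
  suc b ^ N * (suc b * (b ∸ suc N)) ≤⟨ *-monoʳ-≤ (suc b ^ N) step ⟩
  suc b ^ N * (b * (b ∸ N)) ≡⟨ ring (suc b ^ N) b (b ∸ N) ⟩
  b * (suc b ^ N * (b ∸ N)) ≤⟨ *-monoʳ-≤ b (power-ratio b N) ⟩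
  b * b ^ suc N ∎
  where
  open ≤-Reasoning
  ring : ∀ x y w → x * (y * w) ≡ y * (x * w)
  ring = solve-∀
  step : suc b * (b ∸ suc N) ≤ b * (b ∸ N)
  step with suc N ≤? b
  ... | no ≰ = ≤-trans (≤-reflexive (trans (cong (suc b *_) (m≤n⇒m∸n≡0 (<⇒≤ (≰⇒> ≰)))) (*-zeroʳ (suc b)))) z≤n
  ... | yes N<b = ≤-trans (+-monoˡ-≤ (b * (b ∸ suc N)) (m∸n≤m b (suc N))) (≤-reflexive (trans (sym (*-suc b (b ∸ suc N))) (cong (b *_) (sym (+-∸-assoc 1 N<b)))))

blockΠ : (ℕ → ℕ) → ℕ → ℕ
blockΠ g i = Π< (2 ^ i) (λ d → g (2 ^ i + d) ^ 𝟙 (prime? (2 ^ i + d)))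

-- With b = 2^(i-3) each factor 1 + 8/p is at most 1 + 1/b, and `chebyshev` allows at most 16b/i
-- factors; `power-ratio` then gives i/(i - 16).
block-ratio : ∀ i → 3 ≤ i → blockΠ (_+ 8) i * (i ∸ 16) ≤ blockΠ id i * i
block-ratio i 3≤i = *-cancelˡ-≤ (b ^ suc N) {{m^n≢0 b (suc N) {{b≢0}}}} (begin
  b ^ suc N * (A * (i ∸ 16)) ≡⟨ ring₁ b (b ^ N) A (i ∸ 16) ⟩
  A * b ^ N * (b * (i ∸ 16)) ≤⟨ *-mono-≤ shifted gap ⟩
  P * suc b ^ N * (i * (b ∸ N)) ≡⟨ ring₂ P (suc b ^ N) i (b ∸ N) ⟩
  P * i * (suc b ^ N * (b ∸ N)) ≤⟨ *-monoʳ-≤ (P * i) (power-ratio b N) ⟩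
  P * i * b ^ suc N ≡⟨ *-comm (P * i) (b ^ suc N) ⟩
  b ^ suc N * (P * i) ∎)
  where
  open ≤-Reasoning
  b N A P : ℕ
  b = 2 ^ (i ∸ 3)
  N = primesInBlock i
  A = blockΠ (_+ 8) i
  P = blockΠ id i
  b≢0 : NonZero b
  b≢0 = m^n≢0 2 (i ∸ 3)
  8b : 8 * b ≡ 2 ^ i
  8b = trans (sym (^-distribˡ-+-* 2 3 (i ∸ 3))) (cong (2 ^_) (m+[n∸m]≡n 3≤i))
  ring₁ : ∀ b x A y → b * x * (A * y) ≡ A * x * (b * y)
  ring₁ = solve-∀
  ring₂ : ∀ P x i y → P * x * (i * y) ≡ P * i * (x * y)
  ring₂ = solve-∀
  gap : b * (i ∸ 16) ≤ i * (b ∸ N)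
  gap = ≤-trans (≤-reflexive (*-distribˡ-∸ b i 16)) (≤-trans (∸-monoʳ-≤ (b * i) iN≤) (≤-reflexive (trans (cong (_∸ i * N) (*-comm b i)) (sym (*-distribˡ-∸ i b N)))))
    where
    iN≤ : i * N ≤ b * 16
    iN≤ = ≤-trans (chebyshev i (≤-trans (s≤s (s≤s z≤n)) 3≤i)) (≤-reflexive (trans (cong (2 *_) (sym 8b)) (ring b)))
      where
      ring : ∀ b → 2 * (8 * b) ≡ b * 16
      ring = solve-∀
  shifted : A * b ^ N ≤ P * suc b ^ N
  shifted = subst₂ _≤_ (trans (Π-* (2 ^ i) _ _) (cong (A *_) (Π-^Σ (2 ^ i) b _))) (trans (Π-* (2 ^ i) _ _) (cong (P *_) (Π-^Σ (2 ^ i) (suc b) _)))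
    (Π-mono (2 ^ i) λ d _ → subst₂ _≤_ (^-distribʳ-* (2 ^ i + d + 8) b (𝟙 (prime? (2 ^ i + d)))) (^-distribʳ-* (2 ^ i + d) (suc b) (𝟙 (prime? (2 ^ i + d)))) (^-monoˡ-≤ (𝟙 (prime? (2 ^ i + d))) (point d)))
    where
    point : ∀ d → (2 ^ i + d + 8) * b ≤ (2 ^ i + d) * suc b
    point d = linear ((2 ^ i + d + 8) * b) ((2 ^ i + d) * suc b) 0 (≤-trans (≤-reflexive 8b) (m≤m+n (2 ^ i) d)) (ring (2 ^ i + d) b)
      where
      ring : ∀ p b → (p + 8) * b + p + 0 ≡ p * suc b + 8 * b
      ring = solve-∀

private
  growth-core : ∀ j f x → (32 + j) * x * (32 + j) ≤ (16 + j) * ((32 + j) * x + (32 + f) * x)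
  growth-core j f x = ≤-trans (m≤m+n _ ((16 * j + (16 + j) * f) * x)) (≤-reflexive (ring j f x))
    where
    ring : ∀ j f x → (32 + j) * x * (32 + j) + (16 * j + (16 + j) * f) * x ≡ (16 + j) * ((32 + j) * x + (32 + f) * x)
    ring = solve-∀

  growth-step : ∀ i e x → 32 ≤ i → 32 ≤ e → i * x * i ≤ (i ∸ 16) * (i * x + e * x)
  growth-step i e x 32≤i 32≤e = subst (λ e → i * x * i ≤ (i ∸ 16) * (i * x + e * x)) (m+[n∸m]≡n 32≤e)
    (subst₂ (λ i d → i * x * i ≤ d * (i * x + (32 + (e ∸ 32)) * x)) (m+[n∸m]≡n 32≤i)
      (trans (cong (16 +_) (sym (∸-+-assoc i 16 16))) (m+[n∸m]≡n (m+n≤o⇒m≤o∸n 16 32≤i))) (growth-core (i ∸ 32) (e ∸ 32) x))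

-- From i/(i - 16) ≤ 1 + e/i ≤ (1 + 1/i)^e. The first inequality asks for e ≥ 16i/(i - 16), which is
-- at most 32 once i ≥ 32; hence the constant 32.
power-growth : ∀ e i → 32 ≤ e → 32 ≤ i → i ^ e * i ≤ (i ∸ 16) * suc i ^ e
power-growth (suc e) i 32≤e 32≤i = ≤-trans (growth-step i (suc e) (i ^ e) 32≤i 32≤e) (*-monoʳ-≤ (i ∸ 16) (bernoulli i e))

PrimeFrom? : ∀ η → Decidable (λ s → Prime s × 2 ^ η ≤ s)
PrimeFrom? η s = prime? s ×-dec (2 ^ η ≤? s)

rangeΠ : (ℕ → ℕ) → ℕ → ℕ → ℕ
rangeΠ g η ζ = Π< (2 ^ ζ) (λ s → g s ^ 𝟙 (PrimeFrom? η s))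

rangeΠ-empty : ∀ g η → rangeΠ g η η ≡ 1
rangeΠ-empty g η = Π-one (2 ^ η) _ (λ s s<2^η → cong (g s ^_) (𝟙-no (λ (_ , le) → <⇒≱ s<2^η le) (PrimeFrom? η s)))

rangeΠ-suc : ∀ g η ζ → η ≤ ζ → rangeΠ g η (suc ζ) ≡ rangeΠ g η ζ * blockΠ g ζ
rangeΠ-suc g η ζ η≤ζ = trans (cong (λ z → Π< z (λ s → g s ^ 𝟙 (PrimeFrom? η s))) (2^-suc ζ)) (trans (Π-split (2 ^ ζ) (2 ^ ζ) _)
  (cong (rangeΠ g η ζ *_) (Π-cong (2 ^ ζ) (λ d _ → cong (g (2 ^ ζ + d) ^_) (≤-antisym
    (𝟙-mono proj₁ (PrimeFrom? η (2 ^ ζ + d)) (prime? (2 ^ ζ + d)))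
    (𝟙-mono (λ p → p , ≤-trans (^-monoʳ-≤ 2 η≤ζ) (m≤m+n (2 ^ ζ) d)) (prime? (2 ^ ζ + d)) (PrimeFrom? η (2 ^ ζ + d))))))))

-- The block factors i/(i - 16) telescope against ((i + 1)/i)^e. The shift 8 serves twice: 1 + 8/s
-- dominates (1 - 1/s)⁻¹ in Mertens' estimate and equals 1 + 4 · 2/s in Brun's sieve.
range-ratio : ∀ e η t → 32 ≤ e → 32 ≤ η → rangeΠ (_+ 8) η (t + η) ≤ rangeΠ id η (t + η) * (t + η) ^ e
range-ratio e η zero 32≤e 32≤η = ≤-trans (≤-reflexive (rangeΠ-empty (_+ 8) η)) (*-mono-≤ (≤-reflexive (sym (rangeΠ-empty id η))) (m^n>0 η {{>-nonZero (≤-trans (s≤s z≤n) 32≤η)}} e))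
range-ratio e η (suc t) 32≤e 32≤η = *-cancelʳ-≤ _ _ (i ∸ 16) {{>-nonZero (m<n⇒0<n∸m (≤-trans (m≤m+n 17 15) 32≤i))}} (begin
  rangeΠ (_+ 8) η (suc i) * (i ∸ 16) ≡⟨ cong (_* (i ∸ 16)) (rangeΠ-suc (_+ 8) η i η≤i) ⟩
  rangeΠ (_+ 8) η i * blockΠ (_+ 8) i * (i ∸ 16) ≡⟨ *-assoc (rangeΠ (_+ 8) η i) _ _ ⟩
  rangeΠ (_+ 8) η i * (blockΠ (_+ 8) i * (i ∸ 16)) ≤⟨ *-mono-≤ (range-ratio e η t 32≤e 32≤η) (block-ratio i (≤-trans (m≤m+n 3 29) 32≤i)) ⟩
  rangeΠ id η i * i ^ e * (blockΠ id i * i) ≡⟨ *-interchange (rangeΠ id η i) (i ^ e) (blockΠ id i) i ⟩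
  rangeΠ id η i * blockΠ id i * (i ^ e * i) ≤⟨ *-monoʳ-≤ (rangeΠ id η i * blockΠ id i) (power-growth e i 32≤e 32≤i) ⟩
  rangeΠ id η i * blockΠ id i * ((i ∸ 16) * suc i ^ e) ≡⟨ cong₂ _*_ (sym (rangeΠ-suc id η i η≤i)) (*-comm (i ∸ 16) (suc i ^ e)) ⟩
  rangeΠ id η (suc i) * (suc i ^ e * (i ∸ 16)) ≡⟨ sym (*-assoc (rangeΠ id η (suc i)) (suc i ^ e) (i ∸ 16)) ⟩
  rangeΠ id η (suc i) * suc i ^ e * (i ∸ 16) ∎)
  where
  open ≤-Reasoning
  i : ℕ
  i = t + η
  η≤i : η ≤ i
  η≤i = m≤n+m η t
  32≤i : 32 ≤ i
  32≤i = ≤-trans 32≤η η≤i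

fullΠ : (ℕ → ℕ) → ℕ → ℕ
fullΠ g ζ = Π< (2 ^ ζ) (λ p → g p ^ 𝟙 (prime? p))

fullΠ-range : ∀ g η t → fullΠ g (t + η) ≡ fullΠ g η * rangeΠ g η (t + η)
fullΠ-range g η zero    = sym (trans (cong (fullΠ g η *_) (rangeΠ-empty g η)) (*-identityʳ _))
fullΠ-range g η (suc t) = begin
  fullΠ g (suc (t + η)) ≡⟨ cong (λ z → Π< z (λ p → g p ^ 𝟙 (prime? p))) (2^-suc (t + η)) ⟩
  Π< (2 ^ (t + η) + 2 ^ (t + η)) (λ p → g p ^ 𝟙 (prime? p)) ≡⟨ Π-split (2 ^ (t + η)) (2 ^ (t + η)) _ ⟩
  fullΠ g (t + η) * blockΠ g (t + η) ≡⟨ cong (_* blockΠ g (t + η)) (fullΠ-range g η t) ⟩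
  fullΠ g η * rangeΠ g η (t + η) * blockΠ g (t + η) ≡⟨ *-assoc (fullΠ g η) _ _ ⟩
  fullΠ g η * (rangeΠ g η (t + η) * blockΠ g (t + η)) ≡⟨ cong (fullΠ g η *_) (sym (rangeΠ-suc g η (t + η) (m≤n+m η t))) ⟩
  fullΠ g η * rangeΠ g η (suc (t + η)) ∎
  where open ≡-Reasoning

-- Taken over all integers from 2 to Y - 1, the product of p/(p - 1) telescopes to Y - 1. This crude
-- bound serves the finitely many primes below 2^η₀.
Π-primes≤ : ∀ Y → 2 ≤ Y → Π-primes Y ≤ (Y ∸ 1) * Π-predecessors Y
Π-primes≤ (suc zero) (s≤s ())
Π-primes≤ (suc (suc zero)) _ = ≤-refl
Π-primes≤ (suc Y@(suc (suc Y′))) _ = go (prime? Y) (Π-primes≤ Y (s≤s (s≤s z≤n)))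
  where
  go : (d : Dec (Prime Y)) → Π-primes Y ≤ (Y ∸ 1) * Π-predecessors Y → Π-primes Y * Y ^ 𝟙 d ≤ Y * (Π-predecessors Y * (Y ∸ 1) ^ 𝟙 d)
  go (no _) h = ≤-trans (≤-reflexive (*-identityʳ _)) (≤-trans h (*-mono-≤ (n≤1+n (Y ∸ 1)) (≤-reflexive (sym (*-identityʳ _)))))
  go (yes _) h = ≤-trans (*-monoˡ-≤ (Y * 1) h) (≤-reflexive (ring (Y ∸ 1) (Π-predecessors Y) Y))
    where
    ring : ∀ a b c → a * b * (c * 1) ≡ c * (b * (a * 1))
    ring = solve-∀

rangeΠ-* : ∀ f g η ζ → rangeΠ f η ζ * rangeΠ g η ζ ≡ rangeΠ (λ s → f s * g s) η ζ
rangeΠ-* f g η ζ = trans (sym (Π-* (2 ^ ζ) _ _)) (Π-cong (2 ^ ζ) (λ s _ → sym (^-distribʳ-* (f s) (g s) (𝟙 (PrimeFrom? η s)))))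

rangeΠ-mono : ∀ f g η ζ → (∀ s → Prime s → f s ≤ g s) → rangeΠ f η ζ ≤ rangeΠ g η ζ
rangeΠ-mono f g η ζ h = Π-mono (2 ^ ζ) step
  where
  step : ∀ s → s < 2 ^ ζ → f s ^ 𝟙 (PrimeFrom? η s) ≤ g s ^ 𝟙 (PrimeFrom? η s)
  step s _ with PrimeFrom? η s
  ... | yes (ps , _) = ^-monoˡ-≤ 1 (h s ps)
  ... | no _ = ≤-refl

rangeΠ-pos : ∀ g η ζ → (∀ s → Prime s → 1 ≤ g s) → 1 ≤ rangeΠ g η ζ
rangeΠ-pos g η ζ h = subst (_≤ rangeΠ g η ζ) (Π-one (2 ^ ζ) _ (λ s _ → ^-zeroˡ (𝟙 (PrimeFrom? η s)))) (rangeΠ-mono (λ _ → 1) g η ζ h)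

mertens-upper : ∀ e η₀ t → 32 ≤ e → 32 ≤ η₀ → Π-primes (2 ^ (t + η₀)) ≤ 2 ^ η₀ * (t + η₀) ^ e * Π-predecessors (2 ^ (t + η₀))
mertens-upper e η₀ t 32≤e 32≤η₀ = begin
  Π-primes (2 ^ η) ≡⟨ fullΠ-range id η₀ t ⟩
  Π-primes (2 ^ η₀) * R ≤⟨ *-mono-≤ (≤-trans (Π-primes≤ (2 ^ η₀) (^-monoʳ-≤ 2 {1} {η₀} (≤-trans (s≤s z≤n) 32≤η₀))) (*-monoˡ-≤ D₀ (m∸n≤m (2 ^ η₀) 1))) R≤ ⟩
  2 ^ η₀ * D₀ * (R′ * η ^ e) ≡⟨ ring (2 ^ η₀) D₀ R′ (η ^ e) ⟩
  2 ^ η₀ * η ^ e * (D₀ * R′) ≡⟨ cong (2 ^ η₀ * η ^ e *_) (sym (fullΠ-range (_∸ 1) η₀ t)) ⟩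
  2 ^ η₀ * η ^ e * Π-predecessors (2 ^ η) ∎
  where
  open ≤-Reasoning
  η R R′ D₀ : ℕ
  η = t + η₀
  R = rangeΠ id η₀ η
  R′ = rangeΠ (_∸ 1) η₀ η
  D₀ = Π-predecessors (2 ^ η₀)
  ring : ∀ a b c d → a * b * (c * d) ≡ a * d * (b * c)
  ring = solve-∀
  R≤ : R ≤ R′ * η ^ e
  R≤ = *-cancelʳ-≤ R (R′ * η ^ e) R {{>-nonZero (rangeΠ-pos id η₀ η (λ s ps → <⇒≤ (prime>1 ps)))}} (begin
    R * R ≡⟨ rangeΠ-* id id η₀ η ⟩
    rangeΠ (λ s → s * s) η₀ η ≤⟨ rangeΠ-mono (λ s → s * s) (λ s → (s ∸ 1) * (s + 8)) η₀ η (λ s ps → point s (prime>1 ps)) ⟩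
    rangeΠ (λ s → (s ∸ 1) * (s + 8)) η₀ η ≡⟨ sym (rangeΠ-* (_∸ 1) (_+ 8) η₀ η) ⟩
    R′ * rangeΠ (_+ 8) η₀ η ≤⟨ *-monoʳ-≤ R′ (range-ratio e η₀ t 32≤e 32≤η₀) ⟩
    R′ * (R * η ^ e) ≡⟨ trans (cong (R′ *_) (*-comm R (η ^ e))) (sym (*-assoc R′ (η ^ e) R)) ⟩
    R′ * η ^ e * R ∎)
    where
    point : ∀ s → 1 < s → s * s ≤ (s ∸ 1) * (s + 8)
    point (suc zero) (s≤s ())
    point (suc (suc s)) _ = ≤-trans (m≤m+n _ (7 * s + 6)) (≤-reflexive (ring′ s))
      where
      ring′ : ∀ s → (2 + s) * (2 + s) + (7 * s + 6) ≡ (1 + s) * (2 + s + 8)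
      ring′ = solve-∀

-- Π_{2^η ≤ s < 2^ζ} (1 − 2/s) = O((log 2^η)^O(1) / ζ²)
sieve-density : ∀ e η₀ t t′ → 32 ≤ e → 32 ≤ η₀ →
  (t′ + (t + η₀)) * (t′ + (t + η₀)) * rangeΠ (_∸ 2) (t + η₀) (t′ + (t + η₀)) ≤
  (2 ^ suc η₀ * (t + η₀) ^ e) * (2 ^ suc η₀ * (t + η₀) ^ e) * rangeΠ id (t + η₀) (t′ + (t + η₀))
sieve-density e η₀ t t′ 32≤e 32≤η₀ = *-cancelʳ-≤ _ _ R {{>-nonZero (rangeΠ-pos id η ζ (λ s ps → <⇒≤ (prime>1 ps)))}} (begin
  ζ * ζ * rangeΠ (_∸ 2) η ζ * R ≡⟨ *-assoc (ζ * ζ) _ R ⟩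
  ζ * ζ * (rangeΠ (_∸ 2) η ζ * R) ≡⟨ cong (ζ * ζ *_) (rangeΠ-* (_∸ 2) id η ζ) ⟩
  ζ * ζ * rangeΠ (λ s → (s ∸ 2) * s) η ζ ≤⟨ *-monoʳ-≤ (ζ * ζ) (rangeΠ-mono (λ s → (s ∸ 2) * s) (λ s → (s ∸ 1) * (s ∸ 1)) η ζ (λ s ps → point s (prime>1 ps))) ⟩
  ζ * ζ * rangeΠ (λ s → (s ∸ 1) * (s ∸ 1)) η ζ ≡⟨ cong (ζ * ζ *_) (sym (rangeΠ-* (_∸ 1) (_∸ 1) η ζ)) ⟩
  ζ * ζ * (R′ * R′) ≡⟨ *-interchange ζ ζ R′ R′ ⟩
  ζ * R′ * (ζ * R′) ≤⟨ *-mono-≤ one one ⟩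
  K * R * (K * R) ≡⟨ *-interchange K R K R ⟩
  K * K * (R * R) ≡⟨ sym (*-assoc (K * K) R R) ⟩
  K * K * R * R ∎)
  where
  open ≤-Reasoning
  η ζ R R′ K : ℕ
  η = t + η₀
  ζ = t′ + η
  R = rangeΠ id η ζ
  R′ = rangeΠ (_∸ 1) η ζ
  K = 2 ^ suc η₀ * η ^ e
  point : ∀ s → 1 < s → (s ∸ 2) * s ≤ (s ∸ 1) * (s ∸ 1)
  point (suc zero) (s≤s ())
  point (suc (suc s)) _ = ≤-trans (m≤m+n _ 1) (≤-reflexive (ring s))
    where
    ring : ∀ s → s * (2 + s) + 1 ≡ (1 + s) * (1 + s)
    ring = solve-∀
  D : ℕ
  D = Π-predecessors (2 ^ η)
  D>0 : 1 ≤ D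
  D>0 = Π-pos (2 ^ η) _ pos
    where
    pos : ∀ p → p < 2 ^ η → 1 ≤ (p ∸ 1) ^ 𝟙 (prime? p)
    pos p _ with prime? p
    ... | yes pp = subst (1 ≤_) (sym (*-identityʳ (p ∸ 1))) (m<n⇒0<n∸m (prime>1 pp))
    ... | no _ = ≤-refl
  one : ζ * R′ ≤ K * R
  one = *-cancelˡ-≤ D {{>-nonZero D>0}} (begin
    D * (ζ * R′) ≡⟨ ring₁ D ζ R′ ⟩
    ζ * (D * R′) ≡⟨ cong (ζ *_) (sym (fullΠ-range (_∸ 1) η t′)) ⟩
    ζ * Π-predecessors (2 ^ ζ) ≤⟨ euler-product ζ ⟩
    2 * Π-primes (2 ^ ζ) ≡⟨ cong (2 *_) (fullΠ-range id η t′) ⟩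
    2 * (Π-primes (2 ^ η) * R) ≤⟨ *-monoʳ-≤ 2 (*-monoˡ-≤ R (mertens-upper e η₀ t 32≤e 32≤η₀)) ⟩
    2 * (2 ^ η₀ * η ^ e * D * R) ≡⟨ ring₂ (2 ^ η₀) (η ^ e) D R ⟩
    D * (2 * 2 ^ η₀ * η ^ e * R) ∎)
    where
    ring₁ : ∀ a b c → a * (b * c) ≡ b * (a * c)
    ring₁ = solve-∀
    ring₂ : ∀ a b c d → 2 * (a * b * c * d) ≡ c * (2 * a * b * d)
    ring₂ = solve-∀

-- Brun's sieve

linear-root : ∀ s .{{_ : NonZero s}} → Prime s → ∀ a b → s ∤ a →
              ∃ λ r → r < s × (∀ i → (s ∣ a * i + b → i % s ≡ r) × (i % s ≡ r → s ∣ a * i + b))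
linear-root s ps a b s∤a = r , m%n<n r₀ s , λ i → to i , from i
  where
  open PrimeField s ps
  inv r₀ r : ℕ
  inv = a ^ (n ∸ 1)
  r₀ = neg b * inv
  r = r₀ % s
  a*inv : a * inv ≈ 1
  a*inv = trans (cong (λ z → a ^ z % s) (m+[n∸m]≡n 0<n)) (fermat a s∤a)
  a*r₀ : a * r₀ + b ≈ 0
  a*r₀ = begin
    (a * (neg b * inv) + b) % s ≡⟨ cong (_% s) (cong (_+ b) (ring a (neg b) inv)) ⟩
    (neg b * (a * inv) + b) % s ≡⟨ +-≈ {neg b * (a * inv)} {neg b * 1} {b} {b} (*-≈ {neg b} {neg b} {a * inv} {1} refl a*inv) refl ⟩
    (neg b * 1 + b) % s ≡⟨ cong (_% s) (trans (cong (_+ b) (*-identityʳ (neg b))) (+-comm (neg b) b)) ⟩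
    (b + neg b) % s ≡⟨ +-neg b ⟩
    0 % s ∎
    where
    open ≡-Reasoning
    ring : ∀ x y z → x * (y * z) ≡ y * (x * z)
    ring = solve-∀
  to : ∀ i → s ∣ a * i + b → i % s ≡ r
  to i d = *-cancelˡ-≈ a i r₀ s∤a (+-cancelʳ-≈ (a * i) (a * r₀) b (trans (∣⇒≈0 d) (sym a*r₀)))
  from : ∀ i → i % s ≡ r → s ∣ a * i + b
  from i e = ≈0⇒∣ (trans (+-≈ {a * i} {a * r₀} {b} {b} (*-≈ {a} {a} {i} {r₀} refl e) refl) a*r₀)

progression : ∀ s .{{_ : NonZero s}} r → r < s → ∀ M → ∃ λ M′ →
  (∀ (g : ℕ → ℕ) → Σ< M (λ i → 𝟙 (i % s ≟ r) * g i) ≡ Σ< M′ (λ t → g (r + t * s))) × M ≤ r + M′ * s × r + M′ * s < M + s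
progression s r r<s zero = 0 , (λ g → refl) , z≤n , subst (_< s) (sym (+-identityʳ r)) r<s
progression s r r<s (suc M) with progression s r r<s M
... | M′ , eq , lo , hi with M % s ≟ r
...   | no ≢r = M′ , (λ g → trans (+-identityʳ _) (eq g)) ,
          ≤∧≢⇒< lo (λ M≡ → ≢r (trans (cong (_% s) M≡) (trans ([m+kn]%n≡m%n r M′ s) (m<n⇒m%n≡m r<s)))) , m<n⇒m<1+n hi
...   | yes M%s≡r = suc M′ , (λ g → cong₂ _+_ (eq g) (trans (*-identityˡ (g M)) (cong g M≡))) ,
          subst (λ z → suc z ≤ r + suc M′ * s) (sym M≡) (≤-trans (s≤s ≤-refl) (+-monoʳ-< r (m<n+m (M′ * s) (>-nonZero⁻¹ s)))) ,
          ≤-trans (s≤s (≤-reflexive (trans (ring r (M′ * s) s) (cong (_+ s) (sym M≡))))) ≤-refl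
  where
  ring : ∀ r x s → r + (s + x) ≡ r + x + s
  ring = solve-∀
  M≡′ : M ≡ r + M / s * s
  M≡′ = trans (m≡m%n+[m/n]*n M s) (cong (_+ M / s * s) M%s≡r)
  q≤ : M / s ≤ M′
  q≤ = *-cancelʳ-≤ (M / s) M′ s (+-cancelˡ-≤ r _ _ (subst (_≤ r + M′ * s) M≡′ lo))
  q≥ : M′ ≤ M / s
  q≥ = s≤s⁻¹ (*-cancelʳ-< s M′ (suc (M / s)) (+-cancelˡ-< r _ _ (<-≤-trans hi (≤-reflexive (trans (cong (_+ s) M≡′) (sym (ring r (M / s * s) s)))))))
  M≡ : M ≡ r + M′ * s
  M≡ = trans M≡′ (cong (λ z → r + z * s) (≤-antisym q≤ q≥))

private
  -- The induction step as one linear certificate: 2 + σ is the new prime, F counts its survivors,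
  -- F₁ and F₂ the earlier survivors in its two residue classes. As in Bonferroni's inequalities, an
  -- upper bound for F needs lower bounds for the classes, and conversely in `brun-lower`.
  brun-upper : ∀ σ P V E E′ D D′ w F F₁ F₂ M M₁ M₂ →
    P * (F + (F₁ + F₂)) ≤ M * V + M * E + P * D →
    M₁ * V ≤ P * F₁ + M₁ * E′ + P * D′ → M₂ * V ≤ P * F₂ + M₂ * E′ + P * D′ →
    M ≤ (2 + σ) * M₁ + (2 + σ) → M ≤ (2 + σ) * M₂ + (2 + σ) →
    (2 + σ) * M₁ ≤ M + (2 + σ) → (2 + σ) * M₂ ≤ M + (2 + σ) → V ≤ P → E′ ≤ P * w →
    P * (2 + σ) * F ≤ M * (V * σ) + M * ((2 + σ) * E + 2 * E′) + P * (2 + σ) * (D + 2 * D′ + 2 + 2 * w)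
  brun-upper σ P V E E′ D D′ w F F₁ F₂ M M₁ M₂ U L₁ L₂ a₁ a₂ b₁ b₂ v x =
    linear (P * (2 + σ) * F) (M * (V * σ) + M * ((2 + σ) * E + 2 * E′) + P * (2 + σ) * (D + 2 * D′ + 2 + 2 * w)) 0
      (+-mono-≤ (*-monoʳ-≤ (2 + σ) (+-mono-≤ U (+-mono-≤ L₁ L₂)))
        (+-mono-≤ (*-monoʳ-≤ V (+-mono-≤ a₁ a₂)) (+-mono-≤ (*-monoʳ-≤ E′ (+-mono-≤ b₁ b₂)) (*-monoʳ-≤ (2 * (2 + σ)) (+-mono-≤ v x)))))
      (ring σ P V E E′ D D′ w F F₁ F₂ M M₁ M₂)
    where
    ring : ∀ σ P V E E′ D D′ w F F₁ F₂ M M₁ M₂ →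
      P * (2 + σ) * F + ((2 + σ) * (M * V + M * E + P * D + (P * F₁ + M₁ * E′ + P * D′ + (P * F₂ + M₂ * E′ + P * D′)))
        + (V * ((2 + σ) * M₁ + (2 + σ) + ((2 + σ) * M₂ + (2 + σ))) + (E′ * (M + (2 + σ) + (M + (2 + σ))) + 2 * (2 + σ) * (P + P * w)))) + 0
      ≡ M * (V * σ) + M * ((2 + σ) * E + 2 * E′) + P * (2 + σ) * (D + 2 * D′ + 2 + 2 * w)
        + ((2 + σ) * (P * (F + (F₁ + F₂)) + (M₁ * V + M₂ * V)) + (V * (M + M) + (E′ * ((2 + σ) * M₁ + (2 + σ) * M₂) + 2 * (2 + σ) * (V + E′))))
    ring = solve-∀

  brun-lower : ∀ σ P V E E′ D D′ w F F₁ F₂ M M₁ M₂ →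
    M * V ≤ P * (F + (F₁ + F₂)) + M * E + P * D →
    P * F₁ ≤ M₁ * V + M₁ * E′ + P * D′ → P * F₂ ≤ M₂ * V + M₂ * E′ + P * D′ →
    (2 + σ) * M₁ ≤ M + (2 + σ) → (2 + σ) * M₂ ≤ M + (2 + σ) → V ≤ P → E′ ≤ P * w →
    M * (V * σ) ≤ P * (2 + σ) * F + M * ((2 + σ) * E + 2 * E′) + P * (2 + σ) * (D + 2 * D′ + 2 + 2 * w)
  brun-lower σ P V E E′ D D′ w F F₁ F₂ M M₁ M₂ L U₁ U₂ b₁ b₂ v x =
    linear (M * (V * σ)) (P * (2 + σ) * F + M * ((2 + σ) * E + 2 * E′) + P * (2 + σ) * (D + 2 * D′ + 2 + 2 * w)) 0
      (+-mono-≤ (*-monoʳ-≤ (2 + σ) (+-mono-≤ L (+-mono-≤ U₁ U₂)))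
        (+-mono-≤ (*-monoʳ-≤ (V + E′) (+-mono-≤ b₁ b₂)) (*-monoʳ-≤ (2 * (2 + σ)) (+-mono-≤ v x))))
      (ring σ P V E E′ D D′ w F F₁ F₂ M M₁ M₂)
    where
    ring : ∀ σ P V E E′ D D′ w F F₁ F₂ M M₁ M₂ →
      M * (V * σ) + ((2 + σ) * (P * (F + (F₁ + F₂)) + M * E + P * D + (M₁ * V + M₁ * E′ + P * D′ + (M₂ * V + M₂ * E′ + P * D′)))
        + ((V + E′) * (M + (2 + σ) + (M + (2 + σ))) + 2 * (2 + σ) * (P + P * w))) + 0
      ≡ P * (2 + σ) * F + M * ((2 + σ) * E + 2 * E′) + P * (2 + σ) * (D + 2 * D′ + 2 + 2 * w)
        + ((2 + σ) * (M * V + (P * F₁ + P * F₂)) + ((V + E′) * ((2 + σ) * M₁ + (2 + σ) * M₂) + 2 * (2 + σ) * (V + E′)))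
    ring = solve-∀

-- Brun's pure sieve for the linear forms n and en + 1
module Brun (e : ℕ) {S : ℕ → Set} (S? : Decidable S) (S-prime : ∀ s → S s → Prime s) (S∤e : ∀ s → S s → s ∤ e) where

  Hit : ℕ → ℕ → Set
  Hit s n = s ∣ n ⊎ s ∣ e * n + 1

  Hit? : ∀ s → Decidable (Hit s)
  Hit? s n = (s ∣? n) ⊎-dec (s ∣? e * n + 1)

  Survives : ℕ → ℕ → Set
  Survives Y n = ∀ {s} → s < Y → S s → ¬ Hit s n

  Survives? : ∀ Y → Decidable (Survives Y)
  Survives? Y n = allUpTo? (λ s → S? s →-dec ¬? (Hit? s n)) Y

  Φ : ℕ → ℕ → ℕ → ℕ → ℕ
  Φ Y c d M = # M (λ i → Survives? Y (c + d * i))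

  ΠS : (ℕ → ℕ) → ℕ → ℕ
  ΠS g Y = Π< Y (λ s → g s ^ 𝟙 (S? s))

  symmetric′ : ∀ {P : Set} → Dec P → ℕ → ℕ → ℕ → ℕ
  symmetric′ (yes _) Y a b = Y * a + 2 * b
  symmetric′ (no _)  Y a b = a

  -- the r-th elementary symmetric function of the 2/s, multiplied by the product of the s
  symmetric : ℕ → ℕ → ℕ
  symmetric zero    Y       = ΠS id Y
  symmetric (suc r) zero    = 0
  symmetric (suc r) (suc Y) = symmetric′ (S? Y) Y (symmetric (suc r) Y) (symmetric r Y)

  private
    ΠS-yes : ∀ g {Y} → S Y → ΠS g (suc Y) ≡ ΠS g Y * g Y
    ΠS-yes g {Y} SY = cong (ΠS g Y *_) (trans (cong (g Y ^_) (𝟙-yes SY (S? Y))) (*-identityʳ (g Y)))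

    ΠS-no : ∀ g {Y} → ¬ S Y → ΠS g (suc Y) ≡ ΠS g Y
    ΠS-no g {Y} ¬SY = trans (cong (λ z → ΠS g Y * g Y ^ z) (𝟙-no ¬SY (S? Y))) (*-identityʳ _)

    symmetric-yes : ∀ r {Y} → S Y → symmetric (suc r) (suc Y) ≡ Y * symmetric (suc r) Y + 2 * symmetric r Y
    symmetric-yes r {Y} SY with S? Y
    ... | yes _  = refl
    ... | no ¬SY = contradiction SY ¬SY

    symmetric-no : ∀ r {Y} → ¬ S Y → symmetric r (suc Y) ≡ symmetric r Y
    symmetric-no zero    {Y} ¬SY = ΠS-no id ¬SY
    symmetric-no (suc r) {Y} ¬SY with S? Y
    ... | yes SY = contradiction SY ¬SY
    ... | no _   = refl

    ΠS-mono : ∀ f g → (∀ s → f s ≤ g s) → ∀ Y → ΠS f Y ≤ ΠS g Y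
    ΠS-mono f g h Y = Π-mono Y (λ s _ → ^-monoˡ-≤ (𝟙 (S? s)) (h s))

  -- A crude bound that only enters the rounding errors, caused by classes whose sizes differ from
  -- M/s.
  symmetric-bound : ∀ r Y → symmetric r Y ≤ ΠS id Y * Y ^ r
  symmetric-bound zero    Y       = ≤-reflexive (sym (*-identityʳ _))
  symmetric-bound (suc r) zero    = z≤n
  symmetric-bound (suc r) (suc Y) with S? Y
  ... | no _   = ≤-trans (symmetric-bound (suc r) Y) (*-mono-≤ (≤-reflexive (sym (*-identityʳ (ΠS id Y)))) (^-monoˡ-≤ (suc r) (n≤1+n Y)))
  ... | yes SY = begin
      Y * symmetric (suc r) Y + 2 * symmetric r Y ≤⟨ +-mono-≤ (*-monoʳ-≤ Y (symmetric-bound (suc r) Y)) (*-mono-≤ (prime>1 (S-prime Y SY)) (symmetric-bound r Y)) ⟩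
      Y * (ΠS id Y * (Y * Y ^ r)) + Y * (ΠS id Y * Y ^ r) ≡⟨ ring Y (ΠS id Y) (Y ^ r) ⟩
      ΠS id Y * (Y * 1) * (suc Y * Y ^ r) ≤⟨ *-monoʳ-≤ (ΠS id Y * (Y * 1)) (*-monoʳ-≤ (suc Y) (^-monoˡ-≤ r (n≤1+n Y))) ⟩
      ΠS id Y * (Y * 1) * (suc Y * suc Y ^ r) ∎
    where
    open ≤-Reasoning
    ring : ∀ Y P x → Y * (P * (Y * x)) + Y * (P * x) ≡ P * (Y * 1) * (suc Y * x)
    ring = solve-∀

  -- The product Π (1 + 4 · 2/s) is the generating function of the symmetric functions at 4, so it
  -- dominates each single term.
  symmetric-decay : ∀ r Y → 4 ^ r * symmetric r Y ≤ ΠS (_+ 8) Y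
  symmetric-decay zero    Y       = ≤-trans (≤-reflexive (+-identityʳ _)) (ΠS-mono id (_+ 8) (λ s → m≤m+n s 8) Y)
  symmetric-decay (suc r) zero    = ≤-trans (≤-reflexive (*-zeroʳ (4 ^ suc r))) z≤n
  symmetric-decay (suc r) (suc Y) with S? Y
  ... | no _   = ≤-trans (symmetric-decay (suc r) Y) (≤-reflexive (sym (*-identityʳ _)))
  ... | yes SY = begin
      4 * 4 ^ r * (Y * symmetric (suc r) Y + 2 * symmetric r Y) ≡⟨ ring (4 ^ r) Y (symmetric (suc r) Y) (symmetric r Y) ⟩
      Y * (4 ^ suc r * symmetric (suc r) Y) + 8 * (4 ^ r * symmetric r Y) ≤⟨ +-mono-≤ (*-monoʳ-≤ Y (symmetric-decay (suc r) Y)) (*-monoʳ-≤ 8 (symmetric-decay r Y)) ⟩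
      Y * A + 8 * A ≡⟨ trans (sym (*-distribʳ-+ A Y 8)) (trans (*-comm (Y + 8) A) (cong (A *_) (sym (*-identityʳ (Y + 8))))) ⟩
      A * ((Y + 8) * 1) ∎
    where
    open ≤-Reasoning
    A : ℕ
    A = ΠS (_+ 8) Y
    ring : ∀ x Y a b → 4 * x * (Y * a + 2 * b) ≡ Y * (4 * x * a) + 8 * (x * b)
    ring = solve-∀

  private
    -- Write x for the term one level lower. A new prime adds 2x for its two classes and at most 2x
    -- for each of two rounding terms, which is the growth of 6(Y + 1)x when Y increases by one.
    errorTerm : ℕ → ℕ → ℕ
    errorTerm r Y = (6 * suc Y) ^ r

    errorTerm-step : ∀ r Y → errorTerm (suc r) Y + 2 * errorTerm r Y + 2 + 2 * Y ^ r ≤ errorTerm (suc r) (suc Y)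
    errorTerm-step r Y = begin
      6 * suc Y * x + 2 * x + 2 + 2 * Y ^ r ≤⟨ +-mono-≤ (+-monoʳ-≤ (6 * suc Y * x + 2 * x) (*-monoʳ-≤ 2 (m^n>0 (6 * suc Y) r))) (*-monoʳ-≤ 2 (^-monoˡ-≤ r (≤-trans (n≤1+n Y) (m≤n*m (suc Y) 6)))) ⟩
      6 * suc Y * x + 2 * x + 2 * x + 2 * x ≡⟨ ring Y x ⟩
      6 * suc (suc Y) * x ≤⟨ *-monoʳ-≤ (6 * suc (suc Y)) (^-monoˡ-≤ r (*-monoʳ-≤ 6 (n≤1+n (suc Y)))) ⟩
      6 * suc (suc Y) * (6 * suc (suc Y)) ^ r ∎
      where
      open ≤-Reasoning
      x : ℕ
      x = (6 * suc Y) ^ r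
      ring : ∀ Y x → 6 * suc Y * x + 2 * x + 2 * x + 2 * x ≡ 6 * suc (suc Y) * x
      ring = solve-∀

    survives-no : ∀ {Y} → ¬ S Y → ∀ n → 𝟙 (Survives? (suc Y) n) ≡ 𝟙 (Survives? Y n)
    survives-no {Y} ¬SY n = ≤-antisym (𝟙-mono {P = Survives (suc Y) n} {Q = Survives Y n} (λ sv {s} s<Y → sv {s} (m<n⇒m<1+n s<Y)) _ _)
      (𝟙-mono {P = Survives Y n} {Q = Survives (suc Y) n} (λ sv {s} s<1+Y Ss → case m≤n⇒m<n∨m≡n (s≤s⁻¹ s<1+Y) of λ where
        (inj₁ s<Y)  → sv s<Y Ss
        (inj₂ refl) → contradiction Ss ¬SY) _ _)

    -- Two-sided, because either bound calls the opposite one for the residue classes. The number r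
    -- of remaining inclusion-exclusion levels drops by one in this call, and the progression c + di
    -- becomes sparser.
    Estimate : ℕ → ℕ → ℕ → ℕ → ℕ → Set
    Estimate Y r c d M =
      (ΠS id Y * Φ Y c d M ≤ M * ΠS (_∸ 2) Y + M * symmetric r Y + ΠS id Y * errorTerm r Y) ×
      (M * ΠS (_∸ 2) Y ≤ ΠS id Y * Φ Y c d M + M * symmetric r Y + ΠS id Y * errorTerm r Y)

  -- Splitting off the largest prime s = Y: the survivors killed by s lie in two residue classes.
  module _ {Y : ℕ} (SY : S Y) (c d : ℕ) (Y∤d : Y ∤ d) where
    private
      pY : Prime Y
      pY = S-prime Y SY
      instance
        Y≢0 : NonZero Y
        Y≢0 = prime⇒nonZero pY
      root₁ = linear-root Y pY d c Y∤d
      root₂ = linear-root Y pY (e * d) (e * c + 1) (prime∤* e d pY (S∤e Y SY) Y∤d)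
      r₁ r₂ : ℕ
      r₁ = proj₁ root₁
      r₂ = proj₁ root₂
      n : ℕ → ℕ
      n i = c + d * i
      form₁ : ∀ i → d * i + c ≡ n i
      form₁ i = +-comm (d * i) c
      form₂ : ∀ i → e * d * i + (e * c + 1) ≡ e * n i + 1
      form₂ i = ring e d i c
        where
        ring : ∀ e d i c → e * d * i + (e * c + 1) ≡ e * (c + d * i) + 1
        ring = solve-∀
      exclusive : ∀ i → i % Y ≡ r₁ → i % Y ≡ r₂ → ⊥
      exclusive i p p′ = ∤-small z<s (prime>1 pY) (∣m+n∣m⇒∣n (subst (Y ∣_) (form₂ i) (proj₂ (proj₂ (proj₂ root₂) i) p′))
        (∣n⇒∣m*n e (subst (Y ∣_) (form₁ i) (proj₂ (proj₂ (proj₂ root₁) i) p))))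
      hit : ∀ i → Hit Y (n i) → i % Y ≡ r₁ ⊎ i % Y ≡ r₂
      hit i (inj₁ d₁) = inj₁ (proj₁ (proj₂ (proj₂ root₁) i) (subst (Y ∣_) (sym (form₁ i)) d₁))
      hit i (inj₂ d₂) = inj₂ (proj₁ (proj₂ (proj₂ root₂) i) (subst (Y ∣_) (sym (form₂ i)) d₂))
      killed₁ : ∀ i → i % Y ≡ r₁ → ¬ Survives (suc Y) (n i)
      killed₁ i p sv = sv ≤-refl SY (inj₁ (subst (Y ∣_) (form₁ i) (proj₂ (proj₂ (proj₂ root₁) i) p)))
      killed₂ : ∀ i → i % Y ≡ r₂ → ¬ Survives (suc Y) (n i)
      killed₂ i p sv = sv ≤-refl SY (inj₂ (subst (Y ∣_) (form₂ i) (proj₂ (proj₂ (proj₂ root₂) i) p)))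
      point : ∀ i → 𝟙 (Survives? Y (n i)) ≡ 𝟙 (Survives? (suc Y) (n i)) + (𝟙 (i % Y ≟ r₁) * 𝟙 (Survives? Y (n i)) + 𝟙 (i % Y ≟ r₂) * 𝟙 (Survives? Y (n i)))
      point i with i % Y ≟ r₁ | i % Y ≟ r₂
      ... | yes p | yes p′ = ⊥-elim (exclusive i p p′)
      ... | yes p | no _ = sym (trans (cong (_+ (𝟙 (Survives? Y (n i)) + 0 + 0)) (𝟙-no (killed₁ i p) (Survives? (suc Y) (n i)))) (trans (+-identityʳ _) (+-identityʳ _)))
      ... | no _ | yes p = sym (trans (cong (_+ (𝟙 (Survives? Y (n i)) + 0)) (𝟙-no (killed₂ i p) (Survives? (suc Y) (n i)))) (+-identityʳ _))
      ... | no ¬p | no ¬p′ = trans (≤-antisym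
            (𝟙-mono {P = Survives Y (n i)} {Q = Survives (suc Y) (n i)} (λ sv {s} s<1+Y Ss h → case m≤n⇒m<n∨m≡n (s≤s⁻¹ s<1+Y) of λ where
              (inj₁ s<Y)  → sv s<Y Ss h
              (inj₂ refl) → [ ¬p , ¬p′ ]′ (hit i h)) _ _)
            (𝟙-mono {P = Survives (suc Y) (n i)} {Q = Survives Y (n i)} (λ sv {s} s<Y → sv {s} (m<n⇒m<1+n s<Y)) _ _)) (sym (+-identityʳ _))
    split-prime : ∀ M → ∃ λ c₁ → ∃ λ c₂ → ∃ λ M₁ → ∃ λ M₂ →
      Φ Y c d M ≡ Φ (suc Y) c d M + (Φ Y c₁ (d * Y) M₁ + Φ Y c₂ (d * Y) M₂) ×
      (M ≤ Y * M₁ + Y × Y * M₁ ≤ M + Y) × (M ≤ Y * M₂ + Y × Y * M₂ ≤ M + Y)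
    split-prime M with progression Y r₁ (proj₁ (proj₂ root₁)) M | progression Y r₂ (proj₁ (proj₂ root₂)) M
    ... | M₁ , eq₁ , lo₁ , hi₁ | M₂ , eq₂ , lo₂ , hi₂ = n r₁ , n r₂ , M₁ , M₂ ,
        trans (Σ-cong M (λ i _ → point i)) (trans (Σ-+ M _ _) (cong (Φ (suc Y) c d M +_) (trans (Σ-+ M _ _) (cong₂ _+_ (side r₁ M₁ eq₁) (side r₂ M₂ eq₂))))) ,
        bounds r₁ M₁ (proj₁ (proj₂ root₁)) lo₁ hi₁ , bounds r₂ M₂ (proj₁ (proj₂ root₂)) lo₂ hi₂
      where
      side : ∀ r M′ → (∀ (g : ℕ → ℕ) → Σ< M (λ i → 𝟙 (i % Y ≟ r) * g i) ≡ Σ< M′ (λ t → g (r + t * Y))) →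
             Σ< M (λ i → 𝟙 (i % Y ≟ r) * 𝟙 (Survives? Y (n i))) ≡ Φ Y (n r) (d * Y) M′
      side r M′ eq = trans (eq (λ i → 𝟙 (Survives? Y (n i)))) (Σ-cong M′ (λ t _ → cong (λ z → 𝟙 (Survives? Y z)) (ring c d r t Y)))
        where
        ring : ∀ c d r t Y → c + d * (r + t * Y) ≡ c + d * r + d * Y * t
        ring = solve-∀
      bounds : ∀ r M′ → r < Y → M ≤ r + M′ * Y → r + M′ * Y < M + Y → M ≤ Y * M′ + Y × Y * M′ ≤ M + Y
      bounds r M′ r<Y lo hi = ≤-trans lo (≤-trans (+-monoˡ-≤ (M′ * Y) (<⇒≤ r<Y)) (≤-reflexive (trans (+-comm Y (M′ * Y)) (cong (_+ Y) (*-comm M′ Y))))) ,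
        ≤-trans (≤-reflexive (*-comm Y M′)) (≤-trans (m≤n+m (M′ * Y) r) (<⇒≤ hi))

  estimate : ∀ Y r c d M → (∀ s → s < Y → S s → s ∤ d) → Estimate Y r c d M
  estimate zero r c d M _ = ≤-trans (≤-reflexive Φ≡) (≤-trans (m≤m+n _ _) (m≤m+n _ _)) , ≤-trans (≤-reflexive (sym Φ≡)) (≤-trans (m≤m+n _ _) (m≤m+n _ _))
    where
    Φ≡ : 1 * Φ 0 c d M ≡ M * 1
    Φ≡ = trans (*-identityˡ _) (trans (#-all {P? = λ i → Survives? 0 (c + d * i)} M (λ i _ {s} ())) (sym (*-identityʳ M)))
  estimate (suc Y) r c d M co = go (S? Y) r
    where
    go : Dec (S Y) → ∀ r → Estimate (suc Y) r c d M
    go (no ¬SY) r with estimate Y r c d M (λ s s<Y → co s (m<n⇒m<1+n s<Y))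
    ... | U , L rewrite ΠS-no id ¬SY | ΠS-no (_∸ 2) ¬SY | symmetric-no r ¬SY | Σ-cong M (λ i _ → survives-no ¬SY (c + d * i)) =
          ≤-trans U (+-monoʳ-≤ _ (*-monoʳ-≤ (ΠS id Y) D≤)) , ≤-trans L (+-monoʳ-≤ _ (*-monoʳ-≤ (ΠS id Y) D≤))
      where
      D≤ : errorTerm r Y ≤ errorTerm r (suc Y)
      D≤ = ^-monoˡ-≤ r (*-monoʳ-≤ 6 (n≤1+n (suc Y)))
    -- With no level left, the term M · Π s coming from `symmetric` already covers the trivial
    -- bounds on both sides.
    go (yes SY) zero = ≤-trans (≤-trans (*-monoʳ-≤ (ΠS id (suc Y)) (#≤ {P? = λ i → Survives? (suc Y) (c + d * i)} M)) (≤-reflexive (*-comm (ΠS id (suc Y)) M)))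
                   (≤-trans (m≤n+m _ (M * ΠS (_∸ 2) (suc Y))) (m≤m+n _ _)) ,
                 ≤-trans (*-monoʳ-≤ M (ΠS-mono (_∸ 2) id (λ s → m∸n≤m s 2) (suc Y))) (≤-trans (m≤n+m _ (ΠS id (suc Y) * Φ (suc Y) c d M)) (m≤m+n _ _))
    go (yes SY) (suc r′) = finish (split-prime SY c d (co Y ≤-refl SY) M)
      where
      co′ : ∀ s → s < Y → S s → s ∤ d * Y
      co′ s s<Y Ss = prime∤* d Y (S-prime s Ss) (co s (m<n⇒m<1+n s<Y) Ss) (λ s∣Y → <⇒≢ s<Y (prime∣prime (S-prime s Ss) (S-prime Y SY) s∣Y))
      σ : ℕ
      σ = Y ∸ 2
      Y≡ : 2 + σ ≡ Y
      Y≡ = m+[n∸m]≡n (prime>1 (S-prime Y SY))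
      P V E E′ D D′ : ℕ
      P = ΠS id Y
      V = ΠS (_∸ 2) Y
      E = symmetric (suc r′) Y
      E′ = symmetric r′ Y
      D = errorTerm (suc r′) Y
      D′ = errorTerm r′ Y
      finish : (∃ λ c₁ → ∃ λ c₂ → ∃ λ M₁ → ∃ λ M₂ →
        Φ Y c d M ≡ Φ (suc Y) c d M + (Φ Y c₁ (d * Y) M₁ + Φ Y c₂ (d * Y) M₂) ×
        (M ≤ Y * M₁ + Y × Y * M₁ ≤ M + Y) × (M ≤ Y * M₂ + Y × Y * M₂ ≤ M + Y)) → Estimate (suc Y) (suc r′) c d M
      finish (c₁ , c₂ , M₁ , M₂ , split , (a₁ , b₁) , (a₂ , b₂)) =
          ≤-trans (≤-reflexive (cong (_* Φ (suc Y) c d M) (ΠS-yes id SY)))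
            (≤-trans (resub (λ s → P * s * Φ (suc Y) c d M ≤ M * (V * σ) + M * (s * E + 2 * E′) + P * s * (D + 2 * D′ + 2 + 2 * Y ^ r′))
               (brun-upper σ P V E E′ D D′ (Y ^ r′) (Φ (suc Y) c d M) (Φ Y c₁ (d * Y) M₁) (Φ Y c₂ (d * Y) M₂) M M₁ M₂
                 (subst (λ z → P * z ≤ M * V + M * E + P * D) split (proj₁ main)) (proj₂ sub₁) (proj₂ sub₂)
                 (unsub (λ s → M ≤ s * M₁ + s) a₁) (unsub (λ s → M ≤ s * M₂ + s) a₂) (unsub (λ s → s * M₁ ≤ M + s) b₁) (unsub (λ s → s * M₂ ≤ M + s) b₂)
                 V≤P (symmetric-bound r′ Y)))
             tidy₁) ,
          ≤-trans (≤-reflexive (cong (M *_) (ΠS-yes (_∸ 2) SY)))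
            (≤-trans (resub (λ s → M * (V * σ) ≤ P * s * Φ (suc Y) c d M + M * (s * E + 2 * E′) + P * s * (D + 2 * D′ + 2 + 2 * Y ^ r′))
               (brun-lower σ P V E E′ D D′ (Y ^ r′) (Φ (suc Y) c d M) (Φ Y c₁ (d * Y) M₁) (Φ Y c₂ (d * Y) M₂) M M₁ M₂
                 (subst (λ z → M * V ≤ P * z + M * E + P * D) split (proj₂ main)) (proj₁ sub₁) (proj₁ sub₂)
                 (unsub (λ s → s * M₁ ≤ M + s) b₁) (unsub (λ s → s * M₂ ≤ M + s) b₂) V≤P (symmetric-bound r′ Y)))
             tidy₂)
        where
        main = estimate Y (suc r′) c d M (λ s s<Y → co s (m<n⇒m<1+n s<Y))
        sub₁ = estimate Y r′ c₁ (d * Y) M₁ co′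
        sub₂ = estimate Y r′ c₂ (d * Y) M₂ co′
        V≤P : V ≤ P
        V≤P = ΠS-mono (_∸ 2) id (λ s → m∸n≤m s 2) Y
        resub : (T : ℕ → Set) → T (2 + σ) → T Y
        resub T = subst T Y≡
        unsub : (T : ℕ → Set) → T Y → T (2 + σ)
        unsub T = subst T (sym Y≡)
        tidy₁ : M * (V * σ) + M * (Y * E + 2 * E′) + P * Y * (D + 2 * D′ + 2 + 2 * Y ^ r′) ≤
                M * ΠS (_∸ 2) (suc Y) + M * symmetric (suc r′) (suc Y) + ΠS id (suc Y) * errorTerm (suc r′) (suc Y)
        tidy₁ = +-mono-≤ (+-mono-≤ (≤-reflexive (cong (M *_) (sym (ΠS-yes (_∸ 2) SY)))) (≤-reflexive (cong (M *_) (sym (symmetric-yes r′ SY)))))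
                         (*-mono-≤ (≤-reflexive (sym (ΠS-yes id SY))) (errorTerm-step r′ Y))
        tidy₂ : P * Y * Φ (suc Y) c d M + M * (Y * E + 2 * E′) + P * Y * (D + 2 * D′ + 2 + 2 * Y ^ r′) ≤
                ΠS id (suc Y) * Φ (suc Y) c d M + M * symmetric (suc r′) (suc Y) + ΠS id (suc Y) * errorTerm (suc r′) (suc Y)
        tidy₂ = +-mono-≤ (+-mono-≤ (≤-reflexive (cong (_* Φ (suc Y) c d M) (sym (ΠS-yes id SY)))) (≤-reflexive (cong (M *_) (sym (symmetric-yes r′ SY)))))
                         (*-mono-≤ (≤-reflexive (sym (ΠS-yes id SY))) (errorTerm-step r′ Y))

  sieve-upper : ∀ Y r M → ΠS id Y * # M (Survives? Y) ≤ M * ΠS (_∸ 2) Y + M * symmetric r Y + ΠS id Y * (6 * suc Y) ^ r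
  sieve-upper Y r M = subst (λ z → ΠS id Y * z ≤ M * ΠS (_∸ 2) Y + M * symmetric r Y + ΠS id Y * (6 * suc Y) ^ r)
    (Σ-cong M (λ i _ → cong (λ z → 𝟙 (Survives? Y z)) (*-identityˡ i)))
    (proj₁ (estimate Y r 0 1 M (λ s _ Ss s∣1 → <⇒≢ (prime>1 (S-prime s Ss)) (sym (∣1⇒≡1 s∣1)))))

-- Counting integers with exceptional factorisations

#-pred : ∀ N {P R : ℕ → Set} {P? : Decidable P} (R? : Decidable R) → (∀ q → q < N → P q → 1 ≤ q × R (q ∸ 1)) → # N P? ≤ # N R?
#-pred N {P? = P?} R? h = #-inject N N {P? = P?} {Q? = R?} (_∸ 1) (λ q q<N Pq → ≤-<-trans (m∸n≤m q 1) q<N , proj₂ (h q q<N Pq))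
  (λ i j i<N j<N Pi Pj e → trans (sym (m∸n+n≡m (proj₁ (h i i<N Pi)))) (trans (cong (_+ 1) e) (m∸n+n≡m (proj₁ (h j j<N Pj)))))

SquareDivisor? : ∀ k b → Decidable (λ m → 0 < m × ∃ λ d → d < 2 ^ k × 2 ^ b ≤ d × d * d ∣ m)
SquareDivisor? k b m = (0 <? m) ×-dec anyUpTo? (λ d → (2 ^ b ≤? d) ×-dec (d * d ∣? m)) (2 ^ k)

square-count : ∀ k b → 2 ^ b * # (2 ^ k) (SquareDivisor? k b) ≤ k * 2 ^ k
square-count k b = begin
  2 ^ b * # N (SquareDivisor? k b) ≤⟨ *-monoʳ-≤ (2 ^ b) (#-cover N N (SquareDivisor? k b) Hit? (λ m _ → λ { (0<m , d , d<N , 2ᵇ≤d , d²∣m) → d , d<N , 2ᵇ≤d , 0<m , d²∣m })) ⟩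
  2 ^ b * Σ< N (λ d → # N (Hit? d)) ≡⟨ sym (Σ-*ˡ (2 ^ b) N _) ⟩
  Σ< N (λ d → 2 ^ b * # N (Hit? d)) ≤⟨ Σ-harmonic k N (λ d → 2 ^ b * # N (Hit? d)) zero′ block ⟩
  k * N ∎
  where
  open ≤-Reasoning
  N : ℕ
  N = 2 ^ k
  Hit? : ∀ d → Decidable (λ m → 2 ^ b ≤ d × 0 < m × d * d ∣ m)
  Hit? d m = (2 ^ b ≤? d) ×-dec ((0 <? m) ×-dec (d * d ∣? m))
  zero′ : 2 ^ b * # N (Hit? 0) ≡ 0
  zero′ = trans (cong (2 ^ b *_) (#-none {P? = Hit? 0} N (λ m _ h → <⇒≱ (m^n>0 2 b) (proj₁ h)))) (*-zeroʳ (2 ^ b))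
  block : ∀ i d → i < k → 2 ^ i ≤ d → d < 2 ^ suc i → 2 ^ i * (2 ^ b * # N (Hit? d)) ≤ N
  block i d _ 2ⁱ≤d _ = go (2 ^ b ≤? d)
    where
    instance
      d≢0 : NonZero d
      d≢0 = >-nonZero (≤-trans (m^n>0 2 i) 2ⁱ≤d)
      dd≢0 : NonZero (d * d)
      dd≢0 = m*n≢0 d d
    go : Dec (2 ^ b ≤ d) → 2 ^ i * (2 ^ b * # N (Hit? d)) ≤ N
    go (no ≰) = ≤-trans (≤-reflexive (trans (cong (λ z → 2 ^ i * (2 ^ b * z)) (#-none {P? = Hit? d} N (λ m _ h → ≰ (proj₁ h)))) (trans (cong (2 ^ i *_) (*-zeroʳ (2 ^ b))) (*-zeroʳ (2 ^ i))))) z≤n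
    go (yes 2ᵇ≤d) = begin
      2 ^ i * (2 ^ b * # N (Hit? d))
        ≤⟨ *-mono-≤ 2ⁱ≤d (*-mono-≤ 2ᵇ≤d (≤-trans (#-mono {P? = Hit? d} N {Q? = λ m → (0 <? m) ×-dec (d * d ∣? m)} (λ m _ → proj₂)) (#-multiples N (d * d)))) ⟩
      d * (d * (N / (d * d))) ≡⟨ trans (sym (*-assoc d d _)) (*-comm (d * d) _) ⟩
      N / (d * d) * (d * d) ≤⟨ m/n*n≤m N (d * d) ⟩
      N ∎

ManyPrimes? : ∀ k u → Decidable (λ m → 0 < m × u ≤ ω (2 ^ k) m)
ManyPrimes? k u m = (0 <? m) ×-dec (u ≤? ω (2 ^ k) m)

-- An integer with u prime factors has at least 2^u divisors, and the average number of divisors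
-- below 2^k is at most k.
many-primes-count : ∀ k u → 2 ^ u * # (2 ^ k) (ManyPrimes? k u) ≤ k * 2 ^ k
many-primes-count k u = ≤-trans (≤-reflexive (sym (Σ-*ˡ (2 ^ u) (2 ^ k) _))) (≤-trans (Σ-mono (2 ^ k) point) (Σ-divisorCount k))
  where
  point : ∀ m → m < 2 ^ k → 2 ^ u * 𝟙 (ManyPrimes? k u m) ≤ 𝟙 (0 <? m) * divisorCount m
  point m _ with 0 <? m | u ≤? ω (2 ^ k) m
  ... | yes 0<m | yes u≤ω = ≤-trans (≤-reflexive (*-identityʳ (2 ^ u))) (≤-trans (^-monoʳ-≤ 2 u≤ω) (≤-trans (2^ω≤divisorCount (2 ^ k) m 0<m) (≤-reflexive (sym (+-identityʳ _)))))
  ... | yes _ | no _ = ≤-trans (≤-reflexive (*-zeroʳ (2 ^ u))) z≤n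
  ... | no _  | _    = ≤-trans (≤-reflexive (*-zeroʳ (2 ^ u))) z≤n

Σ-dyadic-from : ∀ a w (f : ℕ → ℕ) → Σ< (2 ^ (w + a)) f ≡ Σ< (2 ^ a) f + Σ< w (λ i → Σ< (2 ^ (i + a)) (λ d → f (2 ^ (i + a) + d)))
Σ-dyadic-from a zero    f = sym (+-identityʳ _)
Σ-dyadic-from a (suc w) f = trans (cong (λ z → Σ< z f) (2^-suc (w + a))) (trans (Σ-split (2 ^ (w + a)) (2 ^ (w + a)) f)
  (trans (cong (_+ Σ< (2 ^ (w + a)) (λ d → f (2 ^ (w + a) + d))) (Σ-dyadic-from a w f)) (+-assoc (Σ< (2 ^ a) f) _ _)))

-- Chebyshev's bound gives Σ 1/l ≪ w/a over the primes l in [2^a, 2^(a+w)).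
Σ-prime-blocks : ∀ a w c (f : ℕ → ℕ) → 2 ≤ a → (∀ i l → 2 ^ i ≤ l → l < 2 ^ suc i → 2 ^ i * f l ≤ c) →
                 a * Σ< (2 ^ (w + a)) (λ l → 𝟙 (PrimeFrom? a l) * f l) ≤ w * (2 * c)
Σ-prime-blocks a w c f 2≤a h = begin
  a * Σ< (2 ^ (w + a)) F ≡⟨ cong (a *_) (trans (Σ-dyadic-from a w F) (cong (_+ Σ< w block) (Σ-zero (2 ^ a) F below))) ⟩
  a * Σ< w block ≡⟨ sym (Σ-*ˡ a w block) ⟩
  Σ< w (λ i → a * block i) ≤⟨ Σ-bound w _ (2 * c) (λ i _ → each i) ⟩
  w * (2 * c) ∎
  where
  open ≤-Reasoning
  F : ℕ → ℕ
  F l = 𝟙 (PrimeFrom? a l) * f l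
  block : ℕ → ℕ
  block i = Σ< (2 ^ (i + a)) (λ d → F (2 ^ (i + a) + d))
  below : ∀ l → l < 2 ^ a → F l ≡ 0
  below l l<2ᵃ = cong (_* f l) (𝟙-no (λ p → <⇒≱ l<2ᵃ (proj₂ p)) (PrimeFrom? a l))
  each : ∀ i → a * block i ≤ 2 * c
  each i = *-cancelˡ-≤ N {{m^n≢0 2 (i + a)}} (begin
    N * (a * block i) ≡⟨ ring₁ N a (block i) ⟩
    a * (N * block i) ≡⟨ cong (a *_) (sym (Σ-*ˡ N N _)) ⟩
    a * Σ< N (λ d → N * F (N + d)) ≤⟨ *-mono-≤ (m≤n+m a i) (Σ-mono N (λ d d<N → point d d<N)) ⟩
    (i + a) * Σ< N (λ d → 𝟙 (prime? (N + d)) * c) ≡⟨ cong ((i + a) *_) (Σ-*ʳ c N _) ⟩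
    (i + a) * (primesInBlock (i + a) * c) ≡⟨ sym (*-assoc (i + a) _ c) ⟩
    (i + a) * primesInBlock (i + a) * c ≤⟨ *-monoˡ-≤ c (chebyshev (i + a) (≤-trans 2≤a (m≤n+m a i))) ⟩
    2 * N * c ≡⟨ ring₂ N c ⟩
    N * (2 * c) ∎)
    where
    N : ℕ
    N = 2 ^ (i + a)
    ring₁ : ∀ x y z → x * (y * z) ≡ y * (x * z)
    ring₁ = solve-∀
    ring₂ : ∀ x y → 2 * x * y ≡ x * (2 * y)
    ring₂ = solve-∀
    point : ∀ d → d < N → N * F (N + d) ≤ 𝟙 (prime? (N + d)) * c
    point d d<N = begin
      N * (𝟙 (PrimeFrom? a (N + d)) * f (N + d)) ≤⟨ *-monoʳ-≤ N (*-monoˡ-≤ (f (N + d)) (𝟙-mono proj₁ (PrimeFrom? a (N + d)) (prime? (N + d)))) ⟩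
      N * (𝟙 (prime? (N + d)) * f (N + d)) ≡⟨ ring₁ N (𝟙 (prime? (N + d))) (f (N + d)) ⟩
      𝟙 (prime? (N + d)) * (N * f (N + d)) ≤⟨ *-monoʳ-≤ (𝟙 (prime? (N + d))) (h (i + a) (N + d) (m≤m+n N d) (<-≤-trans (+-monoʳ-< N d<N) (≤-reflexive (sym (2^-suc (i + a)))))) ⟩
      𝟙 (prime? (N + d)) * c ∎

TwoLarge? : ∀ a N → Decidable (λ m → 0 < m × ∃ λ l → l < N × ∃ λ l′ → l′ < N × (Prime l × 2 ^ a ≤ l) × (Prime l′ × 2 ^ a ≤ l′) × l * l′ ∣ m)
TwoLarge? a N m = (0 <? m) ×-dec anyUpTo? (λ l → anyUpTo? (λ l′ → PrimeFrom? a l ×-dec (PrimeFrom? a l′ ×-dec (l * l′ ∣? m))) N) N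

-- The reciprocals of the primes in [2^a, 2^(w+a)) add up to O(w/a), so pairs cost O((w/a)²). This
-- is small when the range is narrow on the logarithmic scale.
two-large-count : ∀ k a w → 2 ≤ a → a * (a * # (2 ^ k) (TwoLarge? a (2 ^ (w + a)))) ≤ w * (2 * (w * (2 * 2 ^ k)))
two-large-count k a w 2≤a = begin
  a * (a * # N (TwoLarge? a R)) ≤⟨ *-monoʳ-≤ a (*-monoʳ-≤ a cover) ⟩
  a * (a * Σ< R (λ l → 𝟙 (PrimeFrom? a l) * Σ< R (λ l′ → 𝟙 (PrimeFrom? a l′) * mult l l′))) ≡⟨ cong (a *_) (trans (sym (Σ-*ˡ a R _)) (Σ-cong R (λ l _ → swap a (𝟙 (PrimeFrom? a l)) _))) ⟩
  a * Σ< R (λ l → 𝟙 (PrimeFrom? a l) * g l) ≤⟨ Σ-prime-blocks a w (w * (2 * N)) g 2≤a outer ⟩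
  w * (2 * (w * (2 * N))) ∎
  where
  open ≤-Reasoning
  N R : ℕ
  N = 2 ^ k
  R = 2 ^ (w + a)
  swap : ∀ x y z → x * (y * z) ≡ y * (x * z)
  swap = solve-∀
  Pair? : ∀ l l′ → Decidable (λ m → 0 < m × l * l′ ∣ m)
  Pair? l l′ m = (0 <? m) ×-dec (l * l′ ∣? m)
  mult : ℕ → ℕ → ℕ
  mult l l′ = # N (Pair? l l′)
  g : ℕ → ℕ
  g l = a * Σ< R (λ l′ → 𝟙 (PrimeFrom? a l′) * mult l l′)
  mult≤ : ∀ i i′ l l′ → 2 ^ i ≤ l → 2 ^ i′ ≤ l′ → 2 ^ i′ * (2 ^ i * mult l l′) ≤ N
  mult≤ i i′ l l′ lo lo′ = begin
    2 ^ i′ * (2 ^ i * mult l l′) ≤⟨ *-mono-≤ lo′ (*-mono-≤ lo (#-multiples N (l * l′))) ⟩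
    l′ * (l * (N / (l * l′))) ≡⟨ ring l l′ (N / (l * l′)) ⟩
    N / (l * l′) * (l * l′) ≤⟨ m/n*n≤m N (l * l′) ⟩
    N ∎
    where
    instance
      ll≢0 : NonZero (l * l′)
      ll≢0 = m*n≢0 l l′ {{>-nonZero (≤-trans (m^n>0 2 i) lo)}} {{>-nonZero (≤-trans (m^n>0 2 i′) lo′)}}
    ring : ∀ l l′ x → l′ * (l * x) ≡ x * (l * l′)
    ring = solve-∀
  outer : ∀ i l → 2 ^ i ≤ l → l < 2 ^ suc i → 2 ^ i * g l ≤ w * (2 * N)
  outer i l lo _ = begin
    2 ^ i * (a * Σ< R (λ l′ → 𝟙 (PrimeFrom? a l′) * mult l l′)) ≡⟨ trans (swap (2 ^ i) a _) (cong (a *_) (trans (sym (Σ-*ˡ (2 ^ i) R _)) (Σ-cong R (λ l′ _ → swap (2 ^ i) (𝟙 (PrimeFrom? a l′)) (mult l l′))))) ⟩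
    a * Σ< R (λ l′ → 𝟙 (PrimeFrom? a l′) * (2 ^ i * mult l l′)) ≤⟨ Σ-prime-blocks a w N (λ l′ → 2 ^ i * mult l l′) 2≤a (λ i′ l′ lo′ _ → mult≤ i i′ l l′ lo lo′) ⟩
    w * (2 * N) ∎
  cover : # N (TwoLarge? a R) ≤ Σ< R (λ l → 𝟙 (PrimeFrom? a l) * Σ< R (λ l′ → 𝟙 (PrimeFrom? a l′) * mult l l′))
  cover = ≤-trans (#-cover N R (TwoLarge? a R) One? (λ m _ → λ { (0<m , l , l<R , l′ , l′<R , pl , pl′ , d) → l , l<R , pl , l′ , l′<R , pl′ , 0<m , d })) (Σ-mono R (λ l _ → first l))
    where
    Two? : ∀ l l′ → Decidable (λ m → (Prime l′ × 2 ^ a ≤ l′) × 0 < m × l * l′ ∣ m)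
    Two? l l′ m = PrimeFrom? a l′ ×-dec Pair? l l′ m
    One? : ∀ l → Decidable (λ m → (Prime l × 2 ^ a ≤ l) × ∃ λ l′ → l′ < R × (Prime l′ × 2 ^ a ≤ l′) × 0 < m × l * l′ ∣ m)
    One? l m = PrimeFrom? a l ×-dec anyUpTo? (λ l′ → Two? l l′ m) R
    guard : ∀ {G : Set} {P R : ℕ → Set} (G? : Dec G) (P? : Decidable P) (R? : Decidable R) → (∀ m → R m → G × P m) → # N R? ≤ 𝟙 G? * # N P?
    guard (yes _) P? R? h = ≤-trans (#-mono {P? = R?} N {Q? = P?} (λ m _ r → proj₂ (h m r))) (≤-reflexive (sym (+-identityʳ _)))
    guard (no ¬G) P? R? h = ≤-reflexive (#-none {P? = R?} N (λ m _ r → ¬G (proj₁ (h m r))))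
    first : ∀ l → # N (One? l) ≤ 𝟙 (PrimeFrom? a l) * Σ< R (λ l′ → 𝟙 (PrimeFrom? a l′) * mult l l′)
    first l = ≤-trans (guard (PrimeFrom? a l) (λ m → anyUpTo? (λ l′ → Two? l l′ m) R) (One? l) (λ m r → r))
      (*-monoʳ-≤ (𝟙 (PrimeFrom? a l)) (≤-trans (#-cover N R (λ m → anyUpTo? (λ l′ → Two? l l′ m) R) (Two? l) (λ m _ p → p))
        (Σ-mono R (λ l′ _ → guard (PrimeFrom? a l′) (Pair? l l′) (Two? l l′) (λ m r → r)))))

#-below : ∀ M A → # M (λ n → n <? A) ≤ A
#-below M A = ≤-trans (#-inject M A {P? = λ n → n <? A} {Q? = λ n → n ≟ n} id (λ n _ n<A → n<A , refl) (λ _ _ _ _ _ _ e → e)) (#≤ {P? = λ n → n ≟ n} A)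

SmallCofactor : ℕ → ℕ → ℕ → Set
SmallCofactor k e q = Prime q × 0 < e × ∃ λ n → n < 2 ^ k × Prime n × q ∸ 1 ≡ e * n

SmallCofactor? : ∀ k e → Decidable (SmallCofactor k e)
SmallCofactor? k e q = prime? q ×-dec ((0 <? e) ×-dec anyUpTo? (λ n → prime? n ×-dec (q ∸ 1 ≟ e * n)) (2 ^ k))

-- Primes q for which q − 1 has a small cofactor

-- The primes in [2^η, 2^ζ) sieve with r levels, for cofactors below 2^η; g is the number of bits
-- gained. `hK` controls the sieve density, `hr` the truncation after r levels, and `hD` the
-- rounding errors together with the n below 2^ζ.
record SieveParameters : Set where
  field
    k g r e′ η₀ t t′ : ℕ
    32≤e′ : 32 ≤ e′
    32≤η₀ : 32 ≤ η₀

  η : ℕ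
  η = t + η₀
  ζ : ℕ
  ζ = t′ + η
  K : ℕ
  K = 2 ^ suc η₀ * η ^ e′

  field
    η≤k : η ≤ k
    hK  : 2 ^ g * (K * K) ≤ ζ * ζ
    1≤ζ : 1 ≤ ζ
    hr  : 2 ^ g * ζ ^ e′ ≤ 4 ^ r
    hD  : 2 ^ g * ((6 * suc (2 ^ ζ)) ^ r + 2 ^ ζ) ≤ 2 ^ (k ∸ η)

module CofactorSieve (parameters : SieveParameters) where
  open SieveParameters parameters

  private
    R V : ℕ
    R = rangeΠ id η ζ
    V = rangeΠ (_∸ 2) η ζ
    D : ℕ
    D = (6 * suc (2 ^ ζ)) ^ r
    R≢0 : NonZero R
    R≢0 = >-nonZero (rangeΠ-pos id η ζ (λ s ps → <⇒≤ (prime>1 ps)))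

    gV≤R : 2 ^ g * V ≤ R
    gV≤R = *-cancelˡ-≤ (ζ * ζ) {{m*n≢0 ζ ζ {{>-nonZero 1≤ζ}} {{>-nonZero 1≤ζ}}}} (begin
      ζ * ζ * (2 ^ g * V) ≡⟨ swap (ζ * ζ) (2 ^ g) V ⟩
      2 ^ g * (ζ * ζ * V) ≤⟨ *-monoʳ-≤ (2 ^ g) (sieve-density e′ η₀ t t′ 32≤e′ 32≤η₀) ⟩
      2 ^ g * (K * K * R) ≡⟨ sym (*-assoc (2 ^ g) (K * K) R) ⟩
      2 ^ g * (K * K) * R ≤⟨ *-monoˡ-≤ R hK ⟩
      ζ * ζ * R ∎)
      where
      open ≤-Reasoning
      swap : ∀ x y z → x * (y * z) ≡ y * (x * z)
      swap = solve-∀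

    module _ (e : ℕ) (0<e : 0 < e) (e<2^η : e < 2 ^ η) where
      open Brun e (PrimeFrom? η) (λ s → proj₁) (λ s Ss → ∤-small 0<e (<-≤-trans e<2^η (proj₂ Ss)))

      gE≤R : 2 ^ g * symmetric r (2 ^ ζ) ≤ R
      gE≤R = *-cancelˡ-≤ (4 ^ r) {{m^n≢0 4 r}} (begin
        4 ^ r * (2 ^ g * E) ≡⟨ swap (4 ^ r) (2 ^ g) E ⟩
        2 ^ g * (4 ^ r * E) ≤⟨ *-monoʳ-≤ (2 ^ g) (≤-trans (symmetric-decay r (2 ^ ζ)) (range-ratio e′ η t′ 32≤e′ (≤-trans 32≤η₀ (m≤n+m η₀ t)))) ⟩
        2 ^ g * (R * ζ ^ e′) ≡⟨ trans (swap (2 ^ g) R (ζ ^ e′)) (*-comm R _) ⟩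
        2 ^ g * ζ ^ e′ * R ≤⟨ *-monoˡ-≤ R hr ⟩
        4 ^ r * R ∎)
        where
        open ≤-Reasoning
        E : ℕ
        E = symmetric r (2 ^ ζ)
        swap : ∀ x y z → x * (y * z) ≡ y * (x * z)
        swap = solve-∀

      survivors : ∀ M → 2 ^ g * # M (Survives? (2 ^ ζ)) ≤ 2 * M + 2 ^ g * D
      survivors M = *-cancelˡ-≤ R {{R≢0}} (begin
        R * (2 ^ g * F) ≡⟨ swap R (2 ^ g) F ⟩
        2 ^ g * (R * F) ≤⟨ *-monoʳ-≤ (2 ^ g) (sieve-upper (2 ^ ζ) r M) ⟩
        2 ^ g * (M * V + M * E + R * D) ≡⟨ ring (2 ^ g) M V E R D ⟩
        M * (2 ^ g * V) + M * (2 ^ g * E) + R * (2 ^ g * D) ≤⟨ +-monoˡ-≤ (R * (2 ^ g * D)) (+-mono-≤ (*-monoʳ-≤ M gV≤R) (*-monoʳ-≤ M gE≤R)) ⟩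
        M * R + M * R + R * (2 ^ g * D) ≡⟨ ring₂ M R (2 ^ g * D) ⟩
        R * (2 * M + 2 ^ g * D) ∎)
        where
        open ≤-Reasoning
        E F : ℕ
        E = symmetric r (2 ^ ζ)
        F = # M (Survives? (2 ^ ζ))
        swap : ∀ x y z → x * (y * z) ≡ y * (x * z)
        swap = solve-∀
        ring : ∀ G M V E R D → G * (M * V + M * E + R * D) ≡ M * (G * V) + M * (G * E) + R * (G * D)
        ring = solve-∀
        ring₂ : ∀ M R x → M * R + M * R + R * x ≡ R * (2 * M + x)
        ring₂ = solve-∀

      survive : ∀ n → Prime n → Prime (e * n + 1) → ¬ n < 2 ^ ζ → Survives (2 ^ ζ) n
      survive n pn pen n≮ {s} s<2^ζ (ps , _) (inj₁ s∣n) = n≮ (subst (_< 2 ^ ζ) (prime∣prime ps pn s∣n) s<2^ζ)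
      survive n pn pen n≮ {s} s<2^ζ (ps , _) (inj₂ s∣) =
        n≮ (≤-<-trans (≤-trans (m≤n*m n e {{>-nonZero 0<e}}) (m≤m+n (e * n) 1)) (subst (_< 2 ^ ζ) (prime∣prime ps pen s∣) s<2^ζ))

      -- The number n = (q - 1)/e is a prime of size at most about 2^k/e for which en + 1 is prime
      -- too, so n survives the sieve unless n < 2^ζ. The sieving primes are at least 2^η > e and so
      -- do not divide e.
      cofactor-count : ∀ i → i < η → 2 ^ i ≤ e → 2 ^ i * (2 ^ g * # (2 ^ k) (SmallCofactor? k e)) ≤ 3 * 2 ^ k
      cofactor-count i i<η 2ⁱ≤e = begin
        2 ^ i * (2 ^ g * # (2 ^ k) (SmallCofactor? k e)) ≤⟨ *-monoʳ-≤ (2 ^ i) (*-monoʳ-≤ (2 ^ g) transfer) ⟩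
        2 ^ i * (2 ^ g * (# M (λ n → n <? 2 ^ ζ) + # M (Survives? (2 ^ ζ))))
                                                                       ≡⟨ cong (2 ^ i *_) (*-distribˡ-+ (2 ^ g) _ _) ⟩
        2 ^ i * (2 ^ g * # M (λ n → n <? 2 ^ ζ) + 2 ^ g * # M (Survives? (2 ^ ζ)))
                                                                       ≤⟨ *-monoʳ-≤ (2 ^ i) (+-mono-≤ (*-monoʳ-≤ (2 ^ g) (#-below M (2 ^ ζ))) (survivors M)) ⟩
        2 ^ i * (2 ^ g * 2 ^ ζ + (2 * M + 2 ^ g * D)) ≡⟨ cong (2 ^ i *_) (ring (2 ^ g) (2 ^ ζ) M D) ⟩
        2 ^ i * (2 * M + 2 ^ g * (D + 2 ^ ζ)) ≤⟨ *-monoʳ-≤ (2 ^ i) (+-monoʳ-≤ (2 * M) (≤-trans hD (^-monoʳ-≤ 2 (∸-monoʳ-≤ k (<⇒≤ i<η))))) ⟩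
        2 ^ i * (2 * M + M) ≡⟨ ring₂ (2 ^ i) M ⟩
        3 * (2 ^ i * M) ≡⟨ cong (3 *_) 2ⁱM ⟩
        3 * 2 ^ k ∎
        where
        open ≤-Reasoning
        M : ℕ
        M = 2 ^ (k ∸ i)
        ring : ∀ G Z M D → G * Z + (2 * M + G * D) ≡ 2 * M + G * (D + Z)
        ring = solve-∀
        ring₂ : ∀ x M → x * (2 * M + M) ≡ 3 * (x * M)
        ring₂ = solve-∀
        2ⁱM : 2 ^ i * M ≡ 2 ^ k
        2ⁱM = trans (sym (^-distribˡ-+-* 2 i (k ∸ i))) (cong (2 ^_) (m+[n∸m]≡n (≤-trans (<⇒≤ i<η) η≤k)))
        instance
          e≢0 : NonZero e
          e≢0 = >-nonZero 0<e
        Target? : Decidable (λ n → Prime n × Prime (e * n + 1))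
        Target? n = prime? n ×-dec prime? (e * n + 1)
        quot : ∀ {q n} → q ∸ 1 ≡ e * n → (q ∸ 1) / e ≡ n
        quot {q} {n} eq = trans (cong (_/ e) (trans eq (*-comm e n))) (m*n/n≡m n e)
        back : ∀ {q} → Prime q → q ∸ 1 + 1 ≡ q
        back pq = m∸n+n≡m (<⇒≤ (prime>1 pq))
        image : ∀ q → q < 2 ^ k → SmallCofactor k e q → (q ∸ 1) / e < M × Prime ((q ∸ 1) / e) × Prime (e * ((q ∸ 1) / e) + 1)
        image q q<2ᵏ (pq , _ , n , _ , pn , eq) = subst (λ z → z < M × Prime z × Prime (e * z + 1)) (sym (quot {q} eq))
          ( *-cancelˡ-< (2 ^ i) n M (≤-<-trans (*-monoˡ-≤ n 2ⁱ≤e) (subst₂ _<_ eq (sym 2ⁱM) (≤-<-trans (m∸n≤m q 1) q<2ᵏ)))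
          , pn , subst Prime (sym (trans (cong (_+ 1) (sym eq)) (back pq))) pq)
        inj : ∀ i j → i < 2 ^ k → j < 2 ^ k → SmallCofactor k e i → SmallCofactor k e j → (i ∸ 1) / e ≡ (j ∸ 1) / e → i ≡ j
        inj i j _ _ (pi , _ , n , _ , _ , eq) (pj , _ , n′ , _ , _ , eq′) same = trans (sym (back pi)) (trans (cong (_+ 1)
          (trans eq (trans (cong (e *_) (trans (sym (quot {i} eq)) (trans same (quot {j} eq′)))) (sym eq′)))) (back pj))
        transfer : # (2 ^ k) (SmallCofactor? k e) ≤ # M (λ n → n <? 2 ^ ζ) + # M (Survives? (2 ^ ζ))
        transfer = ≤-trans (#-inject (2 ^ k) M {P? = SmallCofactor? k e} {Q? = Target?} (λ q → (q ∸ 1) / e) image inj)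
          (#-∪ {P? = Target?} M {Q? = λ n → n <? 2 ^ ζ} {R? = Survives? (2 ^ ζ)} λ n _ (pn , pen) → case n <? 2 ^ ζ of λ where
            (yes lt) → inj₁ lt
            (no n≮)  → inj₂ λ {s} → survive n pn pen n≮ {s})

  AnyCofactor? : Decidable (λ q → ∃ λ e → e < 2 ^ η × SmallCofactor k e q)
  AnyCofactor? q = anyUpTo? (λ e → SmallCofactor? k e q) (2 ^ η)

  any-cofactor-count : 2 ^ g * # (2 ^ k) AnyCofactor? ≤ η * (3 * 2 ^ k)
  any-cofactor-count = begin
    2 ^ g * # (2 ^ k) AnyCofactor? ≤⟨ *-monoʳ-≤ (2 ^ g) (#-cover (2 ^ k) (2 ^ η) AnyCofactor? (SmallCofactor? k) (λ q _ p → p)) ⟩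
    2 ^ g * Σ< (2 ^ η) (λ e → # (2 ^ k) (SmallCofactor? k e)) ≡⟨ sym (Σ-*ˡ (2 ^ g) (2 ^ η) _) ⟩
    Σ< (2 ^ η) (λ e → 2 ^ g * # (2 ^ k) (SmallCofactor? k e)) ≤⟨ Σ-harmonic η (3 * 2 ^ k) _
      (trans (cong (2 ^ g *_) (#-none {P? = SmallCofactor? k 0} (2 ^ k) (λ q _ c → <-irrefl refl (proj₁ (proj₂ c))))) (*-zeroʳ (2 ^ g)))
      (λ i e i<η lo hi → cofactor-count e (≤-trans (m^n>0 2 i) lo) (<-≤-trans hi (^-monoʳ-≤ 2 i<η)) i i<η lo) ⟩
    η * (3 * 2 ^ k) ∎
    where open ≤-Reasoning

lg : ℕ → ℕ
lg n = top (λ i → 2 ^ i ≤? n) n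

lg-lower : ∀ n → 1 ≤ n → 2 ^ lg n ≤ n
lg-lower n 1≤n with lg n ≟ 0
... | yes e = subst (λ z → 2 ^ z ≤ n) (sym e) 1≤n
... | no ≢0 = top-holds (λ i → 2 ^ i ≤? n) n ≢0

n<2^n : ∀ n → n < 2 ^ n
n<2^n zero    = s≤s z≤n
n<2^n (suc n) = ≤-trans (+-mono-≤ (m^n>0 2 n) (n<2^n n)) (≤-reflexive (sym (2^-suc n)))

lg-upper : ∀ n → n < 2 ^ suc (lg n)
lg-upper n = ≰⇒> λ le → <-irrefl refl (top-≥ (λ i → 2 ^ i ≤? n) n (suc (lg n)) (≤-trans (<⇒≤ (n<2^n (suc (lg n)))) le) le)

2^-quotient : ∀ a m i .{{_ : NonZero m}} → m ≤ 2 ^ i → i ≤ a → 2 ^ (a ∸ i) ≤ 2 ^ a / m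
2^-quotient a m i m≤2ⁱ i≤a = ≤-trans (≤-reflexive (sym (m*n/n≡m (2 ^ (a ∸ i)) m))) (/-monoˡ-≤ m
  (≤-trans (*-monoʳ-≤ (2 ^ (a ∸ i)) m≤2ⁱ) (≤-reflexive (trans (sym (^-distribˡ-+-* 2 (a ∸ i) i)) (cong (2 ^_) (m∸n+n≡m i≤a))))))

2^-quotient-≤ : ∀ a i → i ≤ a → (2 ^ a / 2 ^ i) {{m^n≢0 2 i}} ≤ 2 ^ (a ∸ i)
2^-quotient-≤ a i i≤a = ≤-reflexive (trans (cong (λ z → (z / 2 ^ i) {{m^n≢0 2 i}}) (trans (cong (2 ^_) (sym (m∸n+n≡m i≤a))) (^-distribˡ-+-* 2 (a ∸ i) i)))
  (m*n/n≡m (2 ^ (a ∸ i)) (2 ^ i) {{m^n≢0 2 i}}))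

prime-powers-bound : ∀ X n d → 1 ≤ n → n < X → (∀ p a → Prime p → p ^ a ∣ n → p ^ a ≤ d) → n ≤ d ^ ω X n
prime-powers-bound X n d 1≤n n<X h = ≤-trans (∣⇒≤ {{>-nonZero pos}} n∣Π) (≤-trans (Π-mono X small) (≤-reflexive (Π-^Σ X d _)))
  where
  Div? : ∀ p → Decidable (λ a → p ^ a ∣ n)
  Div? p a = p ^ a ∣? n
  v : ℕ → ℕ
  v p = top (Div? p) n
  F : ℕ → ℕ
  F p = (p ^ v p) ^ 𝟙 (PrimeDivisor? n p)
  pow∣ : ∀ p → p ^ v p ∣ n
  pow∣ p with v p ≟ 0
  ... | yes e = subst (λ z → p ^ z ∣ n) (sym e) (1∣ n)
  ... | no ≢0 = top-holds (Div? p) n ≢0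
  n∣Π : n ∣ Π< X F
  n∣Π = prime-powers⇒∣ n (Π< X F) 1≤n λ p a pp pᵃ∣n → case a ≟ 0 of λ where
      (yes refl) → 1∣ Π< X F
      (no a≢0)   → ∣-trans (^-∣ p (top-≥ (Div? p) n a (≤-trans (a≤ p a pp) (∣⇒≤ {{>-nonZero 1≤n}} pᵃ∣n)) pᵃ∣n)) (∣-trans (factor p a pp a≢0 pᵃ∣n) (term∣Π X F (p<X p a a≢0 pᵃ∣n)))
    where
    a≤ : ∀ p a → Prime p → a ≤ p ^ a
    a≤ p a pp = ≤-trans (<⇒≤ (n<2^n a)) (^-monoˡ-≤ a (prime>1 pp))
    p∣n : ∀ p a → a ≢ 0 → p ^ a ∣ n → p ∣ n
    p∣n p zero    a≢0 _ = contradiction refl a≢0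
    p∣n p (suc a) _ d = m*n∣⇒m∣ p (p ^ a) d
    p<X : ∀ p a → a ≢ 0 → p ^ a ∣ n → p < X
    p<X p a a≢0 d = ≤-<-trans (∣⇒≤ {{>-nonZero 1≤n}} (p∣n p a a≢0 d)) n<X
    factor : ∀ p a → Prime p → a ≢ 0 → p ^ a ∣ n → p ^ v p ∣ F p
    factor p a pp a≢0 d = subst (p ^ v p ∣_) (sym (trans (cong ((p ^ v p) ^_) (𝟙-yes (pp , p∣n p a a≢0 d) (PrimeDivisor? n p))) (*-identityʳ (p ^ v p)))) ∣-refl
  pos : 1 ≤ Π< X F
  pos = Π-pos X F step
    where
    step : ∀ p → p < X → 1 ≤ F p
    step p _ with PrimeDivisor? n p
    ... | no _ = ≤-refl
    ... | yes (pp , _) = subst (1 ≤_) (sym (*-identityʳ (p ^ v p))) (m^n>0 p {{prime⇒nonZero pp}} (v p))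
  small : ∀ p → p < X → F p ≤ d ^ 𝟙 (PrimeDivisor? n p)
  small p _ with PrimeDivisor? n p
  ... | no _ = ≤-refl
  ... | yes (pp , _) = ^-monoˡ-≤ 1 (h p (v p) pp (pow∣ p))

odd-prime : ∀ {q} → Prime q → q ≢ 2 → 2 ∣ q ∸ 1
odd-prime {q} pq q≢2 with q % 2 in eq | m%n<n q 2
... | zero        | _ = contradiction (sym (prime∣prime prime[2] pq (m%n≡0⇒n∣m q 2 eq))) q≢2
... | suc zero    | _ = divides (q / 2) (trans (cong (_∸ 1) (trans (m≡m%n+[m/n]*n q 2) (cong (_+ q / 2 * 2) eq))) refl)
... | suc (suc _) | s≤s (s≤s ())

quot₁ : ℕ → ℕ → ℕ
quot₁ a zero      = 0
quot₁ a m@(suc _) = 2 ^ a / m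

quot₁-/ : ∀ a m .{{_ : NonZero m}} → quot₁ a m ≡ 2 ^ a / m
quot₁-/ a (suc m) = refl

-- Since p^a ≤ p · (p^⌊a/2⌋)², and that square divides m, each of the three factors is at most 2^Y.
small-power : ∀ p m c Y → Prime p → c ≤ Y → (∀ d → d * d ∣ m → d < 2 ^ c) → p ≤ 2 ^ Y → ∀ a → p ^ a ∣ m → p ^ a ≤ 2 ^ (3 * Y)
small-power p m c Y pp c≤Y sf p≤ a pᵃ∣m = begin
  p ^ a ≤⟨ ^-monoʳ-≤ p {{prime⇒nonZero pp}} a≤ ⟩
  p * p ^ (b + b) ≡⟨ cong (p *_) (^-distribˡ-+-* p b b) ⟩
  p * (p ^ b * p ^ b) ≤⟨ *-mono-≤ p≤ (*-mono-≤ half half) ⟩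
  2 ^ Y * (2 ^ Y * 2 ^ Y) ≡⟨ sym (trans (cong (2 ^_) (cong (λ z → Y + (Y + z)) (+-identityʳ Y))) (trans (^-distribˡ-+-* 2 Y (Y + Y)) (cong (2 ^ Y *_) (^-distribˡ-+-* 2 Y Y)))) ⟩
  2 ^ (3 * Y) ∎
  where
  open ≤-Reasoning
  b : ℕ
  b = a / 2
  half : p ^ b ≤ 2 ^ Y
  half = ≤-trans (<⇒≤ (sf (p ^ b) (∣-trans (subst (_∣ p ^ a) (^-distribˡ-+-* p b b) (^-∣ p (≤-trans (≤-reflexive (trans (cong (b +_) (sym (+-identityʳ b))) (*-comm 2 b))) (m/n*n≤m a 2)))) pᵃ∣m))) (^-monoʳ-≤ 2 c≤Y)
  a≤ : a ≤ suc (b + b)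
  a≤ = ≤-trans (≤-reflexive (m≡m%n+[m/n]*n a 2)) (+-mono-≤ (s≤s⁻¹ (m%n<n a 2)) (≤-reflexive (trans (*-comm b 2) (cong (b +_) (+-identityʳ b)))))

constant-≤ : ∀ u v B → 1 ≤ B → u + u ≤ v → u * suc B ≤ v * B
constant-≤ u v B 1≤B h = ≤-trans (≤-trans (≤-reflexive (*-suc u B)) (+-monoˡ-≤ (u * B) (≤-trans (≤-reflexive (sym (*-identityʳ u))) (*-monoʳ-≤ u 1≤B)))) (≤-trans (≤-reflexive (sym (*-distribʳ-+ B u u))) (*-monoˡ-≤ B h))

-- The set of primes in one dyadic range

record ScaleSet (k g : ℕ) : Set₁ where
  field
    Q       : ℕ → Set
    Q?      : Decidable Q
    Q-prime : ∀ q → Q q → Prime q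
    Q-lower : ∀ q → Q q → 2 ^ (k ∸ 1) ≤ q
    Q-upper : ∀ q → Q q → q < 2 ^ k
    lost    : 2 ^ g * # (2 ^ k) (λ q → PrimeFrom? (k ∸ 1) q ×-dec ¬? (Q? q)) ≤ 5 * 2 ^ k
    period  : ℕ
    period>0 : 1 ≤ period
    order∣period : ∀ q → Q q → q ∸ 1 ∣ period
    images  : 2 ^ k * Σ< period (λ J → 𝟙 ((1 ≤? J) ×-dec (2 ∣? J)) * Π< (2 ^ k) (λ q → im q J ^ 𝟙 (Q? q))) ≤ Π< (2 ^ k) (λ q → q ^ 𝟙 (Q? q))

2^-+ : ∀ a b → 2 ^ a * 2 ^ b ≡ 2 ^ (a + b)
2^-+ a b = sym (^-distribˡ-+-* 2 a b)

private
  -- Put X = 2^k and D = 2^(3k). Divided by T^X with T = 2^(4k), the hypothesis reads S/P ≤ (1 +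
  -- 1/D)^X - 1, which by `power-ratio` is at most X/(D - X) ≤ 1/X. This is the origin of τ = 4k.
  final-bound : ∀ k (m : ℕ → ℕ) S P → 1 ≤ k → (∀ i → m i ≤ 2 ^ k) →
    (2 ^ (4 * k)) ^ (2 ^ k) * S + (2 ^ (4 * k)) ^ (2 ^ k) * P ≤ P * Π< (2 ^ k) (λ i → 2 ^ (4 * k) + m i) → 2 ^ k * S ≤ P
  final-bound k m S P 1≤k m≤ h = *-cancelˡ-≤ X {{m^n≢0 2 k}} (begin
    X * (X * S) ≡⟨ sym (*-assoc X X S) ⟩
    X * X * S ≤⟨ *-monoˡ-≤ S XX≤ ⟩
    (D ∸ X) * S ≤⟨ sum ⟩
    X * P ∎)
    where
    open ≤-Reasoning
    X D : ℕ
    X = 2 ^ k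
    D = 2 ^ (3 * k)
    D≡ : X * D ≡ 2 ^ (4 * k)
    D≡ = 2^-+ k (3 * k)
    instance
      D≢0 : NonZero D
      D≢0 = m^n≢0 2 (3 * k)
      X≢0 : NonZero X
      X≢0 = m^n≢0 2 k
    XX≤ : X * X ≤ D ∸ X
    XX≤ = m+n≤o⇒m≤o∸n (X * X) (begin
      X * X + X ≤⟨ +-monoʳ-≤ (X * X) (m≤m*n X X) ⟩
      X * X + X * X ≡⟨ cong (X * X +_) (sym (+-identityʳ _)) ⟩
      2 * (X * X) ≤⟨ *-monoˡ-≤ (X * X) (^-monoʳ-≤ 2 {1} {k} 1≤k) ⟩
      X * (X * X) ≡⟨ trans (cong (X *_) (2^-+ k k)) (trans (2^-+ k (k + k)) (cong (λ z → 2 ^ (k + (k + z))) (sym (+-identityʳ k)))) ⟩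
      D ∎)
    X≤D : X ≤ D
    X≤D = ^-monoʳ-≤ 2 (m≤n*m k 3)
    bounded : Π< X (λ i → 2 ^ (4 * k) + m i) ≤ X ^ X * suc D ^ X
    bounded = begin
      Π< X (λ i → 2 ^ (4 * k) + m i) ≤⟨ Π-mono X (λ i _ → ≤-trans (+-monoʳ-≤ _ (m≤ i)) (≤-reflexive (trans (+-comm (2 ^ (4 * k)) X) (trans (cong (X +_) (sym D≡)) (sym (*-suc X D)))))) ⟩
      Π< X (λ _ → X * suc D) ≡⟨ trans (Π-const X (X * suc D)) (^-distribʳ-* X (suc D) X) ⟩
      X ^ X * suc D ^ X ∎
    reduced : D ^ X * (S + P) ≤ P * suc D ^ X
    reduced = *-cancelˡ-≤ (X ^ X) {{m^n≢0 X X}} (begin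
      X ^ X * (D ^ X * (S + P)) ≡⟨ trans (sym (*-assoc (X ^ X) (D ^ X) (S + P))) (cong (_* (S + P)) (trans (sym (^-distribʳ-* X D X)) (cong (_^ X) D≡))) ⟩
      (2 ^ (4 * k)) ^ X * (S + P) ≡⟨ *-distribˡ-+ ((2 ^ (4 * k)) ^ X) S P ⟩
      (2 ^ (4 * k)) ^ X * S + (2 ^ (4 * k)) ^ X * P ≤⟨ h ⟩
      P * Π< X (λ i → 2 ^ (4 * k) + m i) ≤⟨ *-monoʳ-≤ P bounded ⟩
      P * (X ^ X * suc D ^ X) ≡⟨ swap P (X ^ X) (suc D ^ X) ⟩
      X ^ X * (P * suc D ^ X) ∎)
      where
      swap : ∀ x y z → x * (y * z) ≡ y * (x * z)
      swap = solve-∀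
    scaled : (S + P) * (D ∸ X) ≤ P * D
    scaled = *-cancelˡ-≤ (D ^ X) {{m^n≢0 D X}} (begin
      D ^ X * ((S + P) * (D ∸ X)) ≡⟨ sym (*-assoc (D ^ X) (S + P) (D ∸ X)) ⟩
      D ^ X * (S + P) * (D ∸ X) ≤⟨ *-monoˡ-≤ (D ∸ X) reduced ⟩
      P * suc D ^ X * (D ∸ X) ≡⟨ *-assoc P (suc D ^ X) (D ∸ X) ⟩
      P * (suc D ^ X * (D ∸ X)) ≤⟨ *-monoʳ-≤ P (power-ratio D X) ⟩
      P * (D * D ^ X) ≡⟨ trans (sym (*-assoc P D (D ^ X))) (*-comm (P * D) (D ^ X)) ⟩
      D ^ X * (P * D) ∎)
    sum : (D ∸ X) * S ≤ X * P
    sum = +-cancelʳ-≤ (P * (D ∸ X)) _ _ (begin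
      (D ∸ X) * S + P * (D ∸ X) ≡⟨ trans (cong (_+ P * (D ∸ X)) (*-comm (D ∸ X) S)) (sym (*-distribʳ-+ (D ∸ X) S P)) ⟩
      (S + P) * (D ∸ X) ≤⟨ scaled ⟩
      P * D ≡⟨ cong (P *_) (sym (m+[n∸m]≡n X≤D)) ⟩
      P * (X + (D ∸ X)) ≡⟨ trans (*-distribˡ-+ P X (D ∸ X)) (cong (_+ P * (D ∸ X)) (*-comm P X)) ⟩
      X * P + P * (D ∸ X) ∎)

-- The prime q has k bits, 2^κ bounds k, and each kind of discarding may lose a proportion 2^(-g).
-- Square divisors d² are kept to d < 2^c and the number of prime factors below c; pruning uses the
-- fraction 2^(-c). The bound 2^a, a little below 2^(k/2), separates small from large primes, and
-- 2^(w+a) bounds two large primes of the same q - 1. A cofactor (q - 1)/l is at least 2^η and has a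
-- prime factor above 2^Y.
record ScaleParameters : Set₁ where
  field
    k g κ c β h a w Y η : ℕ

  -- A bit budget for `large-count`: 2κ + 2 for kτ, 9 for the ratio between `b` and `B`, c for
  -- pruning, 2 for the factor 3 and 1 for rounding l to a power of 2. `Y` and `β` below come from
  -- the same bookkeeping in `large-near` and `small-count`.
  ω′ : ℕ
  ω′ = 2 * κ + c + 14

  field
    {{k≢0}}   : NonZero k
    k≤2^κ     : k ≤ 2 ^ κ
    g+κ≤c     : g + κ ≤ c
    Y≡        : Y ≡ ω′ + κ + c + 4
    3Yc<η     : 3 * Y * c < η
    ωc≤η      : suc (ω′ + Y + c) ≤ η
    η≤k       : η ≤ k
    2h≤k      : h + h ≤ k
    k≤2h+1    : k ≤ suc (h + h)
    a+β≡h     : a + β ≡ h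
    β≡        : β ≡ c + 2 * κ + 11
    3Y≤a      : 3 * Y ≤ a
    c≤Y       : c ≤ Y
    w≡        : w ≡ k ∸ (a + a)
    h+4≤k     : h + 4 ≤ k
    wag       : 2 ^ g * (w * (2 * (w * 2))) ≤ a * a
    {Cof}     : ℕ → Set
    Cof?      : Decidable Cof
    cof       : ∀ q e l → q < 2 ^ k → Prime q → 0 < e → e < 2 ^ η → l < 2 ^ k → Prime l → q ∸ 1 ≡ e * l → Cof q
    cof-count : 2 ^ g * # (2 ^ k) Cof? ≤ 2 ^ k

module ScaleConstruction (parameters : ScaleParameters) where
  open ScaleParameters parameters

  private
    N ω₀ : ℕ
    N = 2 ^ k
    ω₀ = ω′

    P : ℕ → Set
    P q = (Prime q × 2 ^ (k ∸ 1) ≤ q) × ¬ (0 < q ∸ 1 × ∃ λ d → d < N × 2 ^ c ≤ d × d * d ∣ q ∸ 1) × ¬ (0 < q ∸ 1 × c ≤ ω N (q ∸ 1)) ×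
          ¬ (0 < q ∸ 1 × ∃ λ l → l < 2 ^ (w + a) × ∃ λ l′ → l′ < 2 ^ (w + a) × (Prime l × 2 ^ a ≤ l) × (Prime l′ × 2 ^ a ≤ l′) × l * l′ ∣ q ∸ 1) × ¬ Cof q × q < N

    P? : Decidable P
    P? q = PrimeFrom? (k ∸ 1) q ×-dec (¬? (SquareDivisor? k c (q ∸ 1)) ×-dec (¬? (ManyPrimes? k c (q ∸ 1)) ×-dec (¬? (TwoLarge? a (2 ^ (w + a)) (q ∸ 1)) ×-dec (¬? (Cof? q) ×-dec (q <? N)))))

    All? : Decidable (λ (m : ℕ) → m ≡ m)
    All? m = m ≟ m

    -- The threshold ⌊2^(k-c)/m⌋ is the proportion 2^(-c) of all multiples of m below 2^k, and
    -- summing 1/m over all m costs only a factor k.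
    pruned : Pruning N N (quot₁ (k ∸ c)) P? (Σ< N (λ m → 𝟙 (All? m) * quot₁ (k ∸ c) m))
    pruned = prune N N (quot₁ (k ∸ c)) N P? All? (#≤ {P? = All?} N) (λ m q _ _ ¬A → contradiction refl ¬A)

    open Pruning pruned

    c≤k : c ≤ k
    c≤k = ≤-trans (≤-trans (m≤n+m c (suc (ω₀ + Y))) ωc≤η) η≤k

    count-scale : ∀ e n → κ + g ≤ e → 2 ^ e * n ≤ k * N → 2 ^ g * n ≤ N
    count-scale e n le h = *-cancelˡ-≤ (2 ^ κ) {{m^n≢0 2 κ}} (begin
      2 ^ κ * (2 ^ g * n) ≡⟨ trans (sym (*-assoc (2 ^ κ) (2 ^ g) n)) (cong (_* n) (2^-+ κ g)) ⟩
      2 ^ (κ + g) * n ≤⟨ *-monoˡ-≤ n (^-monoʳ-≤ 2 le) ⟩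
      2 ^ e * n ≤⟨ h ⟩
      k * N ≤⟨ *-monoˡ-≤ N k≤2^κ ⟩
      2 ^ κ * N ∎)
      where open ≤-Reasoning

    κ+g≤c : κ + g ≤ c
    κ+g≤c = ≤-trans (≤-reflexive (+-comm κ g)) g+κ≤c

    budget : 2 ^ c * Σ< N (λ m → 𝟙 (All? m) * quot₁ (k ∸ c) m) ≤ k * N
    budget = begin
      2 ^ c * Σ< N (λ m → 𝟙 (All? m) * quot₁ (k ∸ c) m) ≡⟨ sym (Σ-*ˡ (2 ^ c) N _) ⟩
      Σ< N (λ m → 2 ^ c * (𝟙 (All? m) * quot₁ (k ∸ c) m)) ≤⟨ Σ-harmonic k N (λ m → 2 ^ c * (𝟙 (All? m) * quot₁ (k ∸ c) m)) (trans (cong (2 ^ c *_) (*-zeroʳ (𝟙 (All? 0)))) (*-zeroʳ (2 ^ c))) block ⟩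
      k * N ∎
      where
      open ≤-Reasoning
      block : ∀ i d → i < k → 2 ^ i ≤ d → d < 2 ^ suc i → 2 ^ i * (2 ^ c * (𝟙 (All? d) * quot₁ (k ∸ c) d)) ≤ N
      block i d _ 2ⁱ≤d _ = begin
        2 ^ i * (2 ^ c * (𝟙 (All? d) * quot₁ (k ∸ c) d)) ≤⟨ *-mono-≤ 2ⁱ≤d (*-monoʳ-≤ (2 ^ c) (*-monoˡ-≤ (quot₁ (k ∸ c) d) (𝟙≤1 (All? d)))) ⟩
        d * (2 ^ c * (1 * quot₁ (k ∸ c) d)) ≡⟨ ring d (2 ^ c) (quot₁ (k ∸ c) d) ⟩
        2 ^ c * (quot₁ (k ∸ c) d * d) ≡⟨ cong (λ z → 2 ^ c * (z * d)) (quot₁-/ (k ∸ c) d) ⟩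
        2 ^ c * (2 ^ (k ∸ c) / d * d) ≤⟨ *-monoʳ-≤ (2 ^ c) (m/n*n≤m (2 ^ (k ∸ c)) d) ⟩
        2 ^ c * 2 ^ (k ∸ c) ≡⟨ trans (2^-+ c (k ∸ c)) (cong (2 ^_) (m+[n∸m]≡n c≤k)) ⟩
        N ∎
        where
        instance
          d≢0 : NonZero d
          d≢0 = >-nonZero (≤-trans (m^n>0 2 i) 2ⁱ≤d)
        ring : ∀ d x y → d * (x * (1 * y)) ≡ x * (y * d)
        ring = solve-∀

    a≤h : a ≤ h
    a≤h = ≤-trans (m≤m+n a β) (≤-reflexive a+β≡h)
    14≤Y : 14 ≤ Y
    14≤Y = subst (14 ≤_) (sym Y≡) (≤-trans (m≤n+m 14 (2 * κ + c)) (≤-trans (m≤m+n ω₀ κ) (≤-trans (m≤m+n (ω₀ + κ) c) (m≤m+n (ω₀ + κ + c) 4))))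
    Y≤a : Y ≤ a
    Y≤a = ≤-trans (m≤m+n Y _) 3Y≤a
    2≤a : 2 ≤ a
    2≤a = ≤-trans (≤-trans (s≤s (s≤s z≤n)) 14≤Y) Y≤a
    c≤a : c ≤ a
    c≤a = ≤-trans c≤Y Y≤a

    lost-total : 2 ^ g * # N (λ q → PrimeFrom? (k ∸ 1) q ×-dec ¬? (Q? q)) ≤ 5 * N
    lost-total = begin
      2 ^ g * # N (λ q → PrimeFrom? (k ∸ 1) q ×-dec ¬? (Q? q))
        ≤⟨ *-monoʳ-≤ (2 ^ g) (≤-trans (Σ-mono N point) (≤-reflexive (trans (Σ-+ N _ _) (cong (s₁ +_) (trans (Σ-+ N _ _) (cong (s₂ +_) (trans (Σ-+ N _ _) (cong (s₃ +_) (Σ-+ N _ _))))))))) ⟩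
      2 ^ g * (s₁ + (s₂ + (s₃ + (s₄ + s₅)))) ≡⟨ ring (2 ^ g) s₁ s₂ s₃ s₄ s₅ ⟩
      2 ^ g * s₁ + (2 ^ g * s₂ + (2 ^ g * s₃ + (2 ^ g * s₄ + 2 ^ g * s₅))) ≤⟨ +-mono-≤ b₁ (+-mono-≤ b₂ (+-mono-≤ b₃ (+-mono-≤ cof-count b₅))) ⟩
      N + (N + (N + (N + N))) ≡⟨ ring₂ N ⟩
      5 * N ∎
      where
      open ≤-Reasoning
      G₁? : Decidable (λ q → Prime q × 0 < q ∸ 1 × ∃ λ d → d < N × 2 ^ c ≤ d × d * d ∣ q ∸ 1)
      G₁? q = prime? q ×-dec SquareDivisor? k c (q ∸ 1)
      G₂? : Decidable (λ q → Prime q × 0 < q ∸ 1 × c ≤ ω N (q ∸ 1))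
      G₂? q = prime? q ×-dec ManyPrimes? k c (q ∸ 1)
      G₃? : Decidable (λ q → Prime q × 0 < q ∸ 1 × ∃ λ l → l < 2 ^ (w + a) × ∃ λ l′ → l′ < 2 ^ (w + a) × (Prime l × 2 ^ a ≤ l) × (Prime l′ × 2 ^ a ≤ l′) × l * l′ ∣ q ∸ 1)
      G₃? q = prime? q ×-dec TwoLarge? a (2 ^ (w + a)) (q ∸ 1)
      G₅? : Decidable (λ q → P q × ¬ Q q)
      G₅? q = P? q ×-dec ¬? (Q? q)
      s₁ s₂ s₃ s₄ s₅ : ℕ
      s₁ = # N G₁?
      s₂ = # N G₂?
      s₃ = # N G₃?
      s₄ = # N Cof?
      s₅ = # N G₅?
      ring : ∀ x a b c d e → x * (a + (b + (c + (d + e)))) ≡ x * a + (x * b + (x * c + (x * d + x * e)))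
      ring = solve-∀
      ring₂ : ∀ x → x + (x + (x + (x + x))) ≡ 5 * x
      ring₂ = solve-∀
      b₁ : 2 ^ g * s₁ ≤ N
      b₁ = count-scale c s₁ κ+g≤c (≤-trans (*-monoʳ-≤ (2 ^ c) (#-pred N {P? = G₁?} (SquareDivisor? k c) (λ q _ (pq , r) → <⇒≤ (prime>1 pq) , r))) (square-count k c))
      b₂ : 2 ^ g * s₂ ≤ N
      b₂ = count-scale c s₂ κ+g≤c (≤-trans (*-monoʳ-≤ (2 ^ c) (#-pred N {P? = G₂?} (ManyPrimes? k c) (λ q _ (pq , r) → <⇒≤ (prime>1 pq) , r))) (many-primes-count k c))
      b₃ : 2 ^ g * s₃ ≤ N
      b₃ = *-cancelˡ-≤ (a * a) {{m*n≢0 a a {{a≢0}} {{a≢0}}}} (begin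
        a * a * (2 ^ g * s₃) ≡⟨ ring₃ a (2 ^ g) s₃ ⟩
        2 ^ g * (a * (a * s₃)) ≤⟨ *-monoʳ-≤ (2 ^ g) (*-monoʳ-≤ a (*-monoʳ-≤ a (#-pred N {P? = G₃?} (TwoLarge? a (2 ^ (w + a))) (λ q _ (pq , r) → <⇒≤ (prime>1 pq) , r)))) ⟩
        2 ^ g * (a * (a * # N (TwoLarge? a (2 ^ (w + a))))) ≤⟨ *-monoʳ-≤ (2 ^ g) (two-large-count k a w 2≤a) ⟩
        2 ^ g * (w * (2 * (w * (2 * N)))) ≡⟨ ring₄ (2 ^ g) w N ⟩
        2 ^ g * (w * (2 * (w * 2))) * N ≤⟨ *-monoˡ-≤ N wag ⟩
        a * a * N ∎)
        where
        a≢0 : NonZero a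
        a≢0 = >-nonZero (≤-trans (s≤s z≤n) 2≤a)
        ring₃ : ∀ a x s → a * a * (x * s) ≡ x * (a * (a * s))
        ring₃ = solve-∀
        ring₄ : ∀ x w N → x * (w * (2 * (w * (2 * N)))) ≡ x * (w * (2 * (w * 2))) * N
        ring₄ = solve-∀
      b₅ : 2 ^ g * s₅ ≤ N
      b₅ = count-scale c s₅ κ+g≤c (≤-trans (*-monoʳ-≤ (2 ^ c) lost) budget)
      point : ∀ q → q < N → 𝟙 (PrimeFrom? (k ∸ 1) q ×-dec ¬? (Q? q)) ≤ 𝟙 (G₁? q) + (𝟙 (G₂? q) + (𝟙 (G₃? q) + (𝟙 (Cof? q) + 𝟙 (G₅? q))))
      point q q<N = 𝟙≤-elim (PrimeFrom? (k ∸ 1) q ×-dec ¬? (Q? q)) λ (pf , ¬Qq) →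
          go pf ¬Qq (SquareDivisor? k c (q ∸ 1)) (ManyPrimes? k c (q ∸ 1)) (TwoLarge? a (2 ^ (w + a)) (q ∸ 1)) (Cof? q)
        where
        at : ∀ {A : Set} (d : Dec A) → A → 1 ≤ 𝟙 d
        at d x = ≤-reflexive (sym (𝟙-yes x d))
        go : Prime q × 2 ^ (k ∸ 1) ≤ q → ¬ Q q → Dec _ → Dec _ → Dec _ → Dec (Cof q) → 1 ≤ 𝟙 (G₁? q) + (𝟙 (G₂? q) + (𝟙 (G₃? q) + (𝟙 (Cof? q) + 𝟙 (G₅? q))))
        go pf ¬Qq (yes s) _ _ _ = ≤-trans (at (G₁? q) (proj₁ pf , s)) (m≤m+n _ _)
        go pf ¬Qq (no _) (yes s) _ _ = ≤-trans (at (G₂? q) (proj₁ pf , s)) (≤-trans (m≤m+n _ _) (m≤n+m _ (𝟙 (G₁? q))))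
        go pf ¬Qq (no _) (no _) (yes s) _ = ≤-trans (at (G₃? q) (proj₁ pf , s)) (≤-trans (m≤m+n _ _) (≤-trans (m≤n+m _ (𝟙 (G₂? q))) (m≤n+m _ (𝟙 (G₁? q)))))
        go pf ¬Qq (no _) (no _) (no _) (yes s) = ≤-trans (at (Cof? q) s) (≤-trans (m≤m+n _ _) (≤-trans (m≤n+m _ (𝟙 (G₃? q))) (≤-trans (m≤n+m _ (𝟙 (G₂? q))) (m≤n+m _ (𝟙 (G₁? q))))))
        go pf ¬Qq (no ¬s) (no ¬m) (no ¬t) (no ¬c) = ≤-trans (at (G₅? q) ((pf , ¬s , ¬m , ¬t , ¬c , q<N) , ¬Qq)) (≤-trans (m≤n+m _ (𝟙 (Cof? q))) (≤-trans (m≤n+m _ (𝟙 (G₃? q))) (≤-trans (m≤n+m _ (𝟙 (G₂? q))) (m≤n+m _ (𝟙 (G₁? q))))))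

    Qp : ∀ q → Q q → Prime q
    Qp q Qq = proj₁ (proj₁ (Q⊆P q Qq))
    Q≥ : ∀ q → Q q → 2 ^ (k ∸ 1) ≤ q
    Q≥ q Qq = proj₂ (proj₁ (Q⊆P q Qq))
    Q< : ∀ q → Q q → q < N
    Q< q Qq = proj₂ (proj₂ (proj₂ (proj₂ (proj₂ (Q⊆P q Qq)))))
    n>0 : ∀ q → Q q → 0 < q ∸ 1
    n>0 q Qq = m<n⇒0<n∸m (prime>1 (Qp q Qq))
    n<N : ∀ q → Q q → q ∸ 1 < N
    n<N q Qq = ≤-<-trans (m∸n≤m q 1) (Q< q Qq)
    ∣n⇒<N : ∀ q d → Q q → d ∣ q ∸ 1 → d < N
    ∣n⇒<N q d Qq d∣ = ≤-<-trans (∣⇒≤ {{>-nonZero (n>0 q Qq)}} d∣) (n<N q Qq)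

    squarefree : ∀ q → Q q → ∀ d → d * d ∣ q ∸ 1 → d < 2 ^ c
    squarefree q Qq d d²∣ = ≰⇒> λ 2ᶜ≤d → proj₁ (proj₂ (Q⊆P q Qq)) (n>0 q Qq , d , ∣n⇒<N q d Qq (m*n∣⇒m∣ d d d²∣) , 2ᶜ≤d , d²∣)

    Q≥8 : ∀ q → Q q → 2 ^ (h + 3) ≤ q
    Q≥8 q Qq = ≤-trans (^-monoʳ-≤ 2 (m+n≤o⇒m≤o∸n (h + 3) (≤-trans (≤-reflexive (+-assoc h 3 1)) h+4≤k))) (Q≥ q Qq)

    n≥ : ∀ q → Q q → 4 * 2 ^ h ≤ q ∸ 1
    n≥ q Qq = m+n≤o⇒m≤o∸n (4 * 2 ^ h) (≤-trans (≤-trans (+-monoʳ-≤ (4 * 2 ^ h) (≤-trans (m^n>0 2 h) (m≤n*m (2 ^ h) 4))) (≤-reflexive (trans (ring (2 ^ h)) (2^-+ h 3)))) (Q≥8 q Qq))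
      where
      ring : ∀ x → 4 * x + 4 * x ≡ x * 8
      ring = solve-∀

    odd : ∀ q → Q q → 2 ∣ q ∸ 1
    odd q Qq = odd-prime (Qp q Qq) (λ { refl → <⇒≱ {2} {2 ^ (h + 3)} (≤-trans (s≤s (s≤s (s≤s z≤n))) (^-monoʳ-≤ 2 {3} {h + 3} (m≤n+m 3 h))) (Q≥8 2 Qq) })

    z : ℕ
    z = 2 ^ a

    a+a≤k : a + a ≤ k
    a+a≤k = ≤-trans (+-mono-≤ a≤h a≤h) 2h≤k

    -- From l · l′ < 2^k and l′ > 2^a follows l < 2^(k-a) = 2^(w+a), so two large primes would fall
    -- into the range that `TwoLarge?` excludes.
    large-unique : ∀ q l l′ → Q q → Prime l → Prime l′ → z < l → z < l′ → l ∣ q ∸ 1 → l′ ∣ q ∸ 1 → l ≡ l′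
    large-unique q l l′ Qq pl pl′ z<l z<l′ l∣ l′∣ = decidable-stable (l ≟ l′) λ l≢l′ → proj₁ (proj₂ (proj₂ (proj₂ (Q⊆P q Qq))))
        (n>0 q Qq , l , bound l l′ (<⇒≤ z<l′) (ll′∣ l≢l′) , l′ , bound l′ l (<⇒≤ z<l) (subst (_∣ q ∸ 1) (*-comm l l′) (ll′∣ l≢l′)) , (pl , <⇒≤ z<l) , (pl′ , <⇒≤ z<l′) , ll′∣ l≢l′)
      where
      ll′∣ : l ≢ l′ → l * l′ ∣ q ∸ 1
      ll′∣ l≢l′ = coprime-*∣ (∤⇒coprime l′ pl (λ l∣l′ → l≢l′ (prime∣prime pl pl′ l∣l′))) l∣ l′∣
      w+a+a : w + a + a ≡ k
      w+a+a = trans (+-assoc w a a) (trans (cong (_+ (a + a)) w≡) (m∸n+n≡m a+a≤k))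
      bound : ∀ l l′ → 2 ^ a ≤ l′ → l * l′ ∣ q ∸ 1 → l < 2 ^ (w + a)
      bound l l′ lo d = ≰⇒> λ le → <⇒≱ (∣n⇒<N q (l * l′) Qq d) (≤-trans (≤-reflexive (trans (cong (2 ^_) (sym w+a+a)) (^-distribˡ-+-* 2 (w + a) a))) (*-mono-≤ le lo))

    large-simple : ∀ q l → Q q → Prime l → z < l → l * l ∤ q ∸ 1
    large-simple q l Qq pl z<l d = <⇒≱ (squarefree q Qq l d) (≤-trans (^-monoʳ-≤ 2 c≤a) (<⇒≤ z<l))

    τ : ℕ
    τ = 4 * k

    frame : ScaleFrame
    frame = record { k = k ; τ = τ ; X = N ; z = z ; Q? = Q? ; Q-prime = Qp ; Q<X = Q< ; Q-odd = odd ; Q≤ = n<N ; large-unique = large-unique ; large-simple = large-simple }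

    module S = Scale frame

    -- B₁ is about √(2^k), where the two alternatives of `missing-general` balance; B l, about
    -- 2^(k-ω₀)/l, is as large as the supply of q with l ∣ q - 1 allows. In both cases b + 1 = 512 B
    -- exceeds 136 (B + 1) ≤ 272 B.
    B₁ b₁ : ℕ
    B₁ = 2 ^ h
    b₁ = 2 ^ (h + 9) ∸ 1
    B b : ℕ → ℕ
    B l = 2 ^ (k ∸ lg l ∸ ω₀)
    b l = 2 ^ ((k ∸ lg l ∸ ω₀) + 9) ∸ 1

    1+pred : ∀ e → suc (2 ^ e ∸ 1) ≡ 2 ^ e
    1+pred e = m+[n∸m]≡n (m^n>0 2 e)

    pred>0 : ∀ e → 1 ≤ 2 ^ (e + 9) ∸ 1
    pred>0 e = m<n⇒0<n∸m (≤-trans (s≤s (s≤s z≤n)) (^-monoʳ-≤ 2 {1} {e + 9} (≤-trans (s≤s z≤n) (m≤n+m 9 e))))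

    constant : ∀ e → 136 * suc (2 ^ e) ≤ suc (2 ^ (e + 9) ∸ 1)
    constant e = ≤-trans (constant-≤ 136 (2 ^ 9) (2 ^ e) (m^n>0 2 e) (m≤m+n 272 240)) (≤-reflexive (trans (trans (*-comm (2 ^ 9) (2 ^ e)) (2^-+ e 9)) (sym (1+pred (e + 9)))))

    kτ≤ : k * τ ≤ 2 ^ (κ + (2 + κ))
    kτ≤ = ≤-trans (*-mono-≤ k≤2^κ (*-monoʳ-≤ 4 k≤2^κ)) (≤-reflexive (trans (cong (2 ^ κ *_) (2^-+ 2 κ)) (2^-+ κ (2 + κ))))

    dense-count : ∀ q m i → Q q → m ∣ q ∸ 1 → 1 ≤ m → m ≤ 2 ^ i → i ≤ k ∸ c → 2 ^ (k ∸ c ∸ i) ≤ S.count m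
    dense-count q m i Qq m∣ 1≤m m≤ i≤ = ≤-trans (2^-quotient (k ∸ c) m i {{>-nonZero 1≤m}} m≤ i≤)
      (≤-trans (≤-reflexive (sym (quot₁-/ (k ∸ c) m {{>-nonZero 1≤m}}))) (dense m q (∣n⇒<N q m Qq m∣) (Q< q Qq) Qq m∣))

    ≤-sub₂ : ∀ x i → x + i + c ≤ k → x ≤ k ∸ c ∸ i
    ≤-sub₂ x i le = m+n≤o⇒m≤o∸n x (m+n≤o⇒m≤o∸n (x + i) le)

    small-count : ∀ p a′ q → Prime p → p ≤ z → 1 ≤ a′ → Q q → p ^ a′ ∣ q ∸ 1 → suc b₁ * (k * τ) ≤ S.count (p ^ a′)
    small-count p a′ q pp p≤z 1≤a′ Qq d = begin
      suc b₁ * (k * τ) ≤⟨ *-mono-≤ (≤-reflexive (1+pred (h + 9))) kτ≤ ⟩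
      2 ^ (h + 9) * 2 ^ (κ + (2 + κ)) ≡⟨ 2^-+ (h + 9) (κ + (2 + κ)) ⟩
      2 ^ (h + 9 + (κ + (2 + κ))) ≤⟨ ^-monoʳ-≤ 2 (≤-sub₂ (h + 9 + (κ + (2 + κ))) a exponent) ⟩
      2 ^ (k ∸ c ∸ a) ≤⟨ dense-count q (p ^ a′) a Qq d (m^n>0 p {{prime⇒nonZero pp}} a′) power≤ (m+n≤o⇒m≤o∸n a (≤-trans (m≤n+m (a + c) (h + 9 + (κ + (2 + κ)))) (≤-trans (≤-reflexive (sym (+-assoc (h + 9 + (κ + (2 + κ))) a c))) exponent))) ⟩
      S.count (p ^ a′) ∎
      where
      open ≤-Reasoning
      exponent : h + 9 + (κ + (2 + κ)) + a + c ≤ k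
      exponent = ≤-trans (≤-reflexive (trans (ring h κ a c) (cong (h +_) (trans (cong (a +_) (sym β≡)) a+β≡h)))) 2h≤k
        where
        ring : ∀ h κ a c → h + 9 + (κ + (2 + κ)) + a + c ≡ h + (a + (c + 2 * κ + 11))
        ring = solve-∀
      -- A prime above 2^Y divides q - 1 at most once, because of the bound on square divisors; for
      -- the others `small-power` applies.
      power≤ : p ^ a′ ≤ 2 ^ a
      power≤ = case p ≤? 2 ^ Y of λ where
          (yes p≤) → ≤-trans (small-power p (q ∸ 1) c Y pp c≤Y (squarefree q Qq) p≤ a′ d) (^-monoʳ-≤ 2 3Y≤a)
          (no p≰)  → go p≰ a′ d
        where
        go : p ≰ 2 ^ Y → ∀ a′ → p ^ a′ ∣ q ∸ 1 → p ^ a′ ≤ 2 ^ a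
        go _ zero _ = m^n>0 2 a
        go _ (suc zero) _ = ≤-trans (≤-reflexive (*-identityʳ p)) p≤z
        go p≰ (suc (suc a″)) d = contradiction (≤-trans (<⇒≤ (squarefree q Qq p (∣-trans (subst (_∣ p ^ suc (suc a″)) (cong (p *_) (*-identityʳ p)) (^-∣ p {2} {suc (suc a″)} (s≤s (s≤s z≤n)))) d))) (^-monoʳ-≤ 2 c≤Y)) p≰

    cofactor-large : ∀ q l e → Q q → Prime l → q ∸ 1 ≡ l * e → 2 ^ η ≤ e
    cofactor-large q l e Qq pl eq = ≮⇒≥ λ e<2^η → proj₁ (proj₂ (proj₂ (proj₂ (proj₂ (Q⊆P q Qq)))))
      (cof q e l (Q< q Qq) (Qp q Qq) (n≢0⇒n>0 (λ { refl → <⇒≢ (n>0 q Qq) (sym (trans eq (*-zeroʳ l))) })) e<2^η (∣n⇒<N q l Qq (subst (l ∣_) (sym eq) (m∣m*n e))) pl (trans eq (*-comm l e)))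

    level : ∀ q l → Q q → Prime l → l ∣ q ∸ 1 → lg l + η ≤ k
    level q l Qq pl (divides e eq) = <⇒≤ (≰⇒> λ k≤ → <⇒≱ (n<N q Qq) (begin
      2 ^ k ≤⟨ ^-monoʳ-≤ 2 k≤ ⟩
      2 ^ (lg l + η) ≡⟨ ^-distribˡ-+-* 2 (lg l) η ⟩
      2 ^ lg l * 2 ^ η ≤⟨ *-mono-≤ (lg-lower l (<⇒≤ (prime>1 pl))) (cofactor-large q l e Qq pl (trans eq (*-comm e l))) ⟩
      l * e ≡⟨ trans (*-comm l e) (sym eq) ⟩
      q ∸ 1 ∎))
      where open ≤-Reasoning

    level-split : ∀ i x → x ≤ η → i + η ≤ k → (k ∸ i ∸ x) + x + i ≡ k
    level-split i x x≤η le = trans (cong (_+ i) (m∸n+n≡m (m+n≤o⇒m≤o∸n x (≤-trans (≤-reflexive (+-comm x i)) (≤-trans (+-monoʳ-≤ i x≤η) le))))) (m∸n+n≡m (≤-trans (m≤m+n i η) le))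

    ω₀≤η : ω₀ ≤ η
    ω₀≤η = ≤-trans (≤-trans (m≤m+n ω₀ (Y + c)) (≤-trans (≤-reflexive (sym (+-assoc ω₀ Y c))) (n≤1+n _))) ωc≤η
    Y≤η : Y ≤ η
    Y≤η = ≤-trans (≤-trans (m≤n+m Y ω₀) (≤-trans (m≤m+n (ω₀ + Y) c) (n≤1+n _))) ωc≤η

    index≤ : ∀ i → i + η ≤ k → suc i ≤ k ∸ c
    index≤ i le = m+n≤o⇒m≤o∸n (suc i) (≤-trans (≤-trans (≤-reflexive (sym (+-suc i c))) (+-monoʳ-≤ i (≤-trans (s≤s (m≤n+m c (ω₀ + Y))) ωc≤η))) le)

    large-count : ∀ l q → Prime l → z < l → Q q → l ∣ q ∸ 1 → 3 * (suc (b l) * (k * τ)) ≤ S.count l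
    large-count l q pl z<l Qq d = begin
      3 * (suc (b l) * (k * τ)) ≤⟨ *-mono-≤ (n≤1+n 3) (*-mono-≤ (≤-reflexive (1+pred (s + 9))) kτ≤) ⟩
      4 * (2 ^ (s + 9) * 2 ^ (κ + (2 + κ))) ≡⟨ trans (cong (4 *_) (2^-+ (s + 9) (κ + (2 + κ)))) (2^-+ 2 (s + 9 + (κ + (2 + κ)))) ⟩
      2 ^ (2 + (s + 9 + (κ + (2 + κ)))) ≤⟨ ^-monoʳ-≤ 2 {2 + (s + 9 + (κ + (2 + κ)))} {k ∸ c ∸ suc (lg l)} (≤-sub₂ (2 + (s + 9 + (κ + (2 + κ)))) (suc (lg l)) (≤-reflexive (trans (ring s κ c (lg l)) (level-split (lg l) ω₀ ω₀≤η (level q l Qq pl d))))) ⟩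
      2 ^ (k ∸ c ∸ suc (lg l)) ≤⟨ dense-count q l (suc (lg l)) Qq d (<⇒≤ (prime>1 pl)) (<⇒≤ (lg-upper l)) (index≤ (lg l) (level q l Qq pl d)) ⟩
      S.count l ∎
      where
      open ≤-Reasoning
      s : ℕ
      s = k ∸ lg l ∸ ω₀
      ring : ∀ s κ c i → 2 + (s + 9 + (κ + (2 + κ))) + suc i + c ≡ s + (2 * κ + c + 14) + i
      ring = solve-∀

    -- Otherwise e would be a product of at most c prime powers of size at most 2^(3Y), hence at
    -- most 2^(3Yc) < 2^η, but the sieve has discarded such small cofactors.
    rough-prime : ∀ q l e → Q q → Prime l → q ∸ 1 ≡ l * e → ∃ λ s → Prime s × 2 ^ Y < s × s ∣ e
    rough-prime q l e Qq pl eq = case anyUpTo? (λ s → prime? s ×-dec ((2 ^ Y <? s) ×-dec (s ∣? e))) (suc e) of λ where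
        (yes (s , _ , r)) → s , r
        (no none)         → contradiction (<-≤-trans (≤-<-trans (bound none) (^-monoʳ-< 2 (s≤s (s≤s z≤n)) 3Yc<η)) (cofactor-large q l e Qq pl eq)) (<-irrefl refl)
      where
      NoRoughPrime : Set
      NoRoughPrime = ¬ (∃ λ s → s < suc e × Prime s × 2 ^ Y < s × s ∣ e)
      open ≤-Reasoning
      e∣ : e ∣ q ∸ 1
      e∣ = subst (e ∣_) (sym eq) (n∣m*n l)
      1≤e : 1 ≤ e
      1≤e = ≤-trans (m^n>0 2 η) (cofactor-large q l e Qq pl eq)
      ω<c : ω N e ≤ c
      ω<c = ≤-trans (#-mono {P? = PrimeDivisor? e} N {Q? = PrimeDivisor? (q ∸ 1)} (λ p _ (pp , p∣e) → pp , ∣-trans p∣e e∣)) (<⇒≤ (≰⇒> λ le → proj₁ (proj₂ (proj₂ (Q⊆P q Qq))) (n>0 q Qq , le)))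
      powers : NoRoughPrime → ∀ p a → Prime p → p ^ a ∣ e → p ^ a ≤ 2 ^ (3 * Y)
      powers none p zero    pp d = m^n>0 2 (3 * Y)
      powers none p (suc a) pp d = small-power p (q ∸ 1) c Y pp c≤Y (squarefree q Qq) (≮⇒≥ λ lt → none (p , s≤s (∣⇒≤ {{>-nonZero 1≤e}} p∣e) , pp , lt , p∣e)) (suc a) (∣-trans d e∣)
        where
        p∣e : p ∣ e
        p∣e = m*n∣⇒m∣ p (p ^ a) d
      bound : NoRoughPrime → e ≤ 2 ^ (3 * Y * c)
      bound none = begin
        e ≤⟨ prime-powers-bound N e (2 ^ (3 * Y)) 1≤e (∣n⇒<N q e Qq e∣) (powers none) ⟩
        (2 ^ (3 * Y)) ^ ω N e ≡⟨ ^-*-assoc 2 (3 * Y) (ω N e) ⟩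
        2 ^ (3 * Y * ω N e) ≤⟨ ^-monoʳ-≤ 2 (*-monoʳ-≤ (3 * Y) ω<c) ⟩
        2 ^ (3 * Y * c) ∎

    large-near : ∀ l J J′ → Prime l → z < l → l ∤ ∣ J - J′ ∣ → (∀ q e → Q q → q ∸ 1 ≡ l * e → e ∣ ∣ J - J′ ∣) →
                 3 * # N (S.NearBoth? (B l) l J J′) ≤ S.count l
    large-near l J J′ pl z<l l∤ e∣ = go (anyUpTo? (S.Divisible? l) N)
      where
      open ≤-Reasoning
      i s : ℕ
      i = lg l
      s = k ∸ i ∸ ω₀
      go : Dec (∃ λ q → q < N × Q q × l ∣ q ∸ 1) → 3 * # N (S.NearBoth? (B l) l J J′) ≤ S.count l
      go (no none) = ≤-trans (≤-reflexive (cong (3 *_) (#-none {P? = S.NearBoth? (B l) l J J′} N (λ q q<N d → none (q , q<N , proj₁ d))))) z≤n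
      go (yes (q , _ , Qq , d)) = begin
        3 * # N (S.NearBoth? (B l) l J J′) ≤⟨ *-monoʳ-≤ 3 near ⟩
        3 * (2 * (2 ^ ω₀ * (k * (2 ^ (k ∸ i) / 2 ^ Y)))) ≤⟨ *-mono-≤ (n≤1+n 3) (*-monoʳ-≤ 2 (*-monoʳ-≤ (2 ^ ω₀) (*-mono-≤ k≤2^κ (2^-quotient-≤ (k ∸ i) Y Y≤k-i)))) ⟩
        4 * (2 * (2 ^ ω₀ * (2 ^ κ * 2 ^ (k ∸ i ∸ Y)))) ≡⟨ trans (sym (*-assoc 4 2 (2 ^ ω₀ * (2 ^ κ * 2 ^ (k ∸ i ∸ Y))))) (trans (cong (8 *_) (trans (cong (2 ^ ω₀ *_) (2^-+ κ (k ∸ i ∸ Y))) (2^-+ ω₀ (κ + (k ∸ i ∸ Y))))) (2^-+ 3 (ω₀ + (κ + (k ∸ i ∸ Y))))) ⟩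
        2 ^ (3 + (ω₀ + (κ + (k ∸ i ∸ Y)))) ≤⟨ ^-monoʳ-≤ 2 {3 + (ω₀ + (κ + (k ∸ i ∸ Y)))} {k ∸ c ∸ suc i} (≤-sub₂ (3 + (ω₀ + (κ + (k ∸ i ∸ Y)))) (suc i) (≤-reflexive (trans (ring ω₀ κ (k ∸ i ∸ Y) i c) (trans (cong (λ y → (k ∸ i ∸ Y) + y + i) (sym Y≡)) (level-split i Y Y≤η lev))))) ⟩
        2 ^ (k ∸ c ∸ suc i) ≤⟨ dense-count q l (suc i) Qq d (<⇒≤ (prime>1 pl)) (<⇒≤ (lg-upper l)) (index≤ i lev) ⟩
        S.count l ∎
        where
        instance
          2^Y≢0 : NonZero (2 ^ Y)
          2^Y≢0 = m^n≢0 2 Y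
        lev : i + η ≤ k
        lev = level q l Qq pl d
        Y≤k-i : Y ≤ k ∸ i
        Y≤k-i = m+n≤o⇒m≤o∸n Y (≤-trans (≤-reflexive (+-comm Y i)) (≤-trans (+-monoʳ-≤ i Y≤η) lev))
        ring : ∀ ω κ x i c → 3 + (ω + (κ + x)) + suc i + c ≡ x + (ω + κ + c + 4) + i
        ring = solve-∀
        2ⁱ≤l : 2 ^ i ≤ l
        2ⁱ≤l = lg-lower l (<⇒≤ (prime>1 pl))
        lE : 2 ^ k ≤ l * 2 ^ (k ∸ i)
        lE = ≤-trans (≤-reflexive (trans (cong (2 ^_) (sym (m+[n∸m]≡n (≤-trans (m≤m+n i η) lev)))) (^-distribˡ-+-* 2 i (k ∸ i)))) (*-monoˡ-≤ (2 ^ (k ∸ i)) 2ⁱ≤l)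
        BHl : 2 ^ k ≤ 2 * (B l * (2 ^ ω₀ * l))
        BHl = begin
          2 ^ k ≡⟨ cong (2 ^_) (sym (level-split i ω₀ ω₀≤η lev)) ⟩
          2 ^ (s + ω₀ + i) ≡⟨ trans (^-distribˡ-+-* 2 (s + ω₀) i) (cong (_* 2 ^ i) (^-distribˡ-+-* 2 s ω₀)) ⟩
          2 ^ s * 2 ^ ω₀ * 2 ^ i ≤⟨ *-monoʳ-≤ (2 ^ s * 2 ^ ω₀) 2ⁱ≤l ⟩
          2 ^ s * 2 ^ ω₀ * l ≡⟨ *-assoc (2 ^ s) (2 ^ ω₀) l ⟩
          B l * (2 ^ ω₀ * l) ≤⟨ m≤n*m _ 2 ⟩
          2 * (B l * (2 ^ ω₀ * l)) ∎
        near : # N (S.NearBoth? (B l) l J J′) ≤ 2 * (2 ^ ω₀ * (k * (2 ^ (k ∸ i) / 2 ^ Y)))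
        near = NearCount.near-count k N l (B l) (2 ^ ω₀) (2 ^ (k ∸ i)) (2 ^ Y) J J′ pl l∤ lE BHl (S.NearBoth? (B l) l J J′) (λ q′ D → Q< q′ (proj₁ (proj₁ D)))
          (λ { q′ ((Qq′ , divides e eq) , _) → e , trans eq (*-comm e l) , n>0 q′ Qq′ , n<N q′ Qq′ , e∣ q′ e Qq′ (trans eq (*-comm e l)) , rough-prime q′ l e Qq′ pl (trans eq (*-comm e l)) })
          (λ q′ D → proj₂ D)

    Q≤Bb : ∀ q → Q q → 3 * q ≤ 2 * B₁ * suc b₁
    Q≤Bb q Qq = begin
      3 * q ≤⟨ *-mono-≤ (n≤1+n 3) (<⇒≤ (Q< q Qq)) ⟩
      4 * 2 ^ k ≤⟨ *-monoʳ-≤ 4 (^-monoʳ-≤ 2 k≤2h+1) ⟩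
      4 * 2 ^ suc (h + h) ≡⟨ 2^-+ 2 (suc (h + h)) ⟩
      2 ^ (2 + suc (h + h)) ≤⟨ ^-monoʳ-≤ 2 {2 + suc (h + h)} {suc h + (h + 9)} (≤-trans (m≤m+n (2 + suc (h + h)) 7) (≤-reflexive (ring h))) ⟩
      2 ^ (suc h + (h + 9)) ≡⟨ sym (2^-+ (suc h) (h + 9)) ⟩
      2 ^ suc h * 2 ^ (h + 9) ≡⟨ cong (2 * B₁ *_) (sym (1+pred (h + 9))) ⟩
      2 * B₁ * suc b₁ ∎
      where
      open ≤-Reasoning
      ring : ∀ h → 2 + suc (h + h) + 7 ≡ suc h + (h + 9)
      ring = solve-∀

    b₁≢0 : NonZero b₁
    b₁≢0 = >-nonZero (pred>0 h)

    tolerances : S.Tolerances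
    tolerances = record { B₁ = B₁ ; b₁ = b₁ ; b₁≢0 = b₁≢0 ; B = B ; b = b ; b>0 = λ l → pred>0 (k ∸ lg l ∸ ω₀) ; B≤b = λ l → constant (k ∸ lg l ∸ ω₀) ; 4B₁≤ = n≥ ; B₁≤b₁ = constant h ; Q≤Bb = Q≤Bb
      ; small-count = small-count ; large-count = large-count ; large-near = large-near }

    module T = S.Bounds tolerances

  scaleSet : ScaleSet k g
  scaleSet = record
    { Q = Q ; Q? = Q? ; Q-prime = Qp ; Q-lower = Q≥ ; Q-upper = Q< ; lost = lost-total
    ; period = T.L N ; period>0 = T.L-positive N ; order∣period = T.order∣L-total
    ; images = final-bound k T.modulus _ _ (>-nonZero⁻¹ k) (λ i → <⇒≤ (T.modulus<2^k i)) T.union-bound }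

-- The choice of parameters: k is between 2^(128ν) and 2^(128(ν+1)), and all other exponents
-- are polynomials in ν, hence at most 2^ν.
record Exponents : Set where
  field
    ν k e t n κ g c Y β g′ r : ℕ

  ω′ : ℕ
  ω′ = 2 * κ + c + 14
  η : ℕ
  η = t + e

  field
    32≤e    : 32 ≤ e
    e≤32    : e ≤ 32
    300≤ν   : 300 ≤ ν
    n≡      : n ≡ suc ν
    κ≡      : κ ≡ 128 * n
    g≡      : g ≡ 131 * n
    c≡      : c ≡ g + κ
    Y≡      : Y ≡ ω′ + κ + c + 4
    β≡      : β ≡ c + 2 * κ + 11
    g′≡     : g′ ≡ g + (n + 1)
    r≡      : r ≡ 32 * κ + g′
    t-large : 3 * Y * c + (ω′ + Y + c + (r + (β + β))) ≤ t
    η≤2^ν   : η ≤ 2 ^ ν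
    lo      : 2 ^ (128 * ν) ≤ k
    hi      : k ≤ 2 ^ κ

module Parameters (exponents : Exponents) where
  open Exponents exponents

  private
    h a w ζ t′ K : ℕ
    h = k / 2
    a = h ∸ β
    w = k ∸ (a + a)
    -- The rounding error of the sieve is about 2^(ζr), and r ≤ 2^ν keeps ζr ≤ 2^(127ν), well below
    -- k ≥ 2^(128ν). At the same time K² is near 2^(64ν), so ζ²/K² still exceeds the required gain
    -- of about 2^(132ν).
    ζ = 2 ^ (126 * ν)
    t′ = ζ ∸ η
    K = 2 ^ suc e * η ^ e

    pow-≤ : ∀ {a b} → a ≤ b → 2 ^ a ≤ 2 ^ b
    pow-≤ = ^-monoʳ-≤ 2

    t≤η : t ≤ η
    t≤η = m≤m+n t e

    rest≤t : ω′ + Y + c + (r + (β + β)) ≤ t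
    rest≤t = ≤-trans (m≤n+m _ (3 * Y * c)) t-large

    1≤c : 1 ≤ c
    1≤c = ≤-trans (≤-trans (subst (1 ≤_) (sym n≡) (s≤s z≤n)) (≤-trans (m≤n*m n 131) (≤-reflexive (sym g≡)))) (≤-trans (m≤m+n g κ) (≤-reflexive (sym c≡)))

    k≢0 : NonZero k
    k≢0 = >-nonZero (≤-trans (m^n>0 2 (128 * ν)) lo)

    3Yc<η : 3 * Y * c < η
    3Yc<η = <-≤-trans (s≤s (≤-trans (m≤m+n (3 * Y * c) _) t-large)) (≤-trans (≤-reflexive (+-comm 1 t)) (+-monoʳ-≤ t (≤-trans (s≤s z≤n) 32≤e)))

    ωc≤η : suc (ω′ + Y + c) ≤ η
    ωc≤η = ≤-trans (s≤s (≤-trans (m≤m+n (ω′ + Y + c) _) rest≤t)) (≤-trans (≤-reflexive (+-comm 1 t)) (+-monoʳ-≤ t (≤-trans (s≤s z≤n) 32≤e)))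

    r≤η : r ≤ η
    r≤η = ≤-trans (≤-trans (m≤m+n r (β + β)) (≤-trans (m≤n+m _ (ω′ + Y + c)) rest≤t)) t≤η

    1+2β≤η : suc (β + β) ≤ η
    1+2β≤η = ≤-trans (s≤s (≤-trans (m≤n+m (β + β) r) (≤-trans (m≤n+m _ (ω′ + Y + c)) rest≤t))) (≤-trans (≤-reflexive (+-comm 1 t)) (+-monoʳ-≤ t (≤-trans (s≤s z≤n) 32≤e)))

    3Y+β≤η : 3 * Y + β ≤ η
    3Y+β≤η = ≤-trans (+-mono-≤ (≤-trans (≤-reflexive (sym (*-identityʳ (3 * Y)))) (*-monoʳ-≤ (3 * Y) 1≤c)) (≤-trans (m≤m+n β β) (≤-trans (m≤n+m (β + β) r) (m≤n+m _ (ω′ + Y + c))))) (≤-trans t-large t≤η)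

    g′≤r : g′ ≤ r
    g′≤r = ≤-trans (m≤n+m g′ (32 * κ)) (≤-reflexive (sym r≡))

    ν≤mν : ∀ m .{{_ : NonZero m}} → ν ≤ m * ν
    ν≤mν m = m≤n*m ν m

    exp₁ : 1 + 127 * ν + 2 ≤ 128 * ν
    exp₁ = linear (1 + 127 * ν + 2) (128 * ν) 297 300≤ν (ring ν)
      where
      ring : ∀ ν → 1 + 127 * ν + 2 + ν + 297 ≡ 128 * ν + 300
      ring = solve-∀
    g≡′ : g ≡ 131 * suc ν
    g≡′ = trans g≡ (cong (131 *_) n≡)
    g′≡′ : g′ ≡ 131 * suc ν + (suc ν + 1)
    g′≡′ = trans g′≡ (cong₂ (λ x y → x + (y + 1)) g≡′ n≡)
    exp₂ : g + (ν + (1 + (ν + 1))) ≤ 127 * ν + 127 * ν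
    exp₂ = subst (λ z → z + (ν + (1 + (ν + 1))) ≤ 127 * ν + 127 * ν) (sym g≡′) (linear (131 * suc ν + (ν + (1 + (ν + 1)))) (127 * ν + 127 * ν) (120 * ν + 167) 300≤ν (ring ν))
      where
      ring : ∀ ν → 131 * suc ν + (ν + (1 + (ν + 1))) + ν + (120 * ν + 167) ≡ 127 * ν + 127 * ν + 300
      ring = solve-∀
    exp₃ : g′ + ((33 + ν * 32) + (33 + ν * 32)) ≤ 126 * ν + 126 * ν
    exp₃ = subst (λ z → z + ((33 + ν * 32) + (33 + ν * 32)) ≤ 126 * ν + 126 * ν) (sym g′≡′) (linear (131 * suc ν + (suc ν + 1) + ((33 + ν * 32) + (33 + ν * 32))) (126 * ν + 126 * ν) (55 * ν + 101) 300≤ν (ring ν))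
      where
      ring : ∀ ν → 131 * suc ν + (suc ν + 1) + ((33 + ν * 32) + (33 + ν * 32)) + ν + (55 * ν + 101) ≡ 126 * ν + 126 * ν + 300
      ring = solve-∀
    exp₄ : g′ + 126 * ν * 32 ≤ 2 * r
    exp₄ = subst₂ (λ x y → x + 126 * ν * 32 ≤ 2 * y) (sym g′≡′) (sym (trans r≡ (cong₂ (λ x y → 32 * x + y) (trans κ≡ (cong (128 *_) n≡)) g′≡′))) (≤-trans (m≤m+n _ (4292 * ν + 8325)) (≤-reflexive (ring ν)))
      where
      ring : ∀ ν → 131 * suc ν + (suc ν + 1) + 126 * ν * 32 + (4292 * ν + 8325) ≡ 2 * (32 * (128 * suc ν) + (131 * suc ν + (suc ν + 1)))
      ring = solve-∀

    2^127 : 2 ^ (1 + 127 * ν + 2) ≤ k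
    2^127 = ≤-trans (pow-≤ exp₁) lo

    h+h≤k : h + h ≤ k
    h+h≤k = ≤-trans (≤-reflexive (trans (cong (h +_) (sym (+-identityʳ h))) (*-comm 2 h))) (m/n*n≤m k 2)
    k≤1+h+h : k ≤ suc (h + h)
    k≤1+h+h = ≤-trans (≤-reflexive (m≡m%n+[m/n]*n k 2)) (+-mono-≤ (s≤s⁻¹ (m%n<n k 2)) (≤-reflexive (trans (*-comm h 2) (cong (h +_) (+-identityʳ h)))))

    2^ν≤2^127ν : 2 ^ ν ≤ 2 ^ (127 * ν)
    2^ν≤2^127ν = pow-≤ (ν≤mν 127)

    8·2^127ν≤k : 8 * 2 ^ (127 * ν) ≤ k
    8·2^127ν≤k = ≤-trans (≤-reflexive (trans (*-comm 8 (2 ^ (127 * ν))) (trans (sym (^-distribˡ-+-* 2 (127 * ν) 3)) (cong (2 ^_) (ring ν))))) 2^127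
      where
      ring : ∀ ν → 127 * ν + 3 ≡ 1 + 127 * ν + 2
      ring = solve-∀

    η+2^127ν≤h : η + 2 ^ (127 * ν) ≤ h
    η+2^127ν≤h = *-cancelˡ-≤ 2 (s≤s⁻¹ (begin
      suc (2 * (η + x)) ≤⟨ s≤s (*-monoʳ-≤ 2 (+-monoˡ-≤ x (≤-trans η≤2^ν 2^ν≤2^127ν))) ⟩
      suc (2 * (x + x)) ≤⟨ +-monoˡ-≤ (2 * (x + x)) (≤-trans (m^n>0 2 (127 * ν)) (m≤n*m x 4)) ⟩
      4 * x + 2 * (x + x) ≡⟨ ring x ⟩
      8 * x ≤⟨ 8·2^127ν≤k ⟩
      k ≤⟨ k≤1+h+h ⟩
      suc (h + h) ≡⟨ cong (λ z → suc (h + z)) (sym (+-identityʳ h)) ⟩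
      suc (2 * h) ∎))
      where
      open ≤-Reasoning
      x : ℕ
      x = 2 ^ (127 * ν)
      ring : ∀ x → 4 * x + 2 * (x + x) ≡ 8 * x
      ring = solve-∀

    β≤η : β ≤ η
    β≤η = ≤-trans (m≤n+m β (3 * Y)) 3Y+β≤η
    η≤h : η ≤ h
    η≤h = ≤-trans (m≤m+n η _) η+2^127ν≤h
    a+β≡h : a + β ≡ h
    a+β≡h = m∸n+n≡m (≤-trans β≤η η≤h)
    3Y≤a : 3 * Y ≤ a
    3Y≤a = m+n≤o⇒m≤o∸n (3 * Y) (≤-trans 3Y+β≤η η≤h)
    a-lower : 2 ^ (127 * ν) ≤ a
    a-lower = m+n≤o⇒m≤o∸n (2 ^ (127 * ν)) (≤-trans (+-monoʳ-≤ (2 ^ (127 * ν)) β≤η) (≤-trans (≤-reflexive (+-comm (2 ^ (127 * ν)) η)) η+2^127ν≤h))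
    η≤k : η ≤ k
    η≤k = ≤-trans η≤h (≤-trans (m≤m+n h h) h+h≤k)
    h+4≤k : h + 4 ≤ k
    h+4≤k = ≤-trans (+-monoʳ-≤ h (≤-trans (≤-trans (m≤m+n 4 28) 32≤e) (≤-trans (m≤n+m e t) η≤h))) h+h≤k

    -- The width w is at most 2β + 1, polynomial in ν, while a is of the order of k; this gap makes
    -- pairs of large primes rare in `wag`.
    w≤2^ν : w ≤ 2 ^ ν
    w≤2^ν = ≤-trans (m≤n+o⇒m∸n≤o k (a + a) (≤-trans k≤1+h+h (≤-reflexive (trans (cong (λ z → suc (z + z)) (sym a+β≡h)) (ring a β))))) (≤-trans 1+2β≤η η≤2^ν)
      where
      ring : ∀ a β → suc (a + β + (a + β)) ≡ a + a + suc (β + β)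
      ring = solve-∀

    wag : 2 ^ g * (w * (2 * (w * 2))) ≤ a * a
    wag = begin
      2 ^ g * (w * (2 * (w * 2))) ≤⟨ *-monoʳ-≤ (2 ^ g) (*-mono-≤ w≤2^ν (*-monoʳ-≤ 2 (*-monoˡ-≤ 2 w≤2^ν))) ⟩
      2 ^ g * (2 ^ ν * (2 ^ 1 * (2 ^ ν * 2 ^ 1))) ≡⟨ trans (cong (λ z → 2 ^ g * (2 ^ ν * z)) (trans (cong (2 ^ 1 *_) (2^-+ ν 1)) (2^-+ 1 (ν + 1)))) (trans (cong (2 ^ g *_) (2^-+ ν (1 + (ν + 1)))) (2^-+ g (ν + (1 + (ν + 1))))) ⟩
      2 ^ (g + (ν + (1 + (ν + 1)))) ≤⟨ pow-≤ exp₂ ⟩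
      2 ^ (127 * ν + 127 * ν) ≡⟨ sym (2^-+ (127 * ν) (127 * ν)) ⟩
      2 ^ (127 * ν) * 2 ^ (127 * ν) ≤⟨ *-mono-≤ a-lower a-lower ⟩
      a * a ∎
      where open ≤-Reasoning

    η≤ζ : η ≤ ζ
    η≤ζ = ≤-trans η≤2^ν (pow-≤ (ν≤mν 126))
    ζ≡ : t′ + η ≡ ζ
    ζ≡ = m∸n+n≡m η≤ζ

    x₀ : ℕ
    x₀ = suc e + ν * e

    K≤ : K ≤ 2 ^ x₀
    K≤ = ≤-trans (*-monoʳ-≤ (2 ^ suc e) (≤-trans (^-monoˡ-≤ e η≤2^ν) (≤-reflexive (^-*-assoc 2 ν e)))) (≤-reflexive (2^-+ (suc e) (ν * e)))

    hK : 2 ^ g′ * (K * K) ≤ ζ * ζ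
    hK = begin
      2 ^ g′ * (K * K) ≤⟨ *-monoʳ-≤ (2 ^ g′) (*-mono-≤ K≤ K≤) ⟩
      2 ^ g′ * (2 ^ x₀ * 2 ^ x₀) ≡⟨ trans (cong (2 ^ g′ *_) (2^-+ x₀ x₀)) (2^-+ g′ (x₀ + x₀)) ⟩
      2 ^ (g′ + (x₀ + x₀)) ≤⟨ pow-≤ (≤-trans (+-monoʳ-≤ g′ (+-mono-≤ x₀≤ x₀≤)) exp₃) ⟩
      2 ^ (126 * ν + 126 * ν) ≡⟨ sym (2^-+ (126 * ν) (126 * ν)) ⟩
      ζ * ζ ∎
      where
      open ≤-Reasoning
      x₀≤ : x₀ ≤ 33 + ν * 32
      x₀≤ = +-mono-≤ (s≤s e≤32) (*-monoʳ-≤ ν e≤32)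

    hr : 2 ^ g′ * ζ ^ e ≤ 4 ^ r
    hr = begin
      2 ^ g′ * ζ ^ e ≡⟨ cong (2 ^ g′ *_) (^-*-assoc 2 (126 * ν) e) ⟩
      2 ^ g′ * 2 ^ (126 * ν * e) ≡⟨ 2^-+ g′ (126 * ν * e) ⟩
      2 ^ (g′ + 126 * ν * e) ≤⟨ pow-≤ (≤-trans (+-monoʳ-≤ g′ (*-monoʳ-≤ (126 * ν) e≤32)) exp₄) ⟩
      2 ^ (2 * r) ≡⟨ sym (^-*-assoc 2 2 r) ⟩
      4 ^ r ∎
      where open ≤-Reasoning

    1≤r : 1 ≤ r
    1≤r = ≤-trans (≤-trans (m≤n+m 1 n) (≤-trans (m≤n+m (n + 1) g) (≤-reflexive (sym g′≡)))) g′≤r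

    hD : 2 ^ g′ * ((6 * suc (2 ^ ζ)) ^ r + 2 ^ ζ) ≤ 2 ^ (k ∸ η)
    hD = begin
      2 ^ g′ * ((6 * suc (2 ^ ζ)) ^ r + 2 ^ ζ) ≤⟨ *-monoʳ-≤ (2 ^ g′) (+-mono-≤ (≤-trans (^-monoˡ-≤ r base) (≤-reflexive (^-*-assoc 2 (ζ + 4) r))) (pow-≤ (≤-trans (m≤m+n ζ 4) (≤-trans (≤-reflexive (sym (*-identityʳ (ζ + 4)))) (*-monoʳ-≤ (ζ + 4) 1≤r))))) ⟩
      2 ^ g′ * (2 ^ x + 2 ^ x) ≡⟨ trans (cong (2 ^ g′ *_) (sym (2^-suc x))) (2^-+ g′ (suc x)) ⟩
      2 ^ (g′ + suc x) ≤⟨ pow-≤ (m+n≤o⇒m≤o∸n (g′ + suc x) total) ⟩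
      2 ^ (k ∸ η) ∎
      where
      open ≤-Reasoning
      x : ℕ
      x = (ζ + 4) * r
      base : 6 * suc (2 ^ ζ) ≤ 2 ^ (ζ + 4)
      base = ≤-trans (constant-≤ 6 16 (2 ^ ζ) (m^n>0 2 ζ) (m≤m+n 12 4)) (≤-reflexive (trans (*-comm 16 (2 ^ ζ)) (2^-+ ζ 4)))
      4≤ζ : 4 ≤ ζ
      4≤ζ = ≤-trans (≤-trans (≤-trans (m≤m+n 4 28) 32≤e) (m≤n+m e t)) η≤ζ
      x≤ : x ≤ 2 * 2 ^ (127 * ν)
      x≤ = begin
        (ζ + 4) * r ≤⟨ *-mono-≤ (+-monoʳ-≤ ζ 4≤ζ) (≤-trans r≤η η≤2^ν) ⟩
        (ζ + ζ) * 2 ^ ν ≡⟨ ring₁ ζ (2 ^ ν) ⟩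
        2 * (2 ^ ν * ζ) ≡⟨ cong (2 *_) (trans (2^-+ ν (126 * ν)) refl) ⟩
        2 * 2 ^ (127 * ν) ∎
        where
        ring₁ : ∀ a b → (a + a) * b ≡ 2 * (b * a)
        ring₁ = solve-∀
      y : ℕ
      y = 2 ^ (127 * ν)
      small : ∀ {m} → m ≤ η → m ≤ y
      small m≤η = ≤-trans m≤η (≤-trans η≤2^ν 2^ν≤2^127ν)
      total : g′ + suc x + η ≤ k
      total = begin
        g′ + suc x + η ≤⟨ +-mono-≤ (+-mono-≤ (small (≤-trans g′≤r r≤η)) (+-mono-≤ (m^n>0 2 (127 * ν)) x≤)) (small ≤-refl) ⟩
        y + (y + 2 * y) + y ≤⟨ m≤m+n _ (3 * y) ⟩
        y + (y + 2 * y) + y + 3 * y ≡⟨ ring₂ y ⟩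
        8 * y ≤⟨ 8·2^127ν≤k ⟩
        k ∎
        where
        ring₂ : ∀ y → y + (y + 2 * y) + y + 3 * y ≡ 8 * y
        ring₂ = solve-∀

    sieve : SieveParameters
    sieve = record { k = k ; g = g′ ; r = r ; e′ = e ; η₀ = e ; t = t ; t′ = t′ ; 32≤e′ = 32≤e ; 32≤η₀ = 32≤e ; η≤k = η≤k
      ; hK = subst (λ z → 2 ^ g′ * (K * K) ≤ z * z) (sym ζ≡) hK
      ; 1≤ζ = ≤-trans (≤-trans (≤-trans (s≤s z≤n) 32≤e) (m≤n+m e t)) (m≤n+m η t′)
      ; hr = subst (λ z → 2 ^ g′ * z ^ e ≤ 4 ^ r) (sym ζ≡) hr
      ; hD = subst (λ z → 2 ^ g′ * ((6 * suc (2 ^ z)) ^ r + 2 ^ z) ≤ 2 ^ (k ∸ η)) (sym ζ≡) hD }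

    module Sieve = CofactorSieve sieve

    -- The n + 1 extra bits of g′ over g pay for 3η ≤ 2^(n+1), the price of summing over all
    -- cofactors.
    cof-count : 2 ^ g * # (2 ^ k) Sieve.AnyCofactor? ≤ 2 ^ k
    cof-count = *-cancelˡ-≤ (2 ^ (n + 1)) {{m^n≢0 2 (n + 1)}} (begin
      2 ^ (n + 1) * (2 ^ g * s) ≡⟨ trans (sym (*-assoc (2 ^ (n + 1)) (2 ^ g) s)) (cong (_* s) (trans (2^-+ (n + 1) g) (cong (2 ^_) (trans (+-comm (n + 1) g) (sym g′≡))))) ⟩
      2 ^ g′ * s ≤⟨ Sieve.any-cofactor-count ⟩
      η * (3 * 2 ^ k) ≤⟨ *-mono-≤ η≤2^ν (*-monoˡ-≤ (2 ^ k) (n≤1+n 3)) ⟩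
      2 ^ ν * (2 ^ 2 * 2 ^ k) ≡⟨ trans (sym (*-assoc (2 ^ ν) (2 ^ 2) (2 ^ k))) (cong (_* 2 ^ k) (trans (2^-+ ν 2) (cong (2 ^_) (trans (ring ν) (cong (_+ 1) (sym n≡)))))) ⟩
      2 ^ (n + 1) * 2 ^ k ∎)
      where
      open ≤-Reasoning
      s : ℕ
      s = # (2 ^ k) Sieve.AnyCofactor?
      ring : ∀ ν → ν + 2 ≡ suc ν + 1
      ring = solve-∀

  scale : ScaleSet k g
  scale = ScaleConstruction.scaleSet record
    { k = k ; g = g ; κ = κ ; c = c ; β = β ; h = h ; a = a ; w = w ; Y = Y ; η = η ; k≢0 = k≢0 ; k≤2^κ = hi ; g+κ≤c = ≤-reflexive (sym c≡) ; Y≡ = Y≡ ; 3Yc<η = 3Yc<η ; ωc≤η = ωc≤η ; η≤k = η≤k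
    ; 2h≤k = h+h≤k ; k≤2h+1 = k≤1+h+h ; a+β≡h = a+β≡h ; β≡ = β≡ ; 3Y≤a = 3Y≤a ; c≤Y = ≤-trans (≤-trans (m≤n+m c (ω′ + κ)) (m≤m+n (ω′ + κ + c) 4)) (≤-reflexive (sym Y≡)) ; w≡ = refl
    ; h+4≤k = h+4≤k ; wag = wag ; Cof? = Sieve.AnyCofactor? ; cof = λ q e₀ l _ pq 0<e e< l< pl eq → e₀ , e< , pq , 0<e , l , l< , pl , eq ; cof-count = cof-count }

-- Totients congruent to 2 modulo 4

-- Counting 0 ≤ k < n rather than 1 ≤ k ≤ n suits residues modulo n; the totals agree because the
-- endpoints 0 and n have the same greatest common divisor with n.
coprimeCount : ℕ → ℕ
coprimeCount n = # n (λ k → gcd k n ≟ 1)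

private
  gcd-0-n : ∀ n → gcd 0 n ≡ gcd n n
  gcd-0-n n = trans (gcd[0,n]≡n n) (sym (gcd[n,n]≡n n))
    where
    gcd[0,n]≡n : ∀ n → gcd 0 n ≡ n
    gcd[0,n]≡n n = ∣-antisym (gcd[m,n]∣n 0 n) (gcd-greatest (n ∣0) ∣-refl)
    gcd[n,n]≡n : ∀ n → gcd n n ≡ n
    gcd[n,n]≡n n = ∣-antisym (gcd[m,n]∣m n n) (gcd-greatest ∣-refl ∣-refl)

  length-filter : ∀ {P : ℕ → Set} (P? : Decidable P) (f : ℕ → ℕ) n →
    length (filter P? (map suc (applyUpTo f n))) ≡ Σ< n (λ i → 𝟙 (P? (suc (f i))))
  length-filter P? f zero    = refl
  length-filter P? f (suc n) = trans (step (P? (suc (f 0)))) (sym (Σ-shift n (λ i → 𝟙 (P? (suc (f i))))))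
    where
    rest : ℕ
    rest = Σ< n (λ i → 𝟙 (P? (suc (f (suc i)))))
    step : (d : Dec _) → length (filter P? (suc (f 0) ∷ map suc (applyUpTo (f ∘ suc) n))) ≡ 𝟙 (P? (suc (f 0))) + rest
    step _ with P? (suc (f 0))
    ... | yes _ = cong suc (length-filter P? (f ∘ suc) n)
    ... | no _  = length-filter P? (f ∘ suc) n

φ≡coprimeCount : ∀ n → φ n ≡ coprimeCount n
φ≡coprimeCount n = begin
  φ n ≡⟨ length-filter (λ k → gcd k n ≟ 1) id n ⟩
  Σ< n (λ i → 𝟙 (gcd (suc i) n ≟ 1)) ≡⟨ +-cancelˡ-≡ (𝟙 (gcd 0 n ≟ 1)) _ _ (begin
    𝟙 (gcd 0 n ≟ 1) + Σ< n (λ i → 𝟙 (gcd (suc i) n ≟ 1)) ≡⟨ sym (Σ-shift n (λ k → 𝟙 (gcd k n ≟ 1))) ⟩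
    coprimeCount n + 𝟙 (gcd n n ≟ 1) ≡⟨ cong (λ z → coprimeCount n + 𝟙 (z ≟ 1)) (sym (gcd-0-n n)) ⟩
    coprimeCount n + 𝟙 (gcd 0 n ≟ 1) ≡⟨ +-comm (coprimeCount n) _ ⟩
    𝟙 (gcd 0 n ≟ 1) + coprimeCount n ∎) ⟩
  coprimeCount n ∎
  where open ≡-Reasoning

#-cong : ∀ N {P R : ℕ → Set} (P? : Decidable P) (R? : Decidable R) → (∀ i → i < N → (P i → R i) × (R i → P i)) → # N P? ≡ # N R?
#-cong N P? R? h = Σ-cong N (λ i i<N → ≤-antisym (𝟙-mono (proj₁ (h i i<N)) (P? i) (R? i)) (𝟙-mono (proj₂ (h i i<N)) (R? i) (P? i)))

#-complement : ∀ N {P : ℕ → Set} (P? : Decidable P) → # N P? + # N (λ i → ¬? (P? i)) ≡ N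
#-complement N P? = trans (sym (Σ-+ N _ _)) (trans (Σ-cong N (λ i _ → both (P? i))) (trans (Σ-const N 1) (*-identityʳ N)))
  where
  both : ∀ {P : Set} (d : Dec P) → 𝟙 d + 𝟙 (¬? d) ≡ 1
  both (yes _) = refl
  both (no _)  = refl

-- Injectivity bounds the count from one side; the other side is the same bound for the complement.
#-permute : ∀ N {P : ℕ → Set} (P? : Decidable P) (σ : ℕ → ℕ) → (∀ i → i < N → σ i < N) → (∀ i j → i < N → j < N → σ i ≡ σ j → i ≡ j) →
            # N (λ i → P? (σ i)) ≡ # N P?
#-permute N P? σ σ< inj = ≤-antisym (Σ-inject N N σ (λ b → 𝟙 (P? b)) σ< inj)
  (+-cancelʳ-≤ (# N (λ i → ¬? (P? i))) _ _ (begin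
    # N P? + # N (λ i → ¬? (P? i)) ≡⟨ trans (#-complement N P?) (sym (#-complement N (λ i → P? (σ i)))) ⟩
    # N (λ i → P? (σ i)) + # N (λ i → ¬? (P? (σ i))) ≤⟨ +-monoʳ-≤ (# N (λ i → P? (σ i))) (Σ-inject N N σ (λ b → 𝟙 (¬? (P? b))) σ< inj) ⟩
    # N (λ i → P? (σ i)) + # N (λ i → ¬? (P? i)) ∎))
  where open ≤-Reasoning

chinese-count : ∀ m n .{{_ : NonZero m}} .{{_ : NonZero n}} → Coprime m n → {P R : ℕ → Set} (P? : Decidable P) (R? : Decidable R) →
                # (n * m) (λ a → P? (a % m) ×-dec R? (a % n)) ≡ # m P? * # n R?
chinese-count m n co P? R? = begin
  # (n * m) (λ a → P? (a % m) ×-dec R? (a % n)) ≡⟨ Σ-radix m n _ ⟩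
  Σ< n (λ i → Σ< m (λ j → 𝟙 (P? ((j + i * m) % m) ×-dec R? ((j + i * m) % n)))) ≡⟨ Σ-swap n m _ ⟩
  Σ< m (λ j → Σ< n (λ i → 𝟙 (P? ((j + i * m) % m) ×-dec R? ((j + i * m) % n)))) ≡⟨ Σ-cong m (λ j j<m → Σ-cong n (λ i _ → trans (both (P? ((j + i * m) % m)) (R? ((j + i * m) % n)))
                                                                                         (cong (λ z → 𝟙 (P? z) * 𝟙 (R? ((j + i * m) % n))) (trans ([m+kn]%n≡m%n j i m) (m<n⇒m%n≡m j<m))))) ⟩
  Σ< m (λ j → Σ< n (λ i → 𝟙 (P? j) * 𝟙 (R? ((j + i * m) % n)))) ≡⟨ Σ-cong m (λ j _ → trans (Σ-*ˡ (𝟙 (P? j)) n _) (cong (𝟙 (P? j) *_) (#-permute n R? (λ i → (j + i * m) % n) (λ i _ → m%n<n (j + i * m) n) (inj j)))) ⟩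
  Σ< m (λ j → 𝟙 (P? j) * # n R?) ≡⟨ Σ-*ʳ (# n R?) m _ ⟩
  # m P? * # n R? ∎
  where
  open ≡-Reasoning
  open Congruence n
  both : ∀ {A B : Set} (p : Dec A) (r : Dec B) → 𝟙 (p ×-dec r) ≡ 𝟙 p * 𝟙 r
  both (yes _) (yes _) = refl
  both (yes _) (no _)  = refl
  both (no _)  _       = refl
  inj : ∀ j i i′ → i < n → i′ < n → j + i * m ≈ j + i′ * m → i ≡ i′
  inj j i i′ i<n i′<n e = ≈⇒≡ i<n i′<n (∣⇒≈ i i′ (coprime-divisor (Coprime.sym co) (subst (n ∣_) (trans (∣m+n-m+o∣≡∣n-o∣ j (i * m) (i′ * m)) (trans (cong₂ ∣_-_∣ (*-comm i m) (*-comm i′ m)) (sym (*-distribˡ-∣-∣ m i i′)))) (≈⇒∣ (j + i * m) (j + i′ * m) e))))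

private
  gcd≡1⇒coprime : ∀ {k n} → gcd k n ≡ 1 → Coprime k n
  gcd≡1⇒coprime e (d∣k , d∣n) = ∣1⇒≡1 (subst (_ ∣_) e (gcd-greatest d∣k d∣n))

  coprime⇒gcd≡1 : ∀ {k n} → Coprime k n → gcd k n ≡ 1
  coprime⇒gcd≡1 {k} {n} co = co (gcd[m,n]∣m k n , gcd[m,n]∣n k n)

  ∣%⇒∣ : ∀ {d n} a .{{_ : NonZero n}} → d ∣ n → d ∣ a % n → d ∣ a
  ∣%⇒∣ {d} {n} a d∣n d∣% = subst (d ∣_) (sym (m≡m%n+[m/n]*n a n)) (∣m∣n⇒∣m+n d∣% (∣n⇒∣m*n (a / n) d∣n))

  ∣⇒∣% : ∀ {d n} a .{{_ : NonZero n}} → d ∣ n → d ∣ a → d ∣ a % n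
  ∣⇒∣% {d} {n} a d∣n d∣a = ∣m+n∣m⇒∣n (subst (d ∣_) (trans (m≡m%n+[m/n]*n a n) (+-comm (a % n) _)) d∣a) (∣n⇒∣m*n (a / n) d∣n)

coprimeCount-* : ∀ m n .{{_ : NonZero m}} .{{_ : NonZero n}} → Coprime m n → coprimeCount (n * m) ≡ coprimeCount m * coprimeCount n
coprimeCount-* m n co = trans (#-cong (n * m) (λ a → gcd a (n * m) ≟ 1) (λ a → (gcd (a % m) m ≟ 1) ×-dec (gcd (a % n) n ≟ 1)) (λ a _ → to a , from a))
                              (chinese-count m n co (λ a → gcd a m ≟ 1) (λ a → gcd a n ≟ 1))
  where
  to : ∀ a → gcd a (n * m) ≡ 1 → gcd (a % m) m ≡ 1 × gcd (a % n) n ≡ 1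
  to a e = coprime⇒gcd≡1 (λ (d∣ , d∣m) → gcd≡1⇒coprime e (∣%⇒∣ a d∣m d∣ , ∣n⇒∣m*n n d∣m)) , coprime⇒gcd≡1 (λ (d∣ , d∣n) → gcd≡1⇒coprime e (∣%⇒∣ a d∣n d∣ , ∣m⇒∣m*n m d∣n))
  from : ∀ a → gcd (a % m) m ≡ 1 × gcd (a % n) n ≡ 1 → gcd a (n * m) ≡ 1
  from a (e , e′) = coprime⇒gcd≡1 λ {d} (d∣a , d∣nm) → gcd≡1⇒coprime e (∣⇒∣% a (d∣m d∣a d∣nm) d∣a , d∣m d∣a d∣nm)
    where
    d∣m : ∀ {d} → d ∣ a → d ∣ n * m → d ∣ m
    d∣m {d} d∣a d∣nm = coprime-divisor (λ (x∣d , x∣n) → gcd≡1⇒coprime e′ (∣⇒∣% a x∣n (∣-trans x∣d d∣a) , x∣n)) d∣nm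

coprimeCount-prime-power : ∀ {p} a → Prime p → coprimeCount (p ^ suc a) ≡ p ^ a * (p ∸ 1)
coprimeCount-prime-power {p} a pp = begin
  # (p * p ^ a) (λ k → gcd k (p ^ suc a) ≟ 1) ≡⟨ #-cong (p * p ^ a) (λ k → gcd k (p ^ suc a) ≟ 1) (λ k → ¬? (p ∣? k)) (λ k _ → to k , from k) ⟩
  # (p * p ^ a) (λ k → ¬? (p ∣? k)) ≡⟨ cong (λ z → # z (λ k → ¬? (p ∣? k))) (*-comm p (p ^ a)) ⟩
  # (p ^ a * p) (λ k → ¬? (p ∣? k)) ≡⟨ Σ-radix p (p ^ a) _ ⟩
  Σ< (p ^ a) (λ i → # p (λ j → ¬? (p ∣? j + i * p))) ≡⟨ Σ-cong (p ^ a) (λ i _ → row i) ⟩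
  Σ< (p ^ a) (λ _ → p ∸ 1) ≡⟨ Σ-const (p ^ a) (p ∸ 1) ⟩
  p ^ a * (p ∸ 1) ∎
  where
  open ≡-Reasoning
  p≡ : p ≡ suc (p ∸ 1)
  p≡ = sym (m+[n∸m]≡n (<⇒≤ (prime>1 pp)))
  to : ∀ k → gcd k (p ^ suc a) ≡ 1 → p ∤ k
  to k e p∣k = <⇒≢ (prime>1 pp) (sym (gcd≡1⇒coprime e (p∣k , m∣m*n (p ^ a))))
  from : ∀ k → p ∤ k → gcd k (p ^ suc a) ≡ 1
  from k p∤k = coprime⇒gcd≡1 (λ (d∣k , d∣p) → coprime-^ k (suc a) pp p∤k (d∣p , d∣k))
  row : ∀ i → # p (λ j → ¬? (p ∣? j + i * p)) ≡ p ∸ 1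
  row i = begin
    # p (λ j → ¬? (p ∣? j + i * p)) ≡⟨ #-cong p (λ j → ¬? (p ∣? j + i * p)) (λ j → ¬? (p ∣? j)) (λ j _ → (λ ∤ d → ∤ (∣m∣n⇒∣m+n d (n∣m*n i))) , (λ ∤ d → ∤ (∣m+n∣m⇒∣n (subst (p ∣_) (+-comm j (i * p)) d) (n∣m*n i)))) ⟩
    # p (λ j → ¬? (p ∣? j)) ≡⟨ cong (λ z → # z (λ j → ¬? (p ∣? j))) p≡ ⟩
    # (suc (p ∸ 1)) (λ j → ¬? (p ∣? j)) ≡⟨ Σ-shift (p ∸ 1) (λ j → 𝟙 (¬? (p ∣? j))) ⟩
    𝟙 (¬? (p ∣? 0)) + # (p ∸ 1) (λ j → ¬? (p ∣? suc j)) ≡⟨ cong₂ _+_ (𝟙-no (λ ∤ → ∤ (p ∣0)) (¬? (p ∣? 0))) (#-all {P? = λ j → ¬? (p ∣? suc j)} (p ∸ 1) (λ j j< → ∤-small z<s (≤-trans (s≤s j<) (≤-reflexive (sym p≡))))) ⟩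
    p ∸ 1 ∎

private
  split-off : ∀ {p} n → Prime p → p ∣ n → 1 ≤ n → ∃ λ b → ∃ λ m → p ∤ m × 1 ≤ m × coprimeCount n ≡ p ^ b * (p ∸ 1) * coprimeCount m
  split-off {p} n pp p∣n 1≤n with prime-part pp n 1≤n
  ... | zero  , m , refl , p∤m = contradiction (subst (p ∣_) (+-identityʳ m) p∣n) p∤m
  ... | suc b , m , refl , p∤m = b , m , p∤m , >-nonZero⁻¹ m , trans (cong coprimeCount (*-comm (p ^ suc b) m))
        (trans (coprimeCount-* (p ^ suc b) m (coprime-^ m (suc b) pp p∤m)) (cong (_* coprimeCount m) (coprimeCount-prime-power b pp)))
    where
    instance
      m≢0 : NonZero m
      m≢0 = m*n≢0⇒n≢0 (p ^ suc b) {{>-nonZero 1≤n}}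
      pᵇ≢0 : NonZero (p ^ suc b)
      pᵇ≢0 = m^n≢0 p (suc b) {{prime⇒nonZero pp}}

  odd-factor : ∀ n → 1 ≤ n → (∃ λ p → Prime p × p ≢ 2 × p ∣ n) ⊎ (∃ λ a → n ≡ 2 ^ a)
  odd-factor n 1≤n with prime-part prime[2] n 1≤n
  ... | a , m , refl , 2∤m with m ≟ 1
  ...   | yes refl = inj₂ (a , *-identityʳ (2 ^ a))
  ...   | no m≢1 with prime-factor m (≤∧≢⇒< (>-nonZero⁻¹ m {{m*n≢0⇒n≢0 (2 ^ a) {{>-nonZero 1≤n}}}}) (m≢1 ∘ sym))
  ...     | p , pp , p∣m = inj₁ (p , pp , (λ { refl → 2∤m p∣m }) , ∣n⇒∣m*n (2 ^ a) p∣m)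

coprimeCount-even : ∀ n → 2 < n → 2 ∣ coprimeCount n
coprimeCount-even n 2<n with odd-factor n (≤-trans (s≤s z≤n) 2<n)
... | inj₁ (p , pp , p≢2 , p∣n) with split-off n pp p∣n (≤-trans (s≤s z≤n) 2<n)
...   | b , m , _ , _ , eq = subst (2 ∣_) (sym eq) (∣m⇒∣m*n (coprimeCount m) (∣n⇒∣m*n (p ^ b) (odd-prime pp p≢2)))
coprimeCount-even n 2<n | inj₂ (zero , refl) = contradiction 2<n λ { (s≤s ()) }
coprimeCount-even n 2<n | inj₂ (suc zero , refl) = contradiction 2<n (<-irrefl refl)
coprimeCount-even n 2<n | inj₂ (suc (suc a) , refl) = subst (2 ∣_) (sym (coprimeCount-prime-power (suc a) prime[2])) (∣m⇒∣m*n 1 (m∣m*n (2 ^ a)))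

-- Two odd prime factors, or one and a factor 4, make φ(n) divisible by 4.
φ≡2[mod4] : ∀ n → 1 ≤ n → φ n % 4 ≡ 2 → ∃ λ p → ∃ λ j → Prime p × φ n ≡ p ^ j * (p ∸ 1)
φ≡2[mod4] n 1≤n φ%4≡2 = go (odd-factor n 1≤n)
  where
  4∤ : 4 ∤ coprimeCount n
  4∤ d = case trans (sym φ%4≡2) (n∣m⇒m%n≡0 (φ n) 4 (subst (4 ∣_) (sym (φ≡coprimeCount n)) d)) of λ ()
  Result : Set
  Result = ∃ λ p → ∃ λ j → Prime p × φ n ≡ p ^ j * (p ∸ 1)
  go : (∃ λ p → Prime p × p ≢ 2 × p ∣ n) ⊎ (∃ λ a → n ≡ 2 ^ a) → Result
  go (inj₂ (zero , refl)) = case φ%4≡2 of λ ()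
  go (inj₂ (suc a , refl)) = 2 , a , prime[2] , trans (φ≡coprimeCount n) (coprimeCount-prime-power a prime[2])
  go (inj₁ (p , pp , p≢2 , p∣n)) with split-off n pp p∣n 1≤n
  ... | b , m , p∤m , 1≤m , eq with 2 <? m
  ...   | yes 2<m = contradiction (subst (4 ∣_) (sym eq) (*-pres-∣ {o = 2} {p = 2} (∣n⇒∣m*n (p ^ b) (odd-prime pp p≢2)) (coprimeCount-even m 2<m))) 4∤
  ...   | no 2≮m = p , b , pp , trans (φ≡coprimeCount n) (trans eq (trans (cong (p ^ b * (p ∸ 1) *_) (one m 1≤m (≮⇒≥ 2≮m))) (*-identityʳ _)))
    where
    one : ∀ m → 1 ≤ m → m ≤ 2 → coprimeCount m ≡ 1
    one (suc zero) _ _ = refl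
    one (suc (suc zero)) _ _ = refl
    one (suc (suc (suc _))) _ (s≤s (s≤s ()))

-- Growth of the exponents as functions of ν

private
  Linear Quadratic : (ℕ → ℕ) → Set
  Linear f    = ∃ λ a → ∀ ν → f ν ≤ a * suc ν
  Quadratic f = ∃ λ a → ∀ ν → f ν ≤ a * (suc ν * suc ν)

  linear-const : ∀ c → Linear (λ _ → c)
  linear-const c = c , λ ν → m≤m*n c (suc ν)

  linear-scale : ∀ c → Linear (λ ν → c * suc ν)
  linear-scale c = c , λ ν → ≤-refl

  linear-+ : ∀ {f g} → Linear f → Linear g → Linear (λ ν → f ν + g ν)
  linear-+ (a , h) (b , h′) = a + b , λ ν → ≤-trans (+-mono-≤ (h ν) (h′ ν)) (≤-reflexive (sym (*-distribʳ-+ (suc ν) a b)))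

  linear-* : ∀ c {f} → Linear f → Linear (λ ν → c * f ν)
  linear-* c (a , h) = c * a , λ ν → ≤-trans (*-monoʳ-≤ c (h ν)) (≤-reflexive (sym (*-assoc c a (suc ν))))

  quadratic-* : ∀ {f g} → Linear f → Linear g → Quadratic (λ ν → f ν * g ν)
  quadratic-* (a , h) (b , h′) = a * b , λ ν → ≤-trans (*-mono-≤ (h ν) (h′ ν)) (≤-reflexive (*-interchange a (suc ν) b (suc ν)))

  quadratic-linear : ∀ {f} → Linear f → Quadratic f
  quadratic-linear (a , h) = a , λ ν → ≤-trans (h ν) (*-monoʳ-≤ a (m≤m*n (suc ν) (suc ν)))

  quadratic-+ : ∀ {f g} → Quadratic f → Quadratic g → Quadratic (λ ν → f ν + g ν)
  quadratic-+ (a , h) (b , h′) = a + b , λ ν → ≤-trans (+-mono-≤ (h ν) (h′ ν)) (≤-reflexive (sym (*-distribʳ-+ (suc ν * suc ν) a b)))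

  -- With s = ⌊ν/3⌋ one has ν + 1 ≤ 3(s + 1) and (s + 1)³ ≤ 2^(3s), so one of the three factors s +
  -- 1 is free to absorb the constant 9a.
  quadratic≤2^ : ∀ a → ∃ λ ν₀ → ∀ ν → ν₀ ≤ ν → a * (suc ν * suc ν) ≤ 2 ^ ν
  quadratic≤2^ a = a * 9 * 3 , λ ν ν₀≤ν → bound ν (≤-trans (≤-reflexive (sym (m*n/n≡m (a * 9) 3))) (/-monoˡ-≤ 3 ν₀≤ν))
    where
    open ≤-Reasoning
    bound : ∀ ν → a * 9 ≤ ν / 3 → a * (suc ν * suc ν) ≤ 2 ^ ν
    bound ν le = begin
      a * (suc ν * suc ν) ≤⟨ *-monoʳ-≤ a (*-mono-≤ ν≤ ν≤) ⟩
      a * (suc s * 3 * (suc s * 3)) ≡⟨ ring a (suc s) ⟩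
      a * 9 * (suc s * suc s) ≤⟨ *-monoˡ-≤ (suc s * suc s) (m≤n⇒m≤1+n le) ⟩
      suc s * (suc s * suc s) ≤⟨ *-mono-≤ (n<2^n s) (*-mono-≤ (n<2^n s) (n<2^n s)) ⟩
      2 ^ s * (2 ^ s * 2 ^ s) ≡⟨ trans (cong (2 ^ s *_) (2^-+ s s)) (2^-+ s (s + s)) ⟩
      2 ^ (s + (s + s)) ≤⟨ ^-monoʳ-≤ 2 (≤-trans (≤-reflexive (ring₂ s)) (m/n*n≤m ν 3)) ⟩
      2 ^ ν ∎
      where
      s : ℕ
      s = ν / 3
      ring : ∀ a s → a * (s * 3 * (s * 3)) ≡ a * 9 * (s * s)
      ring = solve-∀
      ring₂ : ∀ s → s + (s + s) ≡ s * 3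
      ring₂ = solve-∀
      ν≤ : suc ν ≤ suc s * 3
      ν≤ = ≤-trans (s≤s (≤-reflexive (m≡m%n+[m/n]*n ν 3))) (+-monoˡ-≤ (s * 3) (m%n<n ν 3))

  κ-of g-of c-of ω-of Y-of β-of g′-of r-of t-of : ℕ → ℕ
  κ-of ν = 128 * suc ν
  g-of ν = 131 * suc ν
  c-of ν = g-of ν + κ-of ν
  ω-of ν = 2 * κ-of ν + c-of ν + 14
  Y-of ν = ω-of ν + κ-of ν + c-of ν + 4
  β-of ν = c-of ν + 2 * κ-of ν + 11
  g′-of ν = g-of ν + (suc ν + 1)
  r-of ν = 32 * κ-of ν + g′-of ν
  t-of ν = 3 * Y-of ν * c-of ν + (ω-of ν + Y-of ν + c-of ν + (r-of ν + (β-of ν + β-of ν)))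

  η-quadratic : Quadratic (λ ν → t-of ν + 32)
  η-quadratic = quadratic-+ {t-of} {λ _ → 32} (quadratic-+ {λ ν → 3 * Y-of ν * c-of ν} {λ ν → ω-of ν + Y-of ν + c-of ν + (r-of ν + (β-of ν + β-of ν))}
      (quadratic-* {λ ν → 3 * Y-of ν} {c-of} (linear-* 3 {Y-of} Y-lin) c-lin)
      (quadratic-linear {λ ν → ω-of ν + Y-of ν + c-of ν + (r-of ν + (β-of ν + β-of ν))}
        (linear-+ {λ ν → ω-of ν + Y-of ν + c-of ν} {λ ν → r-of ν + (β-of ν + β-of ν)}
          (linear-+ {λ ν → ω-of ν + Y-of ν} {c-of} (linear-+ {ω-of} {Y-of} ω-lin Y-lin) c-lin)
          (linear-+ {r-of} {λ ν → β-of ν + β-of ν} r-lin (linear-+ {β-of} {β-of} β-lin β-lin)))))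
      (quadratic-linear {λ _ → 32} (linear-const 32))
    where
    κ-lin : Linear κ-of
    κ-lin = linear-scale 128
    g-lin : Linear g-of
    g-lin = linear-scale 131
    c-lin : Linear c-of
    c-lin = linear-+ {g-of} {κ-of} g-lin κ-lin
    ω-lin : Linear ω-of
    ω-lin = linear-+ {λ ν → 2 * κ-of ν + c-of ν} {λ _ → 14} (linear-+ {λ ν → 2 * κ-of ν} {c-of} (linear-* 2 {κ-of} κ-lin) c-lin) (linear-const 14)
    Y-lin : Linear Y-of
    Y-lin = linear-+ {λ ν → ω-of ν + κ-of ν + c-of ν} {λ _ → 4} (linear-+ {λ ν → ω-of ν + κ-of ν} {c-of} (linear-+ {ω-of} {κ-of} ω-lin κ-lin) c-lin) (linear-const 4)
    β-lin : Linear β-of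
    β-lin = linear-+ {λ ν → c-of ν + 2 * κ-of ν} {λ _ → 11} (linear-+ {c-of} {λ ν → 2 * κ-of ν} c-lin (linear-* 2 {κ-of} κ-lin)) (linear-const 11)
    g′-lin : Linear g′-of
    g′-lin = linear-+ {g-of} {λ ν → suc ν + 1} g-lin (linear-+ {suc} {λ _ → 1} (1 , λ ν → ≤-reflexive (sym (*-identityˡ (suc ν)))) (linear-const 1))
    r-lin : Linear r-of
    r-lin = linear-+ {λ ν → 32 * κ-of ν} {g′-of} (linear-* 32 {κ-of} κ-lin) g′-lin

scaleIndex : ℕ → ℕ
scaleIndex k = lg k / 128

opaque
  -- Opaque because ν₀ is a closed numeral far too large to be evaluated.
  scales-exist : ∃ λ ν₀ → ∀ k → 2 ^ (128 * ν₀) ≤ k → ScaleSet k (131 * suc (scaleIndex k)) × ν₀ ≤ scaleIndex k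
  scales-exist = ν₀ , λ k le → build k le
    where
    A : ℕ
    A = proj₁ η-quadratic
    ν₁ ν₀ : ℕ
    ν₁ = proj₁ (quadratic≤2^ A)
    ν₀ = ν₁ + 300
    build : ∀ k → 2 ^ (128 * ν₀) ≤ k → ScaleSet k (131 * suc (scaleIndex k)) × ν₀ ≤ scaleIndex k
    build k le = Parameters.scale record
        { ν = ν ; k = k ; e = 32 ; t = t-of ν ; n = suc ν ; κ = κ-of ν ; g = g-of ν ; c = c-of ν ; Y = Y-of ν ; β = β-of ν ; g′ = g′-of ν ; r = r-of ν
        ; 32≤e = ≤-refl ; e≤32 = ≤-refl ; 300≤ν = ≤-trans (m≤n+m 300 ν₁) ν₀≤ν ; n≡ = refl ; κ≡ = refl ; g≡ = refl ; c≡ = refl ; Y≡ = refl ; β≡ = refl ; g′≡ = refl ; r≡ = refl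
        ; t-large = ≤-refl ; η≤2^ν = η≤ ; lo = lo ; hi = hi } , ν₀≤ν
      where
      1≤k : 1 ≤ k
      1≤k = ≤-trans (m^n>0 2 (128 * ν₀)) le
      ν : ℕ
      ν = scaleIndex k
      128ν₀≤lg : 128 * ν₀ ≤ lg k
      128ν₀≤lg = top-≥ (λ i → 2 ^ i ≤? k) k (128 * ν₀) (≤-trans (<⇒≤ (n<2^n (128 * ν₀))) le) le
      ν₀≤ν : ν₀ ≤ ν
      ν₀≤ν = ≤-trans (≤-reflexive (sym (m*n/m≡n ν₀))) (/-monoˡ-≤ 128 128ν₀≤lg)
        where
        m*n/m≡n : ∀ x → 128 * x / 128 ≡ x
        m*n/m≡n x = trans (cong (_/ 128) (*-comm 128 x)) (m*n/n≡m x 128)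
      lo : 2 ^ (128 * ν) ≤ k
      lo = ≤-trans (^-monoʳ-≤ 2 (≤-trans (≤-reflexive (*-comm 128 ν)) (m/n*n≤m (lg k) 128))) (lg-lower k 1≤k)
      hi : k ≤ 2 ^ (128 * suc ν)
      hi = ≤-trans (<⇒≤ (lg-upper k)) (^-monoʳ-≤ 2 (≤-trans (s≤s (≤-reflexive (m≡m%n+[m/n]*n (lg k) 128))) (≤-trans (+-monoˡ-≤ (ν * 128) (m%n<n (lg k) 128)) (≤-reflexive (*-comm (suc ν) 128)))))
      η≤ : t-of ν + 32 ≤ 2 ^ ν
      η≤ = ≤-trans (proj₂ η-quadratic ν) (proj₂ (quadratic≤2^ A) ν (≤-trans (m≤m+n ν₁ 300) ν₀≤ν))

-- a rem 0 is a junk value; only prime moduli occur.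
_rem_ : ℕ → ℕ → ℕ
a rem zero      = a
a rem q@(suc _) = a % q

rem≡% : ∀ a q .{{_ : NonZero q}} → a rem q ≡ a % q
rem≡% a (suc q) = refl

rem-< : ∀ a q → 1 ≤ q → a rem q < q
rem-< a (suc q) _ = m%n<n a (suc q)

-- Simultaneous residue conditions and the image modulo q

module MultiChinese {Q : ℕ → Set} (Q? : Decidable Q) (Q-prime : ∀ q → Q q → Prime q) (Q≢2 : ∀ q → Q q → q ≢ 2)
  {A : ℕ → ℕ → Set} (A? : ∀ q → Decidable (A q)) where

  M : ℕ → ℕ
  M X = Π< X (λ q → q ^ 𝟙 (Q? q))

  Good : ℕ → ℕ → Set
  Good X a = a % 4 ≡ 2 × (∀ {q} → q < X → Q q → A q (a rem q))

  Good? : ∀ X → Decidable (Good X)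
  Good? X a = (a % 4 ≟ 2) ×-dec allUpTo? (λ q → Q? q →-dec A? q (a rem q)) X

  M>0 : ∀ X → 1 ≤ M X
  M>0 X = Π-pos X _ pos
    where
    pos : ∀ q → q < X → 1 ≤ q ^ 𝟙 (Q? q)
    pos q _ with Q? q
    ... | yes Qq = subst (1 ≤_) (sym (*-identityʳ q)) (<⇒≤ (prime>1 (Q-prime q Qq)))
    ... | no _   = ≤-refl

  q∣M : ∀ X q → q < X → Q q → q ∣ M X
  q∣M X q q<X Qq = ∣-trans (subst (λ e → q ∣ q ^ e) (sym (𝟙-yes Qq (Q? q))) (m∣m*n 1)) (term∣Π X (λ q → q ^ 𝟙 (Q? q)) q<X)

  good-count : ∀ X → # (4 * M X) (Good? X) ≡ Π< X (λ q → # q (A? q) ^ 𝟙 (Q? q))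
  good-count zero = trans (#-cong 4 (Good? 0) (λ a → a ≟ 2) (λ a a<4 → (λ g → trans (sym (m<n⇒m%n≡m a<4)) (proj₁ g)) , (λ { refl → refl , λ () })))
    (trans (Σ-cong 4 (λ a _ → sym (*-identityʳ (𝟙 (a ≟ 2))))) (Σ-pick 4 (λ _ → 1) {2} (s≤s (s≤s (s≤s z≤n)))))
  good-count (suc X) = go (Q? X)
    where
    m : ℕ
    m = 4 * M X
    go : (d : Dec (Q X)) → # (4 * (M X * X ^ 𝟙 d)) (Good? (suc X)) ≡ Π< X (λ q → # q (A? q) ^ 𝟙 (Q? q)) * # X (A? X) ^ 𝟙 d
    go (no ¬QX) = trans (cong (λ z → # (4 * z) (Good? (suc X))) (*-identityʳ (M X))) (trans (#-cong m (Good? (suc X)) (Good? X) (λ a _ →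
        (λ (r , g) → r , λ {q} q<X → g {q} (m<n⇒m<1+n q<X)) , (λ (r , g) → r , λ {q} q<1+X Qq → case m≤n⇒m<n∨m≡n (s≤s⁻¹ q<1+X) of λ where
          (inj₁ q<X)  → g q<X Qq
          (inj₂ refl) → contradiction Qq ¬QX))) (trans (good-count X) (sym (*-identityʳ _))))
    go (yes QX) = begin
      # (4 * (M X * (X * 1))) (Good? (suc X)) ≡⟨ cong (λ z → # z (Good? (suc X))) (ring (M X) X) ⟩
      # (X * m) (Good? (suc X)) ≡⟨ #-cong (X * m) (Good? (suc X)) (λ a → Good? X (a % m) ×-dec A? X (a % X)) (λ a _ → to a , from a) ⟩
      # (X * m) (λ a → Good? X (a % m) ×-dec A? X (a % X)) ≡⟨ chinese-count m X co (Good? X) (A? X) ⟩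
      # m (Good? X) * # X (A? X) ≡⟨ cong₂ _*_ (good-count X) (sym (*-identityʳ (# X (A? X)))) ⟩
      Π< X (λ q → # q (A? q) ^ 𝟙 (Q? q)) * (# X (A? X) * 1) ∎
      where
      open ≡-Reasoning
      pX : Prime X
      pX = Q-prime X QX
      instance
        X≢0 : NonZero X
        X≢0 = prime⇒nonZero pX
        m≢0 : NonZero m
        m≢0 = m*n≢0 4 (M X) {{_}} {{>-nonZero (M>0 X)}}
      ring : ∀ M X → 4 * (M * (X * 1)) ≡ X * (4 * M)
      ring = solve-∀
      X∤m : X ∤ m
      X∤m = prime∤* 4 (M X) pX (λ d → Q≢2 X QX (prime∣prime pX prime[2] (prime∣^ 2 2 pX d)))
        (prime∤Π X _ pX term)
        where
        term : ∀ q → q < X → X ∤ q ^ 𝟙 (Q? q)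
        term q q<X with Q? q
        ... | yes Qq = λ d → <⇒≢ q<X (sym (prime∣prime pX (Q-prime q Qq) (prime∣^ q 1 pX d)))
        ... | no _   = λ d → <⇒≢ (prime>1 pX) (sym (∣1⇒≡1 d))
      co : Coprime m X
      co = Coprime.sym (∤⇒coprime m pX X∤m)
      4%  : ∀ a → a % m % 4 ≡ a % 4
      4% a = m∣n⇒o%n%m≡o%m 4 m a (m∣m*n (M X))
      modq : ∀ a q → q < X → Q q → (a % m) rem q ≡ a rem q
      modq a q q<X Qq = trans (rem≡% (a % m) q) (trans (m∣n⇒o%n%m≡o%m q m a (∣n⇒∣m*n 4 (q∣M X q q<X Qq))) (sym (rem≡% a q)))
        where
        instance
          q≢0′ : NonZero q
          q≢0′ = prime⇒nonZero (Q-prime q Qq)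
      to : ∀ a → Good (suc X) a → Good X (a % m) × A X (a % X)
      to a (r , g) = (trans (4% a) r , λ {q} q<X Qq → subst (A q) (sym (modq a q q<X Qq)) (g (m<n⇒m<1+n q<X) Qq)) , subst (A X) (rem≡% a X) (g ≤-refl QX)
      from : ∀ a → Good X (a % m) × A X (a % X) → Good (suc X) a
      from a ((r , g) , s) = trans (sym (4% a)) r , λ {q} q<1+X Qq → case m≤n⇒m<n∨m≡n (s≤s⁻¹ q<1+X) of λ where
        (inj₁ q<X)  → subst (A q) (modq a q q<X Qq) (g q<X Qq)
        (inj₂ refl) → subst (A X) (sym (rem≡% a X)) s

ImageAt : ℕ → ℕ → ℕ → Set
ImageAt zero      j b = ⊥
ImageAt q@(suc _) j b = Image q j b

ImageAt? : ∀ q j → Decidable (ImageAt q j)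
ImageAt? zero      j b = no λ ()
ImageAt? q@(suc _) j b = Image? q j b

#-ImageAt : ∀ q j → # q (ImageAt? q j) ≡ im q j
#-ImageAt zero    j = refl
#-ImageAt (suc q) j = refl

module _ (q : ℕ) (pq : Prime q) where
  open PrimeField q pq

  private
    at : ∀ {j b} → ImageAt q j b → ∃ λ y → y < q × b ≡ (j ShiftedPower y) % q
    at = go q
      where
      go : ∀ q .{{_ : NonZero q}} {j b} → ImageAt q j b → ∃ λ y → y < q × b ≡ (j ShiftedPower y) % q
      go (suc q) h = h

    to : ∀ {j b} y → b ≡ (j ShiftedPower y) % q → ImageAt q j b
    to {j} {b} y e = go q (y % q) (m%n<n y q) (trans e (*-≈ {(1 + y) ^ j} {(1 + y % q) ^ j} {y} {y % q} (^-≈ {1 + y} {1 + y % q} j (+-≈ {1} {1} {y} {y % q} refl (sym (%-≈ y)))) (sym (%-≈ y))))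
      where
      go : ∀ q .{{_ : NonZero q}} y → y < q → b ≡ (j ShiftedPower y) % q → ImageAt q j b
      go (suc q) y y<q e = y , y<q , e

  value∈image : ∀ p j → 1 ≤ p → ImageAt q j ((p ^ j * (p ∸ 1)) % q)
  value∈image p j 1≤p = to (p ∸ 1) (cong (λ z → (z ^ j * (p ∸ 1)) % q) (sym (m+[n∸m]≡n 1≤p)))

  image-reduce : ∀ j J c b → 1 ≤ J → j ≡ J + c * n → ImageAt q j b → ImageAt q J b
  image-reduce j J c b 1≤J eq h with at h
  ... | y , _ , e = to y (trans e (*-≈ {(1 + y) ^ j} {(1 + y) ^ J} {y} {y} (trans (cong (λ z → (1 + y) ^ z % q) eq) (^-period (1 + y) J c 1≤J)) refl))

  -- If n ∣ j then x^j(x − 1) is 0 or x − 1 with x ≠ 0.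
  image-avoids : ∀ j b → 1 ≤ j → n ∣ j → ImageAt q j b → b ≢ q ∸ 1
  image-avoids j b 1≤j (divides c eq) h b≡n with at h
  ... | y , _ , e with q ∣? 1 + y
  ...   | no q∤x = q∤x (≈0⇒∣ (begin
        (1 + y) % q ≡⟨ +-≈ {1} {1} {y} {(1 + y) ^ j * y} refl (sym (trans (*-≈ {(1 + y) ^ j} {1} {y} {y} (trans (cong (λ z → (1 + y) ^ z % q) eq) (fermat-* (1 + y) c q∤x)) refl) (cong (_% q) (*-identityˡ y)))) ⟩
        (1 + (1 + y) ^ j * y) % q ≡⟨ +-≈ {1} {1} {(1 + y) ^ j * y} {n} refl (trans (trans (sym e) b≡n) (sym (m<n⇒m%n≡m n<q))) ⟩
        (1 + n) % q ≡⟨ cong (_% q) (sym q≡1+n) ⟩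
        q % q ≡⟨ trans (n%n≡0 q) (sym 0%q≡0) ⟩
        0 % q ∎))
    where open ≡-Reasoning
  ...   | yes q∣x = <⇒≢ 0<n (trans (sym 0%q≡0) (trans (sym (∣⇒≈0 (∣m⇒∣m*n y (∣^ j 1≤j)))) (trans (sym e) b≡n)))
    where
    ∣^ : ∀ j → 1 ≤ j → q ∣ (1 + y) ^ j
    ∣^ (suc j) _ = ∣m⇒∣m*n ((1 + y) ^ j) q∣x

  -- x ↦ 1/x turns x^j(x − 1) into −x^(−j−1)(x − 1)
  image-reflect : ∀ j Λ b → 1 ≤ j → 1 ≤ Λ → n ∣ Λ → ImageAt q j b → ImageAt q (suc j * (Λ ∸ 1)) (neg b % q)
  image-reflect j Λ b 1≤j 1≤Λ (divides c Λ≡) h with at h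
  ... | y , _ , e with q ∣? 1 + y
  ...   | yes q∣x = to 0 (begin
        neg b % q ≡⟨ *-≈ {n} {n} {b} {0} refl (trans (cong (_% q) e) (trans (%-≈ (j ShiftedPower y)) (∣⇒≈0 (∣m⇒∣m*n y (∣^ j 1≤j))))) ⟩
        (n * 0) % q ≡⟨ cong (_% q) (trans (*-zeroʳ n) (sym (*-zeroʳ (1 ^ (suc j * (Λ ∸ 1)))))) ⟩
        ((suc j * (Λ ∸ 1)) ShiftedPower 0) % q ∎)
    where
    open ≡-Reasoning
    ∣^ : ∀ j → 1 ≤ j → q ∣ (1 + y) ^ j
    ∣^ (suc j) _ = ∣m⇒∣m*n ((1 + y) ^ j) q∣x
  ...   | no q∤x = to (u + n) (sym (begin
        ((1 + (u + n)) ^ j′ * (u + n)) % q ≡⟨ *-≈ {(1 + (u + n)) ^ j′} {x ^ suc j} {u + n} {u + n} (trans (^-≈ {1 + (u + n)} {u} j′ 1+u+n) power) refl ⟩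
        (x ^ suc j * (u + n)) % q ≡⟨ cong (_% q) (ring x (x ^ j) u n) ⟩
        (x ^ j * (x * u + n * x)) % q ≡⟨ *-≈ {x ^ j} {x ^ j} {x * u + n * x} {n * y} refl (trans (+-≈ {x * u} {1} {n * x} {n * x} x*u refl) 1+nx) ⟩
        (x ^ j * (n * y)) % q ≡⟨ cong (_% q) (swap (x ^ j) n y) ⟩
        (n * (x ^ j * y)) % q ≡⟨ *-≈ {n} {n} {x ^ j * y} {b} refl (trans (sym (%-≈ (x ^ j * y))) (cong (_% q) (sym e))) ⟩
        neg b % q ∎))
    where
    open ≡-Reasoning
    x u j′ : ℕ
    x = 1 + y
    u = x ^ (n ∸ 1)
    j′ = suc j * (Λ ∸ 1)
    ring : ∀ x z u n → x * z * (u + n) ≡ z * (x * u + n * x)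
    ring = solve-∀
    swap : ∀ a b c → a * (b * c) ≡ b * (a * c)
    swap = solve-∀
    x*u : x * u ≈ 1
    x*u = trans (cong (λ z → x ^ z % q) (m+[n∸m]≡n 0<n)) (fermat x q∤x)
    1+u+n : 1 + (u + n) ≈ u
    1+u+n = trans (cong (_% q) (trans (cong suc (+-comm u n)) (trans (cong (_+ u) (sym q≡1+n)) (+-comm q u)))) ([m+n]%n≡m%n u q)
    1+nx : 1 + n * x ≈ n * y
    1+nx = trans (cong (_% q) (trans (cong (1 +_) (*-suc n y)) (cong (_+ n * y) (sym q≡1+n)))) (trans (cong (_% q) (+-comm q (n * y))) ([m+n]%n≡m%n (n * y) q))
    q∤u : q ∤ u
    q∤u = prime∤^ x (n ∸ 1) pq q∤x
    -- u^(j′) · u^(j+1) = u^((j+1)Λ) = 1 = x^(j+1) · u^(j+1)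
    power : u ^ j′ ≈ x ^ suc j
    power = *-cancelˡ-≈ (u ^ suc j) (u ^ j′) (x ^ suc j) (prime∤^ u (suc j) pq q∤u) (begin
      (u ^ suc j * u ^ j′) % q ≡⟨ cong (_% q) (trans (sym (^-distribˡ-+-* u (suc j) j′)) (cong (u ^_) exponent)) ⟩
      u ^ (suc j * c * n) % q ≡⟨ fermat-* u (suc j * c) q∤u ⟩
      1 % q ≡⟨ sym (trans (^-≈ {x * u} {1} (suc j) x*u) (cong (_% q) (^-zeroˡ (suc j)))) ⟩
      ((x * u) ^ suc j) % q ≡⟨ cong (_% q) (trans (^-distribʳ-* x u (suc j)) (*-comm (x ^ suc j) (u ^ suc j))) ⟩
      (u ^ suc j * x ^ suc j) % q ∎)
      where
      exponent : suc j + j′ ≡ suc j * c * n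
      exponent = trans (trans (cong (_+ j′) (sym (*-identityʳ (suc j)))) (sym (*-distribˡ-+ (suc j) 1 (Λ ∸ 1))))
        (trans (cong (suc j *_) (trans (m+[n∸m]≡n 1≤Λ) Λ≡)) (sym (*-assoc (suc j) c n)))

-- The density of the chosen primes

lg-unique : ∀ {j s} → 2 ^ j ≤ s → s < 2 ^ suc j → lg s ≡ j
lg-unique {j} {s} lo hi = ≤-antisym (s≤s⁻¹ (2^-cancel-< (≤-<-trans (lg-lower s (≤-trans (m^n>0 2 j) lo)) hi))) (s≤s⁻¹ (2^-cancel-< (≤-<-trans lo (lg-upper s))))
  where
  2^-cancel-< : ∀ {a b} → 2 ^ a < 2 ^ b → a < b
  2^-cancel-< h = ≰⇒> λ b≤a → <⇒≱ h (^-monoʳ-≤ 2 b≤a)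

-- Π(1 − 1/b_i) ≥ 1 − Σ 1/b_i, the reciprocals being bounded by w_i/m
weierstrass : ∀ N m (b w : ℕ → ℕ) {R : ℕ → Set} (R? : Decidable R) → 1 ≤ m → (∀ i → R i → m ≤ w i * b i × 1 ≤ b i) →
  Π< N (λ i → b i ^ 𝟙 (R? i)) * (m ∸ Σ< N (λ i → 𝟙 (R? i) * w i)) ≤ Π< N (λ i → (b i ∸ 1) ^ 𝟙 (R? i)) * m
weierstrass zero m b w R? 1≤m h = ≤-refl
weierstrass (suc N) m b w R? 1≤m h with R? N
... | no _ rewrite *-identityʳ (Π< N (λ i → b i ^ 𝟙 (R? i))) | *-identityʳ (Π< N (λ i → (b i ∸ 1) ^ 𝟙 (R? i))) | +-identityʳ (Σ< N (λ i → 𝟙 (R? i) * w i)) = weierstrass N m b w R? 1≤m h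
... | yes RN = *-cancelʳ-≤ _ _ m {{>-nonZero 1≤m}} (begin
    B * (b N * 1) * (m ∸ (W + (w N + 0))) * m ≡⟨ cong₂ (λ x y → B * x * (m ∸ (W + y)) * m) (*-identityʳ (b N)) (+-identityʳ (w N)) ⟩
    B * b N * (m ∸ (W + w N)) * m ≡⟨ ring₁ B (b N) (m ∸ (W + w N)) m ⟩
    B * (b N * (m * (m ∸ (W + w N)))) ≤⟨ *-monoʳ-≤ B (*-monoʳ-≤ (b N) (split W (w N))) ⟩
    B * (b N * ((m ∸ W) * (m ∸ w N))) ≡⟨ ring₂ B (b N) (m ∸ W) (m ∸ w N) ⟩
    B * (m ∸ W) * (b N * (m ∸ w N)) ≤⟨ *-mono-≤ (weierstrass N m b w R? 1≤m h) step ⟩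
    P * m * ((b N ∸ 1) * m) ≡⟨ ring₃ P m (b N ∸ 1) ⟩
    P * (b N ∸ 1) * m * m ≡⟨ cong (λ x → P * x * m * m) (sym (*-identityʳ (b N ∸ 1))) ⟩
    P * ((b N ∸ 1) * 1) * m * m ∎)
  where
  open ≤-Reasoning
  B P W : ℕ
  B = Π< N (λ i → b i ^ 𝟙 (R? i))
  P = Π< N (λ i → (b i ∸ 1) ^ 𝟙 (R? i))
  W = Σ< N (λ i → 𝟙 (R? i) * w i)
  ring₁ : ∀ a b c d → a * b * c * d ≡ a * (b * (d * c))
  ring₁ = solve-∀
  ring₂ : ∀ a b c d → a * (b * (c * d)) ≡ a * c * (b * d)
  ring₂ = solve-∀
  ring₃ : ∀ a b c → a * b * (c * b) ≡ a * c * b * b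
  ring₃ = solve-∀
  split : ∀ x y → m * (m ∸ (x + y)) ≤ (m ∸ x) * (m ∸ y)
  split x y with x + y ≤? m
  ... | no ≰ = ≤-trans (≤-reflexive (trans (cong (m *_) (m≤n⇒m∸n≡0 (<⇒≤ (≰⇒> ≰)))) (*-zeroʳ m))) z≤n
  ... | yes x+y≤m = subst₂ (λ u v → m * u ≤ v * (m ∸ y)) refl (sym (trans (cong (_∸ x) (sym full)) (m+n∸m≡n x (y + z))))
        (subst (λ v → m * z ≤ (y + z) * v) (sym (trans (cong (_∸ y) (trans (sym full) (ring₄ x y z))) (m+n∸m≡n y (x + z))))
          (subst (λ v → v * z ≤ (y + z) * (x + z)) full (≤-trans (m≤m+n _ (x * y)) (≤-reflexive (ring₅ x y z)))))
    where
    z : ℕ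
    z = m ∸ (x + y)
    full : x + (y + z) ≡ m
    full = trans (sym (+-assoc x y z)) (m+[n∸m]≡n x+y≤m)
    ring₄ : ∀ x y z → x + (y + z) ≡ y + (x + z)
    ring₄ = solve-∀
    ring₅ : ∀ x y z → (x + (y + z)) * z + x * y ≡ (y + z) * (x + z)
    ring₅ = solve-∀
  step : b N * (m ∸ w N) ≤ (b N ∸ 1) * m
  step = ≤-trans (≤-reflexive (*-distribˡ-∸ (b N) m (w N))) (≤-trans (∸-monoʳ-≤ (b N * m) (≤-trans (≤-reflexive (*-identityˡ m)) (≤-trans (proj₁ (h N RN)) (≤-reflexive (*-comm (w N) (b N))))))
    (≤-reflexive (sym (*-distribʳ-∸ m (b N) 1))))

module Global (a₀ t : ℕ) (g : ℕ → ℕ) (sc : ∀ i → ScaleSet (suc (i + a₀)) (g i)) where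

  open ScaleSet

  X : ℕ
  X = 2 ^ (t + a₀)

  InQ : ℕ → Set
  InQ q = ∃ λ i → i < t × Q (sc i) q

  InQ? : Decidable InQ
  InQ? q = anyUpTo? (λ i → Q? (sc i) q) t

  InQ-prime : ∀ q → InQ q → Prime q
  InQ-prime q (i , _ , Qq) = Q-prime (sc i) q Qq

  InQ-from : ∀ q → InQ q → Prime q × 2 ^ a₀ ≤ q
  InQ-from q (i , _ , Qq) = Q-prime (sc i) q Qq , ≤-trans (^-monoʳ-≤ 2 (m≤n+m a₀ i)) (Q-lower (sc i) q Qq)

  InQ<X : ∀ q → InQ q → q < X
  InQ<X q (i , i<t , Qq) = <-≤-trans (Q-upper (sc i) q Qq) (^-monoʳ-≤ 2 (+-monoˡ-≤ a₀ i<t))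

  Removed? : Decidable (λ s → (Prime s × 2 ^ a₀ ≤ s) × ¬ InQ s)
  Removed? s = PrimeFrom? a₀ s ×-dec ¬? (InQ? s)

  ΠQ : (ℕ → ℕ) → ℕ
  ΠQ f = Π< X (λ q → f q ^ 𝟙 (InQ? q))

  private
    Πremoved : (ℕ → ℕ) → ℕ
    Πremoved f = Π< X (λ q → f q ^ 𝟙 (Removed? q))

    range-split : ∀ f → rangeΠ f a₀ (t + a₀) ≡ ΠQ f * Πremoved f
    range-split f = trans (Π-cong X (λ s _ → trans (cong (f s ^_) (split s)) (^-distribˡ-+-* (f s) (𝟙 (InQ? s)) (𝟙 (Removed? s))))) (Π-* X _ _)
      where
      split : ∀ s → 𝟙 (PrimeFrom? a₀ s) ≡ 𝟙 (InQ? s) + 𝟙 (Removed? s)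
      split s with PrimeFrom? a₀ s | InQ? s
      ... | yes _ | yes _ = refl
      ... | yes _ | no _  = refl
      ... | no ¬p | yes i = contradiction (InQ-from s i) ¬p
      ... | no _  | no _  = refl

  module _ (G : ℕ) (t+a₀≤G : t + a₀ ≤ G) (g≤G : ∀ i → i < t → g i ≤ G) (series : 2 * Σ< t (λ i → 10 * 2 ^ (G ∸ g i)) ≤ 2 ^ G) where
    private
      -- With 2^G as common denominator, w s stands for 2^(-lg s), an upper bound for 1/s within a
      -- factor 2.
      w : ℕ → ℕ
      w s = 2 ^ (G ∸ lg s)

      F : ℕ → ℕ
      F s = 𝟙 (Removed? s) * w s

      -- The constant is 10 = 5 · 2: at most 5 · 2^(j+1)/2^g primes are lost in [2^j, 2^(j+1)), each
      -- of weight 2^(-j).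
      block : ∀ i → i < t → Σ< (2 ^ (i + a₀)) (λ d → F (2 ^ (i + a₀) + d)) ≤ 10 * 2 ^ (G ∸ g i)
      block i i<t = begin
        Σ< N (λ d → F (N + d)) ≤⟨ Σ-mono N (λ d d<N → ≤-reflexive (cong (λ z → 𝟙 (Removed? (N + d)) * 2 ^ (G ∸ z)) (lg-unique {j} (m≤m+n N d) (<-≤-trans (+-monoʳ-< N d<N) (≤-reflexive (sym (2^-suc j))))))) ⟩
        Σ< N (λ d → 𝟙 (Removed? (N + d)) * 2 ^ (G ∸ j)) ≡⟨ Σ-*ʳ (2 ^ (G ∸ j)) N _ ⟩
        Σ< N (λ d → 𝟙 (Removed? (N + d))) * 2 ^ (G ∸ j) ≤⟨ *-monoˡ-≤ (2 ^ (G ∸ j)) inner ⟩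
        lostᵢ * 2 ^ (G ∸ j) ≤⟨ *-cancelˡ-≤ (2 ^ g i) {{m^n≢0 2 (g i)}} (begin
          2 ^ g i * (lostᵢ * 2 ^ (G ∸ j)) ≡⟨ sym (*-assoc (2 ^ g i) lostᵢ _) ⟩
          2 ^ g i * lostᵢ * 2 ^ (G ∸ j) ≤⟨ *-monoˡ-≤ (2 ^ (G ∸ j)) (lost (sc i)) ⟩
          5 * (2 * 2 ^ j) * 2 ^ (G ∸ j) ≡⟨ trans (ring (2 ^ j) (2 ^ (G ∸ j))) (cong (10 *_) (trans (2^-+ j (G ∸ j)) (cong (2 ^_) (m+[n∸m]≡n j≤G)))) ⟩
          10 * 2 ^ G ≡⟨ cong (λ z → 10 * 2 ^ z) (sym (m+[n∸m]≡n (g≤G i i<t))) ⟩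
          10 * 2 ^ (g i + (G ∸ g i)) ≡⟨ trans (cong (10 *_) (^-distribˡ-+-* 2 (g i) (G ∸ g i))) (swap 10 (2 ^ g i) (2 ^ (G ∸ g i))) ⟩
          2 ^ g i * (10 * 2 ^ (G ∸ g i)) ∎) ⟩
        10 * 2 ^ (G ∸ g i) ∎
        where
        open ≤-Reasoning
        j N : ℕ
        j = i + a₀
        N = 2 ^ j
        j≤G : j ≤ G
        j≤G = ≤-trans (+-monoˡ-≤ a₀ (<⇒≤ i<t)) t+a₀≤G
        Lost? : Decidable (λ q → (Prime q × 2 ^ j ≤ q) × ¬ Q (sc i) q)
        Lost? q = PrimeFrom? j q ×-dec ¬? (Q? (sc i) q)
        lostᵢ : ℕ
        lostᵢ = # (2 ^ suc j) Lost?
        ring : ∀ x y → 5 * (2 * x) * y ≡ 10 * (x * y)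
        ring = solve-∀
        swap : ∀ x y z → x * (y * z) ≡ y * (x * z)
        swap = solve-∀
        inner : Σ< N (λ d → 𝟙 (Removed? (N + d))) ≤ lostᵢ
        inner = ≤-trans (Σ-mono N (λ d _ → 𝟙-mono (λ ((ps , _) , ¬Q) → (ps , m≤m+n N d) , λ Qi → ¬Q (i , i<t , Qi)) (Removed? (N + d)) (Lost? (N + d))))
          (≤-trans (m≤n+m _ (# N Lost?)) (≤-reflexive (sym (trans (cong (λ z → # z Lost?) (2^-suc j)) (Σ-split N N _)))))

      W : ℕ
      W = Σ< X F

      2W≤ : 2 * W ≤ 2 ^ G
      2W≤ = ≤-trans (*-monoʳ-≤ 2 (≤-trans (≤-reflexive (trans (Σ-dyadic-from a₀ t F) (cong (_+ Σ< t (λ i → Σ< (2 ^ (i + a₀)) (λ d → F (2 ^ (i + a₀) + d)))) (Σ-zero (2 ^ a₀) F below)))) (Σ-mono t block))) series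
        where
        below : ∀ s → s < 2 ^ a₀ → F s ≡ 0
        below s s< = cong (_* w s) (𝟙-no (λ ((_ , le) , _) → <⇒≱ s< le) (Removed? s))

      removed-ratio : Πremoved id ≤ 2 * Πremoved (_∸ 1)
      removed-ratio = *-cancelʳ-≤ _ _ m {{>-nonZero (m^n>0 2 G)}} (begin
        Πremoved id * m ≤⟨ *-monoʳ-≤ (Πremoved id) half ⟩
        Πremoved id * (2 * (m ∸ W)) ≡⟨ swap (Πremoved id) (m ∸ W) ⟩
        2 * (Πremoved id * (m ∸ W)) ≤⟨ *-monoʳ-≤ 2 (weierstrass X m id w Removed? (m^n>0 2 G) weights) ⟩
        2 * (Πremoved (_∸ 1) * m) ≡⟨ sym (*-assoc 2 (Πremoved (_∸ 1)) m) ⟩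
        2 * Πremoved (_∸ 1) * m ∎)
        where
        open ≤-Reasoning
        m : ℕ
        m = 2 ^ G
        swap : ∀ x y → x * (2 * y) ≡ 2 * (x * y)
        swap = solve-∀
        half : m ≤ 2 * (m ∸ W)
        half = ≤-trans (m+n≤o⇒m≤o∸n m (≤-trans (+-monoʳ-≤ m 2W≤) (≤-reflexive (cong (m +_) (sym (+-identityʳ m)))))) (≤-reflexive (sym (*-distribˡ-∸ 2 m W)))
        weights : ∀ s → (Prime s × 2 ^ a₀ ≤ s) × ¬ InQ s → m ≤ w s * s × 1 ≤ s
        weights s ((ps , _) , _) = ≤-trans (≤-trans (^-monoʳ-≤ 2 (m≤n+m∸n G (lg s))) (≤-reflexive (trans (cong (2 ^_) (+-comm (lg s) (G ∸ lg s))) (^-distribˡ-+-* 2 (G ∸ lg s) (lg s))))) (*-monoʳ-≤ (w s) (lg-lower s (<⇒≤ (prime>1 ps)))) , <⇒≤ (prime>1 ps)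

    -- Euler's product over all primes below X is at least (t + a₀)/2. Taking out the primes below
    -- 2^a₀ costs at most the factor P₀, a constant once a₀ is fixed, and taking out the removed
    -- primes at most a factor 2.
    density : ∀ E → 4 * Π-primes (2 ^ a₀) * E ≤ t → E * ΠQ (_∸ 1) ≤ ΠQ id
    density E t-large = *-cancelˡ-≤ c {{c≢0}} (begin
      c * (E * ΠQ (_∸ 1)) ≡⟨ sym (*-assoc c E _) ⟩
      c * E * ΠQ (_∸ 1) ≤⟨ *-monoˡ-≤ (ΠQ (_∸ 1)) (≤-trans t-large (m≤m+n t a₀)) ⟩
      (t + a₀) * ΠQ (_∸ 1) ≤⟨ core ⟩
      c * ΠQ id ∎)
      where
      open ≤-Reasoning
      P₀ D₀ c : ℕ
      P₀ = Π-primes (2 ^ a₀)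
      D₀ = Π-predecessors (2 ^ a₀)
      c = 4 * P₀
      positive : ∀ (f : ℕ → ℕ) {R : ℕ → Set} (R? : Decidable R) N → (∀ s → R s → 1 ≤ f s) → 1 ≤ Π< N (λ s → f s ^ 𝟙 (R? s))
      positive f R? N h = Π-pos N _ step
        where
        step : ∀ s → s < N → 1 ≤ f s ^ 𝟙 (R? s)
        step s _ with R? s
        ... | yes r = subst (1 ≤_) (sym (*-identityʳ (f s))) (h s r)
        ... | no _  = ≤-refl
      c≢0 : NonZero c
      c≢0 = m*n≢0 4 P₀ {{_}} {{>-nonZero (positive id prime? (2 ^ a₀) (λ s ps → <⇒≤ (prime>1 ps)))}}
      R₁ : ℕ
      R₁ = Πremoved (_∸ 1)
      core : (t + a₀) * ΠQ (_∸ 1) ≤ c * ΠQ id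
      core = ≤-trans (m≤n*m _ D₀ {{>-nonZero (positive (_∸ 1) prime? (2 ^ a₀) (λ s ps → m<n⇒0<n∸m (prime>1 ps)))}}) (*-cancelʳ-≤ _ _ R₁ {{>-nonZero (positive (_∸ 1) Removed? X (λ s r → m<n⇒0<n∸m (prime>1 (proj₁ (proj₁ r)))))}} (begin
        D₀ * ((t + a₀) * ΠQ (_∸ 1)) * R₁ ≡⟨ ring₁ D₀ (t + a₀) (ΠQ (_∸ 1)) R₁ ⟩
        (t + a₀) * (D₀ * (ΠQ (_∸ 1) * R₁)) ≡⟨ cong ((t + a₀) *_) (trans (cong (D₀ *_) (sym (range-split (_∸ 1)))) (sym (fullΠ-range (_∸ 1) a₀ t))) ⟩
        (t + a₀) * Π-predecessors X ≤⟨ euler-product (t + a₀) ⟩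
        2 * Π-primes X ≡⟨ cong (2 *_) (trans (fullΠ-range id a₀ t) (cong (P₀ *_) (range-split id))) ⟩
        2 * (P₀ * (ΠQ id * Πremoved id)) ≤⟨ *-monoʳ-≤ 2 (*-monoʳ-≤ P₀ (*-monoʳ-≤ (ΠQ id) removed-ratio)) ⟩
        2 * (P₀ * (ΠQ id * (2 * R₁))) ≡⟨ ring₂ P₀ (ΠQ id) R₁ ⟩
        4 * P₀ * ΠQ id * R₁ ∎))
        where
        ring₁ : ∀ a b c d → a * (b * c) * d ≡ b * (a * (c * d))
        ring₁ = solve-∀
        ring₂ : ∀ a b c → 2 * (a * (b * (2 * c))) ≡ 4 * a * b * c
        ring₂ = solve-∀

-- Residue classes that may contain totients

Π-extend : ∀ {m n} (f : ℕ → ℕ) → m ≤ n → (∀ i → m ≤ i → f i ≡ 1) → Π< n f ≡ Π< m f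
Π-extend {m} {n} f m≤n h = trans (cong (λ z → Π< z f) (sym (m+[n∸m]≡n m≤n))) (trans (Π-split m (n ∸ m) f)
  (trans (cong (Π< m f *_) (Π-one (n ∸ m) _ (λ i _ → h (m + i) (m≤m+n m i)))) (*-identityʳ _)))

-- A permutation of the residues modulo each prime, which leaves all counts unchanged: the identity
-- for even exponents, the sign change for odd ones after x ↦ 1/x.
record Symmetry : Set where
  field
    σ     : ℕ → ℕ → ℕ
    σ<    : ∀ q → Prime q → ∀ b → b < q → σ q b < q
    σ-inj : ∀ q → Prime q → ∀ b b′ → b < q → b′ < q → σ q b ≡ σ q b′ → b ≡ b′

identity : Symmetry
identity = record { σ = λ q b → b ; σ< = λ _ _ _ h → h ; σ-inj = λ _ _ _ _ _ _ e → e }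

reflection : Symmetry
reflection = record { σ = λ q b → ((q ∸ 1) * b) rem q ; σ< = λ q pq b _ → rem-< ((q ∸ 1) * b) q (<⇒≤ (prime>1 pq)) ; σ-inj = inj }
  where
  inj : ∀ q → Prime q → ∀ b b′ → b < q → b′ < q → ((q ∸ 1) * b) rem q ≡ ((q ∸ 1) * b′) rem q → b ≡ b′
  inj q pq b b′ b<q b′<q e = ≈⇒≡ b<q b′<q (*-cancelˡ-≈ n b b′ (∤-small 0<n n<q) (trans (sym (rem≡% (n * b) q)) (trans e (rem≡% (n * b′) q))))
    where open PrimeField q pq

geometric : ∀ k t m (U : ℕ → ℕ) → (∀ i → i < t → 2 ^ (k + i) * U i ≤ m) → 2 ^ k * Σ< t U ≤ 2 * m
geometric k t m U h = *-cancelˡ-≤ (2 ^ t) {{m^n≢0 2 t}} (≤-trans (≤-reflexive (trans (sym (*-assoc (2 ^ t) (2 ^ k) _)) (cong (_* Σ< t U) (trans (*-comm (2 ^ t) (2 ^ k)) (2^-+ k t)))))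
  (≤-trans (m≤m+n _ (2 * m)) (≤-trans (go t h) (≤-reflexive (ring (2 ^ t) m)))))
  where
  ring : ∀ x m → 2 * x * m ≡ x * (2 * m)
  ring = solve-∀
  go : ∀ t → (∀ i → i < t → 2 ^ (k + i) * U i ≤ m) → 2 ^ (k + t) * Σ< t U + 2 * m ≤ 2 ^ suc t * m
  go zero h = ≤-reflexive (cong (_+ 2 * m) (*-zeroʳ (2 ^ (k + 0))))
  go (suc t) h = begin
    2 ^ (k + suc t) * (Σ< t U + U t) + 2 * m ≡⟨ cong (λ z → 2 ^ z * (Σ< t U + U t) + 2 * m) (+-suc k t) ⟩
    2 * 2 ^ (k + t) * (Σ< t U + U t) + 2 * m ≡⟨ ring₁ (2 ^ (k + t)) (Σ< t U) (U t) m ⟩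
    2 * (2 ^ (k + t) * Σ< t U) + 2 * (2 ^ (k + t) * U t) + 2 * m ≤⟨ +-monoˡ-≤ (2 * m) (+-monoʳ-≤ (2 * (2 ^ (k + t) * Σ< t U)) (*-monoʳ-≤ 2 (h t ≤-refl))) ⟩
    2 * (2 ^ (k + t) * Σ< t U) + 2 * m + 2 * m ≡⟨ ring₂ (2 ^ (k + t) * Σ< t U) m ⟩
    2 * (2 ^ (k + t) * Σ< t U + 2 * m) ≤⟨ *-monoʳ-≤ 2 (go t (λ i i<t → h i (m<n⇒m<1+n i<t))) ⟩
    2 * (2 ^ suc t * m) ≡⟨ sym (*-assoc 2 (2 ^ suc t) m) ⟩
    2 ^ suc (suc t) * m ∎
    where
    open ≤-Reasoning
    ring₁ : ∀ x s u m → 2 * x * (s + u) + 2 * m ≡ 2 * (x * s) + 2 * (x * u) + 2 * m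
    ring₁ = solve-∀
    ring₂ : ∀ y m → 2 * y + 2 * m + 2 * m ≡ 2 * (y + 2 * m)
    ring₂ = solve-∀

module Classes (a₀ t : ℕ) (2≤a₀ : 2 ≤ a₀) (g : ℕ → ℕ) (sc : ∀ i → ScaleSet (suc (i + a₀)) (g i)) where
  open Global a₀ t g sc public
  open ScaleSet

  M : ℕ
  M = ΠQ id

  InQ≢2 : ∀ q → InQ q → q ≢ 2
  InQ≢2 q iq refl = <⇒≱ (^-monoʳ-< 2 (s≤s (s≤s z≤n)) 2≤a₀) (proj₂ (InQ-from 2 iq))

  Relevant? : Decidable (λ J → 1 ≤ J × 2 ∣ J)
  Relevant? J = (1 ≤? J) ×-dec (2 ∣? J)

  module Signed (s : Symmetry) where
    open Symmetry s

    Avoids? : ∀ q → Decidable (λ b → σ q b ≢ q ∸ 1)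
    Avoids? q b = ¬? (σ q b ≟ q ∸ 1)

    -- Only the primes of the i-th range are constrained and all others stay free, so the number of
    -- classes is M times the product of im q/q over this range.
    Hits? : ∀ i J q → Decidable (λ b → Q (sc i) q → ImageAt q J (σ q b))
    Hits? i J q b = Q? (sc i) q →-dec ImageAt? q J (σ q b)

    module Avoid = MultiChinese InQ? InQ-prime InQ≢2 Avoids?
    module Hit (i J : ℕ) = MultiChinese InQ? InQ-prime InQ≢2 (Hits? i J)

    Bad : ℕ → Set
    Bad a = Avoid.Good X a ⊎ ∃ λ i → i < t × ∃ λ J → J < period (sc i) × (1 ≤ J × 2 ∣ J) × Hit.Good i J X a

    Bad? : Decidable Bad
    Bad? a = Avoid.Good? X a ⊎-dec anyUpTo? (λ i → anyUpTo? (λ J → Relevant? J ×-dec Hit.Good? i J X a) (period (sc i))) t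

    private
      avoid-count : # (4 * M) (Avoid.Good? X) ≤ ΠQ (_∸ 1)
      avoid-count = ≤-trans (≤-reflexive (Avoid.good-count X)) (Π-mono X step)
        where
        bound : ∀ q → Prime q → # q (Avoids? q) ≤ q ∸ 1
        bound q pq = ≤-trans (Σ-inject q q (σ q) (λ b → 𝟙 (¬? (b ≟ q ∸ 1))) (σ< q pq) (σ-inj q pq))
          (subst (λ z → # z (λ b → ¬? (b ≟ q ∸ 1)) ≤ q ∸ 1) (m+[n∸m]≡n (<⇒≤ (prime>1 pq)))
            (≤-trans (≤-reflexive (trans (cong (# (q ∸ 1) (λ b → ¬? (b ≟ q ∸ 1)) +_) (𝟙-no (λ ≢ → ≢ refl) (¬? (q ∸ 1 ≟ q ∸ 1)))) (+-identityʳ _))) (#≤ {P? = λ b → ¬? (b ≟ q ∸ 1)} (q ∸ 1))))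
        step : ∀ q → q < X → # q (Avoids? q) ^ 𝟙 (InQ? q) ≤ (q ∸ 1) ^ 𝟙 (InQ? q)
        step q _ with InQ? q
        ... | yes iq = ^-monoˡ-≤ 1 (bound q (InQ-prime q iq))
        ... | no _   = ≤-refl

    hitTotal : ℕ → ℕ
    hitTotal i = Σ< (period (sc i)) (λ J → 𝟙 (Relevant? J) * # (4 * M) (Hit.Good? i J X))

    private
      hit-count : ∀ i → i < t → 2 ^ (suc a₀ + i) * hitTotal i ≤ M
      hit-count i i<t = *-cancelˡ-≤ P {{P≢0}} (begin
        P * (2 ^ (suc a₀ + i) * hitTotal i) ≡⟨ trans (cong (λ z → P * (2 ^ z * hitTotal i)) (cong suc (+-comm a₀ i))) (swap P (2 ^ k) (hitTotal i)) ⟩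
        2 ^ k * (P * hitTotal i) ≡⟨ cong (2 ^ k *_) (sym (Σ-*ˡ P (period (sc i)) _)) ⟩
        2 ^ k * Σ< (period (sc i)) (λ J → P * (𝟙 (Relevant? J) * # (4 * M) (Hit.Good? i J X)))
                                                                              ≤⟨ *-monoʳ-≤ (2 ^ k) (Σ-mono (period (sc i)) (λ J _ → per J)) ⟩
        2 ^ k * Σ< (period (sc i)) (λ J → M * (𝟙 (Relevant? J) * IM J)) ≡⟨ trans (cong (2 ^ k *_) (Σ-*ˡ M (period (sc i)) _)) (swap (2 ^ k) M _) ⟩
        M * (2 ^ k * Σ< (period (sc i)) (λ J → 𝟙 (Relevant? J) * IM J)) ≤⟨ *-monoʳ-≤ M (images (sc i)) ⟩
        M * P ≡⟨ *-comm M P ⟩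
        P * M ∎)
        where
        open ≤-Reasoning
        k P : ℕ
        k = suc (i + a₀)
        P = Π< (2 ^ k) (λ q → q ^ 𝟙 (Q? (sc i) q))
        IM : ℕ → ℕ
        IM J = Π< (2 ^ k) (λ q → im q J ^ 𝟙 (Q? (sc i) q))
        k≤ : 2 ^ k ≤ X
        k≤ = ^-monoʳ-≤ 2 (+-monoˡ-≤ a₀ i<t)
        swap : ∀ x y z → x * (y * z) ≡ y * (x * z)
        swap = solve-∀
        outside : ∀ (f : ℕ → ℕ) q → 2 ^ k ≤ q → f q ^ 𝟙 (Q? (sc i) q) ≡ 1
        outside f q le = cong (f q ^_) (𝟙-no (λ Qq → <⇒≱ (Q-upper (sc i) q Qq) le) (Q? (sc i) q))
        P≢0 : NonZero P
        P≢0 = >-nonZero (Π-pos (2 ^ k) _ pos)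
          where
          pos : ∀ q → q < 2 ^ k → 1 ≤ q ^ 𝟙 (Q? (sc i) q)
          pos q _ with Q? (sc i) q
          ... | yes Qq = subst (1 ≤_) (sym (*-identityʳ q)) (<⇒≤ (prime>1 (Q-prime (sc i) q Qq)))
          ... | no _   = ≤-refl
        hits : ∀ J → Π< X (λ q → # q (Hits? i J q) ^ 𝟙 (InQ? q)) * P ≤ M * IM J
        hits J = begin
          Π< X (λ q → # q (Hits? i J q) ^ 𝟙 (InQ? q)) * P ≡⟨ trans (cong (Π< X (λ q → # q (Hits? i J q) ^ 𝟙 (InQ? q)) *_) (sym (Π-extend (λ q → q ^ 𝟙 (Q? (sc i) q)) k≤ (outside id)))) (sym (Π-* X _ _)) ⟩
          Π< X (λ q → # q (Hits? i J q) ^ 𝟙 (InQ? q) * q ^ 𝟙 (Q? (sc i) q)) ≤⟨ Π-mono X point ⟩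
          Π< X (λ q → q ^ 𝟙 (InQ? q) * im q J ^ 𝟙 (Q? (sc i) q)) ≡⟨ trans (Π-* X _ _) (cong (M *_) (Π-extend (λ q → im q J ^ 𝟙 (Q? (sc i) q)) k≤ (outside (λ q → im q J)))) ⟩
          M * IM J ∎
          where
          hit-size : ∀ q → Q (sc i) q → # q (Hits? i J q) ≤ im q J
          hit-size q Qq = ≤-trans (#-mono {P? = Hits? i J q} q {Q? = λ b → ImageAt? q J (σ q b)} (λ b _ h → h Qq))
            (≤-trans (Σ-inject q q (σ q) (λ b → 𝟙 (ImageAt? q J b)) (σ< q pq) (σ-inj q pq)) (≤-reflexive (#-ImageAt q J)))
            where
            pq : Prime q
            pq = Q-prime (sc i) q Qq
          go : ∀ q (d : Dec (InQ q)) (d′ : Dec (Q (sc i) q)) → # q (Hits? i J q) ^ 𝟙 d * q ^ 𝟙 d′ ≤ q ^ 𝟙 d * im q J ^ 𝟙 d′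
          go q (yes _) (yes Qq) = ≤-trans (*-monoˡ-≤ (q * 1) (^-monoˡ-≤ 1 (hit-size q Qq))) (≤-reflexive (*-comm (im q J * 1) (q * 1)))
          go q (yes _) (no _)   = *-monoˡ-≤ 1 (^-monoˡ-≤ 1 (#≤ {P? = Hits? i J q} q))
          go q (no ¬iq) (yes Qq) = contradiction (i , i<t , Qq) ¬iq
          go q (no _) (no _)    = ≤-refl
          point : ∀ q → q < X → # q (Hits? i J q) ^ 𝟙 (InQ? q) * q ^ 𝟙 (Q? (sc i) q) ≤ q ^ 𝟙 (InQ? q) * im q J ^ 𝟙 (Q? (sc i) q)
          point q _ = go q (InQ? q) (Q? (sc i) q)
        per : ∀ J → P * (𝟙 (Relevant? J) * # (4 * M) (Hit.Good? i J X)) ≤ M * (𝟙 (Relevant? J) * IM J)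
        per J = begin
          P * (𝟙 (Relevant? J) * # (4 * M) (Hit.Good? i J X)) ≡⟨ trans (swap P (𝟙 (Relevant? J)) _) (cong (𝟙 (Relevant? J) *_) (trans (*-comm P _) (cong (_* P) (Hit.good-count i J X)))) ⟩
          𝟙 (Relevant? J) * (Π< X (λ q → # q (Hits? i J q) ^ 𝟙 (InQ? q)) * P) ≤⟨ *-monoʳ-≤ (𝟙 (Relevant? J)) (hits J) ⟩
          𝟙 (Relevant? J) * (M * IM J) ≡⟨ swap (𝟙 (Relevant? J)) M (IM J) ⟩
          M * (𝟙 (Relevant? J) * IM J) ∎

    bad-count : # (4 * M) Bad? ≤ ΠQ (_∸ 1) + Σ< t hitTotal
    bad-count = ≤-trans (#-∪ {P? = Bad?} (4 * M) {Q? = Avoid.Good? X} {R? = Any?} (λ a _ b → b)) (+-mono-≤ avoid-count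
        (≤-trans (#-cover (4 * M) t Any? AtScale? (λ a _ p → p)) (Σ-mono t (λ i _ → ≤-trans (#-cover (4 * M) (period (sc i)) (AtScale? i) (AtExponent? i) (λ a _ p → p)) (Σ-mono (period (sc i)) (λ J _ → guard i J (Relevant? J)))))))
      where
      AtExponent? : ∀ i J → Decidable (λ a → (1 ≤ J × 2 ∣ J) × Hit.Good i J X a)
      AtExponent? i J a = Relevant? J ×-dec Hit.Good? i J X a
      AtScale? : ∀ i → Decidable (λ a → ∃ λ J → J < period (sc i) × (1 ≤ J × 2 ∣ J) × Hit.Good i J X a)
      AtScale? i a = anyUpTo? (λ J → AtExponent? i J a) (period (sc i))
      Any? : Decidable (λ a → ∃ λ i → i < t × ∃ λ J → J < period (sc i) × (1 ≤ J × 2 ∣ J) × Hit.Good i J X a)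
      Any? a = anyUpTo? (λ i → AtScale? i a) t
      guard : ∀ i J (d : Dec (1 ≤ J × 2 ∣ J)) → # (4 * M) (AtExponent? i J) ≤ 𝟙 d * # (4 * M) (Hit.Good? i J X)
      guard i J (yes _) = ≤-trans (#-mono {P? = AtExponent? i J} (4 * M) {Q? = Hit.Good? i J X} (λ a _ p → proj₂ p)) (≤-reflexive (sym (+-identityʳ _)))
      guard i J (no ¬r) = ≤-reflexive (#-none {P? = AtExponent? i J} (4 * M) (λ a _ p → ¬r (proj₁ p)))

    hit-total : 2 ^ a₀ * Σ< t hitTotal ≤ M
    hit-total = *-cancelˡ-≤ 2 (≤-trans (≤-reflexive (sym (*-assoc 2 (2 ^ a₀) _))) (geometric (suc a₀) t M hitTotal hit-count))

    -- An even exponent is either divisible by every q − 1, or nonzero modulo the period of some scale.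
    even-exponent : ∀ a j → a % 4 ≡ 2 → 1 ≤ j → 2 ∣ j → (∀ q → InQ q → ImageAt q j (σ q (a rem q))) → Bad a
    even-exponent a j a%4≡2 1≤j 2∣j h with anyUpTo? (λ q → InQ? q ×-dec ¬? ((q ∸ 1) ∣? j)) X
    ... | no none = inj₁ (a%4≡2 , λ {q} q<X iq → image-avoids q (InQ-prime q iq) j (σ q (a rem q)) 1≤j (divisible q q<X iq) (h q iq))
      where
      divisible : ∀ q → q < X → InQ q → q ∸ 1 ∣ j
      divisible q q<X iq with (q ∸ 1) ∣? j
      ... | yes d = d
      ... | no ¬d = contradiction (q , q<X , iq , ¬d) none
    ... | yes (q , q<X , (i , i<t , Qq) , ∤j) = inj₂ (i , i<t , J , m%n<n j L , (1≤J , 2∣J) , a%4≡2 , λ {q′} _ iq′ Qq′ →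
          case order∣period (sc i) q′ Qq′ of λ where
            (divides c eq) → image-reduce q′ (InQ-prime q′ iq′) j J (j / L * c) (σ q′ (a rem q′)) 1≤J
              (trans (m≡m%n+[m/n]*n j L) (cong (J +_) (trans (cong (j / L *_) eq) (sym (*-assoc (j / L) c (q′ ∸ 1)))))) (h q′ iq′))
      where
      L J : ℕ
      L = period (sc i)
      instance
        L≢0 : NonZero L
        L≢0 = >-nonZero (period>0 (sc i))
      J = j % L
      n∣L : q ∸ 1 ∣ L
      n∣L = order∣period (sc i) q Qq
      1≤J : 1 ≤ J
      1≤J = n≢0⇒n>0 λ J≡0 → ∤j (∣-trans n∣L (m%n≡0⇒n∣m j L J≡0))
      2∣J : 2 ∣ J
      2∣J = ∣m+n∣m⇒∣n (subst (2 ∣_) (trans (m≡m%n+[m/n]*n j L) (+-comm J _)) 2∣j) (∣n⇒∣m*n (j / L) (∣-trans (odd-prime (Q-prime (sc i) q Qq) (InQ≢2 q (i , i<t , Qq))) n∣L))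

  module Plus  = Signed identity
  module Minus = Signed reflection

  -- The first alternative covers the totients q - 1 of primes q dividing the modulus, which are -1
  -- modulo q and so escape the avoidance condition.
  Bad : ℕ → Set
  Bad a = InQ (suc a) ⊎ (Plus.Bad a ⊎ Minus.Bad a)

  Bad? : Decidable Bad
  Bad? a = InQ? (suc a) ⊎-dec (Plus.Bad? a ⊎-dec Minus.Bad? a)

  M>0 : 1 ≤ M
  M>0 = Plus.Avoid.M>0 X

  private
    -- A common multiple of all q - 1; then (j + 1)(Λ - 1) is a natural number representing the
    -- exponent -(j + 1) for all q at once.
    Λ : ℕ
    Λ = Π< X (λ q → (q ∸ 1) ^ 𝟙 (InQ? q))

    n∣Λ : ∀ q → InQ q → q ∸ 1 ∣ Λ
    n∣Λ q iq = ∣-trans (subst (λ e → q ∸ 1 ∣ (q ∸ 1) ^ e) (sym (𝟙-yes iq (InQ? q))) (m∣m*n 1)) (term∣Π X (λ q → (q ∸ 1) ^ 𝟙 (InQ? q)) (InQ<X q iq))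

    Λ>0 : 1 ≤ Λ
    Λ>0 = Π-pos X _ pos
      where
      pos : ∀ q → q < X → 1 ≤ (q ∸ 1) ^ 𝟙 (InQ? q)
      pos q _ with InQ? q
      ... | yes iq = subst (1 ≤_) (sym (*-identityʳ (q ∸ 1))) (m<n⇒0<n∸m (prime>1 (InQ-prime q iq)))
      ... | no _   = ≤-refl

    even⊎odd : ∀ j → 2 ∣ j ⊎ 2 ∣ suc j
    even⊎odd zero    = inj₁ (2 ∣0)
    even⊎odd (suc j) with even⊎odd j
    ... | inj₁ d = inj₂ (∣m∣n⇒∣m+n (∣-refl {2}) d)
    ... | inj₂ d = inj₁ d

  -- That p may divide the modulus matters for j = 0 only: for j ≥ 1 the value 0 at x = 0 belongs to
  -- the image anyway. An odd exponent j turns into an even multiple of j + 1.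
  bad-value : ∀ a v → a < 4 * M → a % 4 ≡ 2 → (∀ d .{{_ : NonZero d}} → d ∣ 4 * M → v % d ≡ a % d) → ∀ p j → Prime p → v ≡ p ^ j * (p ∸ 1) → Bad a
  bad-value a v a<4M a%4≡2 v≈a p j pp v≡ = go j v≡
    where
    q∣4M : ∀ q → InQ q → q ∣ 4 * M
    q∣4M q iq = ∣n⇒∣m*n 4 (Plus.Avoid.q∣M X q (InQ<X q iq) iq)
    a-rem : ∀ q → InQ q → a rem q ≡ (v rem q)
    a-rem q iq = trans (rem≡% a q) (trans (sym (v≈a q (q∣4M q iq))) (sym (rem≡% v q)))
      where
      instance
        q≢0 : NonZero q
        q≢0 = prime⇒nonZero (InQ-prime q iq)
    hit : ∀ j → v ≡ p ^ j * (p ∸ 1) → ∀ q → InQ q → ImageAt q j (a rem q)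
    hit j eq q iq = subst (ImageAt q j) (sym (trans (a-rem q iq) (trans (cong (_rem q) eq) (rem≡% (p ^ j * (p ∸ 1)) q)))) (value∈image q (InQ-prime q iq) p j (<⇒≤ (prime>1 pp)))
      where
      instance
        q≢0 : NonZero q
        q≢0 = prime⇒nonZero (InQ-prime q iq)
    go : ∀ j → v ≡ p ^ j * (p ∸ 1) → Bad a
    go zero eq with InQ? p
    ... | yes ip = inj₁ (subst InQ (sym (trans (cong suc a≡) (m+[n∸m]≡n (<⇒≤ (prime>1 pp))))) ip)
      where
      instance
        4M≢0 : NonZero (4 * M)
        4M≢0 = m*n≢0 4 M {{_}} {{>-nonZero M>0}}
      p≤4M : p ≤ 4 * M
      p≤4M = ∣⇒≤ (q∣4M p ip)
      a≡ : a ≡ p ∸ 1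
      a≡ = trans (sym (m<n⇒m%n≡m a<4M)) (trans (sym (v≈a (4 * M) ∣-refl)) (trans (cong (_% (4 * M)) (trans eq (*-identityˡ (p ∸ 1)))) (m<n⇒m%n≡m (<-≤-trans (∸-monoʳ-< z<s (<⇒≤ (prime>1 pp))) p≤4M))))
    ... | no ¬ip = inj₂ (inj₁ (inj₁ (a%4≡2 , λ {q} q<X iq e → ¬ip (subst InQ (prime∣prime (InQ-prime q iq) pp (q∣p q iq e)) iq))))
      where
      q∣p : ∀ q → InQ q → a rem q ≡ q ∸ 1 → q ∣ p
      q∣p q iq e = ≈0⇒∣ (begin
        p % q ≡⟨ cong (_% q) (sym (m+[n∸m]≡n (<⇒≤ (prime>1 pp)))) ⟩
        (1 + (p ∸ 1)) % q ≡⟨ +-≈ {1} {1} {p ∸ 1} {n} refl (trans (trans (cong (_% q) (sym (trans eq (*-identityˡ (p ∸ 1))))) (trans (sym (rem≡% v q)) (trans (sym (a-rem q iq)) e))) (sym (m<n⇒m%n≡m n<q))) ⟩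
        (1 + n) % q ≡⟨ cong (_% q) (sym q≡1+n) ⟩
        q % q ≡⟨ trans (n%n≡0 q) (sym 0%q≡0) ⟩
        0 % q ∎)
        where
        open ≡-Reasoning
        open PrimeField q (InQ-prime q iq)
    go (suc j) eq with even⊎odd (suc j)
    ... | inj₁ 2∣j = inj₂ (inj₁ (Plus.even-exponent a (suc j) a%4≡2 (s≤s z≤n) 2∣j (hit (suc j) eq)))
    ... | inj₂ 2∣1+j = case InQ-any of λ where
          (inj₁ 2≤Λ) → inj₂ (inj₂ (Minus.even-exponent a (suc (suc j) * (Λ ∸ 1)) a%4≡2 (*-mono-≤ (s≤s {n = suc j} z≤n) (m<n⇒0<n∸m 2≤Λ)) (∣m⇒∣m*n (Λ ∸ 1) 2∣1+j)
            (λ q iq → subst (ImageAt q (suc (suc j) * (Λ ∸ 1))) (sym (rem≡% ((q ∸ 1) * (a rem q)) q {{prime⇒nonZero (InQ-prime q iq)}}))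
              (image-reflect q (InQ-prime q iq) (suc j) Λ (a rem q) (s≤s z≤n) Λ>0 (n∣Λ q iq) (hit (suc j) eq q iq)))))
          (inj₂ none) → inj₂ (inj₁ (inj₁ (a%4≡2 , λ {q} _ iq → contradiction iq (none q))))
      where
      -- For an empty set of primes Λ = 1 and the new exponent would be 0; the avoidance condition
      -- then holds vacuously.
      InQ-any : 2 ≤ Λ ⊎ (∀ q → ¬ InQ q)
      InQ-any with anyUpTo? InQ? X
      ... | yes (q , _ , iq) = inj₁ (≤-trans (∣⇒≤ {{>-nonZero (m<n⇒0<n∸m (prime>1 (InQ-prime q iq)))}} (odd-prime (InQ-prime q iq) (InQ≢2 q iq))) (∣⇒≤ {{>-nonZero Λ>0}} (n∣Λ q iq)))
      ... | no none = inj₂ (λ q iq → none (q , InQ<X q iq , iq))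

  size : ℕ
  size = # X InQ?

  size-bound : 2 ^ a₀ * size ≤ M
  size-bound = ≤-trans (go size) (≤-trans (≤-reflexive (sym (Π-^Σ X (2 ^ a₀) _))) (Π-mono X step))
    where
    step : ∀ q → q < X → (2 ^ a₀) ^ 𝟙 (InQ? q) ≤ q ^ 𝟙 (InQ? q)
    step q _ with InQ? q
    ... | yes iq = ^-monoˡ-≤ 1 (proj₂ (InQ-from q iq))
    ... | no _   = ≤-refl
    go : ∀ n → 2 ^ a₀ * n ≤ (2 ^ a₀) ^ n
    go zero    = ≤-trans (≤-reflexive (*-zeroʳ (2 ^ a₀))) z≤n
    go (suc n) = *-monoʳ-≤ (2 ^ a₀) (≤-trans (n<2^n n) (^-monoˡ-≤ n (^-monoʳ-≤ 2 {1} {a₀} (≤-trans (s≤s z≤n) 2≤a₀))))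

  BadClass? : Decidable (λ a → a % 4 ≡ 2 × Bad a)
  BadClass? a = (a % 4 ≟ 2) ×-dec Bad? a

  -- There are five contributions of at most M/8E each: the classes of the numbers q - 1 and, for
  -- either sign, the avoiding classes and the hits over all ranges.
  bad-total : ∀ E → 8 * E ≤ 2 ^ a₀ → 8 * E * ΠQ (_∸ 1) ≤ M → E * # (4 * M) BadClass? ≤ M
  bad-total E 8E≤ density = *-cancelˡ-≤ 8 (begin
    8 * (E * # (4 * M) BadClass?) ≤⟨ *-monoʳ-≤ 8 (*-monoʳ-≤ E cover) ⟩
    8 * (E * (size + (D + S₁ + (D + S₂)))) ≡⟨ ring E size D S₁ S₂ ⟩
    8 * E * size + (8 * E * D + 8 * E * S₁ + (8 * E * D + 8 * E * S₂)) ≤⟨ +-mono-≤ (≤-trans (*-monoˡ-≤ size 8E≤) size-bound) (+-mono-≤ (+-mono-≤ density (≤-trans (*-monoˡ-≤ S₁ 8E≤) Plus.hit-total)) (+-mono-≤ density (≤-trans (*-monoˡ-≤ S₂ 8E≤) Minus.hit-total))) ⟩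
    M + (M + M + (M + M)) ≤⟨ m≤m+n _ (3 * M) ⟩
    M + (M + M + (M + M)) + 3 * M ≡⟨ ring₂ M ⟩
    8 * M ∎)
    where
    open ≤-Reasoning
    D S₁ S₂ : ℕ
    D = ΠQ (_∸ 1)
    S₁ = Σ< t Plus.hitTotal
    S₂ = Σ< t Minus.hitTotal
    ring : ∀ E s D S₁ S₂ → 8 * (E * (s + (D + S₁ + (D + S₂)))) ≡ 8 * E * s + (8 * E * D + 8 * E * S₁ + (8 * E * D + 8 * E * S₂))
    ring = solve-∀
    ring₂ : ∀ M → M + (M + M + (M + M)) + 3 * M ≡ 8 * M
    ring₂ = solve-∀
    exceptional : # (4 * M) (λ a → InQ? (suc a)) ≤ size
    exceptional = #-inject (4 * M) X {P? = λ a → InQ? (suc a)} {Q? = InQ?} suc (λ a _ iq → InQ<X (suc a) iq , iq) (λ _ _ _ _ _ _ e → suc-injective e)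
    cover : # (4 * M) BadClass? ≤ size + (D + S₁ + (D + S₂))
    cover = ≤-trans (#-∪ {P? = BadClass?} (4 * M) {Q? = λ a → InQ? (suc a)} {R? = λ a → Plus.Bad? a ⊎-dec Minus.Bad? a} (λ a _ b → proj₂ b))
      (+-mono-≤ exceptional (≤-trans (#-∪ {P? = λ a → Plus.Bad? a ⊎-dec Minus.Bad? a} (4 * M) {Q? = Plus.Bad?} {R? = Minus.Bad?} (λ a _ b → b)) (+-mono-≤ Plus.bad-count Minus.bad-count)))

-- Summing the losses over all ranges

Σ-blocks : ∀ (B f w V : ℕ → ℕ) ν → (∀ μ → B μ ≤ B (suc μ)) → (∀ μ k → B μ ≤ k → f k ≤ w μ) →
  ∀ n → (∀ μ → ν ≤ μ → μ < n + ν → B (suc μ) * w μ + V (suc μ) ≤ V μ) →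
  Σ< (B (n + ν)) (λ k → 𝟙 (B ν ≤? k) * f k) + V (n + ν) ≤ V ν
Σ-blocks B f w V ν B↑ f≤w zero h = ≤-reflexive (cong (_+ V ν) (Σ-zero (B ν) _ (λ k k<B → cong (_* f k) (𝟙-no (<⇒≱ k<B) (B ν ≤? k)))))
Σ-blocks B f w V ν B↑ f≤w (suc n) h = begin
  Σ< (B (suc μ)) F + V (suc μ) ≡⟨ cong (λ z → Σ< z F + V (suc μ)) (sym (m+[n∸m]≡n (B↑ μ))) ⟩
  Σ< (B μ + r) F + V (suc μ) ≡⟨ cong (_+ V (suc μ)) (Σ-split (B μ) r F) ⟩
  Σ< (B μ) F + Σ< r (λ j → F (B μ + j)) + V (suc μ) ≤⟨ +-monoˡ-≤ (V (suc μ)) (+-monoʳ-≤ (Σ< (B μ) F) block) ⟩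
  Σ< (B μ) F + B (suc μ) * w μ + V (suc μ) ≡⟨ +-assoc (Σ< (B μ) F) (B (suc μ) * w μ) (V (suc μ)) ⟩
  Σ< (B μ) F + (B (suc μ) * w μ + V (suc μ)) ≤⟨ +-monoʳ-≤ (Σ< (B μ) F) (h μ (m≤n+m ν n) ≤-refl) ⟩
  Σ< (B μ) F + V μ ≤⟨ Σ-blocks B f w V ν B↑ f≤w n (λ μ′ lo hi → h μ′ lo (m<n⇒m<1+n hi)) ⟩
  V ν ∎
  where
  open ≤-Reasoning
  μ r : ℕ
  μ = n + ν
  r = B (suc μ) ∸ B μ
  F : ℕ → ℕ
  F k = 𝟙 (B ν ≤? k) * f k
  block : Σ< r (λ j → F (B μ + j)) ≤ B (suc μ) * w μ
  block = ≤-trans (Σ-bound r _ (w μ) (λ j _ → ≤-trans (*-monoˡ-≤ (f (B μ + j)) (𝟙≤1 (B ν ≤? B μ + j)))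
      (≤-trans (≤-reflexive (*-identityˡ (f (B μ + j)))) (f≤w μ (B μ + j) (m≤m+n (B μ) j)))))
    (*-monoˡ-≤ (w μ) (m∸n≤m (B (suc μ)) (B μ)))

scaleIndex-≥ : ∀ ν k → 2 ^ (128 * ν) ≤ k → ν ≤ scaleIndex k
scaleIndex-≥ ν k le = ≤-trans (≤-reflexive (sym (trans (cong (_/ 128) (*-comm 128 ν)) (m*n/n≡m ν 128))))
  (/-monoˡ-≤ 128 (top-≥ (λ i → 2 ^ i ≤? k) k (128 * ν) (≤-trans (<⇒≤ (n<2^n (128 * ν))) le) le))

scaleGain : ℕ → ℕ
scaleGain k = 131 * suc (scaleIndex k)

private
  -- one block loses at most 2^(128s)·10·2^(−131s) ≤ 2^(−s), relative to 2^G
  block-loss : ∀ a b G s → 2 ≤ s → 2 ≤ b → suc (a + b) * s ≤ G →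
    2 ^ (a * s) * (10 * 2 ^ (G ∸ suc (a + b) * s)) + 2 ^ (G ∸ s) ≤ 2 * 2 ^ (G ∸ s)
  block-loss a b G s 2≤s 2≤b le = begin
    A * (10 * Y) + 2 ^ (G ∸ s) ≤⟨ +-monoˡ-≤ (2 ^ (G ∸ s)) small ⟩
    2 ^ (G ∸ s) + 2 ^ (G ∸ s) ≡⟨ cong (2 ^ (G ∸ s) +_) (sym (+-identityʳ (2 ^ (G ∸ s)))) ⟩
    2 * 2 ^ (G ∸ s) ∎
    where
    open ≤-Reasoning
    R A Y : ℕ
    R = G ∸ suc (a + b) * s
    A = 2 ^ (a * s)
    Y = 2 ^ R
    ring : ∀ a b s R → suc (a + b) * s + R ≡ R + a * s + b * s + s
    ring = solve-∀
    ring′ : ∀ x y z → y * x * z ≡ x * (z * y)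
    ring′ = solve-∀
    G∸s : G ∸ s ≡ R + a * s + b * s
    G∸s = trans (cong (_∸ s) (trans (sym (m+[n∸m]≡n le)) (ring a b s R))) (m+n∸n≡m (R + a * s + b * s) s)
    10≤ : 10 ≤ 2 ^ (b * s)
    10≤ = ≤-trans (s≤s (s≤s (s≤s (s≤s (s≤s (s≤s (s≤s (s≤s (s≤s (s≤s z≤n)))))))))) (^-monoʳ-≤ 2 {4} {b * s} (*-mono-≤ 2≤b 2≤s))
    small : A * (10 * Y) ≤ 2 ^ (G ∸ s)
    small = begin
      A * (10 * Y) ≤⟨ *-monoʳ-≤ A (*-monoˡ-≤ Y 10≤) ⟩
      A * (2 ^ (b * s) * Y) ≡⟨ sym (ring′ A Y (2 ^ (b * s))) ⟩
      Y * A * 2 ^ (b * s) ≡⟨ cong (_* 2 ^ (b * s)) (2^-+ R (a * s)) ⟩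
      2 ^ (R + a * s) * 2 ^ (b * s) ≡⟨ 2^-+ (R + a * s) (b * s) ⟩
      2 ^ (R + a * s + b * s) ≡⟨ cong (2 ^_) (sym G∸s) ⟩
      2 ^ (G ∸ s) ∎

-- The potential 2^(G-μ) pays for the sum: the k with 2^(128μ) ≤ k < 2^(128(μ+1)) together cost at
-- most its drop from μ to μ + 1. The margin of 131 over 128 makes this possible.
gain-series : ∀ ν a₀ t G → 2 ≤ ν → 2 ^ (128 * ν) ≤ a₀ → 131 * (suc (t + a₀) + ν) ≤ G →
  2 * Σ< t (λ i → 10 * 2 ^ (G ∸ scaleGain (suc (i + a₀)))) ≤ 2 ^ G
gain-series ν a₀ t G 2≤ν B≤a₀ large = begin
  2 * Σ< t (λ i → f (suc (i + a₀))) ≤⟨ *-monoʳ-≤ 2 (Σ-mono t (λ i _ → mark i)) ⟩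
  2 * Σ< t (λ i → F (suc (i + a₀))) ≤⟨ *-monoʳ-≤ 2 (Σ-inject t (B (n + ν)) (λ i → suc (i + a₀)) F below inj) ⟩
  2 * Σ< (B (n + ν)) F ≤⟨ *-monoʳ-≤ 2 (≤-trans (m≤m+n (Σ< (B (n + ν)) F) (V (n + ν))) (Σ-blocks B f w V ν B↑ f≤w n loss)) ⟩
  2 * 2 ^ (G ∸ ν) ≤⟨ *-monoʳ-≤ 2 (^-monoʳ-≤ 2 {G ∸ ν} {G ∸ 1} (∸-monoʳ-≤ G (≤-trans (s≤s z≤n) 2≤ν))) ⟩
  2 * 2 ^ (G ∸ 1) ≡⟨ cong (2 ^_) (m+[n∸m]≡n {1} {G} 1≤G) ⟩
  2 ^ G ∎
  where
  open ≤-Reasoning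
  n : ℕ
  n = suc (t + a₀)
  B f F w V : ℕ → ℕ
  B μ = 2 ^ (128 * μ)
  f k = 10 * 2 ^ (G ∸ scaleGain k)
  F k = 𝟙 (B ν ≤? k) * f k
  w μ = 10 * 2 ^ (G ∸ 131 * suc μ)
  V μ = 2 ^ (G ∸ μ)
  ν≤G : n + ν ≤ G
  ν≤G = ≤-trans (m≤n*m (n + ν) 131) large
  1≤G : 1 ≤ G
  1≤G = ≤-trans (s≤s z≤n) ν≤G
  B↑ : ∀ μ → B μ ≤ B (suc μ)
  B↑ μ = ^-monoʳ-≤ 2 {128 * μ} {128 * suc μ} (*-monoʳ-≤ 128 (n≤1+n μ))
  f≤w : ∀ μ k → B μ ≤ k → f k ≤ w μ
  f≤w μ k le = *-monoʳ-≤ 10 (^-monoʳ-≤ 2 {G ∸ scaleGain k} {G ∸ 131 * suc μ} (∸-monoʳ-≤ G (*-monoʳ-≤ 131 (s≤s (scaleIndex-≥ μ k le)))))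
  loss : ∀ μ → ν ≤ μ → μ < n + ν → B (suc μ) * w μ + V (suc μ) ≤ V μ
  loss μ ν≤μ μ< = ≤-trans (block-loss 128 2 G (suc μ) (≤-trans 2≤ν (≤-trans ν≤μ (n≤1+n μ))) ≤-refl (≤-trans (*-monoʳ-≤ 131 μ<) large))
    (≤-reflexive (cong (2 ^_) (sym (+-∸-assoc 1 {G} {suc μ} (≤-trans μ< ν≤G)))))
  mark : ∀ i → f (suc (i + a₀)) ≤ F (suc (i + a₀))
  mark i = ≤-reflexive (sym (trans (cong (_* f (suc (i + a₀))) (𝟙-yes (≤-trans B≤a₀ (m≤n⇒m≤1+n (m≤n+m a₀ i))) (B ν ≤? suc (i + a₀)))) (*-identityˡ (f (suc (i + a₀))))))
  below : ∀ i → i < t → suc (i + a₀) < B (n + ν)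
  below i i<t = ≤-<-trans (s≤s (+-monoˡ-≤ a₀ (<⇒≤ i<t))) (≤-<-trans (m≤m+n n ν) (<-≤-trans (n<2^n (n + ν)) (^-monoʳ-≤ 2 {n + ν} {128 * (n + ν)} (m≤n*m (n + ν) 128))))
  inj : ∀ i j → i < t → j < t → suc (i + a₀) ≡ suc (j + a₀) → i ≡ j
  inj i j _ _ e = +-cancelʳ-≡ a₀ i j (suc-injective e)

-- From the sparse bad classes to the theorem

∣⊖∣ : ∀ m n → ℤ.∣ m ℤ.⊖ n ∣ ≡ ∣ m - n ∣
∣⊖∣ zero    zero    = refl
∣⊖∣ zero    (suc n) = refl
∣⊖∣ (suc m) zero    = refl
∣⊖∣ (suc m) (suc n) = trans (cong ℤ.∣_∣ (ℤP.[1+m]⊖[1+n]≡m⊖n m n)) (∣⊖∣ m n)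

mod⇒% : ∀ {v a N} d .{{_ : NonZero d}} → d ∣ N → v ≡ a [mod N ] → v % d ≡ a % d
mod⇒% {v} {a} {N} d d∣N v≡a = Congruence.∣⇒≈ d v a (∣-trans d∣N (subst (N ∣_) (trans (cong ℤ.∣_∣ (ℤP.m-n≡m⊖n v a)) (∣⊖∣ v a)) v≡a))

opaque
  sparse-totient-classes : ∀ E → ∃ λ M → 1 ≤ M × Σ (ℕ → Set) λ Bad → Σ (Decidable Bad) λ Bad? →
    (∀ a n → a < 4 * M → a % 4 ≡ 2 → 1 ≤ n → φ n ≡ a [mod 4 * M ] → Bad a) × E * # (4 * M) (λ a → (a % 4 ≟ 2) ×-dec Bad? a) ≤ M
  sparse-totient-classes E = M , M>0 , Bad , Bad? , totient⇒bad , bad-total E 8E≤2^a₀ (density G (m≤m+n (t + a₀) _) gain≤G series (8 * E) ≤-refl)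
    where
    ν₀ ν a₀ t G : ℕ
    ν₀ = proj₁ scales-exist
    -- This ν makes every range beyond a₀ admissible, 2^a₀ at least 8E, and the total loss at most
    -- one half. Afterwards t is taken so large that Euler's product outweighs the primes below
    -- 2^a₀, and G only has to exceed all exponents that occur.
    ν = ν₀ + 8 * E + 2
    a₀ = 2 ^ (128 * ν)
    t = 4 * Π-primes (2 ^ a₀) * (8 * E)
    G = t + a₀ + (Σ< t (λ i → scaleGain (suc (i + a₀))) + 131 * (suc (t + a₀) + ν))
    2≤ν : 2 ≤ ν
    2≤ν = m≤n+m 2 (ν₀ + 8 * E)
    ν≤a₀ : ν ≤ a₀
    ν≤a₀ = ≤-trans (m≤n*m ν 128) (<⇒≤ (n<2^n (128 * ν)))
    8E≤2^a₀ : 8 * E ≤ 2 ^ a₀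
    8E≤2^a₀ = ≤-trans (m≤n+m (8 * E) ν₀) (≤-trans (m≤m+n (ν₀ + 8 * E) 2) (≤-trans ν≤a₀ (<⇒≤ (n<2^n a₀))))
    gain≤G : ∀ i → i < t → scaleGain (suc (i + a₀)) ≤ G
    gain≤G i i<t = ≤-trans (term≤Σ t (λ i → scaleGain (suc (i + a₀))) i<t) (≤-trans (m≤m+n _ (131 * (suc (t + a₀) + ν))) (m≤n+m _ (t + a₀)))
    series : 2 * Σ< t (λ i → 10 * 2 ^ (G ∸ scaleGain (suc (i + a₀)))) ≤ 2 ^ G
    series = gain-series ν a₀ t G 2≤ν ≤-refl (≤-trans (m≤n+m _ (Σ< t (λ i → scaleGain (suc (i + a₀))))) (m≤n+m _ (t + a₀)))
    sc : ∀ i → ScaleSet (suc (i + a₀)) (scaleGain (suc (i + a₀)))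
    sc i = proj₁ (proj₂ scales-exist (suc (i + a₀)) (≤-trans (^-monoʳ-≤ 2 {128 * ν₀} {128 * ν} (*-monoʳ-≤ 128 (≤-trans (m≤m+n ν₀ (8 * E)) (m≤m+n (ν₀ + 8 * E) 2)))) (m≤n⇒m≤1+n (m≤n+m a₀ i))))
    open Classes a₀ t (≤-trans 2≤ν ν≤a₀) (λ i → scaleGain (suc (i + a₀))) sc
    totient⇒bad : ∀ a n → a < 4 * M → a % 4 ≡ 2 → 1 ≤ n → φ n ≡ a [mod 4 * M ] → Bad a
    totient⇒bad a n a<4M a≡2 1≤n φn≡a = case φ≡2[mod4] n 1≤n (trans (mod⇒% {φ n} {a} 4 (m∣m*n M) φn≡a) a≡2) of λ where
      (p , j , pp , e) → bad-value a (φ n) a<4M a≡2 (λ d d∣4M → mod⇒% {φ n} {a} d d∣4M φn≡a) p j pp e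

length-filter-applyUpTo : ∀ {P : ℕ → Set} (P? : Decidable P) (f : ℕ → ℕ) n → length (filter P? (applyUpTo f n)) ≡ Σ< n (λ i → 𝟙 (P? (f i)))
length-filter-applyUpTo P? f zero    = refl
length-filter-applyUpTo P? f (suc n) = trans step (sym (Σ-shift n (λ i → 𝟙 (P? (f i)))))
  where
  step : length (filter P? (f 0 ∷ applyUpTo (f ∘ suc) n)) ≡ 𝟙 (P? (f 0)) + Σ< n (λ i → 𝟙 (P? (f (suc i))))
  step with P? (f 0)
  ... | yes _ = cong suc (length-filter-applyUpTo P? (f ∘ suc) n)
  ... | no _  = length-filter-applyUpTo P? (f ∘ suc) n

#≡2[mod4] : ∀ M → # (4 * M) (λ a → a % 4 ≟ 2) ≡ M
#≡2[mod4] M = begin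
  # (4 * M) (λ a → a % 4 ≟ 2) ≡⟨ cong (λ z → # z (λ a → a % 4 ≟ 2)) (*-comm 4 M) ⟩
  # (M * 4) (λ a → a % 4 ≟ 2) ≡⟨ Σ-radix 4 M _ ⟩
  Σ< M (λ i → Σ< 4 (λ j → 𝟙 ((j + i * 4) % 4 ≟ 2))) ≡⟨ Σ-cong M (λ i _ → Σ-cong 4 (λ j _ → cong (λ z → 𝟙 (z ≟ 2)) ([m+kn]%n≡m%n j i 4))) ⟩
  Σ< M (λ _ → 1) ≡⟨ trans (Σ-const M 1) (*-identityʳ M) ⟩
  M ∎
  where open ≡-Reasoning

-- A positive rational is at least the reciprocal of its denominator, so the denominator of ε may
-- serve as the integer E.
1-ε-bound : ∀ (ε : ℚ) (m s : ℕ) → 0ℚ ℚ.< ε → ℚ.↧ₙ ε * m ≤ ℚ.↧ₙ ε * s + m → (1ℚ ℚ.- ε) ℚ.* ((ℤ.+ m) ℚ./ 1) ℚ.≤ (ℤ.+ s) ℚ./ 1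
1-ε-bound ε@(ℚ.mkℚ (ℤ.+ zero) d _) m s 0<ε h = contradiction (subst₂ ℤ._<_ (ℤP.*-zeroˡ (ℤ.+ suc d)) (ℤP.*-zeroˡ (ℤ.+ 1)) (ℚP.drop-*<* 0<ε)) (ℤP.<-irrefl refl)
1-ε-bound ε@(ℚ.mkℚ ℤ.-[1+ n ] d _) m s (ℚ.*<* ()) h
1-ε-bound ε@(ℚ.mkℚ ℤ.+[1+ n ] d _) m s 0<ε h = ℚP.toℚᵘ-cancel-≤ (begin
  ℚ.toℚᵘ ((1ℚ ℚ.- ε) ℚ.* ((ℤ.+ m) ℚ./ 1))                     ≃⟨ ℚP.toℚᵘ-homo-* (1ℚ ℚ.- ε) ((ℤ.+ m) ℚ./ 1) ⟩
  ℚ.toℚᵘ (1ℚ ℚ.- ε) ℚᵘ.* ℚ.toℚᵘ ((ℤ.+ m) ℚ./ 1)               ≃⟨ ℚᵘP.*-cong (ℚP.toℚᵘ-homo-+ 1ℚ (ℚ.- ε)) (ℚP.toℚᵘ-fromℚᵘ (ℚᵘ.mkℚᵘ (ℤ.+ m) 0)) ⟩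
  (ℚᵘ.1ℚᵘ ℚᵘ.+ ℚᵘ.mkℚᵘ ℤ.-[1+ n ] d) ℚᵘ.* ℚᵘ.mkℚᵘ (ℤ.+ m) 0 ≤⟨ ℚᵘ.*≤* integral ⟩
  ℚᵘ.mkℚᵘ (ℤ.+ s) 0                                           ≃⟨ ℚᵘP.≃-sym (ℚP.toℚᵘ-fromℚᵘ (ℚᵘ.mkℚᵘ (ℤ.+ s) 0)) ⟩
  ℚ.toℚᵘ ((ℤ.+ s) ℚ./ 1) ∎)
  where
  open ℚᵘP.≤-Reasoning
  D N : ℕ
  D = suc d
  N = suc n
  natural : D * m ≤ s * (1 * D * 1) + N * m
  natural = ≤-trans h (+-mono-≤ (≤-reflexive (ring D s)) (m≤m+n m (n * m)))
    where
    ring : ∀ D s → D * s ≡ s * (1 * D * 1)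
    ring = solve-∀
  expand : ∀ D N m → D ℤ.* m ℤ.- N ℤ.* m ≡ (ℤ.+ 1 ℤ.* D ℤ.+ (ℤ.- N) ℤ.* ℤ.+ 1) ℤ.* m ℤ.* ℤ.+ 1
  expand = ℤ-solve.solve-∀
  collapse : ∀ x y → x ℤ.+ y ℤ.- y ≡ x
  collapse = ℤ-solve.solve-∀
  integral : (ℤ.+ 1 ℤ.* ℤ.+ D ℤ.+ (ℤ.- (ℤ.+ N)) ℤ.* ℤ.+ 1) ℤ.* ℤ.+ m ℤ.* ℤ.+ 1 ℤ.≤ ℤ.+ s ℤ.* ℤ.+ (1 * D * 1)
  integral = subst₂ ℤ._≤_ (trans (cong (ℤ._- (ℤ.+ N ℤ.* ℤ.+ m)) (ℤP.pos-* D m)) (expand (ℤ.+ D) (ℤ.+ N) (ℤ.+ m)))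
    (trans (cong (ℤ._- (ℤ.+ N ℤ.* ℤ.+ m)) (trans (ℤP.pos-+ (s * (1 * D * 1)) (N * m)) (cong₂ ℤ._+_ (ℤP.pos-* s (1 * D * 1)) (ℤP.pos-* N m))))
      (collapse (ℤ.+ s ℤ.* ℤ.+ (1 * D * 1)) (ℤ.+ N ℤ.* ℤ.+ m)))
    (ℤP.+-monoˡ-≤ (ℤ.- (ℤ.+ N ℤ.* ℤ.+ m)) (ℤ.+≤+ natural))

theorem2 : (ε : ℚ) → 0ℚ ℚ.< ε →
    Σ ℕ λ m → 0 < m × Σ (List ℕ) λ S → Unique S ×
    All (λ a → 0 < a × a < 4 * m × a % 4 ≡ 2 × TotientFree (4 * m) a) S ×
    (1ℚ ℚ.- ε) ℚ.* ((ℤ.+ m) ℚ./ 1) ℚ.≤ (ℤ.+ length S) ℚ./ 1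
theorem2 ε 0<ε = case sparse-totient-classes (ℚ.↧ₙ ε) of λ where
      (m , 0<m , Bad , Bad? , totient⇒bad , few) → conclude (ℚ.↧ₙ ε) m 0<m Bad? totient⇒bad few (1-ε-bound ε m _ 0<ε)
  where
  conclude : ∀ E m → 0 < m → {Bad : ℕ → Set} (Bad? : Decidable Bad) →
    (∀ a n → a < 4 * m → a % 4 ≡ 2 → 1 ≤ n → φ n ≡ a [mod 4 * m ] → Bad a) →
    E * # (4 * m) (λ a → (a % 4 ≟ 2) ×-dec Bad? a) ≤ m →
    let S = filter (λ a → (a % 4 ≟ 2) ×-dec ¬? (Bad? a)) (upTo (4 * m)) in
    (E * m ≤ E * length S + m → (1ℚ ℚ.- ε) ℚ.* ((ℤ.+ m) ℚ./ 1) ℚ.≤ (ℤ.+ length S) ℚ./ 1) →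
    Σ ℕ λ m → 0 < m × Σ (List ℕ) λ S → Unique S ×
    All (λ a → 0 < a × a < 4 * m × a % 4 ≡ 2 × TotientFree (4 * m) a) S ×
    (1ℚ ℚ.- ε) ℚ.* ((ℤ.+ m) ℚ./ 1) ℚ.≤ (ℤ.+ length S) ℚ./ 1
  conclude E m 0<m {Bad} Bad? totient⇒bad few bound = m , 0<m , S , UniqueP.filter⁺ Free? (UniqueP.upTo⁺ (4 * m)) ,
      All.zipWith free (AllP.filter⁺ Free? (AllP.all-upTo (4 * m)) , AllP.all-filter Free? (upTo (4 * m))) , bound many
    where
    Free? : Decidable (λ a → a % 4 ≡ 2 × ¬ Bad a)
    Free? a = (a % 4 ≟ 2) ×-dec ¬? (Bad? a)
    BadClass? : Decidable (λ a → a % 4 ≡ 2 × Bad a)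
    BadClass? a = (a % 4 ≟ 2) ×-dec Bad? a
    S : List ℕ
    S = filter Free? (upTo (4 * m))
    free : ∀ {a} → a < 4 * m × (a % 4 ≡ 2 × ¬ Bad a) → 0 < a × a < 4 * m × a % 4 ≡ 2 × TotientFree (4 * m) a
    free {zero}      (_ , () , _)
    free {a@(suc _)} (a<4m , a≡2 , ¬bad) = z<s , a<4m , a≡2 , λ n 0<n φn≡a → ¬bad (totient⇒bad a n a<4m a≡2 0<n φn≡a)
    m≤ : m ≤ length S + # (4 * m) BadClass?
    m≤ = ≤-trans (≤-reflexive (sym (#≡2[mod4] m))) (≤-trans (#-∪ {P? = λ a → a % 4 ≟ 2} (4 * m) {Q? = Free?} {R? = BadClass?} (λ a _ → split a))
      (≤-reflexive (cong (_+ # (4 * m) BadClass?) (sym (length-filter-applyUpTo Free? id (4 * m))))))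
      where
      split : ∀ a → a % 4 ≡ 2 → (a % 4 ≡ 2 × ¬ Bad a) ⊎ (a % 4 ≡ 2 × Bad a)
      split a a≡2 with Bad? a
      ... | yes bad = inj₂ (a≡2 , bad)
      ... | no ¬bad = inj₁ (a≡2 , ¬bad)
    many : E * m ≤ E * length S + m
    many = ≤-trans (*-monoʳ-≤ E m≤) (≤-trans (≤-reflexive (*-distribˡ-+ E (length S) (# (4 * m) BadClass?))) (+-monoʳ-≤ (E * length S) few))
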